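{- Let $n\ge 1$ and $k\ge 0$ be integers and let $\mathbf{x}=(x_1,x_2,\ldots)$. Then the symmetric function $\mathcal{A}_{n+1,k}(\mathbf{x};r,u,v,w)$ (defined in the context) is equal to each of the following four determinants: \begin{align*} &\det_{1 \leq i,j \leq n} \left((-1)^{j-i}v^j\binom{i-1}{j-1}+ r u^i w^{j-i}s_{(i-1|j+k-1)}(\mathbf{x})\right)\\ =& \det_{1 \leq i,j \leq n} \left( r u^i e_{n+k+i-j}(\mathbf{x}) +(-1)^{i-1}v^{i}\sum_{m}\binom{m-1}{m-i}e_{n+1-j-m}(\mathbf{x}) \left(\frac{w}{u}\right)^{m-i}\right)\\ =& \det_{1 \leq i,j \leq n+k}\big(M_{i,j}\big)\\ =& \det_{1 \leq i,j \leq n} \left(\delta_{i,j}v^{i}+r u^{j} \sum_{m} \binom{i-1}{i-m}\left(\frac{w}{u}\right)^{i-m} s_{(m-1|j+k-1)}(\mathbf{x})\right), \end{align*} where the $(n+k)\times(n+k)$ matrix $M$ has entries \[ M_{i,j}= v^{n-i+1} h_{i-j}(\mathbf{x}) +(-1)^{k+n-i}\,r\,u^{n-i+1}\sum_{m}\binom{n-i}{m-i} h_{k+1+2n-m-j}(\mathbf{x}) \left(\frac{w}{u}\right)^{m-i}\quad\text{for } 1\le i\le n, \] and $M_{i,j}=h_{i-j}(\mathbf{x})$ for $n+1\le i\le n+k$.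
   Context: $r,u,v,w$ are indeterminates; identities are in symmetric functions in $\mathbf{x}=(x_1,x_2,\dots)$ with coefficients rational in $r,u,v,w$. $h_m$ and $e_m$ are the complete homogeneous and elementary symmetric functions, with $h_0=e_0=1$ and $h_m=e_m=0$ for $m<0$. $s_\lambda$ is the Schur function. All sums over $m$ range over all integers, with $\binom{p}{q}=0$ unless $0\le q\le p$. $\delta_{i,j}$ is the Kronecker delta. Frobenius notation: for a partition $\lambda$ with conjugate $\lambda'$, let $d$ (the Durfee square size) be the largest $d$ with $\lambda_d\ge d$; its Frobenius notation is $(\lambda_1-1,\ldots,\lambda_d-d\,|\,\lambda'_1-1,\ldots,\lambda'_d-d)$, and conversely a symbol $(a_1,\dots,a_d|b_1,\dots,b_d)$ with $a_1>\dots>a_d\ge0$, $b_1>\dots>b_d\ge 0$ denotes the corresponding partition. In particular $s_{(a|b)}$ for $a,b\ge 0$ is the Schur function of the hook $(a+1,1^b)$. A plane partition in an $(n,n,n)$-box is an array $T=(T_{i,j})_{1\le i,j\le n}$ of integers in $[0,n]$ weakly decreasing along rows and columns. It is totally symmetric if it is symmetric ($T_{i,j}=T_{j,i}$) and cyclically symmetric (the set of unit cubes $\{(i,j,l): 1\le l\le T_{i,j}\}$ is invariant under $(i,j,l)\mapsto(j,l,i)$). Let $\mathrm{TSPP}_n$ be the set of these. For $T\in\mathrm{TSPP}_n$ let $\mathrm{diag}(T)$ be the conjugate of the partition with parts $T_{1,1}\ge T_{2,2}\ge\dots\ge T_{n,n}$ (zeros omitted), let $(a_1,\dots,a_d|b_1,\dots,b_d)$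 be its Frobenius notation, and let $\pi_k(T)$ be the partition with Frobenius notation $(a_1,\dots,a_d|b_1+k,\dots,b_d+k)$. For $N\ge1$ and $T\in \mathrm{TSPP}_{N-1}$ put \[\omega(T)=r^d u^{\sum_{i=1}^d (a_i+1)} v^{\binom{N}{2}-\sum_{i=1}^d (b_i+1)} w^{\sum_{i=1}^d (b_i-a_i)},\] and define \[\mathcal{A}_{N,k}(\mathbf{x};r,u,v,w)=\sum_{T\in\mathrm{TSPP}_{N-1}}\omega(T)\,s_{\pi_k(T)}(\mathbf{x}).\] -}

module Defs where

open import Algebra.Bundles using (CommutativeRing)
open import Data.Nat as ℕ using (ℕ; zero; suc; _∸_; _≤ᵇ_; _<ᵇ_; _≡ᵇ_)
open import Data.Integer as ℤ using (ℤ; +_; -[1+_])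
open import Data.List as L using (List; []; _∷_; upTo; concatMap; filterᵇ; length)
open import Data.Bool using (Bool; true; false; _∧_; if_then_else_)
open import Data.Nat.Combinatorics using (_C_)

at : List ℕ → ℕ → ℕ
at []       _       = 0
at (x ∷ xs) zero    = x
at (x ∷ xs) (suc i) = at xs i

all : {A : Set} → (A → Bool) → List A → Bool
all p []       = true
all p (x ∷ xs) = p x ∧ all p xs

countᵇ : {A : Set} → (A → Bool) → List A → ℕ
countᵇ p xs = length (filterᵇ p xs)

sumℕ : List ℕ → ℕ
sumℕ = L.foldr ℕ._+_ 0

oneTo : ℕ → List ℕ
oneTo n = L.map suc (upTo n)

removeZeros : List ℕ → List ℕ
removeZeros = filterᵇ (λ p → 1 ≤ᵇ p)

-- Partitions as lists of parts (weakly decreasing, positive)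

-- λ_i, 1-indexed (λ_i = 0 beyond the length)
part : List ℕ → ℕ → ℕ
part λ′ i = at λ′ (i ∸ 1)

conj : List ℕ → List ℕ
conj λ′ = L.map (λ j → countᵇ (λ p → j ≤ᵇ p) λ′) (oneTo (part λ′ 1))

durfee : List ℕ → ℕ
durfee λ′ = countᵇ (λ i → i ≤ᵇ part λ′ i) (oneTo (length λ′))

frobA : List ℕ → List ℕ
frobA λ′ = L.map (λ i → part λ′ i ∸ i) (oneTo (durfee λ′))

frobB : List ℕ → List ℕ
frobB λ′ = L.map (λ i → part (conj λ′) i ∸ i) (oneTo (durfee λ′))

-- partition with Frobenius notation (a_1..a_d | b_1..b_d):
-- λ_i = a_i + i for i ≤ d, and λ_i = #{ j ≤ d : b_j + j ≥ i } for i > d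
fromFrob : List ℕ → List ℕ → List ℕ
fromFrob a b = removeZeros (L.map (λ i → at a (i ∸ 1) ℕ.+ i) (oneTo d)
                L.++ L.map (λ t → countᵇ (λ j → (suc (d ℕ.+ t)) ≤ᵇ (at b (j ∸ 1) ℕ.+ j)) (oneTo d))
                           (upTo (suc (at b 0) ∸ d)))
  where d = length a

-- Totally symmetric plane partitions in an (n,n,n)-box.
-- An n×n array is a list of length n*n; entry T_{i+1,j+1} = at t (i*n+j).

allLists : ℕ → ℕ → List (List ℕ)
allLists zero    m = [] ∷ []
allLists (suc l) m = concatMap (λ x → L.map (x ∷_) (allLists l m)) (upTo (suc m))

ent : ℕ → List ℕ → ℕ → ℕ → ℕ
ent n t i j = at t ((i ∸ 1) ℕ.* n ℕ.+ (j ∸ 1))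

_⇔ᵇ_ : Bool → Bool → Bool
true  ⇔ᵇ b = b
false ⇔ᵇ true  = false
false ⇔ᵇ false = true

isTSPP : ℕ → List ℕ → Bool
isTSPP n t =
  all (λ i → all (λ j →
        ((if j <ᵇ n then ent n t i (suc j) ≤ᵇ ent n t i j else true)
        ∧ (if i <ᵇ n then ent n t (suc i) j ≤ᵇ ent n t i j else true))
        ∧ (ent n t i j ≡ᵇ ent n t j i)
        -- cyclically symmetric: (i,j,l) ∈ S ⇔ (j,l,i) ∈ S, where
        -- S = { (i,j,l) : 1 ≤ l ≤ T_{i,j} }
        ∧ all (λ l → (l ≤ᵇ ent n t i j) ⇔ᵇ (i ≤ᵇ ent n t j l)) (oneTo n))
      (oneTo n)) (oneTo n)

-- TSPP_n (entries automatically in [0,n])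
TSPP : ℕ → List (List ℕ)
TSPP n = filterᵇ (isTSPP n) (allLists (n ℕ.* n) n)

diagT : ℕ → List ℕ → List ℕ
diagT n t = conj (removeZeros (L.map (λ i → ent n t i i) (oneTo n)))

-- Semistandard Young tableaux with entries in {1..N}, as lists of rows

incLists : ℕ → ℕ → ℕ → List (List ℕ)
incLists zero    lo N = [] ∷ []
incLists (suc l) lo N =
  concatMap (λ x → L.map (x ∷_) (incLists l x N)) (L.map (lo ℕ.+_) (upTo (suc N ∸ lo)))

rowFillings : List ℕ → ℕ → List (List (List ℕ))
rowFillings []       N = [] ∷ []
rowFillings (p ∷ ps) N =
  concatMap (λ row → L.map (row ∷_) (rowFillings ps N)) (incLists p 1 N)

colStrict : List (List ℕ) → Bool
colStrict []                  = true
colStrict (r₁ ∷ [])           = true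
colStrict (r₁ ∷ r₂ ∷ rs) =
  all (λ j → at r₁ j <ᵇ at r₂ j) (upTo (length r₂)) ∧ colStrict (r₂ ∷ rs)

SSYT : List ℕ → ℕ → List (List (List ℕ))
SSYT λ′ N = filterᵇ colStrict (rowFillings λ′ N)

-- Integer binomial: C(p,q) = 0 unless 0 ≤ q ≤ p

binomℤ : ℤ → ℤ → ℕ
binomℤ (+ p) (+ q) = p C q
binomℤ _     _     = 0

-- Ring-valued part: evaluation of symmetric functions at finitely many
-- variables xs = (x_1,…,x_N) in a commutative ring, with parameters
-- r,u,v,w where u,v,w come with (intended) inverses u′,v′,w′.

module Sym {c ℓ} (R : CommutativeRing c ℓ)
           (r u v w u′ v′ w′ : CommutativeRing.Carrier R) where
  open CommutativeRing R

  sumR : List Carrier → Carrier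
  sumR = L.foldr _+_ 0#

  prodR : List Carrier → Carrier
  prodR = L.foldr _*_ 1#

  Σℤ : ℕ → (ℤ → Carrier) → Carrier
  Σℤ B f = sumR (L.map (λ t → f (+ t ℤ.- + B)) (upTo (suc (B ℕ.+ B))))

  infixr 8 _^_
  _^_ : Carrier → ℕ → Carrier
  x ^ zero  = 1#
  x ^ suc n = x * (x ^ n)

  -- integer power, given an inverse x′ of x
  ipow : Carrier → Carrier → ℤ → Carrier
  ipow x x′ (+ n)     = x ^ n
  ipow x x′ -[1+ n ]  = x′ ^ suc n

  fromℕ : ℕ → Carrier
  fromℕ zero    = 0#
  fromℕ (suc n) = 1# + fromℕ n

  sgn : ℤ → Carrier
  sgn z = ipow (- 1#) (- 1#) z

  wu : ℤ → Carrier
  wu z = ipow w w′ z * ipow u′ u z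

  binom : ℤ → ℤ → Carrier
  binom p q = fromℕ (binomℤ p q)

  xAt : List Carrier → ℕ → Carrier
  xAt []       _       = 0#
  xAt (x ∷ xs) zero    = 0#
  xAt (x ∷ xs) (suc zero)    = x
  xAt (x ∷ xs) (suc (suc i)) = xAt xs (suc i)

  eN : ℕ → List Carrier → Carrier
  eN zero    _        = 1#
  eN (suc m) []       = 0#
  eN (suc m) (x ∷ xs) = eN (suc m) xs + x * eN m xs

  hN : ℕ → List Carrier → Carrier
  hN zero    []       = 1#
  hN (suc m) []       = 0#
  hN m       (x ∷ xs) = sumR (L.map (λ j → (x ^ j) * hN (m ∸ j) xs) (upTo (suc m)))

  h : ℤ → List Carrier → Carrier
  h (+ m)    xs = hN m xs
  h -[1+ _ ] xs = 0#

  e : ℤ → List Carrier → Carrier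
  e (+ m)    xs = eN m xs
  e -[1+ _ ] xs = 0#

  schur : List ℕ → List Carrier → Carrier
  schur λ′ xs = sumR (L.map (λ T → prodR (L.map (xAt xs) (L.concat T)))
                            (SSYT λ′ (length xs)))

  hook : ℤ → ℤ → List Carrier → Carrier
  hook (+ a) (+ b) xs = schur (fromFrob (a ∷ []) (b ∷ [])) xs
  hook _     _     xs = 0#

  det : ℕ → (ℕ → ℕ → Carrier) → Carrier
  det zero    f = 1#
  det (suc n) f = sumR (L.map (λ j →
      sgn (+ (j ∸ 1)) * f 1 j
        * det n (λ i′ j′ → f (suc i′) (if j′ <ᵇ j then j′ else suc j′)))
    (oneTo (suc n)))

  δ : ℕ → ℕ → Carrier
  δ i j = if i ≡ᵇ j then 1# else 0#

  ω : ℕ → List ℕ → Carrier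
  ω N μ = (r ^ d) * (u ^ sumℕ (L.map suc a))
        * ipow v v′ (+ (N C 2) ℤ.- + sumℕ (L.map suc b))
        * ipow w w′ (+ sumℕ b ℤ.- + sumℕ a)
    where a = frobA μ
          b = frobB μ
          d = length a

  πk : ℕ → List ℕ → List ℕ
  πk k μ = fromFrob (frobA μ) (L.map (k ℕ.+_) (frobB μ))

  𝒜 : ℕ → ℕ → List Carrier → Carrier
  𝒜 N k xs = sumR (L.map (λ T → ω N (diagT (N ∸ 1) T) * schur (πk k (diagT (N ∸ 1) T)) xs)
                         (TSPP (N ∸ 1)))

  -- bound for the sums over m ∈ ℤ (covers the support of each summand)
  bnd : ℕ → ℕ → ℕ
  bnd n k = suc (suc (n ℕ.+ k))

  D₁ : ℕ → ℕ → List Carrier → ℕ → ℕ → Carrier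
  D₁ n k xs i j =
    sgn (+ j ℤ.- + i) * (v ^ j) * fromℕ ((i ∸ 1) C (j ∸ 1))
    + r * (u ^ i) * ipow w w′ (+ j ℤ.- + i) * hook (+ i ℤ.- + 1) (+ j ℤ.+ + k ℤ.- + 1) xs

  D₂ : ℕ → ℕ → List Carrier → ℕ → ℕ → Carrier
  D₂ n k xs i j =
    r * (u ^ i) * e (+ n ℤ.+ + k ℤ.+ + i ℤ.- + j) xs
    + sgn (+ i ℤ.- + 1) * (v ^ i)
      * Σℤ (bnd n k) (λ m → binom (m ℤ.- + 1) (m ℤ.- + i)
                             * e (+ n ℤ.+ + 1 ℤ.- + j ℤ.- m) xs * wu (m ℤ.- + i))

  M : ℕ → ℕ → List Carrier → ℕ → ℕ → Carrier
  M n k xs i j = if i ≤ᵇ n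
    then (v ^ (n ∸ i ℕ.+ 1)) * h (+ i ℤ.- + j) xs
         + sgn (+ k ℤ.+ + n ℤ.- + i) * r * (u ^ (n ∸ i ℕ.+ 1))
           * Σℤ (bnd n k) (λ m → binom (+ n ℤ.- + i) (m ℤ.- + i)
                 * h (+ k ℤ.+ + 1 ℤ.+ + 2 ℤ.* + n ℤ.- m ℤ.- + j) xs * wu (m ℤ.- + i))
    else h (+ i ℤ.- + j) xs

  D₄ : ℕ → ℕ → List Carrier → ℕ → ℕ → Carrier
  D₄ n k xs i j =
    δ i j * (v ^ i)
    + r * (u ^ j) * Σℤ (bnd n k) (λ m → binom (+ i ℤ.- + 1) (+ i ℤ.- m)
                        * wu (+ i ℤ.- m) * hook (m ℤ.- + 1) (+ j ℤ.+ + k ℤ.- + 1) xs)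

{-# OPTIONS --safe #-}
module Submission where

-- Read M with its rows and columns in reverse order.  Expanding every row
-- multilinearly selects a set B ⊆ {0,…,n-1} of rows of the form
-- Σ_a C(b,a) X_a, the others being rows of the vacuum matrix (h_{j-i}); the signs
-- in M are those of moving the selected rows to the front.  Subtracting from each
-- selected row a multiple of the next one applies Pascal's rule to all of them
-- simultaneously and leaves exactly the interlacing terms.  Iterating, one sums
-- over arrays c_t(i), which are the totally symmetric plane partitions read along
-- their diagonals, c_t(i) = max(0, T_{i,i+t} + 1 - i - t), with b_i = c_0(i) - 1
-- and a_i the number of t ≥ 1 with c_t(i) > 0.  The determinant attached to an
-- array is the Jacobi-Trudi determinant of π_k(T).  Jacobi-Trudi follows from the
-- same row operation, applied when the last variable is removed from the
-- tableaux.
-- The other three determinants are obtained from M by multiplying with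
-- unitriangular matrices, using h_{a+1+c} = Σ_q (-1)^q s_{(a|q)} h_{c-q} and its
-- dual, and the inversion of the binomial matrix.

open import Defs
open import Algebra.Bundles using (CommutativeRing)
open import Level as Level using ()
open import Data.Nat as ℕ using (ℕ; zero; suc; _∸_; _≤_; _<_; _≥_; _>_; z≤n; s≤s; _≤ᵇ_; _<ᵇ_; _≡ᵇ_; pred; _⊓_; _⊔_)
import Data.Nat.Properties as ℕₚ
import Data.Nat.DivMod as DM
import Data.Nat.Solver
module NS = Data.Nat.Solver.+-*-Solver
open import Data.Nat.Divisibility using (divides)
open import Data.Nat.Combinatorics using (_C_; nCk≡nC[n∸k]; nCk+nC[k+1]≡[n+1]C[k+1]; nC1≡n; k>n⇒nCk≡0; nCn≡1)
import Data.Integer.Properties as ℤₚ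
open import Data.List as L using (List; []; _∷_; _++_; upTo; applyUpTo; concatMap; length; replicate)
import Data.List.Properties as Lₚ
open import Data.List.Reverse using (Reverse; reverseView; []; _∶_∶ʳ_)
open import Data.List.Membership.Propositional using (_∈_; find; lose)
import Data.List.Membership.Propositional.Properties as ∈ₚ
import Data.List.Membership.Propositional.Properties.WithK as ∈ₖ
open import Data.List.Relation.Binary.BagAndSetEquality using (∼bag⇒↭)
open import Data.List.Relation.Binary.Permutation.Propositional as Perm using (_↭_)
open import Data.List.Relation.Binary.Pointwise as PW using (Pointwise; []; _∷_)
open import Data.List.Relation.Unary.Any using (here; there)
open import Data.List.Relation.Unary.All as All using (All; []; _∷_)
import Data.List.Relation.Unary.All.Properties as Allₚ
open import Data.List.Relation.Unary.AllPairs using ([]; _∷_)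
open import Data.List.Relation.Unary.Unique.Propositional using (Unique)
import Data.List.Relation.Unary.Unique.Propositional.Properties as Uniqueₚ
open import Data.List.Relation.Unary.Linked as Linked using (Linked; []; [-]; _∷_)
open import Data.Product using (_×_; _,_; proj₁; proj₂; ∃)
open import Data.Sum using (inj₁; inj₂)
open import Data.Empty using (⊥; ⊥-elim)
open import Data.Bool using (Bool; true; false; _∧_; if_then_else_; T; T?)
import Data.Bool.Properties as 𝔹
open import Function using (_∘_; id)
open import Function.Bundles using (mk⇔; Equivalence)
open import Relation.Nullary using (¬_; yes; no)
open import Relation.Binary.Definitions using (tri<; tri≈; tri>)
open import Relation.Binary.PropositionalEquality as ≡ using (_≡_; _≢_)

-- A totally symmetric plane partition is determined by its cubes (i, j, l) with i ≤ j ≤ l, and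
-- c_t(i) counts those over the cell (i, i + t). Monotonicity of T along rows and columns becomes
-- the two bounds on the entries of the next row, so the arrays are families of non-intersecting
-- paths. Counting such families by a determinant usually rests on a sign-reversing involution. Here
-- the row operation takes its place, one time step after another. No sign appears, because only the
-- last path can end, and its row then already stands where it belongs. The weight is a product of
-- one factor for each arm, each leg and each b outside B, so it can be put into the rows in
-- advance.
--
-- M comes first because each of its rows is a vacuum row plus a path row, so that its expansion
-- yields Jacobi-Trudi determinants directly. The coordinates of these rows in the vacuum basis are
-- hook Schur functions. The coordinate matrix `E` is the common form of the other three
-- determinants, up to unitriangular factors and powers of u and w that a diagonal conjugation
-- removes.

module Preliminaries where

  open import Data.Nat using (_+_; _*_)

  T⇒≡ : ∀ {b} → T b → b ≡ true
  T⇒≡ = Equivalence.to 𝔹.T-≡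

  ≡⇒T : ∀ {b} → b ≡ true → T b
  ≡⇒T = Equivalence.from 𝔹.T-≡

  ≤ᵇ-true : ∀ {m n} → m ≤ n → (m ≤ᵇ n) ≡ true
  ≤ᵇ-true p = T⇒≡ (ℕₚ.≤⇒≤ᵇ p)

  ≤ᵇ-true⁻ : ∀ {m n} → (m ≤ᵇ n) ≡ true → m ≤ n
  ≤ᵇ-true⁻ {m} p = ℕₚ.≤ᵇ⇒≤ m _ (≡⇒T p)

  ≤ᵇ-false : ∀ {m n} → n < m → (m ≤ᵇ n) ≡ false
  ≤ᵇ-false {m} {n} n<m with m ≤ᵇ n in eq
  ... | false = ≡.refl
  ... | true  = ⊥-elim (ℕₚ.<⇒≱ n<m (≤ᵇ-true⁻ eq))

  ≤ᵇ-false⁻ : ∀ {m n} → (m ≤ᵇ n) ≡ false → n < m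
  ≤ᵇ-false⁻ p = ℕₚ.≰⇒> (λ m≤n → case (≡.trans (≡.sym (≤ᵇ-true m≤n)) p))
    where
    case : true ≡ false → ⊥
    case ()

  <ᵇ-true : ∀ {m n} → m < n → (m <ᵇ n) ≡ true
  <ᵇ-true p = T⇒≡ (ℕₚ.<⇒<ᵇ p)

  <ᵇ-true⁻ : ∀ {m n} → (m <ᵇ n) ≡ true → m < n
  <ᵇ-true⁻ {m} p = ℕₚ.<ᵇ⇒< m _ (≡⇒T p)

  bool-ext : ∀ {a b : Bool} → (a ≡ true → b ≡ true) → (b ≡ true → a ≡ true) → a ≡ b
  bool-ext {true}  {b}     f g = ≡.sym (f ≡.refl)
  bool-ext {false} {true}  f g = g ≡.refl
  bool-ext {false} {false} f g = ≡.refl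

  ∧-true⁻ : ∀ {a b} → (a ∧ b) ≡ true → a ≡ true × b ≡ true
  ∧-true⁻ {true} {true} _ = ≡.refl , ≡.refl

  ∧-true : ∀ {a b} → a ≡ true → b ≡ true → (a ∧ b) ≡ true
  ∧-true ≡.refl ≡.refl = ≡.refl

  all-applyUpTo⁻ : ∀ {A : Set} (p : A → Bool) (g : ℕ → A) n → all p (applyUpTo g n) ≡ true → ∀ i → i < n → p (g i) ≡ true
  all-applyUpTo⁻ p g (suc n) e zero    _       = proj₁ (∧-true⁻ e)
  all-applyUpTo⁻ p g (suc n) e (suc i) (s≤s q) = all-applyUpTo⁻ p (g ∘ suc) n (proj₂ (∧-true⁻ e)) i q

  all-applyUpTo : ∀ {A : Set} (p : A → Bool) (g : ℕ → A) n → (∀ i → i < n → p (g i) ≡ true) → all p (applyUpTo g n) ≡ true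
  all-applyUpTo p g zero    h = ≡.refl
  all-applyUpTo p g (suc n) h = ∧-true (h 0 (s≤s z≤n)) (all-applyUpTo p (g ∘ suc) n (λ i q → h (suc i) (s≤s q)))

  at-++ˡ : ∀ xs ys j → j < length xs → at (xs ++ ys) j ≡ at xs j
  at-++ˡ (x ∷ xs) ys zero    _       = ≡.refl
  at-++ˡ (x ∷ xs) ys (suc j) (s≤s p) = at-++ˡ xs ys j p

  at-++ʳ : ∀ xs ys j → at (xs ++ ys) (length xs + j) ≡ at ys j
  at-++ʳ []       ys j = ≡.refl
  at-++ʳ (x ∷ xs) ys j = at-++ʳ xs ys j

  at-replicate : ∀ k m j → j < k → at (replicate k m) j ≡ m
  at-replicate (suc k) m zero    _       = ≡.refl
  at-replicate (suc k) m (suc j) (s≤s p) = at-replicate k m j p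

  at-All-≤ : ∀ {m} xs j → All (_≤ m) xs → at xs j ≤ m
  at-All-≤ []       j       _        = z≤n
  at-All-≤ (x ∷ xs) zero    (p ∷ ps) = p
  at-All-≤ (x ∷ xs) (suc j) (p ∷ ps) = at-All-≤ xs j ps

  <∸⇒+< : ∀ m n o → m < n ∸ o → o + m < n
  <∸⇒+< m n       zero    p = p
  <∸⇒+< m (suc n) (suc o) p = s≤s (<∸⇒+< m n o p)

  [m+n]∸[o+n]≡m∸o : ∀ m n o → (m + n) ∸ (o + n) ≡ m ∸ o
  [m+n]∸[o+n]≡m∸o m n o = ≡.trans (≡.cong₂ _∸_ (ℕₚ.+-comm m n) (ℕₚ.+-comm o n)) (ℕₚ.[m+n]∸[m+o]≡n∸o n m o)

-- Partitions in Frobenius notation and their beta-numbers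

module Shapes where

  open import Data.Nat using (_+_; _*_)
  open Preliminaries

  -- The numbers p_i + l - i with l the length of the list, trailing zeros included (beta-numbers,
  -- or first-column hook lengths). They index the rows of a Jacobi-Trudi matrix and turn weak
  -- inequalities between parts into strict ones.
  beta : List ℕ → List ℕ
  beta []       = []
  beta (p ∷ ps) = p + length ps ∷ beta ps

  length-beta : ∀ ps → length (beta ps) ≡ length ps
  length-beta []       = ≡.refl
  length-beta (p ∷ ps) = ≡.cong suc (length-beta ps)

  beta-decreasing : ∀ {ps} → Linked _≥_ ps → Linked _≥_ (beta ps)
  beta-decreasing []      = []
  beta-decreasing [-]     = [-]
  beta-decreasing (p ∷ l) = ℕₚ.+-mono-≤ p (ℕₚ.n≤1+n _) ∷ beta-decreasing l

  at-≤-head : ∀ {p ps} → Linked _≥_ (p ∷ ps) → at ps 0 ≤ p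
  at-≤-head [-]     = z≤n
  at-≤-head (q ∷ _) = q

  link-≥ : ∀ {p ps} → at ps 0 ≤ p → Linked _≥_ ps → Linked _≥_ (p ∷ ps)
  link-≥ {ps = []}    _ _ = [-]
  link-≥ {ps = _ ∷ _} q l = q ∷ l

  beta-∷ʳ0 : ∀ ps → beta (ps ++ 0 ∷ []) ≡ L.map suc (beta ps) ++ 0 ∷ []
  beta-∷ʳ0 []       = ≡.refl
  beta-∷ʳ0 (p ∷ ps) = ≡.cong₂ _∷_
    (≡.trans (≡.cong (p +_) (≡.trans (Lₚ.length-++ ps) (ℕₚ.+-comm (length ps) 1))) (ℕₚ.+-suc p (length ps))) (beta-∷ʳ0 ps)

  beta-suc : ∀ ps → beta (L.map suc ps) ≡ L.map suc (beta ps)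
  beta-suc []       = ≡.refl
  beta-suc (p ∷ ps) = ≡.cong₂ _∷_ (≡.cong (λ m → suc (p + m)) (Lₚ.length-map suc ps)) (beta-suc ps)

  -- Subsets of {1,…,n}, listed decreasingly.
  data Sub : ℕ → List ℕ → Set where
    none : Sub 0 []
    omit : ∀ {n cs} → Sub n cs → Sub (suc n) cs
    take : ∀ {n cs} → Sub n cs → Sub (suc n) (suc n ∷ cs)

  subsets : ∀ n → List (∃ (Sub n))
  subsets zero    = ([] , none) ∷ []
  subsets (suc n) = L.map (λ (cs , s) → cs , omit s) (subsets n) ++ L.map (λ (cs , s) → suc n ∷ cs , take s) (subsets n)

  Sub-head : ∀ {n cs} → Sub n cs → at cs 0 ≤ n
  Sub-head none     = z≤n
  Sub-head (omit s) = ℕₚ.m≤n⇒m≤1+n (Sub-head s)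
  Sub-head (take s) = ℕₚ.≤-refl

  Sub-decreasing : ∀ {n cs} → Sub n cs → Linked _>_ cs
  Sub-decreasing none     = []
  Sub-decreasing (omit s) = Sub-decreasing s
  Sub-decreasing (take s) = link (Sub-head s) (Sub-decreasing s)
    where
    link : ∀ {n cs} → at cs 0 ≤ n → Linked _>_ cs → Linked _>_ (suc n ∷ cs)
    link {cs = []}    _ _ = [-]
    link {cs = _ ∷ _} p l = s≤s p ∷ l

  Sub-positive : ∀ {n cs} → Sub n cs → All (1 ≤_) cs
  Sub-positive none     = []
  Sub-positive (omit s) = Sub-positive s
  Sub-positive (take s) = s≤s z≤n ∷ Sub-positive s

  map-suc-pred : ∀ {cs} → All (1 ≤_) cs → L.map suc (L.map pred cs) ≡ cs
  map-suc-pred []            = ≡.refl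
  map-suc-pred (s≤s z≤n ∷ a) = ≡.cong (_ ∷_) (map-suc-pred a)

  Sub-length : ∀ {n cs} → Sub n cs → length cs ≤ n
  Sub-length none     = z≤n
  Sub-length (omit s) = ℕₚ.m≤n⇒m≤1+n (Sub-length s)
  Sub-length (take s) = s≤s (Sub-length s)

  -- {0,…,k+n-1} with the elements k+c-1, c ∈ cs, removed.
  vac : ∀ k {n cs} → Sub n cs → List ℕ
  vac k none         = upTo k
  vac k (omit {n} s) = vac k s ++ k + n ∷ []
  vac k (take s)     = vac k s

  -- The rows below the Durfee square, trailing zeros included, built along the boundary of the
  -- diagram: an element outside the subset appends an empty row, an element of it adds a box to
  -- every row present. The k initial zeros account for the shift of the legs by k.
  lam : ∀ k {n cs} → Sub n cs → List ℕ
  lam k none     = replicate k 0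
  lam k (omit s) = lam k s ++ 0 ∷ []
  lam k (take s) = L.map suc (lam k s)

  length-lam : ∀ k {n cs} (s : Sub n cs) → length (lam k s) + length cs ≡ k + n
  length-lam k none         = ≡.cong (_+ 0) (Lₚ.length-replicate k)
  length-lam k (omit {n} {cs} s) = ≡.trans (≡.cong (_+ length cs) (≡.trans (Lₚ.length-++ (lam k s)) (ℕₚ.+-comm (length (lam k s)) 1)))
    (≡.trans (≡.cong suc (length-lam k s)) (≡.sym (ℕₚ.+-suc k n)))
  length-lam k (take {n} {cs} s) = ≡.trans (ℕₚ.+-suc (length (L.map suc (lam k s))) (length cs))
    (≡.trans (≡.cong suc (≡.trans (≡.cong (_+ length cs) (Lₚ.length-map suc (lam k s))) (length-lam k s))) (≡.sym (ℕₚ.+-suc k n)))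

  length-vac : ∀ k {n cs} (s : Sub n cs) → length (vac k s) + length cs ≡ k + n
  length-vac k none         = ≡.cong (_+ 0) (Lₚ.length-applyUpTo id k)
  length-vac k (omit {n} {cs} s) = ≡.trans (≡.cong (_+ length cs) (≡.trans (Lₚ.length-++ (vac k s)) (ℕₚ.+-comm (length (vac k s)) 1)))
    (≡.trans (≡.cong suc (length-vac k s)) (≡.sym (ℕₚ.+-suc k n)))
  length-vac k (take {n} {cs} s) = ≡.trans (ℕₚ.+-suc (length (vac k s)) (length cs))
    (≡.trans (≡.cong suc (length-vac k s)) (≡.sym (ℕₚ.+-suc k n)))

  vac-< : ∀ k {n cs} (s : Sub n cs) → All (_< k + n) (vac k s)
  vac-< k none         = Allₚ.applyUpTo⁺₁ id k (λ {i} i<k → ≡.subst (i <_) (≡.sym (ℕₚ.+-identityʳ k)) i<k)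
  vac-< k (omit {n} s) = Allₚ.++⁺ (All.map (λ {i} p → ≡.subst (i <_) (≡.sym (ℕₚ.+-suc k n)) (ℕₚ.m<n⇒m<1+n p)) (vac-< k s))
    (≡.subst (k + n <_) (≡.sym (ℕₚ.+-suc k n)) ℕₚ.≤-refl ∷ [])
  vac-< k (take {n} s) = All.map (λ {i} p → ≡.subst (i <_) (≡.sym (ℕₚ.+-suc k n)) (ℕₚ.m<n⇒m<1+n p)) (vac-< k s)

  map-∸-suc : ∀ m qs → All (_< m) qs → L.map (λ q → m ∸ q) qs ≡ L.map suc (L.map (λ q → m ∸ 1 ∸ q) qs)
  map-∸-suc m       []       _        = ≡.refl
  map-∸-suc (suc m) (q ∷ qs) (s≤s p ∷ ps) = ≡.cong₂ _∷_ (ℕₚ.+-∸-assoc 1 p) (map-∸-suc (suc m) qs ps)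

  -- The beta-numbers of a partition and the reflected ones of its conjugate are complementary. Here
  -- both lists follow one boundary walk: either step enlarges k + n and so raises every reflected
  -- position by one, and `omit` also adds the position k + n, whose reflection is 0.
  beta-lam : ∀ k {n cs} (s : Sub n cs) → beta (lam k s) ≡ L.map (λ q → k + n ∸ 1 ∸ q) (vac k s)
  beta-lam k none = ≡.trans (zeros k) (≡.trans (≡.cong (λ m → applyUpTo (λ q → m ∸ 1 ∸ q) k) (≡.sym (ℕₚ.+-identityʳ k)))
    (≡.sym (Lₚ.map-applyUpTo id (λ q → k + 0 ∸ 1 ∸ q) k)))
    where
    zeros : ∀ k → beta (replicate k 0) ≡ applyUpTo (λ q → k ∸ 1 ∸ q) k
    zeros zero    = ≡.refl
    zeros (suc k) = ≡.cong₂ _∷_ (Lₚ.length-replicate k) (≡.trans (zeros k) (cong-sub k))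
      where
      cong-sub : ∀ k → applyUpTo (λ q → k ∸ 1 ∸ q) k ≡ applyUpTo (λ q → k ∸ suc q) k
      cong-sub zero    = ≡.refl
      cong-sub (suc k) = ≡.refl
  beta-lam k (omit {n} s) = begin
    beta (lam k s ++ 0 ∷ [])                             ≡⟨ beta-∷ʳ0 (lam k s) ⟩
    L.map suc (beta (lam k s)) ++ 0 ∷ []                 ≡⟨ ≡.cong (λ bs → L.map suc bs ++ 0 ∷ []) (beta-lam k s) ⟩
    L.map suc (L.map (λ q → k + n ∸ 1 ∸ q) (vac k s)) ++ 0 ∷ [] ≡⟨ ≡.cong₂ _++_ (map-∸-suc (k + n) (vac k s) (vac-< k s)) (≡.cong (_∷ []) (ℕₚ.n∸n≡0 (k + n))) ⟨
    L.map (λ q → k + n ∸ q) (vac k s) ++ k + n ∸ (k + n) ∷ [] ≡⟨ Lₚ.map-++ (λ q → k + n ∸ q) (vac k s) (k + n ∷ []) ⟨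
    L.map (λ q → k + n ∸ q) (vac k s ++ k + n ∷ [])      ≡⟨ ≡.cong (λ m → L.map (λ q → m ∸ 1 ∸ q) (vac k s ++ k + n ∷ [])) (ℕₚ.+-suc k n) ⟨
    L.map (λ q → k + suc n ∸ 1 ∸ q) (vac k s ++ k + n ∷ []) ∎
    where open ≡.≡-Reasoning
  beta-lam k (take {n} s) = begin
    beta (L.map suc (lam k s))                           ≡⟨ beta-suc (lam k s) ⟩
    L.map suc (beta (lam k s))                           ≡⟨ ≡.cong (L.map suc) (beta-lam k s) ⟩
    L.map suc (L.map (λ q → k + n ∸ 1 ∸ q) (vac k s))    ≡⟨ map-∸-suc (k + n) (vac k s) (vac-< k s) ⟨
    L.map (λ q → k + n ∸ q) (vac k s)                    ≡⟨ ≡.cong (λ m → L.map (λ q → m ∸ 1 ∸ q) (vac k s)) (ℕₚ.+-suc k n) ⟨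
    L.map (λ q → k + suc n ∸ 1 ∸ q) (vac k s)            ∎
    where open ≡.≡-Reasoning

  lam-≤ : ∀ k {n cs} (s : Sub n cs) → All (_≤ length cs) (lam k s)
  lam-≤ k none     = Allₚ.replicate⁺ k z≤n
  lam-≤ k (omit s) = Allₚ.++⁺ (lam-≤ k s) (z≤n ∷ [])
  lam-≤ k (take s) = Allₚ.map⁺ (All.map s≤s (lam-≤ k s))

  lam-decreasing : ∀ k {n cs} (s : Sub n cs) → Linked _≥_ (lam k s)
  lam-decreasing k none = zeros k
    where
    zeros : ∀ k → Linked _≥_ (replicate k 0)
    zeros zero          = []
    zeros (suc zero)    = [-]
    zeros (suc (suc k)) = z≤n ∷ zeros (suc k)
  lam-decreasing k (omit s) = append (lam k s) (lam-decreasing k s)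
    where
    append : ∀ ps → Linked _≥_ ps → Linked _≥_ (ps ++ 0 ∷ [])
    append []           _       = [-]
    append (p ∷ [])     _       = z≤n ∷ [-]
    append (p ∷ q ∷ ps) (r ∷ l) = r ∷ append (q ∷ ps) l
  lam-decreasing k (take s) = sucs (lam k s) (lam-decreasing k s)
    where
    sucs : ∀ ps → Linked _≥_ ps → Linked _≥_ (L.map suc ps)
    sucs []           _       = []
    sucs (p ∷ [])     _       = [-]
    sucs (p ∷ q ∷ ps) (r ∷ l) = s≤s r ∷ sucs (q ∷ ps) l

  -- The number of indices i with x ≤ b_i + s + i, i counted from 0.
  cnt : ℕ → ℕ → List ℕ → ℕ
  cnt s x []       = 0
  cnt s x (b ∷ bs) = (if x ≤ᵇ b + s then 1 else 0) + cnt (suc s) x bs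

  countᵇ-∷ : ∀ {A : Set} (p : A → Bool) x xs → countᵇ p (x ∷ xs) ≡ (if p x then 1 else 0) + countᵇ p xs
  countᵇ-∷ p x xs with p x
  ... | true  = ≡.refl
  ... | false = ≡.refl

  countᵇ-cnt : ∀ s x bs (p : ℕ → Bool) g → (∀ i → p (g i) ≡ (x ≤ᵇ at bs i + (s + i))) →
               countᵇ p (applyUpTo g (length bs)) ≡ cnt s x bs
  countᵇ-cnt s x []       p g h = ≡.refl
  countᵇ-cnt s x (b ∷ bs) p g h = ≡.trans (countᵇ-∷ p (g 0) _) (≡.cong₂ _+_
    (≡.cong (λ y → if y then 1 else 0) (≡.trans (h 0) (≡.cong (λ m → x ≤ᵇ b + m) (ℕₚ.+-identityʳ s))))
    (countᵇ-cnt (suc s) x bs p (g ∘ suc) (λ i → ≡.trans (h (suc i)) (≡.cong (λ m → x ≤ᵇ at bs i + m) (ℕₚ.+-suc s i)))))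

  oneTo-applyUpTo : ∀ n → oneTo n ≡ applyUpTo suc n
  oneTo-applyUpTo n = Lₚ.map-applyUpTo id suc n

  ≤ᵇ-suc : ∀ x y → (suc x ≤ᵇ suc y) ≡ (x ≤ᵇ y)
  ≤ᵇ-suc zero    y = ≡.refl
  ≤ᵇ-suc (suc x) y = ≡.refl

  cnt-suc : ∀ s x bs → cnt (suc s) (suc x) bs ≡ cnt s x bs
  cnt-suc s x []       = ≡.refl
  cnt-suc s x (b ∷ bs) = ≡.cong₂ _+_
    (≡.cong (λ y → if y then 1 else 0) (≡.trans (≡.cong (suc x ≤ᵇ_) (ℕₚ.+-suc b s)) (≤ᵇ-suc x (b + s)))) (cnt-suc (suc s) x bs)

  -- Along strictly decreasing legs b_i + i is weakly decreasing, so a first entry below x rules out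
  -- all later ones.
  cnt-zero : ∀ s x b bs → Linked _>_ (b ∷ bs) → b + s < x → cnt s x (b ∷ bs) ≡ 0
  cnt-zero s x b bs l p rewrite ≤ᵇ-false p = rest bs l
    where
    rest : ∀ bs → Linked _>_ (b ∷ bs) → cnt (suc s) x bs ≡ 0
    rest []        _       = ≡.refl
    rest (b′ ∷ bs) (q ∷ l) = cnt-zero (suc s) x b′ bs l
      (ℕₚ.≤-<-trans (≡.subst (_≤ b + s) (≡.sym (ℕₚ.+-suc b′ s)) (ℕₚ.+-monoˡ-≤ s q)) p)

  applyUpTo-cong< : ∀ {a} {A : Set a} n {f g : ℕ → A} → (∀ i → i < n → f i ≡ g i) → applyUpTo f n ≡ applyUpTo g n
  applyUpTo-cong< zero    h = ≡.refl
  applyUpTo-cong< (suc n) h = ≡.cong₂ _∷_ (h 0 (s≤s z≤n)) (applyUpTo-cong< n (λ i p → h (suc i) (s≤s p)))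

  -- Subsets record c = b + 1, which leaves 0 free as the mark of a finished path. This undoes the
  -- shift and lengthens each leg by k.
  legs : ℕ → List ℕ → List ℕ
  legs k cs = L.map (k +_) (L.map pred cs)

  legs-decreasing : ∀ k {cs} → Linked _>_ cs → All (1 ≤_) cs → Linked _>_ (legs k cs)
  legs-decreasing k []      _ = []
  legs-decreasing k [-]     _ = [-]
  legs-decreasing k {suc c ∷ suc c′ ∷ cs} (s≤s p ∷ l) (_ ∷ a@(s≤s z≤n ∷ _)) = ℕₚ.+-monoʳ-< k p ∷ legs-decreasing k l a

  length-legs : ∀ k cs → length (legs k cs) ≡ length cs
  length-legs k cs = ≡.trans (Lₚ.length-map (k +_) (L.map pred cs)) (Lₚ.length-map pred cs)

  -- Identifies the boundary walk with the counts in `fromFrob`. Under `omit` the new row lies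
  -- beyond every leg. Under `take` the new leg reaches every row in range, and for the other legs
  -- the raised threshold cancels against their raised index.
  lam-cnt : ∀ k {n cs} (s : Sub n cs) →
    applyUpTo (λ t → cnt 1 (suc (length cs + t)) (legs k cs)) (k + n ∸ length cs) ≡ lam k s
  lam-cnt k none = ≡.trans (≡.cong (applyUpTo (λ _ → 0)) (ℕₚ.+-identityʳ k)) (zeros k)
    where
    zeros : ∀ k → applyUpTo (λ _ → 0) k ≡ replicate k 0
    zeros zero    = ≡.refl
    zeros (suc k) = ≡.cong (0 ∷_) (zeros k)
  lam-cnt k (omit {n} {cs} s) = begin
    applyUpTo g (k + suc n ∸ d)              ≡⟨ ≡.cong (λ m → applyUpTo g (m ∸ d)) (ℕₚ.+-suc k n) ⟩
    applyUpTo g (suc (k + n) ∸ d)            ≡⟨ ≡.cong (applyUpTo g) (ℕₚ.+-∸-assoc 1 d≤) ⟩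
    applyUpTo g (suc (k + n ∸ d))            ≡⟨ Lₚ.applyUpTo-∷ʳ g (k + n ∸ d) ⟨
    applyUpTo g (k + n ∸ d) ++ g (k + n ∸ d) ∷ [] ≡⟨ ≡.cong₂ (λ xs y → xs ++ y ∷ []) (lam-cnt k s) last ⟩
    lam k s ++ 0 ∷ []                        ∎
    where
    open ≡.≡-Reasoning
    d : ℕ
    d = length cs
    g : ℕ → ℕ
    g t = cnt 1 (suc (d + t)) (legs k cs)
    d≤ : d ≤ k + n
    d≤ = ℕₚ.≤-trans (Sub-length s) (ℕₚ.m≤n+m n k)
    last : g (k + n ∸ d) ≡ 0
    last rewrite ℕₚ.m+[n∸m]≡n d≤ = bound cs (Sub-head s) (Sub-decreasing s) (Sub-positive s)
      where
      bound : ∀ cs → at cs 0 ≤ n → Linked _>_ cs → All (1 ≤_) cs → cnt 1 (suc (k + n)) (legs k cs) ≡ 0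
      bound []           _ _ _ = ≡.refl
      bound (suc c ∷ cs) p l a@(s≤s z≤n ∷ _) = cnt-zero 1 (suc (k + n)) (k + c) (legs k cs) (legs-decreasing k l a)
        (s≤s (≡.subst (_≤ k + n) (≡.sym (≡.trans (ℕₚ.+-assoc k c 1) (≡.cong (k +_) (ℕₚ.+-comm c 1)))) (ℕₚ.+-monoʳ-≤ k p)))
  lam-cnt k (take {n} {cs} s) = begin
    applyUpTo g (k + suc n ∸ suc d)      ≡⟨ ≡.cong (λ m → applyUpTo g (m ∸ suc d)) (ℕₚ.+-suc k n) ⟩
    applyUpTo g (k + n ∸ d)              ≡⟨ applyUpTo-cong< (k + n ∸ d) step ⟩
    applyUpTo (suc ∘ g′) (k + n ∸ d)     ≡⟨ Lₚ.map-applyUpTo g′ suc (k + n ∸ d) ⟨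
    L.map suc (applyUpTo g′ (k + n ∸ d)) ≡⟨ ≡.cong (L.map suc) (lam-cnt k s) ⟩
    L.map suc (lam k s)                  ∎
    where
    open ≡.≡-Reasoning
    d : ℕ
    d = length cs
    g g′ : ℕ → ℕ
    g t = cnt 1 (suc (suc d + t)) (legs k (suc n ∷ cs))
    g′ t = cnt 1 (suc (d + t)) (legs k cs)
    step : ∀ t → t < k + n ∸ d → g t ≡ suc (g′ t)
    step t t< = ≡.cong₂ _+_ (≡.cong (λ y → if y then 1 else 0) (≤ᵇ-true {suc (suc d + t)} {k + n + 1}
        (≡.subst (suc (suc d + t) ≤_) (ℕₚ.+-comm 1 (k + n)) (s≤s (<∸⇒+< t (k + n) d t<)))))
      (cnt-suc 1 (suc (d + t)) (legs k cs))

  arm : ℕ → List ℕ → List ℕ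
  arm s []       = []
  arm s (a ∷ as) = a + suc s ∷ arm (suc s) as

  length-arm : ∀ s as → length (arm s as) ≡ length as
  length-arm s []       = ≡.refl
  length-arm s (a ∷ as) = ≡.cong suc (length-arm (suc s) as)

  arm-applyUpTo : ∀ s as → applyUpTo (λ i → at as i + suc (s + i)) (length as) ≡ arm s as
  arm-applyUpTo s []       = ≡.refl
  arm-applyUpTo s (a ∷ as) = ≡.cong₂ _∷_ (≡.cong (λ m → a + suc m) (ℕₚ.+-identityʳ s))
    (≡.trans (applyUpTo-cong< (length as) (λ i _ → ≡.cong (λ m → at as i + suc m) (ℕₚ.+-suc s i))) (arm-applyUpTo (suc s) as))

  -- The index i in a_i + i and the descending shift of `beta` add up to a constant, so every arm is
  -- raised by the same amount.
  beta-arm : ∀ s as ps → beta (arm s as ++ ps) ≡ L.map (λ a → a + (s + (length as + length ps))) as ++ beta ps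
  beta-arm s []       ps = ≡.refl
  beta-arm s (a ∷ as) ps = ≡.cong₂ _∷_
    (≡.trans (≡.cong (a + suc s +_) (≡.trans (Lₚ.length-++ (arm (suc s) as)) (≡.cong (_+ length ps) (length-arm (suc s) as))))
      (≡.trans (ℕₚ.+-assoc a (suc s) _) (≡.cong (a +_) (≡.sym (ℕₚ.+-suc s _)))))
    (≡.trans (beta-arm (suc s) as ps)
      (≡.cong (λ m → L.map (λ a → a + m) as ++ beta ps) (≡.sym (ℕₚ.+-suc s _))))

  arm-decreasing : ∀ s as ps → Linked _>_ as → Linked _≥_ ps → at ps 0 ≤ s + length as → Linked _≥_ (arm s as ++ ps)
  arm-decreasing s []            ps _       l p = l
  arm-decreasing s (a ∷ [])      ps _       l p = link-≥ (ℕₚ.≤-trans p (≡.subst (_≤ a + suc s) (ℕₚ.+-comm 1 s) (ℕₚ.m≤n+m (suc s) a))) l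
  arm-decreasing s (a ∷ a′ ∷ as) ps (q ∷ m) l p =
    ≡.subst (_≤ a + suc s) (≡.sym (ℕₚ.+-suc a′ (suc s))) (ℕₚ.+-monoˡ-≤ (suc s) q)
    ∷ arm-decreasing (suc s) (a′ ∷ as) ps m l (≡.subst (at ps 0 ≤_) (ℕₚ.+-suc s _) p)

  -- Zeros pad the partition to exactly k + n parts, so that the Jacobi-Trudi matrices of all plane
  -- partitions have the same size.
  shape : ∀ k {n cs} → Sub n cs → List ℕ → List ℕ
  shape k s as = arm 0 as ++ lam k s

  removeZeros-zeros : ∀ {ps} → Linked _≥_ (0 ∷ ps) → removeZeros ps ≡ []
  removeZeros-zeros [-]         = ≡.refl
  removeZeros-zeros (z≤n ∷ dec) = removeZeros-zeros dec

  removeZeros-++ : ∀ xs ys → removeZeros (xs ++ ys) ≡ removeZeros xs ++ removeZeros ys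
  removeZeros-++ = Lₚ.filter-++ (T? ∘ (1 ≤ᵇ_))

  removeZeros-applyUpTo : ∀ (g : ℕ → ℕ) {m n} → m ≤ n → (∀ i → m ≤ i → i < n → g i ≡ 0) →
                          removeZeros (applyUpTo g m) ≡ removeZeros (applyUpTo g n)
  removeZeros-applyUpTo g {zero} {zero}  _ h = ≡.refl
  removeZeros-applyUpTo g {zero} {suc n} _ h with g 0 | h 0 z≤n (s≤s z≤n)
  ... | .0 | ≡.refl = removeZeros-applyUpTo (g ∘ suc) {0} {n} z≤n (λ i _ p → h (suc i) z≤n (s≤s p))
  removeZeros-applyUpTo g {suc m} {suc n} (s≤s m≤n) h with g 0
  ... | zero  = removeZeros-applyUpTo (g ∘ suc) m≤n (λ i p q → h (suc i) (s≤s p) (s≤s q))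
  ... | suc x = ≡.cong (suc x ∷_) (removeZeros-applyUpTo (g ∘ suc) m≤n (λ i p q → h (suc i) (s≤s p) (s≤s q)))

  fromFrob-shape : ∀ k {n cs} (s : Sub n cs) as → length as ≡ length cs → 1 ≤ k + n →
                   fromFrob as (legs k cs) ≡ removeZeros (shape k s as)
  fromFrob-shape k {n} {cs} s as e pos = begin
    removeZeros (L.map (λ i → at as (i ∸ 1) + i) (oneTo d) ++ L.map g (upTo (suc (at bs 0) ∸ d)))
      ≡⟨ ≡.cong₂ (λ xs ys → removeZeros (xs ++ ys))
           (≡.trans (≡.cong (L.map _) (oneTo-applyUpTo d)) (≡.trans (Lₚ.map-applyUpTo suc _ d) (arm-applyUpTo 0 as)))
           (≡.trans (Lₚ.map-applyUpTo id g _) (applyUpTo-cong< (suc (at bs 0) ∸ d) (λ t _ → g-cnt t))) ⟩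
    removeZeros (arm 0 as ++ applyUpTo g′ (suc (at bs 0) ∸ d))
      ≡⟨ removeZeros-++ (arm 0 as) _ ⟩
    removeZeros (arm 0 as) ++ removeZeros (applyUpTo g′ (suc (at bs 0) ∸ d))
      ≡⟨ ≡.cong (removeZeros (arm 0 as) ++_) (≡.trans (removeZeros-applyUpTo g′ (tail-≤ cs (Sub-head s) (Sub-positive s)) (tail-0 cs (Sub-decreasing s) (Sub-positive s)))
           (≡.cong removeZeros (≡.trans (≡.cong (λ m → applyUpTo (λ t → cnt 1 (suc (m + t)) bs) (k + n ∸ m)) e) (lam-cnt k s)))) ⟩
    removeZeros (arm 0 as) ++ removeZeros (lam k s)
      ≡⟨ removeZeros-++ (arm 0 as) (lam k s) ⟨
    removeZeros (shape k s as) ∎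
    where
    open ≡.≡-Reasoning
    d : ℕ
    d = length as
    bs : List ℕ
    bs = legs k cs
    g g′ : ℕ → ℕ
    g t = countᵇ (λ j → suc (d + t) ≤ᵇ (at bs (j ∸ 1) + j)) (oneTo d)
    g′ t = cnt 1 (suc (d + t)) bs
    g-cnt : ∀ t → g t ≡ g′ t
    g-cnt t = ≡.trans (≡.cong (countᵇ _) (≡.trans (oneTo-applyUpTo d) (≡.cong (applyUpTo suc) (≡.trans e (≡.sym (length-legs k cs))))))
      (countᵇ-cnt 1 (suc (d + t)) bs (λ j → suc (d + t) ≤ᵇ (at bs (j ∸ 1) + j)) suc (λ i → ≡.refl))
    tail-≤ : ∀ cs → at cs 0 ≤ n → All (1 ≤_) cs → suc (at (legs k cs) 0) ∸ d ≤ k + n ∸ d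
    -- For the empty symbol `at` defaults to 0, so `fromFrob` generates one entry, a zero; 1 ≤ k + n
    -- makes room for it.
    tail-≤ []           p _ = ℕₚ.∸-monoˡ-≤ d pos
    tail-≤ (suc c ∷ cs) p (s≤s z≤n ∷ _) = ℕₚ.∸-monoˡ-≤ d (≡.subst (_≤ k + n) (ℕₚ.+-suc k c) (ℕₚ.+-monoʳ-≤ k p))
    tail-0 : ∀ cs → Linked _>_ cs → All (1 ≤_) cs → ∀ i → suc (at (legs k cs) 0) ∸ d ≤ i → i < k + n ∸ d → cnt 1 (suc (d + i)) (legs k cs) ≡ 0
    tail-0 []           l a i p _ = ≡.refl
    tail-0 (suc c ∷ cs) l a@(s≤s z≤n ∷ _) i p _ = cnt-zero 1 (suc (d + i)) (k + c) (legs k cs) (legs-decreasing k l a)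
      (s≤s (≡.subst (_≤ d + i) (ℕₚ.+-comm 1 (k + c)) (ℕₚ.≤-trans (ℕₚ.m≤n+m∸n (suc (k + c)) d) (ℕₚ.+-monoʳ-≤ d p))))

  length-shape : ∀ k {n cs} (s : Sub n cs) as → length as ≡ length cs → length (shape k s as) ≡ k + n
  length-shape k {n} {cs} s as e = ≡.trans (Lₚ.length-++ (arm 0 as)) (≡.trans (ℕₚ.+-comm (length (arm 0 as)) (length (lam k s)))
    (≡.trans (≡.cong (length (lam k s) +_) (≡.trans (length-arm 0 as) e)) (length-lam k s)))

  shape-decreasing : ∀ k {n cs} (s : Sub n cs) as → length as ≡ length cs → Linked _>_ as → Linked _≥_ (shape k s as)
  shape-decreasing k s as e l = arm-decreasing 0 as (lam k s) l (lam-decreasing k s)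
    (at-All-≤ (lam k s) 0 (≡.subst (λ m → All (_≤ m) (lam k s)) (≡.sym e) (lam-≤ k s)))

  beta-shape : ∀ k {n cs} (s : Sub n cs) as → length as ≡ length cs →
    beta (shape k s as) ≡ L.map (λ a → a + (k + n)) as ++ L.map (λ q → k + n ∸ 1 ∸ q) (vac k s)
  beta-shape k {n} {cs} s as e = ≡.trans (beta-arm 0 as (lam k s)) (≡.cong₂ _++_
    (≡.cong (λ m → L.map (λ a → a + m) as) (≡.trans (≡.cong (_+ length (lam k s)) e)
      (≡.trans (ℕₚ.+-comm (length cs) (length (lam k s))) (length-lam k s))))
    (beta-lam k s))

-- Arrays of non-intersecting paths

module Arrays where

  open import Data.Nat using (_+_; _*_)
  open Preliminaries
  open Shapes

  -- c′ < c, or both are 0.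
  infix 4 _⊒_
  _⊒_ : ℕ → ℕ → Set
  c ⊒ c′ = c′ ≤ c ∸ 1

  -- The heights b = c - 1 of the living paths. Stopping at the first zero loses nothing, since in a
  -- `⊒`-linked row a zero is followed by zeros only.
  pos : List ℕ → List ℕ
  pos []           = []
  pos (zero ∷ cs)  = []
  pos (suc b ∷ cs) = b ∷ pos cs

  -- Consecutive rows of an array satisfy c_{t+1}(i) ∈ [ c_t(i+1) , c_t(i) - 1 ]: these are
  -- non-intersecting lattice paths, c_t(i) - 1 being the height of the i-th path at time t.
  data Next : List ℕ → List ℕ → Set where
    []   : Next [] []
    cons : ∀ {c cs γ γs} → at cs 0 ≤ γ → c ⊒ γ → Next cs γs → Next (c ∷ cs) (γ ∷ γs)

  data Chain : ℕ → List ℕ → List (List ℕ) → Set where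
    []  : ∀ {cs} → Chain 0 cs []
    _∷_ : ∀ {m cs cs′ ch} → Next cs cs′ → Chain m cs′ ch → Chain (suc m) cs (cs′ ∷ ch)

  range : ℕ → ℕ → List ℕ
  range lo hi = L.map (lo +_) (upTo (suc hi ∸ lo))

  ∈-range : ∀ {lo hi x} → lo ≤ x → x ≤ hi → x ∈ range lo hi
  ∈-range {lo} {hi} {x} lo≤x x≤hi = ≡.subst (_∈ range lo hi) (ℕₚ.m+[n∸m]≡n lo≤x)
    (∈ₚ.∈-map⁺ (lo +_) (∈ₚ.∈-upTo⁺ (≡.subst (suc (x ∸ lo) ≤_) (≡.sym (ℕₚ.+-∸-assoc 1 (ℕₚ.≤-trans lo≤x x≤hi))) (s≤s (ℕₚ.∸-monoˡ-≤ lo x≤hi)))))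

  ∈-range⁻ : ∀ {lo hi x} → x ∈ range lo hi → lo ≤ x × x ≤ hi
  ∈-range⁻ {lo} {hi} x∈ with ∈ₚ.∈-map⁻ (lo +_) x∈
  ... | s , s∈ , ≡.refl = ℕₚ.m≤m+n lo s , ℕ.≤-pred (<∸⇒+< s (suc hi) lo (∈ₚ.∈-upTo⁻ s∈))

  range-unique : ∀ lo hi → Unique (range lo hi)
  range-unique lo hi = Uniqueₚ.map⁺ (ℕₚ.+-cancelˡ-≡ lo _ _) (Uniqueₚ.upTo⁺ (suc hi ∸ lo))

  prefixed : ∀ {A : Set} → List A → (A → List (List A)) → List (List A)
  prefixed xs g = concatMap (λ x → L.map (x ∷_) (g x)) xs

  ∈-prefixed : ∀ {A : Set} (xs : List A) (g : A → List (List A)) {x ys} → x ∈ xs → ys ∈ g x → x ∷ ys ∈ prefixed xs g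
  ∈-prefixed xs g {x} x∈ ys∈ = ∈ₚ.∈-concatMap⁺ (λ x → L.map (x ∷_) (g x)) (lose x∈ (∈ₚ.∈-map⁺ (x ∷_) ys∈))

  ∈-prefixed⁻ : ∀ {A : Set} (xs : List A) (g : A → List (List A)) {zs} → zs ∈ prefixed xs g →
                ∃ λ x → ∃ λ ys → zs ≡ x ∷ ys × x ∈ xs × ys ∈ g x
  ∈-prefixed⁻ xs g zs∈ with find (∈ₚ.∈-concatMap⁻ (λ x → L.map (x ∷_) (g x)) {xs = xs} zs∈)
  ... | x , x∈ , zs∈′ with ∈ₚ.∈-map⁻ (x ∷_) zs∈′
  ... | ys , ys∈ , e = x , ys , e , x∈ , ys∈

  prefixed-unique : ∀ {A : Set} (xs : List A) (g : A → List (List A)) → Unique xs → (∀ x → Unique (g x)) → Unique (prefixed xs g)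
  prefixed-unique []       g _        h = []
  prefixed-unique (x ∷ xs) g (p ∷ ps) h = Uniqueₚ.++⁺ (Uniqueₚ.map⁺ (λ e → Lₚ.∷-injectiveʳ e) (h x)) (prefixed-unique xs g ps h) disjoint
    where
    disjoint : ∀ {v} → ¬ (v ∈ L.map (x ∷_) (g x) × v ∈ prefixed xs g)
    disjoint (v∈ , v∈′) with ∈ₚ.∈-map⁻ (x ∷_) v∈ | ∈-prefixed⁻ xs g v∈′
    ... | _ , _ , e | x′ , _ , e′ , x′∈ , _ = All.lookup p x′∈ (Lₚ.∷-injectiveˡ (≡.trans (≡.sym e) e′))

  nextL : List ℕ → List (List ℕ)
  nextL []       = [] ∷ []
  nextL (c ∷ cs) = prefixed (range (at cs 0) (c ∸ 1)) (λ _ → nextL cs)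

  chainsL : ℕ → List ℕ → List (List (List ℕ))
  chainsL zero    cs = [] ∷ []
  chainsL (suc m) cs = prefixed (nextL cs) (chainsL m)

  ∈-nextL : ∀ {cs cs′} → Next cs cs′ → cs′ ∈ nextL cs
  ∈-nextL []             = here ≡.refl
  ∈-nextL (cons lo hi n) = ∈-prefixed _ _ (∈-range lo hi) (∈-nextL n)

  ∈-nextL⁻ : ∀ cs {cs′} → cs′ ∈ nextL cs → Next cs cs′
  ∈-nextL⁻ []       (here ≡.refl) = []
  ∈-nextL⁻ (c ∷ cs) p with ∈-prefixed⁻ (range (at cs 0) (c ∸ 1)) (λ _ → nextL cs) p
  ... | γ , γs , ≡.refl , γ∈ , γs∈ = cons (proj₁ (∈-range⁻ γ∈)) (proj₂ (∈-range⁻ {at cs 0} γ∈)) (∈-nextL⁻ cs γs∈)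

  ∈-chainsL : ∀ {m cs ch} → Chain m cs ch → ch ∈ chainsL m cs
  ∈-chainsL []       = here ≡.refl
  ∈-chainsL (n ∷ ch) = ∈-prefixed _ _ (∈-nextL n) (∈-chainsL ch)

  ∈-chainsL⁻ : ∀ m cs {ch} → ch ∈ chainsL m cs → Chain m cs ch
  ∈-chainsL⁻ zero    cs (here ≡.refl) = []
  ∈-chainsL⁻ (suc m) cs p with ∈-prefixed⁻ (nextL cs) (chainsL m) p
  ... | c′ , ch , ≡.refl , c′∈ , ch∈ = ∈-nextL⁻ cs c′∈ ∷ ∈-chainsL⁻ m c′ ch∈

  nextL-unique : ∀ cs → Unique (nextL cs)
  nextL-unique []       = [] ∷ []
  nextL-unique (c ∷ cs) = prefixed-unique _ _ (range-unique (at cs 0) (c ∸ 1)) (λ _ → nextL-unique cs)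

  chainsL-unique : ∀ m cs → Unique (chainsL m cs)
  chainsL-unique zero    cs = [] ∷ []
  chainsL-unique (suc m) cs = prefixed-unique _ _ (nextL-unique cs) (chainsL-unique m)

  Next-head : ∀ {cs cs′} → Next cs cs′ → at cs′ 0 ≤ at cs 0 ∸ 1
  Next-head []            = z≤n
  Next-head (cons _ hi _) = hi

  -- The upper bound on one entry meets the lower bound on its left neighbour: γ(i+1) ≤ c(i+1) - 1 ≤
  -- γ(i) - 1.
  Next-linked : ∀ {cs cs′} → Next cs cs′ → Linked _⊒_ cs′
  Next-linked []                              = []
  Next-linked (cons _ _ [])                   = [-]
  Next-linked (cons lo hi n@(cons _ hi′ _)) = ℕₚ.≤-trans hi′ (ℕₚ.∸-monoˡ-≤ 1 lo) ∷ Next-linked n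

  Next-zeros : ∀ {cs cs′} → Linked _⊒_ (0 ∷ cs) → Next cs cs′ → pos cs′ ≡ []
  Next-zeros l         []                           = ≡.refl
  Next-zeros (z≤n ∷ l) (cons {γ = zero} lo hi n) = ≡.refl

  -- At each time at most one path ends, and then it is the last one: γ(i) ≥ c(i+1) keeps a path
  -- alive as long as the path after it is alive.
  data Survives (cs cs′ : List ℕ) : Set where
    all-survive : length (pos cs′) ≡ length (pos cs) → L.take (length (pos cs)) cs′ ≡ L.map suc (pos cs′) → Survives cs cs′
    last-dies   : suc (length (pos cs′)) ≡ length (pos cs) → L.take (length (pos cs)) cs′ ≡ L.map suc (pos cs′) ++ 0 ∷ [] → Survives cs cs′

  survives : ∀ {cs cs′} → Linked _⊒_ cs → Next cs cs′ → Survives cs cs′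
  survives l [] = all-survive ≡.refl ≡.refl
  survives {zero ∷ cs} l n@(cons _ _ _) = all-survive (≡.cong length (Next-zeros (z≤n ∷ l) n)) (≡.cong (L.map suc) (≡.sym (Next-zeros (z≤n ∷ l) n)))
  survives {suc b ∷ cs} l (cons {γ = suc g} lo hi n) with survives (Linked.tail l) n
  ... | all-survive e₁ e₂ = all-survive (≡.cong suc e₁) (≡.cong (suc g ∷_) e₂)
  ... | last-dies e₁ e₂   = last-dies (≡.cong suc e₁) (≡.cong (suc g ∷_) e₂)
  survives {suc b ∷ []} l (cons {γ = zero} lo hi []) = last-dies ≡.refl ≡.refl
  survives {suc b ∷ zero ∷ cs} l (cons {γ = zero} lo hi n) = last-dies ≡.refl ≡.refl

  -- The times t at which an entry becomes 0, in decreasing order: the numbers a_1 > … > a_d.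
  arms : ℕ → List ℕ → List ℕ → List (List ℕ) → List ℕ
  arms t cs as []         = as
  arms t cs as (cs′ ∷ ch) = arms (suc t) cs′ (if length (pos cs′) <ᵇ length (pos cs) then t ∷ as else as) ch

  pos-0 : ∀ {cs} → at cs 0 ≤ 0 → pos cs ≡ []
  pos-0 {[]}        _ = ≡.refl
  pos-0 {zero ∷ cs} _ = ≡.refl

  <ᵇ-irrefl : ∀ n → (n <ᵇ n) ≡ false
  <ᵇ-irrefl zero    = ≡.refl
  <ᵇ-irrefl (suc n) = <ᵇ-irrefl n

  <ᵇ-suc : ∀ n → (n <ᵇ suc n) ≡ true
  <ᵇ-suc n = <ᵇ-true (ℕₚ.n<1+n n)

  Below : ℕ → List ℕ → Set
  Below t as = Linked _>_ (t ∷ as)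

  Below-suc : ∀ {t as} → Below t as → Below (suc t) as
  Below-suc [-]     = [-]
  Below-suc (p ∷ l) = ℕₚ.m<n⇒m<1+n p ∷ l

  -- A nonzero first entry drops at every step, so m steps from a height of at most m end all paths,
  -- and each is recorded once. Times are put in front as they grow, which gives the decreasing
  -- order.
  arms-props : ∀ {m t cs as ch} → Linked _⊒_ cs → at cs 0 ≤ m → Chain m cs ch → Below t as →
    length (arms t cs as ch) ≡ length (pos cs) + length as × Linked _>_ (arms t cs as ch)
  arms-props {cs = cs} l p [] b rewrite pos-0 {cs} p = ≡.refl , Linked.tail b
  arms-props {t = t} {cs} {as} l p (_∷_ {cs′ = cs′} n ch) b with survives l n
  ... | all-survive e _ rewrite e | <ᵇ-irrefl (length (pos cs)) with arms-props {t = suc t} {as = as} (Next-linked n) (ℕₚ.≤-trans (Next-head n) (ℕₚ.∸-monoˡ-≤ 1 p)) ch (Below-suc b)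
  ...   | e₁ , e₂ = ≡.trans e₁ (≡.cong (_+ length as) e) , e₂
  arms-props {t = t} {cs} {as} l p (_∷_ {cs′ = cs′} n ch) b | last-dies e _ rewrite ≡.sym e | <ᵇ-suc (length (pos cs′)) with arms-props {t = suc t} {as = t ∷ as} (Next-linked n) (ℕₚ.≤-trans (Next-head n) (ℕₚ.∸-monoˡ-≤ 1 p)) ch (ℕₚ.≤-refl ∷ b)
  ...   | e₁ , e₂ = ≡.trans e₁ (ℕₚ.+-suc (length (pos cs′)) (length as)) , e₂

  pad : ℕ → List ℕ → List ℕ
  pad n cs = cs ++ replicate (n ∸ length cs) 0

  pos-pad : ∀ n {cs} → All (1 ≤_) cs → pos (pad n cs) ≡ L.map pred cs
  pos-pad n {[]} [] = zeros n
    where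
    zeros : ∀ n → pos (replicate n 0) ≡ []
    zeros zero    = ≡.refl
    zeros (suc n) = ≡.refl
  pos-pad n {suc c ∷ cs} (s≤s _ ∷ a) = ≡.cong (c ∷_) (go (n ∸ length (suc c ∷ cs)) a)
    where
    go : ∀ m {cs} → All (1 ≤_) cs → pos (cs ++ replicate m 0) ≡ L.map pred cs
    go zero    {[]} [] = ≡.refl
    go (suc m) {[]} [] = ≡.refl
    go m {suc c ∷ cs} (s≤s _ ∷ a) = ≡.cong (c ∷_) (go m a)

  pad-linked : ∀ m {cs} → Linked _>_ cs → Linked _⊒_ (cs ++ replicate m 0)
  pad-linked m {[]} _ = zeros m
    where
    zeros : ∀ n → Linked _⊒_ (replicate n 0)
    zeros zero          = []
    zeros (suc zero)    = [-]
    zeros (suc (suc n)) = z≤n ∷ zeros (suc n)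
  pad-linked zero    {c ∷ []} _ = [-]
  pad-linked (suc m) {c ∷ []} _ = z≤n ∷ pad-linked (suc m) {[]} []
  pad-linked m {suc c ∷ c′ ∷ cs} (s≤s p ∷ l) = p ∷ pad-linked m l

  pad-head : ∀ n m {cs} → at cs 0 ≤ n → at (cs ++ replicate m 0) 0 ≤ n
  pad-head n zero    {[]}    p = z≤n
  pad-head n (suc m) {[]}    p = z≤n
  pad-head n m       {_ ∷ _} p = p

  unique-map : ∀ {A B : Set} (f : A → B) {xs} → (∀ {x y} → x ∈ xs → y ∈ xs → f x ≡ f y → x ≡ y) → Unique xs → Unique (L.map f xs)
  unique-map f inj []       = []
  unique-map f inj (p ∷ ps) = Allₚ.map⁺ (All.tabulate (λ {y} y∈ e → All.lookup p y∈ (inj (here ≡.refl) (there y∈) e)))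
    ∷ unique-map f (λ x∈ y∈ → inj (there x∈) (there y∈)) ps

  at-ext : ∀ xs ys → length xs ≡ length ys → (∀ i → i < length xs → at xs i ≡ at ys i) → xs ≡ ys
  at-ext []       []       _ _ = ≡.refl
  at-ext (x ∷ xs) (y ∷ ys) e h = ≡.cong₂ _∷_ (h 0 (s≤s z≤n)) (at-ext xs ys (ℕₚ.suc-injective e) (λ i p → h (suc i) (s≤s p)))

  at-applyUpTo : ∀ f n i → i < n → at (applyUpTo f n) i ≡ f i
  at-applyUpTo f (suc n) zero    _       = ≡.refl
  at-applyUpTo f (suc n) (suc i) (s≤s p) = at-applyUpTo (f ∘ suc) n i p

  at-beyond : ∀ xs i → length xs ≤ i → at xs i ≡ 0
  at-beyond []       i       _       = ≡.refl
  at-beyond (x ∷ xs) (suc i) (s≤s p) = at-beyond xs i p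

  rowAt : List (List ℕ) → ℕ → List ℕ
  rowAt []       _       = []
  rowAt (r ∷ rs) zero    = r
  rowAt (r ∷ rs) (suc t) = rowAt rs t

  rowAt-ext : ∀ rs ss → length rs ≡ length ss → (∀ t → t < length rs → rowAt rs t ≡ rowAt ss t) → rs ≡ ss
  rowAt-ext []       []       _ _ = ≡.refl
  rowAt-ext (r ∷ rs) (s ∷ ss) e h = ≡.cong₂ _∷_ (h 0 (s≤s z≤n)) (rowAt-ext rs ss (ℕₚ.suc-injective e) (λ i p → h (suc i) (s≤s p)))

  rowAt-applyUpTo : ∀ f n t → t < n → rowAt (applyUpTo f n) t ≡ f t
  rowAt-applyUpTo f (suc n) zero    _       = ≡.refl
  rowAt-applyUpTo f (suc n) (suc t) (s≤s p) = rowAt-applyUpTo (f ∘ suc) n t p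

  starts : ℕ → List (List ℕ)
  starts n = L.map (λ (cs , _) → pad n cs) (subsets n)

  -- Since the first entry is at most n and drops until it is 0, the n further rows carry every path
  -- to its end.
  arrays : ℕ → List (List (List ℕ))
  arrays n = prefixed (starts n) (chainsL n)

  subsets-complete : ∀ {n cs} (s : Sub n cs) → (cs , s) ∈ subsets n
  subsets-complete none         = here ≡.refl
  subsets-complete (omit {n} s) = ∈ₚ.∈-++⁺ˡ (∈ₚ.∈-map⁺ (λ (cs , s) → cs , omit s) (subsets-complete s))
  subsets-complete (take {n} s) = ∈ₚ.∈-++⁺ʳ (L.map (λ (cs , s) → cs , omit s) (subsets n)) (∈ₚ.∈-map⁺ (λ (cs , s) → suc n ∷ cs , take s) (subsets-complete s))

  subsets-unique : ∀ n → Unique (L.map proj₁ (subsets n))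
  subsets-unique zero    = [] ∷ []
  subsets-unique (suc n) = ≡.subst Unique (≡.sym split) (Uniqueₚ.++⁺ (subsets-unique n) (Uniqueₚ.map⁺ Lₚ.∷-injectiveʳ (subsets-unique n)) disjoint)
    where
    split : L.map proj₁ (subsets (suc n)) ≡ L.map proj₁ (subsets n) ++ L.map (suc n ∷_) (L.map proj₁ (subsets n))
    split = ≡.trans (Lₚ.map-++ proj₁ (L.map (λ (cs , s) → cs , omit s) (subsets n)) _)
      (≡.cong₂ _++_ (≡.sym (Lₚ.map-∘ (subsets n))) (≡.trans (≡.sym (Lₚ.map-∘ (subsets n))) (Lₚ.map-∘ (subsets n))))
    disjoint : ∀ {v} → ¬ (v ∈ L.map proj₁ (subsets n) × v ∈ L.map (suc n ∷_) (L.map proj₁ (subsets n)))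
    disjoint (p , q) with ∈ₚ.∈-map⁻ proj₁ p | ∈ₚ.∈-map⁻ (suc n ∷_) q
    ... | (_ , s) , _ , ≡.refl | _ , _ , ≡.refl = ℕₚ.1+n≰n (Sub-head s)

  starts-unique : ∀ n → Unique (starts n)
  starts-unique n = ≡.subst Unique (≡.sym (Lₚ.map-∘ (subsets n))) (unique-map (pad n) inj (subsets-unique n))
    where
    positive : ∀ {cs} → cs ∈ L.map proj₁ (subsets n) → All (1 ≤_) cs
    positive p with ∈ₚ.∈-map⁻ proj₁ p
    ... | (_ , s) , _ , ≡.refl = Sub-positive s
    inj : ∀ {x y} → x ∈ L.map proj₁ (subsets n) → y ∈ L.map proj₁ (subsets n) → pad n x ≡ pad n y → x ≡ y
    inj x∈ y∈ e = ≡.trans (≡.sym (map-suc-pred (positive x∈))) (≡.trans (≡.cong (L.map suc)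
      (≡.trans (≡.sym (pos-pad n (positive x∈))) (≡.trans (≡.cong pos e) (pos-pad n (positive y∈))))) (map-suc-pred (positive y∈)))

  arrays-unique : ∀ n → Unique (arrays n)
  arrays-unique n = prefixed-unique (starts n) (chainsL n) (starts-unique n) (chainsL-unique n)

  pos-complement : ∀ cs → Linked _⊒_ cs → cs ≡ L.map suc (pos cs) ++ replicate (length cs ∸ length (L.map suc (pos cs))) 0
  pos-complement []           _ = ≡.refl
  pos-complement (zero ∷ cs)  l = ≡.cong (0 ∷_) (zeros cs l)
    where
    zeros : ∀ cs → Linked _⊒_ (0 ∷ cs) → cs ≡ replicate (length cs) 0
    zeros []       _         = ≡.refl
    zeros (_ ∷ cs) (z≤n ∷ l) = ≡.cong (0 ∷_) (zeros cs l)
  pos-complement (suc b ∷ cs) l = ≡.cong (suc b ∷_) (pos-complement cs (Linked.tail l))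

  toSub : ∀ n cs → Linked _⊒_ cs → at cs 0 ≤ n → Sub n (L.map suc (pos cs))
  toSub zero    cs           l p rewrite pos-0 {cs} p = none
  toSub (suc n) []           l p = omit (toSub n [] l z≤n)
  toSub (suc n) (zero ∷ cs)  l p = omit (toSub n (zero ∷ cs) l z≤n)
  toSub (suc n) (suc b ∷ cs) l p with b ℕ.≟ n
  ... | yes ≡.refl = take (toSub n cs (Linked.tail l) (head-≤ l))
    where
    head-≤ : ∀ {c cs} → Linked _⊒_ (suc c ∷ cs) → at cs 0 ≤ c
    head-≤ [-]     = z≤n
    head-≤ (q ∷ _) = q
  ... | no b≢n = omit (toSub n (suc b ∷ cs) l (ℕₚ.≤∧≢⇒< (ℕ.≤-pred p) b≢n))

  ∈-starts : ∀ n cs → length cs ≡ n → Linked _⊒_ cs → at cs 0 ≤ n → cs ∈ starts n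
  ∈-starts n cs e l p = ≡.subst (_∈ starts n) (≡.trans (≡.cong (λ m → L.map suc (pos cs) ++ replicate (m ∸ length (L.map suc (pos cs))) 0) (≡.sym e)) (≡.sym (pos-complement cs l)))
    (∈ₚ.∈-map⁺ (λ (cs , _) → pad n cs) (subsets-complete (toSub n cs l p)))

  ∈-starts⁻ : ∀ n {cs} → cs ∈ starts n → length cs ≡ n × Linked _⊒_ cs × at cs 0 ≤ n
  ∈-starts⁻ n p with ∈ₚ.∈-map⁻ (λ (cs , _) → pad n cs) p
  ... | (cs , s) , _ , ≡.refl = ≡.trans (Lₚ.length-++ cs) (≡.trans (≡.cong (length cs +_) (Lₚ.length-replicate (n ∸ length cs))) (ℕₚ.m+[n∸m]≡n (Sub-length s)))
    , pad-linked (n ∸ length cs) (Sub-decreasing s) , pad-head n (n ∸ length cs) {cs} (Sub-head s)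

  next-applyUpTo : ∀ n (g g′ : ℕ → ℕ) → (∀ i → suc i < n → g (suc i) ≤ g′ i) → (∀ i → i < n → g i ⊒ g′ i) → Next (applyUpTo g n) (applyUpTo g′ n)
  next-applyUpTo zero          g g′ lo hi = []
  next-applyUpTo (suc zero)    g g′ lo hi = cons z≤n (hi 0 (s≤s z≤n)) []
  next-applyUpTo (suc (suc n)) g g′ lo hi = cons (lo 0 (s≤s (s≤s z≤n))) (hi 0 (s≤s z≤n))
    (next-applyUpTo (suc n) (g ∘ suc) (g′ ∘ suc) (λ i p → lo (suc i) (s≤s p)) (λ i p → hi (suc i) (s≤s p)))

  chain-applyUpTo : ∀ m (ρ : ℕ → List ℕ) → (∀ t → Next (ρ t) (ρ (suc t))) → Chain m (ρ 0) (applyUpTo (ρ ∘ suc) m)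
  chain-applyUpTo zero    ρ h = []
  chain-applyUpTo (suc m) ρ h = h 0 ∷ chain-applyUpTo m (ρ ∘ suc) (h ∘ suc)

  Next-at : ∀ {cs cs′} → Next cs cs′ → ∀ i → at cs (suc i) ≤ at cs′ i × at cs i ⊒ at cs′ i
  Next-at []             i       = z≤n , z≤n
  Next-at (cons lo hi n) zero    = lo , hi
  Next-at (cons lo hi n) (suc i) = Next-at n i

  Next-length : ∀ {cs cs′} → Next cs cs′ → length cs′ ≡ length cs
  Next-length []           = ≡.refl
  Next-length (cons _ _ n) = ≡.cong suc (Next-length n)

  Chain-Next : ∀ {m cs ch} → Chain m cs ch → ∀ t → t < m → Next (rowAt (cs ∷ ch) t) (rowAt (cs ∷ ch) (suc t))
  Chain-Next (n ∷ c) zero    _       = n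
  Chain-Next (n ∷ c) (suc t) (s≤s p) = Chain-Next c t p

  Chain-length : ∀ {m cs ch} → Chain m cs ch → length ch ≡ m
  Chain-length []      = ≡.refl
  Chain-length (n ∷ c) = ≡.cong suc (Chain-length c)

  Linked-at : ∀ {cs} → Linked _⊒_ cs → ∀ i → at cs i ⊒ at cs (suc i)
  Linked-at []      i       = z≤n
  Linked-at [-]     zero    = z≤n
  Linked-at [-]     (suc i) = z≤n
  Linked-at (p ∷ l) zero    = p
  Linked-at (p ∷ l) (suc i) = Linked-at l i

  linked-applyUpTo : ∀ n (g : ℕ → ℕ) → (∀ i → suc i < n → g i ⊒ g (suc i)) → Linked _⊒_ (applyUpTo g n)
  linked-applyUpTo zero          g h = []
  linked-applyUpTo (suc zero)    g h = [-]
  linked-applyUpTo (suc (suc n)) g h = h 0 (s≤s (s≤s z≤n)) ∷ linked-applyUpTo (suc n) (g ∘ suc) (λ i p → h (suc i) (s≤s p))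

  pos-positive : ∀ {cs} → Linked _⊒_ cs → ∀ i → i < length (pos cs) → 1 ≤ at cs i
  pos-positive {suc b ∷ cs} l zero    _       = s≤s z≤n
  pos-positive {suc b ∷ cs} l (suc i) (s≤s p) = pos-positive (Linked.tail l) i p

  positive-pos : ∀ {cs} → Linked _⊒_ cs → ∀ i → 1 ≤ at cs i → i < length (pos cs)
  positive-pos {suc b ∷ cs} l zero    p = s≤s z≤n
  positive-pos {suc b ∷ cs} l (suc i) p = s≤s (positive-pos (Linked.tail l) i p)
  positive-pos {zero ∷ cs}  l (suc i) p = ⊥-elim (zeros l i p)
    where
    zeros : ∀ {cs} → Linked _⊒_ (0 ∷ cs) → ∀ i → 1 ≤ at cs i → ⊥
    zeros (z≤n ∷ l) (suc i) p = zeros l i p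

  at-pos : ∀ {cs} → Linked _⊒_ cs → ∀ i → at (pos cs) i ≡ at cs i ∸ 1
  at-pos {[]}         l i       = ≡.refl
  at-pos {zero ∷ cs}  l zero    = ≡.refl
  at-pos {zero ∷ []}  l (suc i) = ≡.refl
  at-pos {zero ∷ _ ∷ cs} (z≤n ∷ l) (suc i) = at-pos l i
  at-pos {suc b ∷ cs} l zero    = ≡.refl
  at-pos {suc b ∷ cs} l (suc i) = at-pos (Linked.tail l) i

  drop-cons : ∀ xs i → i < length xs → L.drop i xs ≡ at xs i ∷ L.drop (suc i) xs
  drop-cons (x ∷ xs) zero    _       = ≡.refl
  drop-cons (x ∷ xs) (suc i) (s≤s p) = drop-cons xs i p

  -- At time t the times recorded so far are the a_i with a_i < t, i.e. those beyond position length (pos cs).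
  arms-determined : ∀ {m cs ch} t as → Linked _⊒_ cs → at cs 0 ≤ m → Chain m cs ch → length (pos cs) ≤ length as →
    (∀ s i → s ≤ m → i < length as → (1 ≤ at (rowAt (cs ∷ ch) s) i → t + s ≤ at as i) × (t + s ≤ at as i → 1 ≤ at (rowAt (cs ∷ ch) s) i)) →
    arms t cs (L.drop (length (pos cs)) as) ch ≡ as
  arms-determined {cs = cs} t as l p [] len h rewrite pos-0 {cs} p = ≡.refl
  arms-determined {suc m} {cs} {cs′ ∷ ch} t as l p (n ∷ c) len h with survives l n
  ... | all-survive e _ rewrite e | <ᵇ-irrefl (length (pos cs)) | ≡.sym e =
    arms-determined (suc t) as (Next-linked n) (ℕₚ.≤-trans (Next-head n) (ℕₚ.∸-monoˡ-≤ 1 p)) c len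
      (λ s i s≤m i< → ≡.subst (λ z → (1 ≤ at (rowAt (cs′ ∷ ch) s) i → z ≤ at as i) × (z ≤ at as i → 1 ≤ at (rowAt (cs′ ∷ ch) s) i)) (ℕₚ.+-suc t s) (h (suc s) i (s≤s s≤m) i<))
  ... | last-dies e _ rewrite ≡.sym e | <ᵇ-suc (length (pos cs′)) =
    ≡.trans (≡.cong (λ ys → arms (suc t) cs′ ys ch) (≡.trans (≡.cong (_∷ L.drop (suc d′) as) (≡.sym a≡t)) (≡.sym (drop-cons as d′ len))))
      (arms-determined (suc t) as (Next-linked n) (ℕₚ.≤-trans (Next-head n) (ℕₚ.∸-monoˡ-≤ 1 p)) c (ℕₚ.<⇒≤ len)
        (λ s i s≤m i< → ≡.subst (λ z → (1 ≤ at (rowAt (cs′ ∷ ch) s) i → z ≤ at as i) × (z ≤ at as i → 1 ≤ at (rowAt (cs′ ∷ ch) s) i)) (ℕₚ.+-suc t s) (h (suc s) i (s≤s s≤m) i<)))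
    where
    d′ : ℕ
    d′ = length (pos cs′)
    -- The path d′ is alive at time t and dead at time t + 1, so the hypothesis for s = 0 and s = 1
    -- fixes its value.
    a≡t : at as d′ ≡ t
    a≡t = ℕₚ.≤-antisym
      (ℕₚ.≮⇒≥ (λ t<a → ℕₚ.<-irrefl ≡.refl (positive-pos (Next-linked n) d′
        (proj₂ (h 1 d′ (s≤s z≤n) len) (≡.subst (_≤ at as d′) (ℕₚ.+-comm 1 t) t<a)))))
      (≡.subst (_≤ at as d′) (ℕₚ.+-identityʳ t) (proj₁ (h 0 d′ z≤n len) (pos-positive l d′ (≡.subst (d′ <_) e (ℕₚ.n<1+n d′)))))

-- The bijection between totally symmetric plane partitions and arrays

module PlanePartitions where

  open import Data.Nat using (_+_; _*_)
  open Preliminaries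
  open Shapes
  open Arrays

  all-oneTo⁻ : ∀ (p : ℕ → Bool) n → all p (oneTo n) ≡ true → ∀ i → 1 ≤ i → i ≤ n → p i ≡ true
  all-oneTo⁻ p n e (suc i) _ i≤n = all-applyUpTo⁻ p suc n (≡.subst (λ xs → all p xs ≡ true) (oneTo-applyUpTo n) e) i i≤n

  all-oneTo : ∀ (p : ℕ → Bool) n → (∀ i → 1 ≤ i → i ≤ n → p i ≡ true) → all p (oneTo n) ≡ true
  all-oneTo p n h = ≡.subst (λ xs → all p xs ≡ true) (≡.sym (oneTo-applyUpTo n)) (all-applyUpTo p suc n (λ i i<n → h (suc i) (s≤s z≤n) i<n))

  ⇔ᵇ-true⁻ : ∀ {a b} → (a ⇔ᵇ b) ≡ true → a ≡ b
  ⇔ᵇ-true⁻ {true}  {true}  _ = ≡.refl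
  ⇔ᵇ-true⁻ {false} {false} _ = ≡.refl

  ⇔ᵇ-true : ∀ {a b} → a ≡ b → (a ⇔ᵇ b) ≡ true
  ⇔ᵇ-true {true}  ≡.refl = ≡.refl
  ⇔ᵇ-true {false} ≡.refl = ≡.refl

  record IsTSPP (n : ℕ) (T : ℕ → ℕ → ℕ) : Set where
    field
      row-mono  : ∀ i j → 1 ≤ i → i ≤ n → 1 ≤ j → j < n → T i (suc j) ≤ T i j
      symmetric : ∀ i j → 1 ≤ i → i ≤ n → 1 ≤ j → j ≤ n → T i j ≡ T j i
      cyclic    : ∀ i j l → 1 ≤ i → i ≤ n → 1 ≤ j → j ≤ n → 1 ≤ l → l ≤ n → l ≤ T i j → i ≤ T j l
      bounded   : ∀ i j → 1 ≤ i → i ≤ n → 1 ≤ j → j ≤ n → T i j ≤ n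

  if-true : ∀ (b : Bool) {x} → b ≡ true → (if b then x else true) ≡ true → x ≡ true
  if-true true ≡.refl e = e

  true-if : ∀ (b : Bool) {x} → (b ≡ true → x ≡ true) → (if b then x else true) ≡ true
  true-if true  h = h ≡.refl
  true-if false h = ≡.refl

  isTSPP⇒IsTSPP : ∀ n t → All (_≤ n) t → isTSPP n t ≡ true → IsTSPP n (ent n t)
  isTSPP⇒IsTSPP n t t≤ e = record
    { row-mono  = λ i j 1≤i i≤n 1≤j j<n → ≤ᵇ-true⁻ (if-true (j <ᵇ n) (<ᵇ-true j<n)
        (proj₁ (∧-true⁻ (proj₁ (∧-true⁻ {monotone i j} (cell i j 1≤i i≤n 1≤j (ℕₚ.<⇒≤ j<n)))))))
    ; symmetric = λ i j 1≤i i≤n 1≤j j≤n → ℕₚ.≡ᵇ⇒≡ _ _ (≡⇒T (proj₁ (symmetric-cyclic i j 1≤i i≤n 1≤j j≤n)))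
    ; cyclic    = λ i j l 1≤i i≤n 1≤j j≤n 1≤l l≤n p → ≤ᵇ-true⁻ (≡.trans
        (≡.sym (⇔ᵇ-true⁻ (all-oneTo⁻ (rotation i j) n (proj₂ (symmetric-cyclic i j 1≤i i≤n 1≤j j≤n)) l 1≤l l≤n))) (≤ᵇ-true p))
    ; bounded   = λ i j _ _ _ _ → at-All-≤ t _ t≤
    }
    where
    monotone : ℕ → ℕ → Bool
    monotone i j = (if j <ᵇ n then ent n t i (suc j) ≤ᵇ ent n t i j else true) ∧ (if i <ᵇ n then ent n t (suc i) j ≤ᵇ ent n t i j else true)
    rotation : ℕ → ℕ → ℕ → Bool
    rotation i j l = (l ≤ᵇ ent n t i j) ⇔ᵇ (i ≤ᵇ ent n t j l)
    cell : ∀ i j → 1 ≤ i → i ≤ n → 1 ≤ j → j ≤ n → (monotone i j ∧ (ent n t i j ≡ᵇ ent n t j i) ∧ all (rotation i j) (oneTo n)) ≡ true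
    cell i j 1≤i i≤n 1≤j j≤n = all-oneTo⁻ _ n (all-oneTo⁻ _ n e i 1≤i i≤n) j 1≤j j≤n
    symmetric-cyclic : ∀ i j → 1 ≤ i → i ≤ n → 1 ≤ j → j ≤ n → (ent n t i j ≡ᵇ ent n t j i) ≡ true × all (rotation i j) (oneTo n) ≡ true
    symmetric-cyclic i j 1≤i i≤n 1≤j j≤n = ∧-true⁻ (proj₂ (∧-true⁻ {monotone i j} (cell i j 1≤i i≤n 1≤j j≤n)))

  IsTSPP⇒isTSPP : ∀ n t → IsTSPP n (ent n t) → isTSPP n t ≡ true
  IsTSPP⇒isTSPP n t tspp = all-oneTo _ n λ i 1≤i i≤n → all-oneTo _ n λ j 1≤j j≤n →
    ∧-true (∧-true (true-if (j <ᵇ n) (λ e → ≤ᵇ-true (row-mono i j 1≤i i≤n 1≤j (<ᵇ-true⁻ e))))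
                   (true-if (i <ᵇ n) (λ e → ≤ᵇ-true (≡.subst₂ _≤_ (symmetric j (suc i) 1≤j j≤n (s≤s z≤n) (<ᵇ-true⁻ e)) (symmetric j i 1≤j j≤n 1≤i i≤n)
                     (row-mono j i 1≤j j≤n 1≤i (<ᵇ-true⁻ e))))))
    (∧-true (T⇒≡ (ℕₚ.≡⇒≡ᵇ _ _ (symmetric i j 1≤i i≤n 1≤j j≤n)))
      (all-oneTo _ n λ l 1≤l l≤n → ⇔ᵇ-true (bool-ext
        (λ e → ≤ᵇ-true (cyclic i j l 1≤i i≤n 1≤j j≤n 1≤l l≤n (≤ᵇ-true⁻ e)))
        -- The rotation of the indices has order three, so its inverse is two further rotations.
        (λ e → ≤ᵇ-true (cyclic l i j 1≤l l≤n 1≤i i≤n 1≤j j≤n (cyclic j l i 1≤j j≤n 1≤l l≤n 1≤i i≤n (≤ᵇ-true⁻ e)))))))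
    where open IsTSPP tspp

  count-≤ : ∀ (p : ℕ → Bool) g n → countᵇ p (applyUpTo g n) ≤ n
  count-≤ p g zero    = z≤n
  count-≤ p g (suc n) rewrite countᵇ-∷ p (g 0) (applyUpTo (g ∘ suc) n) with p (g 0)
  ... | true  = s≤s (count-≤ p (g ∘ suc) n)
  ... | false = ℕₚ.m≤n⇒m≤1+n (count-≤ p (g ∘ suc) n)

  count-none : ∀ (p : ℕ → Bool) g n → (∀ i → i < n → p (g i) ≡ false) → countᵇ p (applyUpTo g n) ≡ 0
  count-none p g zero    h = ≡.refl
  count-none p g (suc n) h rewrite countᵇ-∷ p (g 0) (applyUpTo (g ∘ suc) n) | h 0 (s≤s z≤n) = count-none p (g ∘ suc) n (λ i q → h (suc i) (s≤s q))

  -- The indices at which such a predicate holds form an initial segment, and the count is its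
  -- length. In this way heights are translated into sets of cubes and back.
  count-downset : ∀ (p : ℕ → Bool) g n → (∀ i → suc i < n → p (g (suc i)) ≡ true → p (g i) ≡ true) →
    ∀ i → i < n → (i < countᵇ p (applyUpTo g n) → p (g i) ≡ true) × (p (g i) ≡ true → i < countᵇ p (applyUpTo g n))
  count-downset p g (suc n) h i i<n rewrite countᵇ-∷ p (g 0) (applyUpTo (g ∘ suc) n) with p (g 0) in eq
  count-downset p g (suc n) h zero    i<n | true = (λ _ → eq) , (λ _ → s≤s z≤n)
  count-downset p g (suc n) h (suc i) (s≤s i<n) | true with count-downset p (g ∘ suc) n (λ i q → h (suc i) (s≤s q)) i i<n
  ... | f , g′ = (λ { (s≤s q) → f q }) , (λ q → s≤s (g′ q))
  count-downset p g (suc n) h i i<n | false = (λ q → ⊥-elim (ℕₚ.n≮0 (≡.subst (i <_) (count-none p (g ∘ suc) n (λ i q → all-false (suc i) (s≤s q))) q)))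
    , (λ q → ⊥-elim (true≢false (≡.trans (≡.sym q) (all-false i i<n))))
    where
    true≢false : true ≢ false
    true≢false ()
    all-false : ∀ i → i < suc n → p (g i) ≡ false
    all-false zero    _ = eq
    all-false (suc i) q with p (g (suc i)) in eq′
    ... | false = ≡.refl
    ... | true  = ⊥-elim (true≢false (≡.trans (≡.sym (h i q eq′)) (all-false i (ℕₚ.<-trans (ℕₚ.n<1+n i) q))))

  count : (ℕ → Bool) → ℕ → ℕ
  count p n = countᵇ p (oneTo n)

  count-bound : ∀ p n → count p n ≤ n
  count-bound p n = ≡.subst (λ xs → countᵇ p xs ≤ n) (≡.sym (oneTo-applyUpTo n)) (count-≤ p suc n)

  module _ (p : ℕ → Bool) (n : ℕ) (down : ∀ i → 1 ≤ i → i < n → p (suc i) ≡ true → p i ≡ true) where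

    private
      both : ∀ i → i < n → (i < count p n → p (suc i) ≡ true) × (p (suc i) ≡ true → i < count p n)
      both i i<n = ≡.subst (λ xs → (i < countᵇ p xs → p (suc i) ≡ true) × (p (suc i) ≡ true → i < countᵇ p xs))
        (≡.sym (oneTo-applyUpTo n)) (count-downset p suc n (λ i q → down (suc i) (s≤s z≤n) q) i i<n)

    count-true : ∀ i → 1 ≤ i → i ≤ n → i ≤ count p n → p i ≡ true
    count-true (suc i) _ i≤n q = proj₁ (both i i≤n) q

    true-count : ∀ i → 1 ≤ i → i ≤ n → p i ≡ true → i ≤ count p n
    true-count (suc i) _ i≤n q = proj₂ (both i i≤n) q

  count-cong : ∀ {p q : ℕ → Bool} n → (∀ i → 1 ≤ i → i ≤ n → p i ≡ q i) → count p n ≡ count q n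
  count-cong {p} {q} n h = ≡.subst (λ xs → countᵇ p xs ≡ countᵇ q xs) (≡.sym (oneTo-applyUpTo n)) (go n suc (λ i i<n → h (suc i) (s≤s z≤n) i<n))
    where
    go : ∀ n (g : ℕ → ℕ) → (∀ i → i < n → p (g i) ≡ q (g i)) → countᵇ p (applyUpTo g n) ≡ countᵇ q (applyUpTo g n)
    go zero    g h = ≡.refl
    go (suc n) g h = ≡.trans (countᵇ-∷ p (g 0) _) (≡.trans (≡.cong₂ (λ b m → (if b then 1 else 0) + m) (h 0 (s≤s z≤n)) (go n (g ∘ suc) (λ i r → h (suc i) (s≤s r))))
      (≡.sym (countᵇ-∷ q (g 0) _)))

  ≤-by-elements : ∀ {n a b} → a ≤ n → (∀ l → 1 ≤ l → l ≤ n → l ≤ a → l ≤ b) → a ≤ b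
  ≤-by-elements {a = zero}  a≤n h = z≤n
  ≤-by-elements {a = suc a} a≤n h = h (suc a) (s≤s z≤n) a≤n ℕₚ.≤-refl

  ≤-ext : ∀ {n a b} → a ≤ n → b ≤ n → (∀ l → 1 ≤ l → l ≤ n → l ≤ a → l ≤ b) → (∀ l → 1 ≤ l → l ≤ n → l ≤ b → l ≤ a) → a ≡ b
  ≤-ext a≤n b≤n f g = ℕₚ.≤-antisym (≤-by-elements a≤n f) (≤-by-elements b≤n g)

  -- The median as the maximum of the pairwise minima: in this form it is monotone in each index,
  -- and its symmetry follows from the laws of `⊓` and `⊔`.
  med : ℕ → ℕ → ℕ → ℕ
  med i j l = (i ⊓ j) ⊔ ((i ⊓ l) ⊔ (j ⊓ l))

  min₃ max₃ : ℕ → ℕ → ℕ → ℕ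
  min₃ i j l = (i ⊓ j) ⊓ l
  max₃ i j l = (i ⊔ j) ⊔ l

  -- Extends a predicate on sorted triples to all triples. Invariance under permutations is thereby
  -- built in; this is how a totally symmetric plane partition is rebuilt from its cubes with i ≤ j
  -- ≤ l.
  sorted₃ : (ℕ → ℕ → ℕ → Bool) → ℕ → ℕ → ℕ → Bool
  sorted₃ B i j l = B (min₃ i j l) (med i j l) (max₃ i j l)

  cong₃ : ∀ (B : ℕ → ℕ → ℕ → Bool) {a a′ b b′ c c′} → a ≡ a′ → b ≡ b′ → c ≡ c′ → B a b c ≡ B a′ b′ c′
  cong₃ B ≡.refl ≡.refl ≡.refl = ≡.refl

  sorted₃-swap : ∀ B i j l → sorted₃ B i j l ≡ sorted₃ B j i l
  sorted₃-swap B i j l = cong₃ B (≡.cong (_⊓ l) (ℕₚ.⊓-comm i j)) (≡.cong₂ _⊔_ (ℕₚ.⊓-comm i j) (ℕₚ.⊔-comm (i ⊓ l) (j ⊓ l))) (≡.cong (_⊔ l) (ℕₚ.⊔-comm i j))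

  sorted₃-rotate : ∀ B i j l → sorted₃ B i j l ≡ sorted₃ B j l i
  sorted₃-rotate B i j l = cong₃ B
    (≡.trans (ℕₚ.⊓-assoc i j l) (ℕₚ.⊓-comm i (j ⊓ l)))
    (≡.trans (≡.sym (ℕₚ.⊔-assoc (i ⊓ j) (i ⊓ l) (j ⊓ l))) (≡.trans (ℕₚ.⊔-comm _ (j ⊓ l)) (≡.cong ((j ⊓ l) ⊔_) (≡.cong₂ _⊔_ (ℕₚ.⊓-comm i j) (ℕₚ.⊓-comm i l)))))
    (≡.trans (ℕₚ.⊔-assoc i j l) (ℕₚ.⊔-comm i (j ⊔ l)))

  min₃≤med : ∀ i j l → min₃ i j l ≤ med i j l
  min₃≤med i j l = ℕₚ.≤-trans (ℕₚ.m⊓n≤m (i ⊓ j) l) (ℕₚ.m≤m⊔n (i ⊓ j) _)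

  med≤max₃ : ∀ i j l → med i j l ≤ max₃ i j l
  med≤max₃ i j l = ℕₚ.⊔-lub (ℕₚ.≤-trans (ℕₚ.m⊓n≤m i j) (ℕₚ.≤-trans (ℕₚ.m≤m⊔n i j) (ℕₚ.m≤m⊔n (i ⊔ j) l)))
    (ℕₚ.⊔-lub (ℕₚ.≤-trans (ℕₚ.m⊓n≤n i l) (ℕₚ.m≤n⊔m (i ⊔ j) l)) (ℕₚ.≤-trans (ℕₚ.m⊓n≤n j l) (ℕₚ.m≤n⊔m (i ⊔ j) l)))

  sorted₃-id : ∀ B {p q s} → p ≤ q → q ≤ s → sorted₃ B p q s ≡ B p q s
  sorted₃-id B {p} {q} {s} p≤q q≤s = cong₃ B
    (≡.trans (≡.cong (_⊓ s) (ℕₚ.m≤n⇒m⊓n≡m p≤q)) (ℕₚ.m≤n⇒m⊓n≡m (ℕₚ.≤-trans p≤q q≤s)))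
    (≡.trans (≡.cong₂ _⊔_ (ℕₚ.m≤n⇒m⊓n≡m p≤q) (≡.cong₂ _⊔_ (ℕₚ.m≤n⇒m⊓n≡m (ℕₚ.≤-trans p≤q q≤s)) (ℕₚ.m≤n⇒m⊓n≡m q≤s)))
      (≡.trans (≡.cong (p ⊔_) (ℕₚ.m≤n⇒m⊔n≡n p≤q)) (ℕₚ.m≤n⇒m⊔n≡n p≤q)))
    (≡.trans (≡.cong (_⊔ s) (ℕₚ.m≤n⇒m⊔n≡n p≤q)) (ℕₚ.m≤n⇒m⊔n≡n q≤s))

  -- A transposition and the rotation generate all permutations of three indices.
  sort-cases : ∀ (P : ℕ → ℕ → ℕ → Set) → (∀ {i j l} → P j i l → P i j l) → (∀ {i j l} → P j l i → P i j l) →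
    (∀ {i j l} → i ≤ j → j ≤ l → P i j l) → ∀ i j l → P i j l
  sort-cases P swap rotate base i j l with ℕₚ.≤-total i j | ℕₚ.≤-total j l | ℕₚ.≤-total i l
  ... | inj₁ i≤j | inj₁ j≤l | _        = base i≤j j≤l
  ... | inj₁ i≤j | inj₂ l≤j | inj₁ i≤l = rotate (rotate (swap (base i≤l l≤j)))
  ... | inj₁ i≤j | inj₂ l≤j | inj₂ l≤i = rotate (rotate (base l≤i i≤j))
  ... | inj₂ j≤i | inj₁ j≤l | inj₁ i≤l = swap (base j≤i i≤l)
  ... | inj₂ j≤i | inj₁ j≤l | inj₂ l≤i = rotate (base j≤l l≤i)
  ... | inj₂ j≤i | inj₂ l≤j | _        = rotate (swap (base l≤j j≤i))

  -- The number of cubes (i , i + t , l) with l ≥ i + t, where i is the index plus one.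
  cell : ℕ → (ℕ → ℕ → ℕ) → ℕ → ℕ → ℕ
  cell n T t i = if suc i + t ≤ᵇ n then suc (T (suc i) (suc i + t)) ∸ (suc i + t) else 0

  -- The row t = n lies outside the plane partition and is zero, which matches the n steps of
  -- `arrays`.
  toArray : ℕ → (ℕ → ℕ → ℕ) → List (List ℕ)
  toArray n T = applyUpTo (λ t → applyUpTo (cell n T t) n) (suc n)

  cell-inside : ∀ n T t i → suc i + t ≤ n → cell n T t i ≡ suc (T (suc i) (suc i + t)) ∸ (suc i + t)
  cell-inside n T t i p rewrite ≤ᵇ-true p = ≡.refl

  cell-outside : ∀ n T t i → n < suc i + t → cell n T t i ≡ 0
  cell-outside n T t i p rewrite ≤ᵇ-false p = ≡.refl

  module FromTSPP {n : ℕ} {T : ℕ → ℕ → ℕ} (tspp : IsTSPP n T) where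
    open IsTSPP tspp

    column-mono : ∀ i j → 1 ≤ i → i < n → 1 ≤ j → j ≤ n → T (suc i) j ≤ T i j
    column-mono i j 1≤i i<n 1≤j j≤n = ≡.subst₂ _≤_ (symmetric j (suc i) 1≤j j≤n (s≤s z≤n) i<n) (symmetric j i 1≤j j≤n 1≤i (ℕₚ.<⇒≤ i<n)) (row-mono j i 1≤j j≤n 1≤i i<n)

    -- One column further to the right T does not grow, while the subtracted column index grows by
    -- one.
    cell-next : ∀ t i → cell n T t i ⊒ cell n T (suc t) i
    cell-next t i with suc i + suc t ℕ.≤? n
    ... | no ¬p = ≡.subst (_≤ cell n T t i ∸ 1) (≡.sym (cell-outside n T (suc t) i (ℕₚ.≰⇒> ¬p))) z≤n
    ... | yes p = ≡.subst₂ _≤_ (≡.sym (cell-inside n T (suc t) i p)) (≡.cong (_∸ 1) (≡.sym (cell-inside n T t i (ℕₚ.<⇒≤ p′)))) (begin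
        suc (T (suc i) (suc i + suc t)) ∸ (suc i + suc t) ≡⟨ ≡.cong (λ j → suc (T (suc i) j) ∸ j) (ℕₚ.+-suc (suc i) t) ⟩
        T (suc i) (suc (suc i + t)) ∸ (suc i + t)         ≤⟨ ℕₚ.∸-monoˡ-≤ (suc i + t) (row-mono (suc i) (suc i + t) (s≤s z≤n) (ℕₚ.≤-trans (ℕₚ.m≤m+n (suc i) (suc t)) p) (s≤s z≤n) p′) ⟩
        T (suc i) (suc i + t) ∸ (suc i + t)               ≡⟨ ℕₚ.pred[m∸n]≡m∸[1+n] (suc (T (suc i) (suc i + t))) (suc i + t) ⟨
        pred (suc (T (suc i) (suc i + t)) ∸ (suc i + t))  ≡⟨ pred≡∸1 (suc (T (suc i) (suc i + t)) ∸ (suc i + t)) ⟩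
        suc (T (suc i) (suc i + t)) ∸ (suc i + t) ∸ 1     ∎)
      where
      open ℕₚ.≤-Reasoning
      p′ : suc i + t < n
      p′ = ≡.subst (_≤ n) (ℕₚ.+-suc (suc i) t) p
      pred≡∸1 : ∀ m → pred m ≡ m ∸ 1
      pred≡∸1 zero    = ≡.refl
      pred≡∸1 (suc m) = ≡.refl

    -- Both cells lie in the same column i + t + 2 of T, so the same number is subtracted and column
    -- monotonicity decides.
    cell-shift : ∀ t i → cell n T t (suc i) ≤ cell n T (suc t) i
    cell-shift t i with suc i + suc t ℕ.≤? n
    ... | no ¬p = ≡.subst (_≤ cell n T (suc t) i) (≡.sym (cell-outside n T t (suc i) (≡.subst (n <_) (ℕₚ.+-suc (suc i) t) (ℕₚ.≰⇒> ¬p)))) z≤n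
    ... | yes p = ≡.subst₂ _≤_ (≡.sym (cell-inside n T t (suc i) p′)) (≡.sym (≡.trans (cell-inside n T (suc t) i p) (≡.cong (λ j → suc (T (suc i) j) ∸ j) (ℕₚ.+-suc (suc i) t))))
        (ℕₚ.∸-monoˡ-≤ (suc (suc i) + t) (s≤s (column-mono (suc i) (suc (suc i) + t) (s≤s z≤n) (ℕₚ.≤-trans (ℕₚ.m≤m+n (suc (suc i)) t) p′) (s≤s z≤n) p′)))
      where
      p′ : suc (suc i) + t ≤ n
      p′ = ≡.subst (_≤ n) (ℕₚ.+-suc (suc i) t) p

    toArray-Next : ∀ t → Next (applyUpTo (cell n T t) n) (applyUpTo (cell n T (suc t)) n)
    toArray-Next t = next-applyUpTo n (cell n T t) (cell n T (suc t)) (λ i _ → cell-shift t i) (λ i _ → cell-next t i)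

    toArray-linked : Linked _⊒_ (applyUpTo (cell n T 0) n)
    toArray-linked = linked-applyUpTo n (cell n T 0) (λ i _ → ℕₚ.≤-trans (cell-shift 0 i) (cell-next 0 i))

    toArray-head : at (applyUpTo (cell n T 0) n) 0 ≤ n
    toArray-head = head n ℕₚ.≤-refl
      where
      head : ∀ m → m ≤ n → at (applyUpTo (cell n T 0) m) 0 ≤ n
      head zero    _ = z≤n
      head (suc m) p = ≡.subst (_≤ n) (≡.sym (cell-inside n T 0 0 1≤n)) (bounded 1 1 ℕₚ.≤-refl 1≤n ℕₚ.≤-refl 1≤n)
        where
        1≤n : 1 ≤ n
        1≤n = ℕₚ.≤-trans (s≤s z≤n) p

    toArray-Chain : Chain n (applyUpTo (cell n T 0) n) (applyUpTo (λ t → applyUpTo (cell n T (suc t)) n) n)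
    toArray-Chain = chain-applyUpTo n (λ t → applyUpTo (cell n T t) n) toArray-Next

    toArray-∈ : toArray n T ∈ arrays n
    toArray-∈ = ∈-prefixed (starts n) (chainsL n)
      (∈-starts n _ (Lₚ.length-applyUpTo (cell n T 0) n) toArray-linked toArray-head) (∈-chainsL toArray-Chain)

  entry : List (List ℕ) → ℕ → ℕ → ℕ
  entry A p q = at (rowAt A (q ∸ p)) (p ∸ 1)

  -- Inverts entry = T(p,q) + 1 - q: for p ≤ q ≤ s the cube is present if s ≤ T(p,q) = q + entry -
  -- 1. If T(p,q) < q, the truncated entry is 0 and no s ≥ q satisfies the test, as it should be.
  sortedCube : List (List ℕ) → ℕ → ℕ → ℕ → Bool
  sortedCube A p q s = s <ᵇ q + entry A p q

  cube : List (List ℕ) → ℕ → ℕ → ℕ → Bool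
  cube A = sorted₃ (sortedCube A)

  heights : ℕ → List (List ℕ) → ℕ → ℕ → ℕ
  heights n A i j = count (cube A i j) n

  module FromArray {n : ℕ} {A : List (List ℕ)} (A∈ : A ∈ arrays n) where

    private
      decomposed : ∃ λ c₀ → ∃ λ ch → A ≡ c₀ ∷ ch × c₀ ∈ starts n × ch ∈ chainsL n c₀
      decomposed = ∈-prefixed⁻ (starts n) (chainsL n) A∈

      f : ℕ → ℕ → ℕ
      f t i = at (rowAt A t) i

      A-Next : ∀ t → t < n → Next (rowAt A t) (rowAt A (suc t))
      A-Next t t<n with decomposed
      ... | c₀ , ch , ≡.refl , _ , ch∈ = Chain-Next (∈-chainsL⁻ n c₀ ch∈) t t<n

    array-length : length A ≡ suc n
    array-length with decomposed
    ... | c₀ , ch , ≡.refl , _ , ch∈ = ≡.cong suc (Chain-length (∈-chainsL⁻ n c₀ ch∈))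

    row-length : ∀ t → t ≤ n → length (rowAt A t) ≡ n
    row-length zero    _ with decomposed
    ... | c₀ , ch , ≡.refl , c₀∈ , _ = proj₁ (∈-starts⁻ n c₀∈)
    row-length (suc t) p = ≡.trans (Next-length (A-Next t p)) (row-length t (ℕₚ.<⇒≤ p))

    f-bound : ∀ t i → t ≤ n → f t i ≤ n ∸ (i + t)
    f-bound zero i _ = ≡.subst (λ m → f 0 i ≤ n ∸ m) (≡.sym (ℕₚ.+-identityʳ i)) (first i)
      where
      first : ∀ i → f 0 i ≤ n ∸ i
      first i with decomposed
      ... | c₀ , ch , ≡.refl , c₀∈ , _ = go i
        where
        go : ∀ i → at c₀ i ≤ n ∸ i
        go zero    = proj₂ (proj₂ (∈-starts⁻ n c₀∈))
        go (suc i) = ℕₚ.≤-trans (Linked-at (proj₁ (proj₂ (∈-starts⁻ n c₀∈))) i)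
          (ℕₚ.≤-trans (ℕₚ.∸-monoˡ-≤ 1 (go i)) (ℕₚ.≤-reflexive (≡.trans (ℕₚ.∸-+-assoc n i 1) (≡.cong (n ∸_) (ℕₚ.+-comm i 1)))))
    f-bound (suc t) i p = ℕₚ.≤-trans (proj₂ (Next-at (A-Next t p) i)) (ℕₚ.≤-trans (ℕₚ.∸-monoˡ-≤ 1 (f-bound t i (ℕₚ.<⇒≤ p)))
      (ℕₚ.≤-reflexive (≡.trans (ℕₚ.∸-+-assoc n (i + t) 1) (≡.cong (n ∸_) (≡.trans (ℕₚ.+-comm (i + t) 1) (≡.sym (ℕₚ.+-suc i t)))))))

    entry-p : ∀ p q → 1 ≤ p → suc p ≤ q → q ≤ n → entry A (suc p) q ≤ entry A p q
    entry-p (suc p) q _ p<q q≤n = ≡.subst (λ t → f (q ∸ suc (suc p)) (suc p) ≤ f t p) (≡.sym (ℕₚ.+-∸-assoc 1 p<q))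
      (proj₁ (Next-at (A-Next (q ∸ suc (suc p)) (ℕₚ.<-≤-trans (ℕₚ.∸-monoʳ-< (s≤s z≤n) p<q) q≤n)) p))

    entry-q : ∀ p q → 1 ≤ p → p ≤ q → suc q ≤ n → entry A p q ⊒ entry A p (suc q)
    entry-q p q 1≤p p≤q q<n = ≡.subst (λ t → f t (p ∸ 1) ≤ f (q ∸ p) (p ∸ 1) ∸ 1) (≡.sym (ℕₚ.+-∸-assoc 1 p≤q))
      (proj₂ (Next-at (A-Next (q ∸ p) (ℕₚ.≤-<-trans (ℕₚ.m∸n≤m q p) q<n)) (p ∸ 1)))

    entry-p* : ∀ {p p′ q} → 1 ≤ p → p ℕ.≤′ p′ → p′ ≤ q → q ≤ n → entry A p′ q ≤ entry A p q
    entry-p* 1≤p ℕ.≤′-refl         p′≤q q≤n = ℕₚ.≤-refl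
    entry-p* 1≤p (ℕ.≤′-step {p″} p≤p″) p′≤q q≤n = ℕₚ.≤-trans (entry-p p″ _ (ℕₚ.≤-trans 1≤p (ℕₚ.≤′⇒≤ p≤p″)) p′≤q q≤n)
      (entry-p* 1≤p p≤p″ (ℕₚ.<⇒≤ p′≤q) q≤n)

    -- The number q + entry stands for T(p,q) + 1 and decreases weakly as long as entries are
    -- positive. Once they are truncated to 0 it grows with q, hence the positivity hypothesis.
    entry-q* : ∀ {p q q′} → 1 ≤ p → p ≤ q → q ℕ.≤′ q′ → q′ ≤ n → 1 ≤ entry A p q′ → q′ + entry A p q′ ≤ q + entry A p q
    entry-q* 1≤p p≤q ℕ.≤′-refl         q′≤n pos′ = ℕₚ.≤-refl
    entry-q* {p} {q} {suc q″} 1≤p p≤q (ℕ.≤′-step q≤q″) q′≤n pos′ = ℕₚ.≤-trans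
      (≡.subst (_≤ q″ + entry A p q″) (ℕₚ.+-suc q″ _) (ℕₚ.+-monoʳ-≤ q″ bigger))
      (entry-q* 1≤p p≤q q≤q″ (ℕₚ.<⇒≤ q′≤n) (ℕₚ.≤-trans (s≤s z≤n) bigger))
      where
      ⊒-> : ∀ {c c′} → 1 ≤ c′ → c ⊒ c′ → c′ < c
      ⊒-> {zero}  (s≤s _) ()
      ⊒-> {suc c} _ q = s≤s q
      bigger : entry A p (suc q″) < entry A p q″
      bigger = ⊒-> pos′ (entry-q p q″ 1≤p (ℕₚ.≤-trans p≤q (ℕₚ.≤′⇒≤ q≤q″)) q′≤n)

    sorted-mono : ∀ {p q s p′ q′ s′} → 1 ≤ p → p ≤ q → p′ ≤ q′ → q′ ≤ s′ → q′ ≤ n → p ≤ p′ → q ≤ q′ → s ≤ s′ →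
      s′ < q′ + entry A p′ q′ → s < q + entry A p q
    sorted-mono {p} {q} {s} {p′} {q′} {s′} 1≤p p≤q p′≤q′ q′≤s′ q′≤n p≤p′ q≤q′ s≤s′ h = ℕₚ.≤-<-trans s≤s′
      (ℕₚ.<-≤-trans h′ (entry-q* 1≤p p≤q (ℕₚ.≤⇒≤′ q≤q′) q′≤n
        -- The entry is positive because q′ ≤ s′ < q′ + entry.
        (ℕₚ.+-cancelˡ-< q′ 0 _ (≡.subst (_< q′ + entry A p q′) (≡.sym (ℕₚ.+-identityʳ q′)) (ℕₚ.≤-<-trans q′≤s′ h′)))))
      where
      h′ : s′ < q′ + entry A p q′
      h′ = ℕₚ.<-≤-trans h (ℕₚ.+-monoʳ-≤ q′ (entry-p* 1≤p (ℕₚ.≤⇒≤′ p≤p′) p′≤q′ q′≤n))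

    -- Minimum, median and maximum are monotone in every index, which reduces the claim to sorted
    -- triples.
    cube-mono : ∀ {i j l i′ j′ l′} → 1 ≤ i → 1 ≤ j → 1 ≤ l → i′ ≤ n → j′ ≤ n → l′ ≤ n → i ≤ i′ → j ≤ j′ → l ≤ l′ →
      cube A i′ j′ l′ ≡ true → cube A i j l ≡ true
    cube-mono {i} {j} {l} {i′} {j′} {l′} 1≤i 1≤j 1≤l i′≤n j′≤n l′≤n i≤ j≤ l≤ h = <ᵇ-true (sorted-mono
      (ℕₚ.⊓-glb (ℕₚ.⊓-glb 1≤i 1≤j) 1≤l) (min₃≤med i j l) (min₃≤med i′ j′ l′) (med≤max₃ i′ j′ l′)
      (ℕₚ.≤-trans (med≤max₃ i′ j′ l′) (ℕₚ.⊔-lub (ℕₚ.⊔-lub i′≤n j′≤n) l′≤n))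
      (ℕₚ.⊓-mono-≤ (ℕₚ.⊓-mono-≤ i≤ j≤) l≤)
      (ℕₚ.⊔-mono-≤ (ℕₚ.⊓-mono-≤ i≤ j≤) (ℕₚ.⊔-mono-≤ (ℕₚ.⊓-mono-≤ i≤ l≤) (ℕₚ.⊓-mono-≤ j≤ l≤)))
      (ℕₚ.⊔-mono-≤ (ℕₚ.⊔-mono-≤ i≤ j≤) l≤)
      (<ᵇ-true⁻ h))

    module _ {i j} (1≤i : 1 ≤ i) (i≤n : i ≤ n) (1≤j : 1 ≤ j) (j≤n : j ≤ n) where

      private
        down : ∀ l → 1 ≤ l → l < n → cube A i j (suc l) ≡ true → cube A i j l ≡ true
        down l 1≤l l<n = cube-mono 1≤i 1≤j 1≤l i≤n j≤n l<n ℕₚ.≤-refl ℕₚ.≤-refl (ℕₚ.n≤1+n l)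

      heights⇒cube : ∀ l → 1 ≤ l → l ≤ n → l ≤ heights n A i j → cube A i j l ≡ true
      heights⇒cube = count-true (cube A i j) n down

      cube⇒heights : ∀ l → 1 ≤ l → l ≤ n → cube A i j l ≡ true → l ≤ heights n A i j
      cube⇒heights = true-count (cube A i j) n down

    -- Invariance under permutations of the indices is built into `sorted₃`, and monotonicity is
    -- `cube-mono`.
    heights-TSPP : IsTSPP n (heights n A)
    heights-TSPP = record
      { row-mono  = λ i j 1≤i i≤n 1≤j j<n → ≤-by-elements (count-bound _ n) (λ l 1≤l l≤n p →
          cube⇒heights 1≤i i≤n 1≤j (ℕₚ.<⇒≤ j<n) l 1≤l l≤n (cube-mono 1≤i 1≤j 1≤l i≤n j<n l≤n ℕₚ.≤-refl (ℕₚ.n≤1+n j) ℕₚ.≤-refl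
            (heights⇒cube 1≤i i≤n (s≤s z≤n) j<n l 1≤l l≤n p)))
      ; symmetric = λ i j _ _ _ _ → count-cong n (λ l _ _ → sorted₃-swap (sortedCube A) i j l)
      ; cyclic    = λ i j l 1≤i i≤n 1≤j j≤n 1≤l l≤n p → cube⇒heights 1≤j j≤n 1≤l l≤n i 1≤i i≤n
          (≡.trans (≡.sym (sorted₃-rotate (sortedCube A) i j l)) (heights⇒cube 1≤i i≤n 1≤j j≤n l 1≤l l≤n p))
      ; bounded   = λ i j _ _ _ _ → count-bound _ n
      }

    cell-heights : ∀ t i → t ≤ n → i < n → cell n (heights n A) t i ≡ f t i
    cell-heights t i t≤n i<n with suc i + t ℕ.≤? n
    ... | no ¬p = ≡.trans (cell-outside n (heights n A) t i (ℕₚ.≰⇒> ¬p))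
      (≡.sym (ℕₚ.n≤0⇒n≡0 (ℕₚ.≤-trans (f-bound t i t≤n) (ℕₚ.≤-reflexive (ℕₚ.m≤n⇒m∸n≡0 (ℕ.≤-pred (ℕₚ.≰⇒> ¬p)))))))
    ... | yes j≤n = ≡.trans (cell-inside n (heights n A) t i j≤n) (≡.trans value (≡.cong (λ s → f s i) (ℕₚ.m+n∸m≡n (suc i) t)))
      where
      j τ γ : ℕ
      j = suc i + t
      τ = heights n A (suc i) j
      γ = entry A (suc i) j
      i≤j : suc i ≤ j
      i≤j = ℕₚ.m≤m+n (suc i) t
      above : ∀ l → j ≤ l → cube A (suc i) j l ≡ (l <ᵇ j + γ)
      above l j≤l = sorted₃-id (sortedCube A) i≤j j≤l
      -- The count in `heights` stops at n, so the topmost cube j + γ - 1 prescribed by the array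
      -- must not lie higher.
      γ-bound : j + γ ≤ suc n
      γ-bound = s≤s (≡.subst (λ s → i + t + f s i ≤ n) (≡.sym (ℕₚ.m+n∸m≡n (suc i) t))
        (ℕₚ.≤-trans (ℕₚ.+-monoʳ-≤ (i + t) (f-bound t i t≤n)) (ℕₚ.≤-reflexive (ℕₚ.m+[n∸m]≡n (ℕₚ.<⇒≤ j≤n)))))
      -- Were the column to reach height j + γ, the cube there would satisfy j + γ < j + γ.
      upper : suc τ ≤ j + γ
      upper = ℕₚ.≰⇒> (λ q → ℕₚ.<-irrefl {j + γ} ≡.refl (<ᵇ-true⁻ {j + γ} {j + γ} (≡.trans (≡.sym (above (j + γ) (ℕₚ.m≤m+n j γ)))
        (heights⇒cube (s≤s z≤n) i<n (s≤s z≤n) j≤n (j + γ) (s≤s z≤n) (ℕₚ.≤-trans q (count-bound _ n)) q))))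
      lower : ∀ g → γ ≡ g → g ≤ suc τ ∸ j
      lower zero    e = z≤n
      lower (suc g) e = ≡.subst (_≤ suc τ ∸ j) (ℕₚ.m+n∸m≡n j (suc g)) (ℕₚ.∸-monoˡ-≤ j (≡.subst (_≤ suc τ) (≡.sym (ℕₚ.+-suc j g))
        (s≤s (cube⇒heights (s≤s z≤n) i<n (s≤s z≤n) j≤n (j + g) (s≤s z≤n)
          (ℕ.≤-pred (≡.subst (_≤ suc n) (≡.trans (≡.cong (j +_) e) (ℕₚ.+-suc j g)) γ-bound))
          (≡.trans (above (j + g) (ℕₚ.m≤m+n j g)) (<ᵇ-true (≡.subst (λ m → j + g < j + m) (≡.sym e) (ℕₚ.+-monoʳ-< j (ℕₚ.n<1+n g)))))))))
      value : suc τ ∸ j ≡ γ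
      value = ℕₚ.≤-antisym (≡.subst (suc τ ∸ j ≤_) (ℕₚ.m+n∸m≡n j γ) (ℕₚ.∸-monoˡ-≤ j upper)) (lower γ ≡.refl)

    toArray-heights : toArray n (heights n A) ≡ A
    toArray-heights = rowAt-ext (toArray n (heights n A)) A
      (≡.trans (Lₚ.length-applyUpTo (λ t → applyUpTo (cell n (heights n A) t) n) (suc n)) (≡.sym array-length))
      (λ t t< → let t<1+n = ≡.subst (t <_) (Lₚ.length-applyUpTo (λ t → applyUpTo (cell n (heights n A) t) n) (suc n)) t< in
        ≡.trans (rowAt-applyUpTo (λ t → applyUpTo (cell n (heights n A) t) n) (suc n) t t<1+n) (row t (ℕ.≤-pred t<1+n)))
      where
      row : ∀ t → t ≤ n → applyUpTo (cell n (heights n A) t) n ≡ rowAt A t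
      row t t≤n = at-ext _ _ (≡.trans (Lₚ.length-applyUpTo _ n) (≡.sym (row-length t t≤n)))
        (λ i i< → let i<n = ≡.subst (i <_) (Lₚ.length-applyUpTo (cell n (heights n A) t) n) i< in
          ≡.trans (at-applyUpTo (cell n (heights n A) t) n i i<n) (cell-heights t i t≤n i<n))

  module _ {n : ℕ} {T : ℕ → ℕ → ℕ} (tspp : IsTSPP n T) where
    open IsTSPP tspp
    open FromTSPP tspp

    entry-toArray : ∀ i j → 1 ≤ i → i ≤ j → j ≤ n → entry (toArray n T) i j ≡ suc (T i j) ∸ j
    entry-toArray (suc i) j _ i≤j j≤n = begin
      at (rowAt (toArray n T) (j ∸ suc i)) i
        ≡⟨ ≡.cong (λ r → at r i) (rowAt-applyUpTo (λ t → applyUpTo (cell n T t) n) (suc n) (j ∸ suc i) (s≤s (ℕₚ.≤-trans (ℕₚ.m∸n≤m j (suc i)) j≤n))) ⟩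
      at (applyUpTo (cell n T (j ∸ suc i)) n) i
        ≡⟨ at-applyUpTo (cell n T (j ∸ suc i)) n i (ℕₚ.≤-trans i≤j j≤n) ⟩
      cell n T (j ∸ suc i) i
        ≡⟨ cell-inside n T (j ∸ suc i) i (≡.subst (_≤ n) (≡.sym back) j≤n) ⟩
      suc (T (suc i) (suc i + (j ∸ suc i))) ∸ (suc i + (j ∸ suc i))
        ≡⟨ ≡.cong (λ m → suc (T (suc i) m) ∸ m) back ⟩
      suc (T (suc i) j) ∸ j ∎
      where
      open ≡.≡-Reasoning
      back : suc i + (j ∸ suc i) ≡ j
      back = ℕₚ.m+[n∸m]≡n i≤j

    private
      InRange : ℕ → Set
      InRange i = 1 ≤ i × i ≤ n

    -- Both sides are invariant under permutations, so i ≤ j ≤ l may be assumed. Then l ≥ j, and the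
    -- truncation in the entry does not affect the comparison.
    cube-toArray : ∀ i j l → InRange i → InRange j → InRange l → cube (toArray n T) i j l ≡ (l ≤ᵇ T i j)
    cube-toArray = sort-cases (λ i j l → InRange i → InRange j → InRange l → cube (toArray n T) i j l ≡ (l ≤ᵇ T i j))
      (λ {i} {j} {l} h ri rj rl → ≡.trans (sorted₃-swap (sortedCube (toArray n T)) i j l)
        (≡.trans (h rj ri rl) (≡.cong (l ≤ᵇ_) (symmetric j i (proj₁ rj) (proj₂ rj) (proj₁ ri) (proj₂ ri)))))
      (λ {i} {j} {l} h (1≤i , i≤n) (1≤j , j≤n) (1≤l , l≤n) → ≡.trans (sorted₃-rotate (sortedCube (toArray n T)) i j l)
        (≡.trans (h (1≤j , j≤n) (1≤l , l≤n) (1≤i , i≤n)) (bool-ext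
          (λ e → ≤ᵇ-true (cyclic l i j 1≤l l≤n 1≤i i≤n 1≤j j≤n (cyclic j l i 1≤j j≤n 1≤l l≤n 1≤i i≤n (≤ᵇ-true⁻ e))))
          (λ e → ≤ᵇ-true (cyclic i j l 1≤i i≤n 1≤j j≤n 1≤l l≤n (≤ᵇ-true⁻ e))))))
      (λ {i} {j} {l} i≤j j≤l (1≤i , _) (_ , j≤n) _ → ≡.trans (sorted₃-id (sortedCube (toArray n T)) i≤j j≤l)
        (≡.trans (≡.cong (λ m → l <ᵇ j + m) (entry-toArray i j 1≤i i≤j j≤n)) (compare j l (T i j) j≤l)))
      where
      compare : ∀ j l m → j ≤ l → (l <ᵇ j + (suc m ∸ j)) ≡ (l ≤ᵇ m)
      compare j l m j≤l = bool-ext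
        (λ e → ≤ᵇ-true (forward (<ᵇ-true⁻ e)))
        (λ e → <ᵇ-true (≡.subst (l <_) (≡.sym (ℕₚ.m+[n∸m]≡n (ℕₚ.≤-trans j≤l (ℕₚ.m≤n⇒m≤1+n (≤ᵇ-true⁻ e))))) (s≤s (≤ᵇ-true⁻ e))))
        where
        forward : l < j + (suc m ∸ j) → l ≤ m
        forward p with ℕₚ.≤-total j (suc m)
        ... | inj₁ q = ℕ.≤-pred (≡.subst (l <_) (ℕₚ.m+[n∸m]≡n q) p)
        ... | inj₂ q = ⊥-elim (ℕₚ.<⇒≱ p (≡.subst (_≤ l) (≡.sym (≡.trans (≡.cong (j +_) (ℕₚ.m≤n⇒m∸n≡0 q)) (ℕₚ.+-identityʳ j))) j≤l))

    heights-toArray : ∀ i j → 1 ≤ i → i ≤ n → 1 ≤ j → j ≤ n → heights n (toArray n T) i j ≡ T i j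
    heights-toArray i j 1≤i i≤n 1≤j j≤n = ≤-ext (count-bound _ n) (bounded i j 1≤i i≤n 1≤j j≤n)
      (λ l 1≤l l≤n p → ≤ᵇ-true⁻ (≡.trans (≡.sym (cube-toArray i j l (1≤i , i≤n) (1≤j , j≤n) (1≤l , l≤n)))
        (FromArray.heights⇒cube toArray-∈ 1≤i i≤n 1≤j j≤n l 1≤l l≤n p)))
      (λ l 1≤l l≤n p → FromArray.cube⇒heights toArray-∈ 1≤i i≤n 1≤j j≤n l 1≤l l≤n
        (≡.trans (cube-toArray i j l (1≤i , i≤n) (1≤j , j≤n) (1≤l , l≤n)) (≤ᵇ-true p)))

  IsTSPP-cong : ∀ {n T T′} → (∀ i j → 1 ≤ i → i ≤ n → 1 ≤ j → j ≤ n → T i j ≡ T′ i j) → IsTSPP n T → IsTSPP n T′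
  IsTSPP-cong {n} h tspp = record
    { row-mono  = λ i j 1≤i i≤n 1≤j j<n → ≡.subst₂ _≤_ (h i (suc j) 1≤i i≤n (s≤s z≤n) j<n) (h i j 1≤i i≤n 1≤j (ℕₚ.<⇒≤ j<n)) (row-mono i j 1≤i i≤n 1≤j j<n)
    ; symmetric = λ i j 1≤i i≤n 1≤j j≤n → ≡.trans (≡.sym (h i j 1≤i i≤n 1≤j j≤n)) (≡.trans (symmetric i j 1≤i i≤n 1≤j j≤n) (h j i 1≤j j≤n 1≤i i≤n))
    ; cyclic    = λ i j l 1≤i i≤n 1≤j j≤n 1≤l l≤n p → ≡.subst (i ≤_) (h j l 1≤j j≤n 1≤l l≤n)
        (cyclic i j l 1≤i i≤n 1≤j j≤n 1≤l l≤n (≡.subst (l ≤_) (≡.sym (h i j 1≤i i≤n 1≤j j≤n)) p))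
    ; bounded   = λ i j 1≤i i≤n 1≤j j≤n → ≡.subst (_≤ n) (h i j 1≤i i≤n 1≤j j≤n) (bounded i j 1≤i i≤n 1≤j j≤n)
    }
    where open IsTSPP tspp

  toArray-cong : ∀ {n T T′} → (∀ i j → 1 ≤ i → i ≤ n → 1 ≤ j → j ≤ n → T i j ≡ T′ i j) → toArray n T ≡ toArray n T′
  toArray-cong {n} {T} {T′} h = applyUpTo-cong< (suc n) (λ t _ → applyUpTo-cong< n (λ i _ → same t i))
    where
    same : ∀ t i → cell n T t i ≡ cell n T′ t i
    same t i with suc i + t ℕ.≤? n
    ... | yes p = ≡.trans (cell-inside n T t i p) (≡.trans (≡.cong (λ m → suc m ∸ (suc i + t))
      (h (suc i) (suc i + t) (s≤s z≤n) (ℕₚ.≤-trans (ℕₚ.m≤m+n (suc i) t) p) (s≤s z≤n) p)) (≡.sym (cell-inside n T′ t i p)))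
    ... | no ¬p = ≡.trans (cell-outside n T t i (ℕₚ.≰⇒> ¬p)) (≡.sym (cell-outside n T′ t i (ℕₚ.≰⇒> ¬p)))

  allLists-∈⁻ : ∀ l m {t} → t ∈ allLists l m → length t ≡ l × All (_≤ m) t
  allLists-∈⁻ zero    m (here ≡.refl) = ≡.refl , []
  allLists-∈⁻ (suc l) m p with ∈-prefixed⁻ (upTo (suc m)) (λ _ → allLists l m) p
  ... | x , ys , ≡.refl , x∈ , ys∈ with allLists-∈⁻ l m ys∈
  ... | e , a = ≡.cong suc e , ℕ.≤-pred (∈ₚ.∈-upTo⁻ x∈) ∷ a

  allLists-∈ : ∀ l m t → length t ≡ l → All (_≤ m) t → t ∈ allLists l m
  allLists-∈ zero    m []      _ _       = here ≡.refl
  allLists-∈ (suc l) m (x ∷ t) e (p ∷ a) = ∈-prefixed (upTo (suc m)) (λ _ → allLists l m) (∈ₚ.∈-upTo⁺ (s≤s p)) (allLists-∈ l m t (ℕₚ.suc-injective e) a)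

  allLists-unique : ∀ l m → Unique (allLists l m)
  allLists-unique zero    m = [] ∷ []
  allLists-unique (suc l) m = prefixed-unique (upTo (suc m)) (λ _ → allLists l m) (Uniqueₚ.upTo⁺ (suc m)) (λ _ → allLists-unique l m)

  TSPP-∈⁻ : ∀ n {t} → t ∈ TSPP n → length t ≡ n * n × IsTSPP n (ent n t)
  TSPP-∈⁻ n {t} p with ∈ₚ.∈-filter⁻ (T? ∘ isTSPP n) {xs = allLists (n * n) n} p
  ... | t∈ , q with allLists-∈⁻ (n * n) n t∈
  ... | e , a = e , isTSPP⇒IsTSPP n t a (T⇒≡ q)

  module Bijection (n : ℕ) .{{_ : ℕ.NonZero n}} where

    fromHeights : (ℕ → ℕ → ℕ) → List ℕ
    fromHeights T = applyUpTo (λ x → T (suc (x DM./ n)) (suc (x DM.% n))) (n * n)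

    index-< : ∀ i j → i < n → j < n → i * n + j < n * n
    index-< i j i<n j<n = ℕₚ.<-≤-trans (ℕₚ.+-monoʳ-< (i * n) j<n) (ℕₚ.≤-trans (ℕₚ.≤-reflexive (ℕₚ.+-comm (i * n) n)) (ℕₚ.*-monoˡ-≤ n i<n))

    ent-fromHeights : ∀ T i j → 1 ≤ i → i ≤ n → 1 ≤ j → j ≤ n → ent n (fromHeights T) i j ≡ T i j
    ent-fromHeights T (suc i) (suc j) _ i<n _ j<n = ≡.trans (at-applyUpTo _ (n * n) (i * n + j) (index-< i j i<n j<n)) (≡.cong₂ (λ a b → T (suc a) (suc b)) quotient remainder)
      where
      quotient : (i * n + j) DM./ n ≡ i
      quotient = ≡.trans (DM.+-distrib-/-∣ˡ j (divides i ≡.refl)) (≡.trans (≡.cong₂ _+_ (DM.m*n/n≡m i n) (DM.m<n⇒m/n≡0 j<n)) (ℕₚ.+-identityʳ i))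
      remainder : (i * n + j) DM.% n ≡ j
      remainder = ≡.trans (≡.cong (DM._% n) (ℕₚ.+-comm (i * n) j)) (≡.trans (DM.[m+kn]%n≡m%n j i n) (DM.m<n⇒m%n≡m j<n))

    fromHeights-∈ : ∀ {T} → IsTSPP n T → fromHeights T ∈ TSPP n
    fromHeights-∈ {T} tspp = ∈ₚ.∈-filter⁺ (T? ∘ isTSPP n)
      (allLists-∈ (n * n) n (fromHeights T) (Lₚ.length-applyUpTo _ (n * n)) (Allₚ.applyUpTo⁺₁ _ (n * n) (λ {x} x< →
        IsTSPP.bounded tspp _ _ (s≤s z≤n) (DM.m<n*o⇒m/o<n x<) (s≤s z≤n) (DM.m%n<n x n))))
      (≡⇒T (IsTSPP⇒isTSPP n (fromHeights T) (IsTSPP-cong (λ i j 1≤i i≤n 1≤j j≤n → ≡.sym (ent-fromHeights T i j 1≤i i≤n 1≤j j≤n)) tspp)))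

    list-ext : ∀ t T → length t ≡ n * n → (∀ i j → 1 ≤ i → i ≤ n → 1 ≤ j → j ≤ n → ent n t i j ≡ T i j) → t ≡ fromHeights T
    list-ext t T e h = at-ext t (fromHeights T) (≡.trans e (≡.sym (Lₚ.length-applyUpTo _ (n * n)))) (λ x x< →
      let x<n = ≡.subst (x <_) e x< in
      ≡.trans (≡.cong (at t) (≡.trans (DM.m≡m%n+[m/n]*n x n) (ℕₚ.+-comm (x DM.% n) _)))
        (≡.trans (h (suc (x DM./ n)) (suc (x DM.% n)) (s≤s z≤n) (DM.m<n*o⇒m/o<n x<n) (s≤s z≤n) (DM.m%n<n x n))
          (≡.sym (at-applyUpTo _ (n * n) x x<n))))

    array : List ℕ → List (List ℕ)
    array t = toArray n (ent n t)

    array-inverse : ∀ {t} → t ∈ TSPP n → t ≡ fromHeights (heights n (array t))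
    array-inverse {t} t∈ with TSPP-∈⁻ n t∈
    ... | e , tspp = list-ext t _ e (λ i j 1≤i i≤n 1≤j j≤n → ≡.sym (heights-toArray tspp i j 1≤i i≤n 1≤j j≤n))

    -- Two lists without repetitions and with the same members are permutations of each other. In
    -- this form the bijection applies to sums over lists.
    TSPP↭arrays : L.map array (TSPP n) ↭ arrays n
    TSPP↭arrays = ∼bag⇒↭ (∈ₖ.unique∧set⇒bag
      (unique-map array (λ x∈ y∈ e → ≡.trans (array-inverse x∈) (≡.trans (≡.cong (fromHeights ∘ heights n) e) (≡.sym (array-inverse y∈))))
        (Uniqueₚ.filter⁺ (T? ∘ isTSPP n) (allLists-unique (n * n) n)))
      (arrays-unique n)
      (mk⇔ to from))
      where
      to : ∀ {A} → A ∈ L.map array (TSPP n) → A ∈ arrays n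
      to p with ∈ₚ.∈-map⁻ array p
      ... | t , t∈ , ≡.refl = FromTSPP.toArray-∈ (proj₂ (TSPP-∈⁻ n t∈))
      from : ∀ {A} → A ∈ arrays n → A ∈ L.map array (TSPP n)
      from {A} A∈ = ≡.subst (_∈ L.map array (TSPP n)) (≡.trans (toArray-cong (ent-fromHeights (heights n A))) (FromArray.toArray-heights A∈))
        (∈ₚ.∈-map⁺ array (fromHeights-∈ (FromArray.heights-TSPP A∈)))

-- Frobenius coordinates of the diagonal, read off the array

module FrobeniusData where

  open import Data.Nat using (_+_; _*_)
  open Preliminaries
  open Shapes
  open Arrays
  open PlanePartitions

  at-removeZeros : ∀ {xs} → Linked _≥_ xs → ∀ i → at (removeZeros xs) i ≡ at xs i
  at-removeZeros {[]}         l i       = ≡.refl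
  at-removeZeros {zero ∷ xs}  l i       = ≡.trans (≡.cong (λ ys → at ys i) (removeZeros-zeros l)) (≡.sym (at-zeros (0 ∷ xs) (z≤n ∷ l) i))
    where
    at-zeros : ∀ xs → Linked _≥_ (0 ∷ xs) → ∀ i → at xs i ≡ 0
    at-zeros []       l         i       = ≡.refl
    at-zeros (_ ∷ xs) (z≤n ∷ l) zero    = ≡.refl
    at-zeros (_ ∷ xs) (z≤n ∷ l) (suc i) = at-zeros xs l i
  at-removeZeros {suc x ∷ xs} l zero    = ≡.refl
  at-removeZeros {suc x ∷ xs} l (suc i) = at-removeZeros (Linked.tail l) i

  count-removeZeros : ∀ j xs → countᵇ (suc j ≤ᵇ_) (removeZeros xs) ≡ countᵇ (suc j ≤ᵇ_) xs
  count-removeZeros j []           = ≡.refl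
  count-removeZeros j (zero ∷ xs)  = count-removeZeros j xs
  count-removeZeros j (suc x ∷ xs) = ≡.trans (countᵇ-∷ (suc j ≤ᵇ_) (suc x) (removeZeros xs))
    (≡.trans (≡.cong ((if suc j ≤ᵇ suc x then 1 else 0) +_) (count-removeZeros j xs)) (≡.sym (countᵇ-∷ (suc j ≤ᵇ_) (suc x) xs)))

  count-map : ∀ {A B : Set} (p : B → Bool) (g : A → B) xs → countᵇ p (L.map g xs) ≡ countᵇ (p ∘ g) xs
  count-map p g []       = ≡.refl
  count-map p g (x ∷ xs) = ≡.trans (countᵇ-∷ p (g x) (L.map g xs))
    (≡.trans (≡.cong ((if p (g x) then 1 else 0) +_) (count-map p g xs)) (≡.sym (countᵇ-∷ (p ∘ g) x xs)))

  map-oneTo-cong : ∀ n {f g : ℕ → ℕ} → (∀ i → 1 ≤ i → i ≤ n → f i ≡ g i) → L.map f (oneTo n) ≡ applyUpTo (g ∘ suc) n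
  map-oneTo-cong n {f} {g} h = ≡.trans (≡.cong (L.map f) (oneTo-applyUpTo n))
    (≡.trans (Lₚ.map-applyUpTo suc f n) (applyUpTo-cong< n (λ i i<n → h (suc i) (s≤s z≤n) i<n)))

  decreasing-applyUpTo : ∀ n (g : ℕ → ℕ) → (∀ i → suc i < n → g (suc i) ≤ g i) → Linked _≥_ (applyUpTo g n)
  decreasing-applyUpTo zero          g h = []
  decreasing-applyUpTo (suc zero)    g h = [-]
  decreasing-applyUpTo (suc (suc n)) g h = h 0 (s≤s (s≤s z≤n)) ∷ decreasing-applyUpTo (suc n) (g ∘ suc) (λ i p → h (suc i) (s≤s p))

  <-ext : ∀ {a b} → (∀ i → i < a → i < b) → (∀ i → i < b → i < a) → a ≡ b
  <-ext f g = ℕₚ.≤-antisym (half f) (half g)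
    where
    half : ∀ {a b} → (∀ i → i < a → i < b) → a ≤ b
    half {zero}  h = z≤n
    half {suc a} h = h a ℕₚ.≤-refl

  module Conjugation (n : ℕ) (δ : ℕ → ℕ) (δ-mono : ∀ i → 1 ≤ i → i < n → δ (suc i) ≤ δ i) where

    δ-mono* : ∀ {i j} → 1 ≤ i → i ℕ.≤′ j → j ≤ n → δ j ≤ δ i
    δ-mono* 1≤i ℕ.≤′-refl       j≤n = ℕₚ.≤-refl
    δ-mono* 1≤i (ℕ.≤′-step {j} p) j≤n = ℕₚ.≤-trans (δ-mono j (ℕₚ.≤-trans 1≤i (ℕₚ.≤′⇒≤ p)) j≤n) (δ-mono* 1≤i p (ℕₚ.<⇒≤ j≤n))

    -- The conjugate of the diagonal as a function on all indices. It forms a Galois connection with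
    -- δ, that is, i ≤ M j exactly if j ≤ δ i for 1 ≤ i ≤ n; the comparisons with conjugates rest on
    -- this.
    M : ℕ → ℕ
    M j = count (λ i → j ≤ᵇ δ i) n

    private
      down : ∀ j i → 1 ≤ i → i < n → (j ≤ᵇ δ (suc i)) ≡ true → (j ≤ᵇ δ i) ≡ true
      down j i 1≤i i<n e = ≤ᵇ-true {j} (ℕₚ.≤-trans (≤ᵇ-true⁻ {j} e) (δ-mono i 1≤i i<n))

    M-bound : ∀ j → M j ≤ n
    M-bound j = count-bound _ n

    M⇒δ : ∀ i j → 1 ≤ i → i ≤ M j → j ≤ δ i
    M⇒δ i j 1≤i p = ≤ᵇ-true⁻ (count-true (λ i → j ≤ᵇ δ i) n (down j) i 1≤i (ℕₚ.≤-trans p (M-bound j)) p)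

    δ⇒M : ∀ i j → 1 ≤ i → i ≤ n → j ≤ δ i → i ≤ M j
    δ⇒M i j 1≤i i≤n p = true-count (λ i → j ≤ᵇ δ i) n (down j) i 1≤i i≤n (≤ᵇ-true p)

    M-anti : ∀ {i j} → i ≤ j → M j ≤ M i
    M-anti {i} {j} i≤j = half (M j) ≡.refl
      where
      half : ∀ m → M j ≡ m → M j ≤ M i
      half zero    e = ≡.subst (_≤ M i) (≡.sym e) z≤n
      half (suc m) e = δ⇒M (M j) i pos-M (M-bound j) (ℕₚ.≤-trans i≤j (M⇒δ (M j) j pos-M ℕₚ.≤-refl))
        where
        pos-M : 1 ≤ M j
        pos-M = ≡.subst (1 ≤_) (≡.sym e) (s≤s z≤n)

    D μ : List ℕ
    D = removeZeros (L.map δ (oneTo n))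
    μ = conj D

    h : ℕ
    h = part D 1

    private
      diagonal : L.map δ (oneTo n) ≡ applyUpTo (δ ∘ suc) n
      diagonal = map-oneTo-cong n (λ _ _ _ → ≡.refl)

    part-D : ∀ i → 1 ≤ i → i ≤ n → part D i ≡ δ i
    part-D (suc i) _ i<n = ≡.trans (at-removeZeros (≡.subst (Linked _≥_) (≡.sym diagonal) (decreasing-applyUpTo n (δ ∘ suc) (λ i p → δ-mono (suc i) (s≤s z≤n) p))) i)
      (≡.trans (≡.cong (λ ys → at ys i) diagonal) (at-applyUpTo (δ ∘ suc) n i i<n))

    δ≤h : ∀ i → 1 ≤ i → i ≤ n → δ i ≤ h
    δ≤h i 1≤i i≤n = ≡.subst (δ i ≤_) (≡.sym (part-D 1 ℕₚ.≤-refl (ℕₚ.≤-trans 1≤i i≤n))) (δ-mono* ℕₚ.≤-refl (ℕₚ.≤⇒≤′ 1≤i) i≤n)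

    M-positive : ∀ {i} → 1 ≤ M i → i ≤ h
    M-positive {i} p = ℕₚ.≤-trans (M⇒δ 1 i ℕₚ.≤-refl p) (δ≤h 1 ℕₚ.≤-refl (ℕₚ.≤-trans p (M-bound i)))

    μ-applyUpTo : μ ≡ applyUpTo (M ∘ suc) h
    μ-applyUpTo = map-oneTo-cong h {g = M} (λ { (suc j) _ _ → ≡.trans (count-removeZeros j (L.map δ (oneTo n))) (count-map (suc j ≤ᵇ_) δ (oneTo n)) })

    length-μ : length μ ≡ h
    length-μ = ≡.trans (≡.cong length μ-applyUpTo) (Lₚ.length-applyUpTo (M ∘ suc) h)

    part-μ : ∀ i → 1 ≤ i → part μ i ≡ M i
    part-μ (suc i) _ with suc i ℕ.≤? h
    ... | yes p = ≡.trans (≡.cong (λ ys → at ys i) μ-applyUpTo) (at-applyUpTo (M ∘ suc) h i p)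
    ... | no ¬p = ≡.trans (at-beyond μ i (≡.subst (_≤ i) (≡.sym length-μ) (ℕ.≤-pred (ℕₚ.≰⇒> ¬p))))
      (≡.sym (ℕₚ.n≤0⇒n≡0 (ℕₚ.≮⇒≥ (λ q → ¬p (M-positive q)))))

    d : ℕ
    d = durfee μ

    private
      p-durfee : ℕ → Bool
      p-durfee i = i ≤ᵇ part μ i

      down-durfee : ∀ i → 1 ≤ i → i < length μ → p-durfee (suc i) ≡ true → p-durfee i ≡ true
      down-durfee i 1≤i _ e = ≤ᵇ-true (≡.subst (i ≤_) (≡.sym (part-μ i 1≤i))
        (ℕₚ.≤-trans (ℕₚ.n≤1+n i) (ℕₚ.≤-trans (≡.subst (suc i ≤_) (part-μ (suc i) (s≤s z≤n)) (≤ᵇ-true⁻ e)) (M-anti (ℕₚ.n≤1+n i)))))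

    durfee⇒ : ∀ i → 1 ≤ i → i ≤ d → i ≤ M i
    durfee⇒ i 1≤i i≤d = ≡.subst (i ≤_) (part-μ i 1≤i) (≤ᵇ-true⁻ (count-true p-durfee (length μ) down-durfee i 1≤i
      (ℕₚ.≤-trans i≤d (count-bound p-durfee (length μ))) i≤d))

    ⇒durfee : ∀ i → 1 ≤ i → i ≤ M i → i ≤ d
    ⇒durfee i 1≤i p = true-count p-durfee (length μ) down-durfee i 1≤i (≡.subst (i ≤_) (≡.sym length-μ) (M-positive (ℕₚ.≤-trans 1≤i p)))
      (≤ᵇ-true (≡.subst (i ≤_) (≡.sym (part-μ i 1≤i)) p))

    frobA-≡ : frobA μ ≡ applyUpTo (λ i → M (suc i) ∸ suc i) d
    frobA-≡ = map-oneTo-cong d {g = λ i → M i ∸ i} (λ i 1≤i _ → ≡.cong (_∸ i) (part-μ i 1≤i))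

    -- Conjugating twice gives back the diagonal, by the Galois connection. The Frobenius
    -- coordinates involve the indices up to the Durfee size, for which i ≤ M i ≤ n.
    part-conj-μ : ∀ i → 1 ≤ i → i ≤ d → part (conj μ) i ≡ δ i
    part-conj-μ (suc i) 1≤i i≤d = begin
      at (conj μ) i
        ≡⟨ ≡.cong (λ ys → at ys i) (map-oneTo-cong (part μ 1) {g = λ j → countᵇ (j ≤ᵇ_) μ} (λ _ _ _ → ≡.refl)) ⟩
      at (applyUpTo (λ j → countᵇ (suc j ≤ᵇ_) μ) (part μ 1)) i
        ≡⟨ at-applyUpTo (λ j → countᵇ (suc j ≤ᵇ_) μ) (part μ 1) i (≡.subst (suc i ≤_) (≡.sym (part-μ 1 ℕₚ.≤-refl)) (ℕₚ.≤-trans i≤M (M-anti (s≤s z≤n)))) ⟩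
      countᵇ (suc i ≤ᵇ_) μ
        ≡⟨ ≡.cong (countᵇ (suc i ≤ᵇ_)) (≡.trans μ-applyUpTo (≡.sym (map-oneTo-cong h (λ _ _ _ → ≡.refl)))) ⟩
      countᵇ (suc i ≤ᵇ_) (L.map M (oneTo h))
        ≡⟨ count-map (suc i ≤ᵇ_) M (oneTo h) ⟩
      count (λ j → suc i ≤ᵇ M j) h
        ≡⟨ ≤-ext (count-bound _ h) (δ≤h (suc i) 1≤i i≤n)
             (λ j 1≤j j≤h p → M⇒δ (suc i) j 1≤i (≤ᵇ-true⁻ (count-true (λ j → suc i ≤ᵇ M j) h downM j 1≤j j≤h p)))
             (λ j 1≤j j≤h p → true-count (λ j → suc i ≤ᵇ M j) h downM j 1≤j j≤h (≤ᵇ-true (δ⇒M (suc i) j 1≤i i≤n p))) ⟩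
      δ (suc i) ∎
      where
      open ≡.≡-Reasoning
      i≤M : suc i ≤ M (suc i)
      i≤M = durfee⇒ (suc i) 1≤i i≤d
      i≤n : suc i ≤ n
      i≤n = ℕₚ.≤-trans i≤M (M-bound (suc i))
      downM : ∀ j → 1 ≤ j → j < h → (suc i ≤ᵇ M (suc j)) ≡ true → (suc i ≤ᵇ M j) ≡ true
      downM j _ _ e = ≤ᵇ-true (ℕₚ.≤-trans (≤ᵇ-true⁻ e) (M-anti (ℕₚ.n≤1+n j)))

    frobB-≡ : frobB μ ≡ applyUpTo (λ i → δ (suc i) ∸ suc i) d
    frobB-≡ = map-oneTo-cong d {g = λ i → δ i ∸ i} (λ i 1≤i i≤d → ≡.cong (_∸ i) (part-conj-μ i 1≤i i≤d))

  module FrobeniusOfTSPP {n : ℕ} {T : ℕ → ℕ → ℕ} (tspp : IsTSPP n T) where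
    open IsTSPP tspp
    open FromTSPP tspp

    δ : ℕ → ℕ
    δ i = T i i

    open Conjugation n δ (λ i 1≤i i<n → ℕₚ.≤-trans (column-mono i (suc i) 1≤i i<n (s≤s z≤n) i<n) (row-mono i i 1≤i (ℕₚ.<⇒≤ i<n) 1≤i i<n)) public

    row : ℕ → List ℕ
    row t = applyUpTo (cell n T t) n

    -- An entry is positive exactly when the cube (i , i + t , i + t) is present.
    cell⇒M : ∀ t i → 1 ≤ cell n T t i → suc i + t ≤ M (suc i)
    cell⇒M t i p with suc i + t ℕ.≤? n
    ... | no ¬q = ⊥-elim (ℕₚ.n≮0 (≡.subst (1 ≤_) (cell-outside n T t i (ℕₚ.≰⇒> ¬q)) p))
    ... | yes q = δ⇒M (suc i + t) (suc i) (s≤s z≤n) q (cyclic (suc i) (suc i + t) (suc i + t) (s≤s z≤n) (ℕₚ.≤-trans (ℕₚ.m≤m+n (suc i) t) q) (s≤s z≤n) q (s≤s z≤n) q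
      (ℕ.≤-pred (≡.subst (_< suc (T (suc i) (suc i + t))) (ℕₚ.+-identityʳ (suc i + t)) (<∸⇒+< 0 (suc (T (suc i) (suc i + t))) (suc i + t) (≡.subst (1 ≤_) (cell-inside n T t i q) p)))))

    M⇒cell : ∀ t i → suc i + t ≤ M (suc i) → 1 ≤ cell n T t i
    M⇒cell t i p = ≡.subst (1 ≤_) (≡.sym (cell-inside n T t i q)) (ℕₚ.m<n⇒0<n∸m (s≤s
      (≡.subst (suc i + t ≤_) (symmetric (suc i + t) (suc i) (s≤s z≤n) q (s≤s z≤n) i≤n)
        (cyclic (suc i + t) (suc i + t) (suc i) (s≤s z≤n) q (s≤s z≤n) q (s≤s z≤n) i≤n (M⇒δ (suc i + t) (suc i) (s≤s z≤n) p)))))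
      where
      q : suc i + t ≤ n
      q = ℕₚ.≤-trans p (M-bound (suc i))
      i≤n : suc i ≤ n
      i≤n = ℕₚ.≤-trans (ℕₚ.m≤m+n (suc i) t) q

    at-row-positive : ∀ t i → 1 ≤ at (row t) i → i < n
    at-row-positive t i p with i ℕ.<? n
    ... | yes q = q
    ... | no ¬q = ⊥-elim (ℕₚ.n≮0 (≡.subst (1 ≤_) (at-beyond (row t) i (≡.subst (_≤ i) (≡.sym (Lₚ.length-applyUpTo (cell n T t) n)) (ℕₚ.≮⇒≥ ¬q))) p))

    row⇒M : ∀ t i → 1 ≤ at (row t) i → suc i + t ≤ M (suc i)
    row⇒M t i p = cell⇒M t i (≡.subst (1 ≤_) (at-applyUpTo (cell n T t) n i (at-row-positive t i p)) p)

    M⇒row : ∀ t i → suc i + t ≤ M (suc i) → 1 ≤ at (row t) i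
    M⇒row t i p = ≡.subst (1 ≤_) (≡.sym (at-applyUpTo (cell n T t) n i (ℕₚ.≤-trans (ℕₚ.m≤m+n (suc i) t) (ℕₚ.≤-trans p (M-bound (suc i)))))) (M⇒cell t i p)

    length-pos-row : length (pos (row 0)) ≡ d
    length-pos-row = <-ext
      (λ i p → ⇒durfee (suc i) (s≤s z≤n) (≡.subst (_≤ M (suc i)) (ℕₚ.+-identityʳ (suc i)) (row⇒M 0 i (pos-positive toArray-linked i p))))
      (λ i p → positive-pos toArray-linked i (M⇒row 0 i (≡.subst (_≤ M (suc i)) (≡.sym (ℕₚ.+-identityʳ (suc i))) (durfee⇒ (suc i) (s≤s z≤n) p))))

    frobB-pos : frobB μ ≡ pos (row 0)
    frobB-pos = ≡.trans frobB-≡ (at-ext _ _ (≡.trans (Lₚ.length-applyUpTo _ d) (≡.sym length-pos-row)) (λ i i< →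
      let i<d = ≡.subst (i <_) (Lₚ.length-applyUpTo (λ i → δ (suc i) ∸ suc i) d) i<
          i<n = ℕₚ.≤-trans (durfee⇒ (suc i) (s≤s z≤n) i<d) (M-bound (suc i)) in
      ≡.trans (at-applyUpTo _ d i i<d) (≡.sym (≡.trans (at-pos toArray-linked i)
        (≡.trans (≡.cong (_∸ 1) (≡.trans (at-applyUpTo (cell n T 0) n i i<n) (≡.trans (cell-inside n T 0 i (≡.subst (_≤ n) (≡.sym (ℕₚ.+-identityʳ (suc i))) i<n))
          (≡.cong (λ m → suc (T (suc i) m) ∸ m) (ℕₚ.+-identityʳ (suc i))))))
          (≡.trans (ℕₚ.∸-+-assoc (suc (δ (suc i))) (suc i) 1) (≡.cong (suc (δ (suc i)) ∸_) (ℕₚ.+-comm (suc i) 1))))))))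

    -- Path i is alive at time s exactly if i + s ≤ M i. Its last living time is therefore M i - i,
    -- the arm a_i, and this is the time that `arms` records.
    frobA-arms : frobA μ ≡ arms 0 (row 0) [] (applyUpTo (row ∘ suc) n)
    -- Nothing is recorded at time 0: dropping as many entries as there are living paths leaves the
    -- empty list.
    frobA-arms = ≡.sym (≡.trans (≡.cong (λ ys → arms 0 (row 0) ys (applyUpTo (row ∘ suc) n)) (≡.sym dropped))
      (arms-determined 0 (frobA μ) toArray-linked toArray-head toArray-Chain (ℕₚ.≤-reflexive (≡.trans length-pos-row (≡.sym length-A))) times))
      where
      length-A : length (frobA μ) ≡ d
      length-A = ≡.trans (≡.cong length frobA-≡) (Lₚ.length-applyUpTo _ d)
      dropped : L.drop (length (pos (row 0))) (frobA μ) ≡ []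
      dropped = Lₚ.drop-all (length (pos (row 0))) (frobA μ) (ℕₚ.≤-reflexive (≡.trans length-A (≡.sym length-pos-row)))
      at-A : ∀ i → i < length (frobA μ) → at (frobA μ) i ≡ M (suc i) ∸ suc i
      at-A i p = ≡.trans (≡.cong (λ ys → at ys i) frobA-≡) (at-applyUpTo _ d i (≡.subst (i <_) length-A p))
      times : ∀ s i → s ≤ n → i < length (frobA μ) →
        (1 ≤ at (rowAt (toArray n T) s) i → s ≤ at (frobA μ) i) × (s ≤ at (frobA μ) i → 1 ≤ at (rowAt (toArray n T) s) i)
      times s i s≤n i< rewrite rowAt-applyUpTo row (suc n) s (s≤s s≤n) | at-A i i< =
        (λ p → ≡.subst (_≤ M (suc i) ∸ suc i) (ℕₚ.m+n∸m≡n (suc i) s) (ℕₚ.∸-monoˡ-≤ (suc i) (row⇒M s i p))) ,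
        (λ p → M⇒row s i (≡.subst (suc i + s ≤_) (ℕₚ.m+[n∸m]≡n (durfee⇒ (suc i) (s≤s z≤n) (≡.subst (i <_) length-A i<))) (ℕₚ.+-monoʳ-≤ (suc i) p)))

-- Finite sums and signs in a commutative ring

module RingSums {c ℓ} (R : CommutativeRing c ℓ) where

  open CommutativeRing R public hiding (zero)
  open import Algebra.Properties.Ring ring public using (-1*x≈-x)
  open import Algebra.Properties.CommutativeSemiring.Exp commutativeSemiring public using (_^_; ^-homo-*; ^-distrib-*)
  open import Algebra.Solver.Ring.NaturalCoefficients.Default commutativeSemiring public using (solve; _:=_; _:+_; _:*_)
  open import Relation.Binary.Reasoning.Setoid setoid public

  ≡⇒≈ : ∀ {x y} → x ≡ y → x ≈ y
  ≡⇒≈ ≡.refl = refl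

  -- Signs are powers of an atom ε, so that a solver for commutative semirings can handle them. Its
  -- special laws are x + ε x ≈ 0 and what follows from it, such as ε ε ≈ 1.
  ε : Carrier
  ε = - 1#

  x+εx≈0 : ∀ x → x + ε * x ≈ 0#
  x+εx≈0 x = trans (+-congˡ (-1*x≈-x x)) (-‿inverseʳ x)

  εx+x≈0 : ∀ x → ε * x + x ≈ 0#
  εx+x≈0 x = trans (+-comm _ _) (x+εx≈0 x)

  +-unique-ε : ∀ {x y} → x + y ≈ 0# → x ≈ ε * y
  +-unique-ε {x} {y} p = begin
    x                  ≈⟨ +-identityʳ x ⟨
    x + 0#             ≈⟨ +-congˡ (x+εx≈0 y) ⟨
    x + (y + ε * y)    ≈⟨ +-assoc _ _ _ ⟨
    (x + y) + ε * y    ≈⟨ +-congʳ p ⟩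
    0# + ε * y         ≈⟨ +-identityˡ _ ⟩
    ε * y              ∎

  ε*ε≈1 : ε * ε ≈ 1#
  ε*ε≈1 = sym (+-unique-ε (trans (+-congˡ (sym (*-identityʳ ε))) (x+εx≈0 1#)))

  sg : ℕ → Carrier
  sg n = ε ^ n

  sg*sg≈1 : ∀ n → sg n * sg n ≈ 1#
  sg*sg≈1 zero    = *-identityˡ 1#
  sg*sg≈1 (suc n) = begin
    (ε * sg n) * (ε * sg n)  ≈⟨ solve 2 (λ a b → (a :* b) :* (a :* b) := (a :* a) :* (b :* b)) refl ε (sg n) ⟩
    (ε * ε) * (sg n * sg n)  ≈⟨ *-cong ε*ε≈1 (sg*sg≈1 n) ⟩
    1# * 1#                  ≈⟨ *-identityˡ 1# ⟩
    1#                       ∎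

  sg-cancel : ∀ n x → sg n * (sg n * x) ≈ x
  sg-cancel n x = trans (sym (*-assoc _ _ _)) (trans (*-congʳ (sg*sg≈1 n)) (*-identityˡ x))

  ^-inverse : ∀ {x y} → x * y ≈ 1# → ∀ n → x ^ n * y ^ n ≈ 1#
  ^-inverse {x} {y} p n = trans (sym (^-distrib-* x y n)) (1^ n)
    where
    1^ : ∀ n → (x * y) ^ n ≈ 1#
    1^ zero    = refl
    1^ (suc n) = trans (*-cong p (1^ n)) (*-identityˡ 1#)

  opaque
    Σ< : ℕ → (ℕ → Carrier) → Carrier
    Σ< zero    f = 0#
    Σ< (suc n) f = f 0 + Σ< n (f ∘ suc)

  opaque
    unfolding Σ<

    Σ<-0 : ∀ f → Σ< 0 f ≈ 0#
    Σ<-0 f = refl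

    Σ<-suc : ∀ n f → Σ< (suc n) f ≈ f 0 + Σ< n (f ∘ suc)
    Σ<-suc n f = refl

    Σ<-cong< : ∀ n {f g} → (∀ i → i < n → f i ≈ g i) → Σ< n f ≈ Σ< n g
    Σ<-cong< zero    p = refl
    Σ<-cong< (suc n) p = +-cong (p 0 (s≤s z≤n)) (Σ<-cong< n (λ i i<n → p (suc i) (s≤s i<n)))

    Σ<-cong : ∀ n {f g} → (∀ i → f i ≈ g i) → Σ< n f ≈ Σ< n g
    Σ<-cong n p = Σ<-cong< n (λ i _ → p i)

    Σ<-zero : ∀ n {f} → (∀ i → i < n → f i ≈ 0#) → Σ< n f ≈ 0#
    Σ<-zero zero    p = refl
    Σ<-zero (suc n) p = trans (+-cong (p 0 (s≤s z≤n)) (Σ<-zero n (λ i i<n → p (suc i) (s≤s i<n)))) (+-identityˡ 0#)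

    Σ<-+ : ∀ n f g → Σ< n (λ i → f i + g i) ≈ Σ< n f + Σ< n g
    Σ<-+ zero    f g = sym (+-identityˡ 0#)
    Σ<-+ (suc n) f g = trans (+-congˡ (Σ<-+ n _ _))
      (solve 4 (λ a b x y → (a :+ b) :+ (x :+ y) := (a :+ x) :+ (b :+ y)) refl _ _ _ _)

    Σ<-*ˡ : ∀ n x f → Σ< n (λ i → x * f i) ≈ x * Σ< n f
    Σ<-*ˡ zero    x f = sym (zeroʳ x)
    Σ<-*ˡ (suc n) x f = trans (+-congˡ (Σ<-*ˡ n x _)) (sym (distribˡ _ _ _))

    Σ<-*ʳ : ∀ n x f → Σ< n (λ i → f i * x) ≈ Σ< n f * x
    Σ<-*ʳ n x f = trans (Σ<-cong n (λ i → *-comm _ _)) (trans (Σ<-*ˡ n x f) (*-comm _ _))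

    Σ<-last : ∀ n f → Σ< (suc n) f ≈ Σ< n f + f n
    Σ<-last zero    f = +-comm _ _
    Σ<-last (suc n) f = trans (+-congˡ (Σ<-last n (f ∘ suc))) (sym (+-assoc _ _ _))

    Σ<-swap : ∀ m n (f : ℕ → ℕ → Carrier) → Σ< m (λ i → Σ< n (λ j → f i j)) ≈ Σ< n (λ j → Σ< m (λ i → f i j))
    Σ<-swap zero    n f = sym (Σ<-zero n (λ _ _ → refl))
    Σ<-swap (suc m) n f = trans (+-congˡ (Σ<-swap m n (f ∘ suc))) (sym (Σ<-+ n _ _))

    Σ<-single : ∀ n j {f} → j < n → (∀ i → i < n → i ≢ j → f i ≈ 0#) → Σ< n f ≈ f j
    Σ<-single (suc n) zero    _ p =
      trans (+-congˡ (Σ<-zero n (λ i i<n → p (suc i) (s≤s i<n) (λ ())))) (+-identityʳ _)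
    Σ<-single (suc n) (suc j) (s≤s j<n) p =
      trans (+-cong (p 0 (s≤s z≤n) (λ ()))
                    (Σ<-single n j j<n (λ i i<n i≢j → p (suc i) (s≤s i<n) (i≢j ∘ ℕₚ.suc-injective))))
            (+-identityˡ _)

    Σ<-pair : ∀ n j {f} → suc j < n → f j + f (suc j) ≈ 0# →
              (∀ i → i < n → i ≢ j → i ≢ suc j → f i ≈ 0#) → Σ< n f ≈ 0#
    Σ<-pair (suc (suc n)) zero _ q p =
      trans (sym (+-assoc _ _ _))
        (trans (+-cong q (Σ<-zero n (λ i i<n → p (suc (suc i)) (s≤s (s≤s i<n)) (λ ()) (λ ())))) (+-identityˡ _))
    Σ<-pair (suc n) (suc j) (s≤s j<n) q p =
      trans (+-cong (p 0 (s≤s z≤n) (λ ()) (λ ()))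
                    (Σ<-pair n j j<n q (λ i i<n a b → p (suc i) (s≤s i<n) (a ∘ ℕₚ.suc-injective) (b ∘ ℕₚ.suc-injective))))
            (+-identityˡ _)

    Σ<-extend : ∀ {m n} f → m ≤ n → (∀ i → m ≤ i → i < n → f i ≈ 0#) → Σ< m f ≈ Σ< n f
    Σ<-extend {zero} {n} f _ p = sym (Σ<-zero n (λ i i<n → p i z≤n i<n))
    Σ<-extend {suc m} {suc n} f (s≤s m≤n) p =
      +-congˡ (Σ<-extend (f ∘ suc) m≤n (λ i m≤i i<n → p (suc i) (s≤s m≤i) (s≤s i<n)))

    Σ<-reverse : ∀ n f → Σ< (suc n) f ≈ Σ< (suc n) (λ i → f (n ∸ i))
    Σ<-reverse zero    f = refl
    Σ<-reverse (suc n) f = begin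
      f 0 + Σ< (suc n) (f ∘ suc)                     ≈⟨ +-congˡ (Σ<-reverse n (f ∘ suc)) ⟩
      f 0 + Σ< (suc n) (λ i → f (suc (n ∸ i)))       ≈⟨ +-comm _ _ ⟩
      Σ< (suc n) (λ i → f (suc (n ∸ i))) + f 0       ≈⟨ +-cong (Σ<-cong< (suc n) (λ i i<1+n → ≡⇒≈ (≡.cong f (≡.sym (ℕₚ.+-∸-assoc 1 (ℕ.≤-pred i<1+n)))))) (≡⇒≈ (≡.cong f (≡.sym (ℕₚ.n∸n≡0 (suc n))))) ⟩
      Σ< (suc n) (λ i → f (suc n ∸ i)) + f (suc n ∸ suc n) ≈⟨ Σ<-last (suc n) (λ i → f (suc n ∸ i)) ⟨
      Σ< (suc (suc n)) (λ i → f (suc n ∸ i))         ∎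

  ΣL : ∀ {a} {A : Set a} → List A → (A → Carrier) → Carrier
  ΣL xs f = L.foldr _+_ 0# (L.map f xs)

  ΣL-cong : ∀ {a} {A : Set a} (xs : List A) {f g} → (∀ x → x ∈ xs → f x ≈ g x) → ΣL xs f ≈ ΣL xs g
  ΣL-cong []       p = refl
  ΣL-cong (x ∷ xs) p = +-cong (p x (here ≡.refl)) (ΣL-cong xs (λ y y∈ → p y (there y∈)))

  ΣL-++ : ∀ {a} {A : Set a} (xs ys : List A) f → ΣL (xs ++ ys) f ≈ ΣL xs f + ΣL ys f
  ΣL-++ []       ys f = sym (+-identityˡ _)
  ΣL-++ (x ∷ xs) ys f = trans (+-congˡ (ΣL-++ xs ys f)) (sym (+-assoc _ _ _))

  ΣL-map : ∀ {a b} {A : Set a} {B : Set b} (g : A → B) xs f → ΣL (L.map g xs) f ≈ ΣL xs (f ∘ g)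
  ΣL-map g []       f = refl
  ΣL-map g (x ∷ xs) f = +-congˡ (ΣL-map g xs f)

  ΣL-concatMap : ∀ {a b} {A : Set a} {B : Set b} (g : A → List B) xs f →
                 ΣL (concatMap g xs) f ≈ ΣL xs (λ x → ΣL (g x) f)
  ΣL-concatMap g []       f = refl
  ΣL-concatMap g (x ∷ xs) f = trans (ΣL-++ (g x) _ f) (+-congˡ (ΣL-concatMap g xs f))

  ΣL-*ˡ : ∀ {a} {A : Set a} (xs : List A) y f → ΣL xs (λ x → y * f x) ≈ y * ΣL xs f
  ΣL-*ˡ []       y f = sym (zeroʳ y)
  ΣL-*ˡ (x ∷ xs) y f = trans (+-congˡ (ΣL-*ˡ xs y f)) (sym (distribˡ _ _ _))

  ΣL-zero : ∀ {a} {A : Set a} (xs : List A) {f} → (∀ x → x ∈ xs → f x ≈ 0#) → ΣL xs f ≈ 0#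
  ΣL-zero []       p = refl
  ΣL-zero (x ∷ xs) p = trans (+-cong (p x (here ≡.refl)) (ΣL-zero xs (λ y y∈ → p y (there y∈)))) (+-identityˡ 0#)

  ΣL-filter : ∀ {a} {A : Set a} (p : A → Bool) xs f →
              ΣL (L.filterᵇ p xs) f ≈ ΣL xs (λ x → if p x then f x else 0#)
  ΣL-filter p []       f = refl
  ΣL-filter p (x ∷ xs) f with p x
  ... | true  = +-congˡ (ΣL-filter p xs f)
  ... | false = trans (ΣL-filter p xs f) (sym (+-identityˡ _))

  ΣL-↭ : ∀ {a} {A : Set a} {xs ys : List A} f → xs ↭ ys → ΣL xs f ≈ ΣL ys f
  ΣL-↭ f Perm.refl          = refl
  ΣL-↭ f (Perm.prep x p)    = +-congˡ (ΣL-↭ f p)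
  ΣL-↭ f (Perm.swap x y p)  = trans (+-congˡ (+-congˡ (ΣL-↭ f p)))
    (solve 3 (λ a b z → a :+ (b :+ z) := b :+ (a :+ z)) refl _ _ _)
  ΣL-↭ f (Perm.trans p q)   = trans (ΣL-↭ f p) (ΣL-↭ f q)

  opaque
    unfolding Σ<

    ΣL-applyUpTo : ∀ {a} {A : Set a} (g : ℕ → A) n f → ΣL (applyUpTo g n) f ≈ Σ< n (f ∘ g)
    ΣL-applyUpTo g zero    f = refl
    ΣL-applyUpTo g (suc n) f = +-congˡ (ΣL-applyUpTo (g ∘ suc) n f)

  ΣL-upTo : ∀ n f → ΣL (upTo n) f ≈ Σ< n f
  ΣL-upTo = ΣL-applyUpTo id

  Σ<-drop : ∀ m n f → (∀ i → i < m → f i ≈ 0#) → Σ< n f ≈ Σ< (n ∸ m) (λ s → f (m ℕ.+ s))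
  Σ<-drop zero    n       f p = refl
  Σ<-drop (suc m) zero    f p = trans (Σ<-0 _) (sym (Σ<-0 _))
  Σ<-drop (suc m) (suc n) f p = trans (Σ<-suc n f) (trans (+-congʳ (p 0 (s≤s z≤n)))
    (trans (+-identityˡ _) (Σ<-drop m n (f ∘ suc) (λ i i<m → p (suc i) (s≤s i<m)))))

  Σ<-ΣL-swap : ∀ n {a} {A : Set a} (xs : List A) (f : ℕ → A → Carrier) → Σ< n (λ i → ΣL xs (f i)) ≈ ΣL xs (λ y → Σ< n (λ i → f i y))
  Σ<-ΣL-swap n []       f = Σ<-zero n (λ _ _ → refl)
  Σ<-ΣL-swap n (y ∷ xs) f = trans (Σ<-+ n _ _) (+-congˡ (Σ<-ΣL-swap n xs f))

  ΣL-+ : ∀ {a} {A : Set a} (xs : List A) {f g : A → Carrier} → ΣL xs (λ x → f x + g x) ≈ ΣL xs f + ΣL xs g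
  ΣL-+ []       = sym (+-identityˡ 0#)
  ΣL-+ (x ∷ xs) = trans (+-congˡ (ΣL-+ xs)) (solve 4 (λ a b x y → (a :+ b) :+ (x :+ y) := (a :+ x) :+ (b :+ y)) refl _ _ _ _)

  sg-+ : ∀ m n → sg (m ℕ.+ n) ≈ sg m * sg n
  sg-+ = ^-homo-* ε

  sg-∸ : ∀ {m n} → n ≤ m → sg (m ∸ n) ≈ sg m * sg n
  sg-∸ {m} {n} n≤m = begin
    sg (m ∸ n)                    ≈⟨ *-identityʳ _ ⟨
    sg (m ∸ n) * 1#               ≈⟨ *-congˡ (sg*sg≈1 n) ⟨
    sg (m ∸ n) * (sg n * sg n)    ≈⟨ *-assoc _ _ _ ⟨
    sg (m ∸ n) * sg n * sg n      ≈⟨ *-congʳ (sg-+ (m ∸ n) n) ⟨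
    sg (m ∸ n ℕ.+ n) * sg n       ≡⟨ ≡.cong (λ k → sg k * sg n) (ℕₚ.m∸n+n≡m n≤m) ⟩
    sg m * sg n                   ∎

  1^n*x≈x : ∀ n x → 1# ^ n * x ≈ x
  1^n*x≈x n x = trans (*-congʳ (1^ n)) (*-identityˡ x)
    where
    1^ : ∀ n → 1# ^ n ≈ 1#
    1^ zero    = refl
    1^ (suc n) = trans (*-identityˡ _) (1^ n)

-- Determinants by means of alternating functionals

module Determinant {c ℓ} (R : CommutativeRing c ℓ) where

  open RingSums R

  Row : Set c
  Row = ℕ → Carrier

  Matrix : Set c
  Matrix = ℕ → Row

  skip : ℕ → ℕ → ℕ
  skip zero    c       = suc c
  skip (suc j) zero    = zero
  skip (suc j) (suc c) = suc (skip j c)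

  skip-< : ∀ j {c n} → c < n → skip j c < suc n
  skip-< zero    c<n             = s≤s c<n
  skip-< (suc j) {zero} c<n      = s≤s z≤n
  skip-< (suc j) {suc c} (s≤s p) = s≤s (skip-< j p)

  skip-injective : ∀ j {c d} → skip j c ≡ skip j d → c ≡ d
  skip-injective zero    p = ℕₚ.suc-injective p
  skip-injective (suc j) {zero}  {zero}  p = ≡.refl
  skip-injective (suc j) {suc c} {suc d} p = ≡.cong suc (skip-injective j (ℕₚ.suc-injective p))

  skip-≢ : ∀ j {c} → skip j c ≢ j
  skip-≢ (suc j) {suc c} p = skip-≢ j (ℕₚ.suc-injective p)

  skip-below : ∀ {j c} → c < j → skip j c ≡ c
  skip-below {suc j} {zero}  p       = ≡.refl
  skip-below {suc j} {suc c} (s≤s p) = ≡.cong suc (skip-below p)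

  skip-above : ∀ {j c} → j ≤ c → skip j c ≡ suc c
  skip-above z≤n     = ≡.refl
  skip-above (s≤s p) = ≡.cong suc (skip-above p)

  skip-onto : ∀ {k j n} → k < j → j < suc n → ∃ λ j′ → j′ < n × skip k j′ ≡ j × j ≡ suc j′
  skip-onto {j = suc j′} (s≤s k≤j′) (s≤s j′<n) = j′ , j′<n , skip-above k≤j′ , ≡.refl

  Det : ℕ → Matrix → Carrier
  Det zero    f = 1#
  Det (suc n) f = Σ< (suc n) (λ j → sg j * f 0 j * Det n (λ i c → f (suc i) (skip j c)))

  Det-cong : ∀ n {f g : Matrix} → (∀ i j → i < n → j < n → f i j ≈ g i j) → Det n f ≈ Det n g
  Det-cong zero    p = refl
  Det-cong (suc n) p = Σ<-cong< (suc n) λ j j<n →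
    *-cong (*-congˡ (p 0 j (s≤s z≤n) j<n))
           (Det-cong n (λ i c i<n c<n → p (suc i) (skip j c) (s≤s i<n) (skip-< j c<n)))

  -- Columns come before rows because the Laplace expansion runs along the first row: column j is
  -- the coefficient in the term of j and survives as a column of the minor in every other term.
  Det-column-linear : ∀ n j {f g h : Matrix} a b → j < n →
    (∀ i → f i j ≈ a * g i j + b * h i j) →
    (∀ i c → c ≢ j → f i c ≈ g i c) → (∀ i c → c ≢ j → f i c ≈ h i c) →
    Det n f ≈ a * Det n g + b * Det n h
  Det-column-linear (suc n) j {f} {g} {h} a b j<n fj f≈g f≈h = begin
    Σ< (suc n) (term f)                                       ≈⟨ Σ<-cong< (suc n) split ⟩
    Σ< (suc n) (λ i → a * term g i + b * term h i)            ≈⟨ Σ<-+ (suc n) _ _ ⟩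
    Σ< (suc n) (λ i → a * term g i) + Σ< (suc n) (λ i → b * term h i) ≈⟨ +-cong (Σ<-*ˡ (suc n) a _) (Σ<-*ˡ (suc n) b _) ⟩
    a * Det (suc n) g + b * Det (suc n) h                     ∎
    where
    minor : ℕ → Matrix → Matrix
    minor k m i c = m (suc i) (skip k c)
    term : Matrix → ℕ → Carrier
    term m k = sg k * m 0 k * Det n (minor k m)
    other : ∀ k j′ → j′ < n → skip k j′ ≡ j → k ≢ j → term f k ≈ a * term g k + b * term h k
    other k j′ j′<n e k≢j = begin
      sg k * f 0 k * Det n (minor k f)
        ≈⟨ *-congˡ (Det-column-linear n j′ a b j′<n
             (λ i → ≡.subst (λ z → f (suc i) z ≈ a * g (suc i) z + b * h (suc i) z) (≡.sym e) (fj (suc i)))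
             (λ i c c≢ → f≈g (suc i) (skip k c) (λ q → c≢ (skip-injective k (≡.trans q (≡.sym e)))))
             (λ i c c≢ → f≈h (suc i) (skip k c) (λ q → c≢ (skip-injective k (≡.trans q (≡.sym e)))))) ⟩
      sg k * f 0 k * (a * Det n (minor k g) + b * Det n (minor k h))
        ≈⟨ solve 6 (λ s x a b y z → s :* x :* (a :* y :+ b :* z) := a :* (s :* x :* y) :+ b :* (s :* x :* z)) refl _ _ _ _ _ _ ⟩
      a * (sg k * f 0 k * Det n (minor k g)) + b * (sg k * f 0 k * Det n (minor k h))
        ≈⟨ +-cong (*-congˡ (*-congʳ (*-congˡ (f≈g 0 k k≢j)))) (*-congˡ (*-congʳ (*-congˡ (f≈h 0 k k≢j)))) ⟩
      a * term g k + b * term h k ∎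
    split : ∀ k → k < suc n → term f k ≈ a * term g k + b * term h k
    split k k<n with ℕₚ.<-cmp k j
    split k (s≤s k≤n) | tri> _ k≢j j<k = other k j (ℕₚ.<-≤-trans j<k k≤n) (skip-below j<k) k≢j
    split k k<n | tri≈ _ ≡.refl _ = begin
      sg j * f 0 j * Det n (minor j f)
        ≈⟨ *-congʳ (*-congˡ (fj 0)) ⟩
      sg j * (a * g 0 j + b * h 0 j) * Det n (minor j f)
        ≈⟨ solve 6 (λ s d a b y z → s :* (a :* y :+ b :* z) :* d := a :* (s :* y :* d) :+ b :* (s :* z :* d)) refl _ _ _ _ _ _ ⟩
      a * (sg j * g 0 j * Det n (minor j f)) + b * (sg j * h 0 j * Det n (minor j f))
        ≈⟨ +-cong (*-congˡ (*-congˡ (Det-cong n (λ i c _ _ → f≈g (suc i) (skip j c) (skip-≢ j)))))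
                  (*-congˡ (*-congˡ (Det-cong n (λ i c _ _ → f≈h (suc i) (skip j c) (skip-≢ j))))) ⟩
      a * term g j + b * term h j ∎
    split k k<n | tri< k<j k≢j _ with skip-onto k<j j<n
    ... | j₁ , j₁<n , e , _ = other k j₁ j₁<n e k≢j

  -- The terms of j and j + 1 have equal minors and opposite signs. Every other minor keeps both
  -- equal columns, and they stay adjacent.
  Det-column-alternating : ∀ n j {f : Matrix} → suc j < n → (∀ i → f i j ≈ f i (suc j)) → Det n f ≈ 0#
  Det-column-alternating (suc n) j {f} j<n p = Σ<-pair (suc n) j j<n cancel vanish
    where
    term : ℕ → Carrier
    term k = sg k * f 0 k * Det n (λ i c → f (suc i) (skip k c))
    minors : ∀ i c → f (suc i) (skip j c) ≈ f (suc i) (skip (suc j) c)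
    minors i c with ℕₚ.<-cmp c j
    ... | tri< c<j _ _ = ≡⇒≈ (≡.cong (f (suc i)) (≡.trans (skip-below c<j) (≡.sym (skip-below (ℕₚ.m<n⇒m<1+n c<j)))))
    ... | tri≈ _ ≡.refl _ = begin
      f (suc i) (skip j j)        ≡⟨ ≡.cong (f (suc i)) (skip-above ℕₚ.≤-refl) ⟩
      f (suc i) (suc j)           ≈⟨ p (suc i) ⟨
      f (suc i) j                 ≡⟨ ≡.cong (f (suc i)) (skip-below ℕₚ.≤-refl) ⟨
      f (suc i) (skip (suc j) j)  ∎
    ... | tri> _ _ j<c = ≡⇒≈ (≡.cong (f (suc i)) (≡.trans (skip-above (ℕₚ.<⇒≤ j<c)) (≡.sym (skip-above j<c))))
    cancel : term j + term (suc j) ≈ 0#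
    cancel = begin
      term j + ε * sg j * f 0 (suc j) * Det n (λ i c → f (suc i) (skip (suc j) c))
        ≈⟨ +-congˡ (*-cong (*-congˡ (sym (p 0))) (Det-cong n (λ i c _ _ → sym (minors i c)))) ⟩
      term j + ε * sg j * f 0 j * Det n (λ i c → f (suc i) (skip j c))
        ≈⟨ +-congˡ (solve 4 (λ e s x d → e :* s :* x :* d := e :* (s :* x :* d)) refl _ _ _ _) ⟩
      term j + ε * term j  ≈⟨ x+εx≈0 _ ⟩
      0# ∎
    shifted : ∀ k j′ → suc j′ < n → skip k j′ ≡ j → skip k (suc j′) ≡ suc j → term k ≈ 0#
    shifted k j′ j′<n e e′ = trans (*-congˡ (Det-column-alternating n j′ j′<n (λ i →
      trans (≡⇒≈ (≡.cong (f (suc i)) e)) (trans (p (suc i)) (≡⇒≈ (≡.cong (f (suc i)) (≡.sym e′))))))) (zeroʳ _)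
    vanish : ∀ k → k < suc n → k ≢ j → k ≢ suc j → term k ≈ 0#
    vanish k k<n k≢j k≢1+j with ℕₚ.<-cmp k j
    ... | tri≈ _ e _ = ⊥-elim (k≢j e)
    ... | tri> _ _ j<k with ℕₚ.≤∧≢⇒< j<k (k≢1+j ∘ ≡.sym)
    ...   | 1+j<k = shifted k j (ℕₚ.<-≤-trans 1+j<k (ℕ.≤-pred k<n)) (skip-below j<k) (skip-below 1+j<k)
    vanish k k<n k≢j k≢1+j | tri< k<j _ _ with skip-onto k<j (ℕₚ.<-trans (ℕₚ.n<1+n j) j<n)
    ... | j₁ , _ , e , ≡.refl = shifted k j₁ (ℕ.≤-pred j<n) e (skip-above (ℕₚ.<⇒≤ k<j))

  nth : List Row → ℕ → Row
  nth []       _       = λ _ → 0#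
  nth (x ∷ xs) zero    = x
  nth (x ∷ xs) (suc i) = nth xs i

  detL : List Row → Carrier
  detL xs = Det (length xs) (nth xs)

  nth-here : ∀ pre x post → nth (pre ++ x ∷ post) (length pre) ≡ x
  nth-here []        x post = ≡.refl
  nth-here (y ∷ pre) x post = nth-here pre x post

  nth-there : ∀ pre x y post i → i ≢ length pre → nth (pre ++ x ∷ post) i ≡ nth (pre ++ y ∷ post) i
  nth-there []        x y post zero    p = ⊥-elim (p ≡.refl)
  nth-there []        x y post (suc i) p = ≡.refl
  nth-there (_ ∷ pre) x y post zero    p = ≡.refl
  nth-there (_ ∷ pre) x y post (suc i) p = nth-there pre x y post i (p ∘ ≡.cong suc)

  nth-map : ∀ (g : Row → Row) xs i → i < length xs → nth (L.map g xs) i ≡ g (nth xs i)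
  nth-map g (x ∷ xs) zero    _       = ≡.refl
  nth-map g (x ∷ xs) (suc i) (s≤s p) = nth-map g xs i p

  nth-applyUpTo : ∀ (f : ℕ → Row) n i → i < n → nth (applyUpTo f n) i ≡ f i
  nth-applyUpTo f (suc n) zero    _       = ≡.refl
  nth-applyUpTo f (suc n) (suc i) (s≤s p) = nth-applyUpTo (f ∘ suc) n i p

  nth-Pointwise : ∀ {r} {_∼_ : Row → Row → Set r} {xs ys} → Pointwise _∼_ xs ys →
                  ∀ i → i < length xs → nth xs i ∼ nth ys i
  nth-Pointwise (p ∷ ps) zero    _       = p
  nth-Pointwise (p ∷ ps) (suc i) (s≤s q) = nth-Pointwise ps i q

  detL-applyUpTo : ∀ n (f : Matrix) → detL (applyUpTo f n) ≈ Det n f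
  detL-applyUpTo n f = trans (≡⇒≈ (≡.cong (λ m → Det m (nth (applyUpTo f n))) (Lₚ.length-applyUpTo f n)))
    (Det-cong n (λ i j i<n _ → ≡⇒≈ (≡.cong (λ r → r j) (nth-applyUpTo f n i i<n))))

  infix 4 _≋_ _≋[_]_
  _≋_ : Row → Row → Set ℓ
  x ≋ y = ∀ c → x c ≈ y c

  _≋[_]_ : Row → ℕ → Row → Set ℓ
  x ≋[ n ] y = ∀ c → c < n → x c ≈ y c

  -- The size n enters only through `cong<`, which compares rows on the columns below n. The other
  -- laws hold for lists of every length, so `detL-alternating 0` supplies them for any size.
  record Alternating (n : ℕ) (A : List Row → Carrier) : Set (c Level.⊔ ℓ) where
    field
      cong<  : ∀ {xs ys} → length xs ≡ n → Pointwise _≋[ n ]_ xs ys → A xs ≈ A ys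
      cong   : ∀ {xs ys} → Pointwise _≋_ xs ys → A xs ≈ A ys
      linear : ∀ pre a x b y post →
               A (pre ++ (λ c → a * x c + b * y c) ∷ post) ≈ a * A (pre ++ x ∷ post) + b * A (pre ++ y ∷ post)
      alternating : ∀ pre x post → A (pre ++ x ∷ x ∷ post) ≈ 0#

  ≋-refl : ∀ {xs} → Pointwise _≋_ xs xs
  ≋-refl = PW.refl (λ _ → refl)

  ≋-at : ∀ pre {x y} post → x ≋ y → Pointwise _≋_ (pre ++ x ∷ post) (pre ++ y ∷ post)
  ≋-at pre post p = PW.++⁺ ≋-refl (p ∷ ≋-refl)

  module AlternatingProperties {n A} (isAlternating : Alternating n A) where
    open Alternating isAlternating

    at-++ : ∀ (pre mid post : List Row) → A ((pre ++ mid) ++ post) ≈ A (pre ++ mid ++ post)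
    at-++ pre mid post = ≡⇒≈ (≡.cong A (Lₚ.++-assoc pre mid post))

    scale : ∀ pre a x post → A (pre ++ (λ c → a * x c) ∷ post) ≈ a * A (pre ++ x ∷ post)
    scale pre a x post = begin
      A (pre ++ (λ c → a * x c) ∷ post)
        ≈⟨ cong (≋-at pre post (λ c → sym (trans (+-congˡ (zeroˡ _)) (+-identityʳ _)))) ⟩
      A (pre ++ (λ c → a * x c + 0# * x c) ∷ post)       ≈⟨ linear pre a x 0# x post ⟩
      a * A (pre ++ x ∷ post) + 0# * A (pre ++ x ∷ post) ≈⟨ trans (+-congˡ (zeroˡ _)) (+-identityʳ _) ⟩
      a * A (pre ++ x ∷ post)                            ∎

    add : ∀ pre x y post → A (pre ++ (λ c → x c + y c) ∷ post) ≈ A (pre ++ x ∷ post) + A (pre ++ y ∷ post)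
    add pre x y post = begin
      A (pre ++ (λ c → x c + y c) ∷ post)
        ≈⟨ cong (≋-at pre post (λ c → +-cong (sym (*-identityˡ _)) (sym (*-identityˡ _)))) ⟩
      A (pre ++ (λ c → 1# * x c + 1# * y c) ∷ post)      ≈⟨ linear pre 1# x 1# y post ⟩
      1# * A (pre ++ x ∷ post) + 1# * A (pre ++ y ∷ post) ≈⟨ +-cong (*-identityˡ _) (*-identityˡ _) ⟩
      A (pre ++ x ∷ post) + A (pre ++ y ∷ post)          ∎

    null : ∀ pre post → A (pre ++ (λ _ → 0#) ∷ post) ≈ 0#
    null pre post = begin
      A (pre ++ (λ _ → 0#) ∷ post)        ≈⟨ cong (≋-at pre post (λ c → sym (zeroˡ 0#))) ⟩
      A (pre ++ (λ _ → 0# * 0#) ∷ post)   ≈⟨ scale pre 0# (λ _ → 0#) post ⟩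
      0# * A (pre ++ (λ _ → 0#) ∷ post)   ≈⟨ zeroˡ _ ⟩
      0#                                  ∎

    linear-Σ : ∀ pre m (a : ℕ → Carrier) (x : Matrix) post →
               A (pre ++ (λ c → Σ< m (λ k → a k * x k c)) ∷ post) ≈ Σ< m (λ k → a k * A (pre ++ x k ∷ post))
    linear-Σ pre zero    a x post =
      trans (cong (≋-at pre post (λ c → Σ<-0 _))) (trans (null pre post) (sym (Σ<-0 _)))
    linear-Σ pre (suc m) a x post = trans (cong (≋-at pre post (λ c → Σ<-suc m _)))
      (trans (add pre _ _ post)
        (trans (+-cong (scale pre _ _ post) (linear-Σ pre m (a ∘ suc) (x ∘ suc) post)) (sym (Σ<-suc m _))))

    -- Polarization: expand the value 0 at two adjacent rows x + y.
    swap : ∀ pre x y post → A (pre ++ x ∷ y ∷ post) ≈ ε * A (pre ++ y ∷ x ∷ post)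
    swap pre x y post = +-unique-ε (begin
      xy + yx                          ≈⟨ +-cong (sym (+-identityˡ xy)) (sym (+-identityʳ yx)) ⟩
      (0# + xy) + (yx + 0#)            ≈⟨ +-cong (+-congʳ (alternating pre x post)) (+-congˡ (alternating pre y post)) ⟨
      (A (pre ++ x ∷ x ∷ post) + xy) + (yx + A (pre ++ y ∷ y ∷ post)) ≈⟨ +-cong (add′ x) (add′ y) ⟨
      A (pre ++ x ∷ s ∷ post) + A (pre ++ y ∷ s ∷ post) ≈⟨ add pre x y (s ∷ post) ⟨
      A (pre ++ s ∷ s ∷ post)          ≈⟨ alternating pre s post ⟩
      0#                               ∎)
      where
      s : Row
      s c = x c + y c
      xy yx : Carrier
      xy = A (pre ++ x ∷ y ∷ post)
      yx = A (pre ++ y ∷ x ∷ post)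
      add′ : ∀ z → A (pre ++ z ∷ s ∷ post) ≈ A (pre ++ z ∷ x ∷ post) + A (pre ++ z ∷ y ∷ post)
      add′ z = trans (sym (at-++ pre (z ∷ []) _))
        (trans (add (pre ++ z ∷ []) x y post) (+-cong (at-++ pre (z ∷ []) _) (at-++ pre (z ∷ []) _)))

    move : ∀ pre mid x post → A (pre ++ mid ++ x ∷ post) ≈ sg (length mid) * A (pre ++ x ∷ mid ++ post)
    move pre []        x post = sym (*-identityˡ _)
    move pre (y ∷ mid) x post = begin
      A (pre ++ y ∷ mid ++ x ∷ post)                     ≈⟨ at-++ pre (y ∷ []) _ ⟨
      A ((pre ++ y ∷ []) ++ mid ++ x ∷ post)             ≈⟨ move (pre ++ y ∷ []) mid x post ⟩
      sg (length mid) * A ((pre ++ y ∷ []) ++ x ∷ mid ++ post) ≈⟨ *-congˡ (at-++ pre (y ∷ []) _) ⟩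
      sg (length mid) * A (pre ++ y ∷ x ∷ mid ++ post)   ≈⟨ *-congˡ (swap pre y x _) ⟩
      sg (length mid) * (ε * A (pre ++ x ∷ y ∷ mid ++ post)) ≈⟨ solve 3 (λ s e z → s :* (e :* z) := (e :* s) :* z) refl _ _ _ ⟩
      ε * sg (length mid) * A (pre ++ x ∷ y ∷ mid ++ post) ∎

    alternating-far : ∀ pre x mid post → A (pre ++ x ∷ mid ++ x ∷ post) ≈ 0#
    alternating-far pre x mid post = begin
      A (pre ++ x ∷ mid ++ x ∷ post)              ≈⟨ at-++ pre (x ∷ []) _ ⟨
      A ((pre ++ x ∷ []) ++ mid ++ x ∷ post)      ≈⟨ move (pre ++ x ∷ []) mid x post ⟩
      sg (length mid) * A ((pre ++ x ∷ []) ++ x ∷ mid ++ post) ≈⟨ *-congˡ (trans (at-++ pre (x ∷ []) _) (alternating pre x _)) ⟩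
      sg (length mid) * 0#                        ≈⟨ zeroʳ _ ⟩
      0#                                          ∎

    add-multiple : ∀ pre x mid a y post → A (pre ++ x ∷ mid ++ (λ c → a * x c + y c) ∷ post) ≈ A (pre ++ x ∷ mid ++ y ∷ post)
    add-multiple pre x mid a y post = begin
      A (pre ++ (x ∷ mid) ++ z ∷ post)             ≈⟨ at-++ pre (x ∷ mid) _ ⟨
      A ((pre ++ x ∷ mid) ++ z ∷ post)             ≈⟨ add (pre ++ x ∷ mid) _ y post ⟩
      A ((pre ++ x ∷ mid) ++ (λ c → a * x c) ∷ post) + A ((pre ++ x ∷ mid) ++ y ∷ post) ≈⟨ +-congʳ (scale (pre ++ x ∷ mid) a x post) ⟩
      a * A ((pre ++ x ∷ mid) ++ x ∷ post) + A ((pre ++ x ∷ mid) ++ y ∷ post)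
        ≈⟨ +-cong (*-congˡ (trans (at-++ pre (x ∷ mid) _) (alternating-far pre x mid post))) (at-++ pre (x ∷ mid) _) ⟩
      a * 0# + A (pre ++ x ∷ mid ++ y ∷ post)      ≈⟨ trans (+-congʳ (zeroʳ a)) (+-identityˡ _) ⟩
      A (pre ++ x ∷ mid ++ y ∷ post)               ∎
      where
      z : Row
      z c = a * x c + y c

  kr : Matrix
  kr zero    zero    = 1#
  kr zero    (suc j) = 0#
  kr (suc i) zero    = 0#
  kr (suc i) (suc j) = kr i j

  kr-diag : ∀ i → kr i i ≡ 1#
  kr-diag zero    = ≡.refl
  kr-diag (suc i) = kr-diag i

  kr-off : ∀ {i j} → i ≢ j → kr i j ≡ 0#
  kr-off {zero}  {zero}  p = ⊥-elim (p ≡.refl)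
  kr-off {zero}  {suc j} p = ≡.refl
  kr-off {suc i} {zero}  p = ≡.refl
  kr-off {suc i} {suc j} p = kr-off (p ∘ ≡.cong suc)

  Σ<-kr : ∀ n j (f : Row) → j < n → Σ< n (λ k → f k * kr k j) ≈ f j
  Σ<-kr n j f j<n = trans (Σ<-single n j j<n (λ i _ i≢j → trans (*-congˡ (≡⇒≈ (kr-off i≢j))) (zeroʳ _)))
    (trans (*-congˡ (≡⇒≈ (kr-diag j))) (*-identityʳ _))

  basis : ℕ → List Row
  basis = applyUpTo kr

  -- Inserts a zero column at j. This is a section of the deletion by `skip`; adding the missing
  -- multiple of the basis vector j restores the row.
  insert : ℕ → Row → Row
  insert zero    x zero    = 0#
  insert zero    x (suc c) = x c
  insert (suc j) x zero    = x zero
  insert (suc j) x (suc c) = insert j (x ∘ suc) c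

  insert-skip : ∀ j (x : Row) c → insert j (x ∘ skip j) c + x j * kr j c ≈ x c
  insert-skip zero    x zero    = trans (+-identityˡ _) (*-identityʳ _)
  insert-skip zero    x (suc c) = trans (+-congˡ (zeroʳ _)) (+-identityʳ _)
  insert-skip (suc j) x zero    = trans (+-congˡ (zeroʳ _)) (+-identityʳ _)
  insert-skip (suc j) x (suc c) = insert-skip j (x ∘ suc) c

  insert-cong : ∀ {j n} {x y : Row} → j ≤ n → x ≋[ n ] y → insert j x ≋[ suc n ] insert j y
  insert-cong z≤n     p zero    _       = refl
  insert-cong z≤n     p (suc c) (s≤s q) = p c q
  insert-cong (s≤s r) p zero    _       = p zero (s≤s z≤n)
  insert-cong (s≤s r) p (suc c) (s≤s q) = insert-cong r (λ c c<n → p (suc c) (s≤s c<n)) c q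

  insert-cong-≋ : ∀ j {x y : Row} → x ≋ y → insert j x ≋ insert j y
  insert-cong-≋ zero    p zero    = refl
  insert-cong-≋ zero    p (suc c) = p c
  insert-cong-≋ (suc j) p zero    = p zero
  insert-cong-≋ (suc j) p (suc c) = insert-cong-≋ j (p ∘ suc) c

  insert-linear : ∀ j a b (x y : Row) → insert j (λ c → a * x c + b * y c) ≋ (λ c → a * insert j x c + b * insert j y c)
  insert-linear zero    a b x y zero    = sym (trans (+-cong (zeroʳ a) (zeroʳ b)) (+-identityˡ 0#))
  insert-linear zero    a b x y (suc c) = refl
  insert-linear (suc j) a b x y zero    = refl
  insert-linear (suc j) a b x y (suc c) = insert-linear j a b (x ∘ suc) (y ∘ suc) c

  insert-kr : ∀ j i → insert j (kr i) ≋ kr (skip j i)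
  insert-kr zero    i       zero    = refl
  insert-kr zero    i       (suc c) = refl
  insert-kr (suc j) zero    zero    = refl
  insert-kr (suc j) (suc i) zero    = refl
  insert-kr (suc j) zero    (suc c) = insert-0 j c
    where
    insert-0 : ∀ j c → insert j (λ _ → 0#) c ≈ 0#
    insert-0 zero    zero    = refl
    insert-0 zero    (suc c) = refl
    insert-0 (suc j) zero    = refl
    insert-0 (suc j) (suc c) = insert-0 j c
  insert-kr (suc j) (suc i) (suc c) = insert-kr j i c

  applyUpTo-skip : ∀ {a} {B : Set a} (f : ℕ → B) {j n} → j ≤ n →
    ∃ λ p → ∃ λ q → applyUpTo (f ∘ skip j) n ≡ p ++ q × applyUpTo f (suc n) ≡ p ++ f j ∷ q × length p ≡ j
  applyUpTo-skip f z≤n = [] , _ , ≡.refl , ≡.refl , ≡.refl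
  applyUpTo-skip f (s≤s j≤n) with applyUpTo-skip (f ∘ suc) j≤n
  ... | p , q , e₁ , e₂ , e₃ = f 0 ∷ p , q , ≡.cong (f 0 ∷_) e₁ , ≡.cong (f 0 ∷_) e₂ , ≡.cong suc e₃

  -- With the basis vector j as first row and zeros in column j below it, a functional on n + 1 rows
  -- becomes one on n rows. This carries the induction in `alternating-unique`.
  minorFunctional : (List Row → Carrier) → ℕ → List Row → Carrier
  minorFunctional A j xs = A (kr j ∷ L.map (insert j) xs)

  minorFunctional-alternating : ∀ {n A j} → j ≤ n → Alternating (suc n) A → Alternating n (minorFunctional A j)
  minorFunctional-alternating {n} {A} {j} j≤n isAlt = record
    { cong<  = λ {xs} e ps → Alt.cong< (≡.cong suc (≡.trans (Lₚ.length-map (insert j) xs) e))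
                 ((λ _ _ → refl) ∷ PW.map⁺ _ _ (PW.map (insert-cong j≤n) ps))
    ; cong   = λ ps → Alt.cong ((λ _ → refl) ∷ PW.map⁺ _ _ (PW.map (insert-cong-≋ j) ps))
    ; linear = λ pre a x b y post → begin
        A (kr j ∷ L.map (insert j) (pre ++ (λ c → a * x c + b * y c) ∷ post))
          ≈⟨ map-at pre _ post ⟩
        A (kr j ∷ L.map (insert j) pre ++ insert j (λ c → a * x c + b * y c) ∷ L.map (insert j) post)
          ≈⟨ Alt.cong (≋-at (kr j ∷ L.map (insert j) pre) _ (insert-linear j a b x y)) ⟩
        A (kr j ∷ L.map (insert j) pre ++ (λ c → a * insert j x c + b * insert j y c) ∷ L.map (insert j) post)
          ≈⟨ Alt.linear (kr j ∷ L.map (insert j) pre) a _ b _ _ ⟩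
        a * A (kr j ∷ L.map (insert j) pre ++ insert j x ∷ L.map (insert j) post)
          + b * A (kr j ∷ L.map (insert j) pre ++ insert j y ∷ L.map (insert j) post)
          ≈⟨ +-cong (*-congˡ (map-at pre x post)) (*-congˡ (map-at pre y post)) ⟨
        a * minorFunctional A j (pre ++ x ∷ post) + b * minorFunctional A j (pre ++ y ∷ post) ∎
    ; alternating = λ pre x post → trans (map-at pre x (x ∷ post)) (Alt.alternating (kr j ∷ L.map (insert j) pre) _ _)
    }
    where
    module Alt = Alternating isAlt
    map-at : ∀ pre x post → A (kr j ∷ L.map (insert j) (pre ++ x ∷ post)) ≈ A (kr j ∷ L.map (insert j) pre ++ insert j x ∷ L.map (insert j) post)
    map-at pre x post = ≡⇒≈ (≡.cong (λ ys → A (kr j ∷ ys)) (Lₚ.map-++ (insert j) pre (x ∷ post)))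

  -- Multiples of the first row clear column j in every later row; `pre` collects the rows already
  -- cleared.
  clear-column : ∀ {n A} → Alternating n A → ∀ j pre xs →
    A (kr j ∷ pre ++ xs) ≈ A (kr j ∷ pre ++ L.map (λ x → insert j (x ∘ skip j)) xs)
  clear-column isAlt j pre []       = refl
  clear-column {A = A} isAlt j pre (x ∷ xs) = begin
    A (kr j ∷ pre ++ x ∷ xs)
      ≈⟨ cong (≋-at (kr j ∷ pre) xs (λ c → trans (sym (insert-skip j x c)) (+-comm _ _))) ⟩
    A (kr j ∷ pre ++ (λ c → x j * kr j c + x′ c) ∷ xs) ≈⟨ add-multiple [] (kr j) pre (x j) x′ xs ⟩
    A (kr j ∷ pre ++ x′ ∷ xs)                          ≈⟨ at-++ (kr j ∷ pre) (x′ ∷ []) xs ⟨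
    A (kr j ∷ (pre ++ x′ ∷ []) ++ xs)                  ≈⟨ clear-column isAlt j (pre ++ x′ ∷ []) xs ⟩
    A (kr j ∷ (pre ++ x′ ∷ []) ++ L.map _ xs)          ≈⟨ at-++ (kr j ∷ pre) (x′ ∷ []) _ ⟩
    A (kr j ∷ pre ++ x′ ∷ L.map _ xs)                  ∎
    where
    open Alternating isAlt
    open AlternatingProperties isAlt
    x′ : Row
    x′ = insert j (x ∘ skip j)

  -- Induction on n. Expanding the first row in basis vectors and clearing column k leaves the minor
  -- functional of k. Its value at the basis is a permuted basis of size n + 1, and moving the
  -- vector k into place costs (-1)^k, the sign in the Laplace expansion. Transposition and
  -- multiplicativity are instances.
  alternating-unique : ∀ n {A} → Alternating n A → ∀ xs → length xs ≡ n → A xs ≈ detL xs * A (basis n)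
  alternating-unique zero    isAlt []       _ = sym (*-identityˡ _)
  alternating-unique (suc n) {A} isAlt (x ∷ xs) e = begin
    A (x ∷ xs)
      ≈⟨ cong< e ((λ c c<n → sym (Σ<-kr (suc n) c x c<n)) ∷ PW.refl (λ _ _ → refl)) ⟩
    A ((λ c → Σ< (suc n) (λ k → x k * kr k c)) ∷ xs)      ≈⟨ linear-Σ [] (suc n) x kr xs ⟩
    Σ< (suc n) (λ k → x k * A (kr k ∷ xs))                ≈⟨ Σ<-cong< (suc n) term ⟩
    Σ< (suc n) (λ k → sg k * x k * Det n (λ i c → nth xs i (skip k c)) * A (basis (suc n))) ≈⟨ Σ<-*ʳ (suc n) _ _ ⟩
    Σ< (suc n) (λ k → sg k * x k * Det n (λ i c → nth xs i (skip k c))) * A (basis (suc n))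
      ≡⟨ ≡.cong (λ m → Σ< (suc m) (λ k → sg k * x k * Det m (λ i c → nth xs i (skip k c))) * A (basis (suc n))) (≡.sym e′) ⟩
    detL (x ∷ xs) * A (basis (suc n))                     ∎
    where
    open Alternating isAlt
    open AlternatingProperties isAlt
    e′ : length xs ≡ n
    e′ = ℕₚ.suc-injective e
    corner : ∀ k → k ≤ n → A (kr k ∷ L.map (insert k) (basis n)) ≈ sg k * A (basis (suc n))
    corner k k≤n with applyUpTo-skip kr k≤n
    ... | p , q , e₁ , e₂ , e₃ = begin
      A (kr k ∷ L.map (insert k) (basis n))  ≈⟨ cong ((λ _ → refl) ∷ inserted n (λ i → i)) ⟩
      A (kr k ∷ applyUpTo (kr ∘ skip k) n)   ≡⟨ ≡.cong (λ ys → A (kr k ∷ ys)) e₁ ⟩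
      A (kr k ∷ p ++ q)                      ≈⟨ sg-cancel k _ ⟨
      sg k * (sg k * A (kr k ∷ p ++ q))      ≡⟨ ≡.cong (λ m → sg k * (sg m * A (kr k ∷ p ++ q))) (≡.sym e₃) ⟩
      sg k * (sg (length p) * A (kr k ∷ p ++ q)) ≈⟨ *-congˡ (move [] p (kr k) q) ⟨
      sg k * A (p ++ kr k ∷ q)               ≡⟨ ≡.cong (λ ys → sg k * A ys) (≡.sym e₂) ⟩
      sg k * A (basis (suc n))               ∎
      where
      inserted : ∀ m (g : ℕ → ℕ) → Pointwise _≋_ (L.map (insert k) (applyUpTo (kr ∘ g) m)) (applyUpTo (kr ∘ skip k ∘ g) m)
      inserted zero    g = []
      inserted (suc m) g = insert-kr k (g 0) ∷ inserted m (g ∘ suc)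
    minors : ∀ k → Det n (nth (L.map (_∘ skip k) xs)) ≈ Det n (λ i c → nth xs i (skip k c))
    minors k = Det-cong n (λ i c i<n _ → ≡⇒≈ (≡.cong (λ r → r c) (nth-map (_∘ skip k) xs i (≡.subst (i <_) (≡.sym e′) i<n))))
    length-minor : ∀ k → length (L.map (_∘ skip k) xs) ≡ n
    length-minor k = ≡.trans (Lₚ.length-map _ xs) e′
    term : ∀ k → k < suc n → x k * A (kr k ∷ xs) ≈ sg k * x k * Det n (λ i c → nth xs i (skip k c)) * A (basis (suc n))
    term k k<n = begin
      x k * A (kr k ∷ xs)                                              ≈⟨ *-congˡ (clear-column isAlt k [] xs) ⟩
      x k * A (kr k ∷ L.map (λ y → insert k (y ∘ skip k)) xs)
        ≡⟨ ≡.cong (λ ys → x k * A (kr k ∷ ys)) (Lₚ.map-∘ xs) ⟩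
      x k * minorFunctional A k (L.map (_∘ skip k) xs)
        ≈⟨ *-congˡ (alternating-unique n (minorFunctional-alternating (ℕ.≤-pred k<n) isAlt) (L.map (_∘ skip k) xs) (length-minor k)) ⟩
      x k * (detL (L.map (_∘ skip k) xs) * A (kr k ∷ L.map (insert k) (basis n)))
        ≈⟨ *-congˡ (*-cong (trans (≡⇒≈ (≡.cong (λ m → Det m (nth (L.map (_∘ skip k) xs))) (length-minor k))) (minors k)) (corner k (ℕ.≤-pred k<n))) ⟩
      x k * (Det n (λ i c → nth xs i (skip k c)) * (sg k * A (basis (suc n))))
        ≈⟨ solve 4 (λ x d s a → x :* (d :* (s :* a)) := s :* x :* d :* a) refl _ _ _ _ ⟩
      sg k * x k * Det n (λ i c → nth xs i (skip k c)) * A (basis (suc n)) ∎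

  detLᵀ : List Row → Carrier
  detLᵀ xs = Det (length xs) (λ i j → nth xs j i)

  length-at : ∀ (pre : List Row) x y post → length (pre ++ x ∷ post) ≡ length (pre ++ y ∷ post)
  length-at []        x y post = ≡.refl
  length-at (_ ∷ pre) x y post = ≡.cong suc (length-at pre x y post)

  length-here : ∀ (pre : List Row) x post → length pre < length (pre ++ x ∷ post)
  length-here []        x post = s≤s z≤n
  length-here (_ ∷ pre) x post = s≤s (length-here pre x post)

  detLᵀ-alternating : ∀ n → Alternating n detLᵀ
  detLᵀ-alternating n = record
    { cong<  = λ {xs} {ys} e ps → begin
        Det (length xs) (λ i j → nth xs j i)
          ≈⟨ Det-cong (length xs) (λ i j i<n j<n → nth-Pointwise ps j j<n i (≡.subst (i <_) e i<n)) ⟩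
        Det (length xs) (λ i j → nth ys j i)
          ≡⟨ ≡.cong (λ m → Det m (λ i j → nth ys j i)) (PW.Pointwise-length ps) ⟩
        detLᵀ ys ∎
    ; cong   = λ {xs} {ys} ps → begin
        Det (length xs) (λ i j → nth xs j i)
          ≈⟨ Det-cong (length xs) (λ i j i<n j<n → nth-Pointwise ps j j<n i) ⟩
        Det (length xs) (λ i j → nth ys j i)
          ≡⟨ ≡.cong (λ m → Det m (λ i j → nth ys j i)) (PW.Pointwise-length ps) ⟩
        detLᵀ ys ∎
    ; linear = λ pre a x b y post → let z = λ c → a * x c + b * y c in begin
        Det (length (pre ++ z ∷ post)) (λ i j → nth (pre ++ z ∷ post) j i)
          ≈⟨ Det-column-linear (length (pre ++ z ∷ post)) (length pre) a b (length-here pre z post)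
               (λ i → trans (col pre z post i) (+-cong (*-congˡ (sym (col pre x post i))) (*-congˡ (sym (col pre y post i)))))
               (λ i c c≢ → ≡⇒≈ (≡.cong (λ r → r i) (nth-there pre z x post c c≢)))
               (λ i c c≢ → ≡⇒≈ (≡.cong (λ r → r i) (nth-there pre z y post c c≢))) ⟩
        _ ≡⟨ ≡.cong₂ (λ m m′ → a * Det m (λ i j → nth (pre ++ x ∷ post) j i) + b * Det m′ (λ i j → nth (pre ++ y ∷ post) j i))
               (length-at pre z x post) (length-at pre z y post) ⟩
        a * detLᵀ (pre ++ x ∷ post) + b * detLᵀ (pre ++ y ∷ post) ∎
    ; alternating = λ pre x post →
        Det-column-alternating (length (pre ++ x ∷ x ∷ post)) (length pre) (length-here₂ pre x post)
          (λ i → trans (col pre x (x ∷ post) i) (sym (col₂ pre x post i)))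
    }
    where
    col : ∀ pre x post i → nth (pre ++ x ∷ post) (length pre) i ≈ x i
    col pre x post i = ≡⇒≈ (≡.cong (λ r → r i) (nth-here pre x post))
    col₂ : ∀ pre x post i → nth (pre ++ x ∷ x ∷ post) (suc (length pre)) i ≈ x i
    col₂ []        x post i = refl
    col₂ (_ ∷ pre) x post i = col₂ pre x post i
    length-here₂ : ∀ (pre : List Row) x post → suc (length pre) < length (pre ++ x ∷ x ∷ post)
    length-here₂ []        x post = s≤s (s≤s z≤n)
    length-here₂ (_ ∷ pre) x post = s≤s (length-here₂ pre x post)

  Det-lowerUnitriangular : ∀ n {f : Matrix} → (∀ i → i < n → f i i ≈ 1#) → (∀ i j → i < j → j < n → f i j ≈ 0#) → Det n f ≈ 1#
  Det-lowerUnitriangular zero    d o = refl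
  Det-lowerUnitriangular (suc n) {f} d o = begin
    Det (suc n) f
      ≈⟨ Σ<-single (suc n) 0 (s≤s z≤n) (λ j j<n j≢0 →
           trans (*-congʳ (trans (*-congˡ (o 0 j (ℕₚ.n≢0⇒n>0 j≢0) j<n)) (zeroʳ _))) (zeroˡ _)) ⟩
    1# * f 0 0 * Det n (λ i c → f (suc i) (suc c))
      ≈⟨ *-cong (trans (*-identityˡ _) (d 0 (s≤s z≤n)))
           (Det-lowerUnitriangular n (λ i i<n → d (suc i) (s≤s i<n)) (λ i j i<j j<n → o (suc i) (suc j) (s≤s i<j) (s≤s j<n))) ⟩
    1# * 1#  ≈⟨ *-identityˡ _ ⟩
    1#       ∎

  -- By the column laws, `detLᵀ` is an alternating functional; its value at the basis is one.
  Det-transpose : ∀ n (f : Matrix) → Det n (λ i j → f j i) ≈ Det n f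
  Det-transpose n f = begin
    Det n (λ i j → f j i)
      ≈⟨ Det-cong n (λ i j _ j<n → ≡⇒≈ (≡.cong (λ r → r i) (≡.sym (nth-applyUpTo f n j j<n)))) ⟩
    Det n (λ i j → nth (applyUpTo f n) j i)
      ≡⟨ ≡.cong (λ m → Det m (λ i j → nth (applyUpTo f n) j i)) (≡.sym (Lₚ.length-applyUpTo f n)) ⟩
    detLᵀ (applyUpTo f n)
      ≈⟨ alternating-unique n (detLᵀ-alternating n) (applyUpTo f n) (Lₚ.length-applyUpTo f n) ⟩
    detL (applyUpTo f n) * detLᵀ (basis n)  ≈⟨ *-cong (detL-applyUpTo n f) unit ⟩
    Det n f * 1#                            ≈⟨ *-identityʳ _ ⟩
    Det n f                                 ∎
    where
    unit : detLᵀ (basis n) ≈ 1#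
    unit = begin
      Det (length (basis n)) (λ i j → nth (basis n) j i)
        ≡⟨ ≡.cong (λ m → Det m (λ i j → nth (basis n) j i)) (Lₚ.length-applyUpTo kr n) ⟩
      Det n (λ i j → nth (basis n) j i)
        ≈⟨ Det-cong n (λ i j _ j<n → ≡⇒≈ (≡.cong (λ r → r i) (nth-applyUpTo kr n j j<n))) ⟩
      Det n (λ i j → kr j i)
        ≈⟨ Det-lowerUnitriangular n (λ i _ → ≡⇒≈ (kr-diag i)) (λ i j i<j _ → ≡⇒≈ (kr-off (λ e → ℕₚ.<⇒≢ i<j (≡.sym e)))) ⟩
      1# ∎

  -- The row laws are the column laws carried over by transposition.
  detL-alternating : ∀ n → Alternating n detL
  detL-alternating n = record
    { cong<  = λ {xs} {ys} e ps → trans (sym (tr xs)) (trans (T.cong< e ps) (tr ys))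
    ; cong   = λ {xs} {ys} ps → trans (sym (tr xs)) (trans (T.cong ps) (tr ys))
    ; linear = λ pre a x b y post → trans (sym (tr (pre ++ (λ c → a * x c + b * y c) ∷ post)))
        (trans (T.linear pre a x b y post) (+-cong (*-congˡ (tr (pre ++ x ∷ post))) (*-congˡ (tr (pre ++ y ∷ post)))))
    ; alternating = λ pre x post → trans (sym (tr (pre ++ x ∷ x ∷ post))) (T.alternating pre x post)
    }
    where
    module T = Alternating (detLᵀ-alternating n)
    tr : ∀ xs → detLᵀ xs ≈ detL xs
    tr xs = Det-transpose (length xs) (nth xs)

  Det-upperUnitriangular : ∀ n {f : Matrix} → (∀ i → i < n → f i i ≈ 1#) → (∀ i j → j < i → i < n → f i j ≈ 0#) → Det n f ≈ 1#
  Det-upperUnitriangular n {f} d o = trans (sym (Det-transpose n f)) (Det-lowerUnitriangular n d (λ i j → o j i))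

  infixl 7 _·[_]_
  _·[_]_ : Row → ℕ → Matrix → Row
  (x ·[ n ] g) c = Σ< n (λ k → x k * g k c)

  map-alternating : ∀ n (φ : Row → Row) → (∀ {x y} → x ≋[ n ] y → φ x ≋[ n ] φ y) → (∀ {x y} → x ≋ y → φ x ≋ φ y) →
    (∀ a x b y → φ (λ c → a * x c + b * y c) ≋ (λ c → a * φ x c + b * φ y c)) →
    Alternating n (detL ∘ L.map φ)
  map-alternating n φ φ-cong< φ-cong φ-linear = record
    { cong<  = λ {xs} e ps → D.cong< (≡.trans (Lₚ.length-map φ xs) e) (PW.map⁺ _ _ (PW.map φ-cong< ps))
    ; cong   = λ ps → D.cong (PW.map⁺ _ _ (PW.map φ-cong ps))
    ; linear = λ pre a x b y post → begin
        detL (L.map φ (pre ++ (λ c → a * x c + b * y c) ∷ post))  ≈⟨ map-at pre _ post ⟩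
        detL (L.map φ pre ++ φ (λ c → a * x c + b * y c) ∷ L.map φ post)
          ≈⟨ D.cong (≋-at (L.map φ pre) _ (φ-linear a x b y)) ⟩
        detL (L.map φ pre ++ (λ c → a * φ x c + b * φ y c) ∷ L.map φ post) ≈⟨ D.linear (L.map φ pre) a _ b _ _ ⟩
        _ ≈⟨ +-cong (*-congˡ (map-at pre x post)) (*-congˡ (map-at pre y post)) ⟨
        a * detL (L.map φ (pre ++ x ∷ post)) + b * detL (L.map φ (pre ++ y ∷ post)) ∎
    ; alternating = λ pre x post → trans (map-at pre x (x ∷ post)) (D.alternating (L.map φ pre) _ _)
    }
    where
    module D = Alternating (detL-alternating n)
    map-at : ∀ pre x post → detL (L.map φ (pre ++ x ∷ post)) ≈ detL (L.map φ pre ++ φ x ∷ L.map φ post)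
    map-at pre x post = ≡⇒≈ (≡.cong detL (Lₚ.map-++ φ pre (x ∷ post)))

  -- Multiplication by g from the right acts on every row separately, so it yields an alternating
  -- functional of f, whose value at the basis is the determinant of g.
  Det-* : ∀ n (f g : Matrix) → Det n (λ i → f i ·[ n ] g) ≈ Det n f * Det n g
  Det-* n f g = begin
    Det n (φ ∘ f)                       ≈⟨ detL-applyUpTo n (φ ∘ f) ⟨
    detL (applyUpTo (φ ∘ f) n)          ≡⟨ ≡.cong detL (Lₚ.map-applyUpTo f φ n) ⟨
    detL (L.map φ (applyUpTo f n))
      ≈⟨ alternating-unique n (map-alternating n φ
           (λ p c _ → Σ<-cong< n (λ k k<n → *-congʳ (p k k<n))) (λ p c → Σ<-cong n (λ k → *-congʳ (p k))) lin)
           (applyUpTo f n) (Lₚ.length-applyUpTo f n) ⟩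
    detL (applyUpTo f n) * detL (L.map φ (basis n)) ≡⟨ ≡.cong (λ ys → detL (applyUpTo f n) * detL ys) (Lₚ.map-applyUpTo kr φ n) ⟩
    detL (applyUpTo f n) * detL (applyUpTo (φ ∘ kr) n) ≈⟨ *-cong (detL-applyUpTo n f) (detL-applyUpTo n (φ ∘ kr)) ⟩
    Det n f * Det n (φ ∘ kr)            ≈⟨ *-congˡ (Det-cong n (λ i j i<n _ → kr-row i j i<n)) ⟩
    Det n f * Det n g                   ∎
    where
    φ : Row → Row
    φ x = x ·[ n ] g
    lin : ∀ a x b y → φ (λ c → a * x c + b * y c) ≋ (λ c → a * φ x c + b * φ y c)
    lin a x b y c = begin
      Σ< n (λ k → (a * x k + b * y k) * g k c)
        ≈⟨ Σ<-cong n (λ k → solve 5 (λ a x b y g → (a :* x :+ b :* y) :* g := a :* (x :* g) :+ b :* (y :* g)) refl _ _ _ _ _) ⟩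
      Σ< n (λ k → a * (x k * g k c) + b * (y k * g k c)) ≈⟨ Σ<-+ n _ _ ⟩
      _ ≈⟨ +-cong (Σ<-*ˡ n a _) (Σ<-*ˡ n b _) ⟩
      a * φ x c + b * φ y c ∎
    kr-row : ∀ i j → i < n → φ (kr i) j ≈ g i j
    kr-row i j i<n = trans (Σ<-single n i i<n (λ k _ k≢i → trans (*-congʳ (≡⇒≈ (kr-off (k≢i ∘ ≡.sym)))) (zeroˡ _)))
      (trans (*-congʳ (≡⇒≈ (kr-diag i))) (*-identityˡ _))

  Π< : ℕ → (ℕ → Carrier) → Carrier
  Π< zero    f = 1#
  Π< (suc n) f = f 0 * Π< n (f ∘ suc)

  Det-scaleRows : ∀ n (a : ℕ → Carrier) (f : Matrix) → Det n (λ i j → a i * f i j) ≈ Π< n a * Det n f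
  Det-scaleRows zero    a f = sym (*-identityˡ _)
  Det-scaleRows (suc n) a f = begin
    Σ< (suc n) (λ j → sg j * (a 0 * f 0 j) * Det n (λ i c → a (suc i) * f (suc i) (skip j c)))
      ≈⟨ Σ<-cong (suc n) (λ j → *-congˡ (Det-scaleRows n (a ∘ suc) (λ i c → f (suc i) (skip j c)))) ⟩
    Σ< (suc n) (λ j → sg j * (a 0 * f 0 j) * (Π< n (a ∘ suc) * Det n (λ i c → f (suc i) (skip j c))))
      ≈⟨ Σ<-cong (suc n) (λ j → solve 5 (λ s a f p d → s :* (a :* f) :* (p :* d) := (a :* p) :* (s :* f :* d)) refl _ _ _ _ _) ⟩
    Σ< (suc n) (λ j → (a 0 * Π< n (a ∘ suc)) * (sg j * f 0 j * Det n (λ i c → f (suc i) (skip j c)))) ≈⟨ Σ<-*ˡ (suc n) _ _ ⟩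
    Π< (suc n) a * Det (suc n) f ∎

  Det-scaleColumns : ∀ n (a : ℕ → Carrier) (f : Matrix) → Det n (λ i j → a j * f i j) ≈ Π< n a * Det n f
  Det-scaleColumns n a f = begin
    Det n (λ i j → a j * f i j)     ≈⟨ Det-transpose n (λ i j → a j * f i j) ⟨
    Det n (λ i j → a i * f j i)     ≈⟨ Det-scaleRows n a (λ i j → f j i) ⟩
    Π< n a * Det n (λ i j → f j i)  ≈⟨ *-congˡ (Det-transpose n f) ⟩
    Π< n a * Det n f                ∎

  Π<-inverse : ∀ n {a b} → (∀ i → a i * b i ≈ 1#) → Π< n a * Π< n b ≈ 1#
  Π<-inverse zero    p = *-identityˡ 1#
  Π<-inverse (suc n) p = trans (solve 4 (λ a x b y → (a :* x) :* (b :* y) := (a :* b) :* (x :* y)) refl _ _ _ _)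
    (trans (*-cong (p 0) (Π<-inverse n (p ∘ suc))) (*-identityˡ 1#))

  -- The row factors a i and the column factors b j have total product one. This disposes of the
  -- signs and of the powers of u and w in which the matrices of the theorem differ.
  Det-conjugate : ∀ n {a b} (f : Matrix) → (∀ i → a i * b i ≈ 1#) → Det n (λ i j → a i * (b j * f i j)) ≈ Det n f
  Det-conjugate n {a} {b} f p = begin
    Det n (λ i j → a i * (b j * f i j))  ≈⟨ Det-scaleRows n a (λ i j → b j * f i j) ⟩
    Π< n a * Det n (λ i j → b j * f i j) ≈⟨ *-congˡ (Det-scaleColumns n b f) ⟩
    Π< n a * (Π< n b * Det n f)          ≈⟨ *-assoc _ _ _ ⟨
    Π< n a * Π< n b * Det n f            ≈⟨ *-congʳ (Π<-inverse n p) ⟩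
    1# * Det n f                         ≈⟨ *-identityˡ _ ⟩
    Det n f                              ∎

  Π<-last : ∀ n f → Π< (suc n) f ≈ Π< n f * f n
  Π<-last zero    f = *-comm _ _
  Π<-last (suc n) f = trans (*-congˡ (Π<-last n (f ∘ suc))) (sym (*-assoc _ _ _))

  -- This is (-1)^(n(n-1)/2), the sign of reversing n columns. Below it occurs in pairs, which
  -- cancel by `reversalSign²`.
  reversalSign : ℕ → Carrier
  reversalSign n = Π< n sg

  reversalSign² : ∀ n → reversalSign n * reversalSign n ≈ 1#
  reversalSign² n = Π<-inverse n sg*sg≈1

  Det-antidiagonal : ∀ n → Det n (λ i j → kr i (n ∸ 1 ∸ j)) ≈ reversalSign n
  Det-antidiagonal zero    = refl
  Det-antidiagonal (suc n) = begin
    Det (suc n) (λ i j → kr i (n ∸ j))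
      ≈⟨ Σ<-single (suc n) n ℕₚ.≤-refl (λ j j<1+n j≢n → trans (*-congʳ (trans (*-congˡ
           (≡⇒≈ (kr-off (λ e → ℕₚ.<⇒≢ (ℕₚ.m<n⇒0<n∸m (ℕₚ.≤∧≢⇒< (ℕ.≤-pred j<1+n) j≢n)) e)))) (zeroʳ _))) (zeroˡ _)) ⟩
    sg n * kr 0 (n ∸ n) * Det n (λ i c → kr (suc i) (n ∸ skip n c))
      ≈⟨ *-cong (trans (*-congˡ (≡⇒≈ (≡.cong (kr 0) (ℕₚ.n∸n≡0 n)))) (*-identityʳ _))
           (Det-cong n (λ i c _ c<n → ≡⇒≈ (≡.cong (kr (suc i)) (last-column c<n)))) ⟩
    sg n * Det n (λ i c → kr i (n ∸ 1 ∸ c))  ≈⟨ *-congˡ (Det-antidiagonal n) ⟩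
    sg n * reversalSign n                    ≈⟨ *-comm _ _ ⟩
    reversalSign n * sg n                    ≈⟨ Π<-last n sg ⟨
    reversalSign (suc n)                     ∎
    where
    last-column : ∀ {n c} → c < n → n ∸ skip n c ≡ suc (n ∸ 1 ∸ c)
    last-column {suc n} {c} c<n = ≡.trans (≡.cong (suc n ∸_) (skip-below c<n)) (ℕₚ.+-∸-assoc 1 (ℕ.≤-pred c<n))

  Det-reverseColumns : ∀ n (f : Matrix) → Det n (λ i j → f i (n ∸ 1 ∸ j)) ≈ reversalSign n * Det n f
  Det-reverseColumns n f = begin
    Det n (λ i j → f i (n ∸ 1 ∸ j))
      ≈⟨ Det-cong n (λ i j _ j<n → sym (Σ<-kr n (n ∸ 1 ∸ j) (f i) (reflected j<n))) ⟩
    Det n (λ i → f i ·[ n ] (λ k j → kr k (n ∸ 1 ∸ j)))  ≈⟨ Det-* n f _ ⟩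
    Det n f * Det n (λ k j → kr k (n ∸ 1 ∸ j))           ≈⟨ *-congˡ (Det-antidiagonal n) ⟩
    Det n f * reversalSign n                             ≈⟨ *-comm _ _ ⟩
    reversalSign n * Det n f                             ∎
    where
    reflected : ∀ {n j} → j < n → n ∸ 1 ∸ j < n
    reflected {suc n} {j} _ = s≤s (ℕₚ.m∸n≤m n j)

  Det-reverse : ∀ n (f : Matrix) → Det n (λ i j → f (n ∸ 1 ∸ i) (n ∸ 1 ∸ j)) ≈ Det n f
  Det-reverse n f = begin
    Det n (λ i j → f (n ∸ 1 ∸ i) (n ∸ 1 ∸ j))       ≈⟨ Det-reverseColumns n (λ i j → f (n ∸ 1 ∸ i) j) ⟩
    ρ * Det n (λ i j → f (n ∸ 1 ∸ i) j)             ≈⟨ *-congˡ (Det-transpose n _) ⟨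
    ρ * Det n (λ i j → f (n ∸ 1 ∸ j) i)             ≈⟨ *-congˡ (Det-reverseColumns n (λ i j → f j i)) ⟩
    ρ * (ρ * Det n (λ i j → f j i))                 ≈⟨ *-assoc _ _ _ ⟨
    ρ * ρ * Det n (λ i j → f j i)                   ≈⟨ *-cong (reversalSign² n) (Det-transpose n f) ⟩
    1# * Det n f                                    ≈⟨ *-identityˡ _ ⟩
    Det n f                                         ∎
    where
    ρ : Carrier
    ρ = reversalSign n

  Det-dropUnitRow : ∀ n {f : Matrix} → f 0 ≋[ suc n ] kr 0 → Det (suc n) f ≈ Det n (λ i j → f (suc i) (suc j))
  Det-dropUnitRow n {f} p = begin
    Det (suc n) f
      ≈⟨ Σ<-single (suc n) 0 (s≤s z≤n) (λ j j<n j≢0 → trans (*-congʳ (trans (*-congˡ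
           (trans (p j j<n) (≡⇒≈ (kr-off (j≢0 ∘ ≡.sym))))) (zeroʳ _))) (zeroˡ _)) ⟩
    1# * f 0 0 * Det n (λ i j → f (suc i) (suc j))
      ≈⟨ trans (*-congʳ (trans (*-identityˡ _) (p 0 (s≤s z≤n)))) (*-identityˡ _) ⟩
    Det n (λ i j → f (suc i) (suc j)) ∎

  Det-dropUnitRows : ∀ k n {f : Matrix} → (∀ i → i < k → f i ≋[ k ℕ.+ n ] kr i) →
                     Det (k ℕ.+ n) f ≈ Det n (λ i j → f (k ℕ.+ i) (k ℕ.+ j))
  Det-dropUnitRows zero    n p = refl
  Det-dropUnitRows (suc k) n {f} p = trans (Det-dropUnitRow (k ℕ.+ n) {f} (p 0 (s≤s z≤n)))
    (Det-dropUnitRows k n {λ i j → f (suc i) (suc j)} (λ i i<k j j<n → p (suc i) (s≤s i<k) (suc j) (s≤s j<n)))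

  nth-++ˡ : ∀ (xs ys : List Row) i → i < length xs → nth (xs ++ ys) i ≡ nth xs i
  nth-++ˡ (x ∷ xs) ys zero    _       = ≡.refl
  nth-++ˡ (x ∷ xs) ys (suc i) (s≤s p) = nth-++ˡ xs ys i p

  nth-++ʳ : ∀ (xs ys : List Row) i → nth (xs ++ ys) (length xs ℕ.+ i) ≡ nth ys i
  nth-++ʳ []       ys i = ≡.refl
  nth-++ʳ (x ∷ xs) ys i = nth-++ʳ xs ys i

  module _ (k n : ℕ) (f g : Matrix) where

    -- Alternating functionals act on lists of rows while `Det` takes an index function; a block of
    -- k rows above n further rows has to be read both ways.
    block : List Row
    block = applyUpTo f k ++ applyUpTo g n

    length-block : length block ≡ k ℕ.+ n
    length-block = ≡.trans (Lₚ.length-++ (applyUpTo f k)) (≡.cong₂ ℕ._+_ (Lₚ.length-applyUpTo f k) (Lₚ.length-applyUpTo g n))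

    nth-block-upper : ∀ i → i < k → nth block i ≡ f i
    nth-block-upper i i<k = ≡.trans (nth-++ˡ (applyUpTo f k) _ i (≡.subst (i <_) (≡.sym (Lₚ.length-applyUpTo f k)) i<k)) (nth-applyUpTo f k i i<k)

    nth-block-lower : ∀ b → b < n → nth block (k ℕ.+ b) ≡ g b
    nth-block-lower b b<n = ≡.trans (≡.cong (λ m → nth block (m ℕ.+ b)) (≡.sym (Lₚ.length-applyUpTo f k)))
      (≡.trans (nth-++ʳ (applyUpTo f k) (applyUpTo g n) b) (nth-applyUpTo g n b b<n))

    detL-block : detL block ≈ Det (k ℕ.+ n) (nth block)
    detL-block = ≡⇒≈ (≡.cong (λ m → Det m (nth block)) length-block)

    Det-block-cong : ∀ {F : Matrix} → (∀ i j → i < k → j < k ℕ.+ n → f i j ≈ F i j) →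
      (∀ b j → b < n → j < k ℕ.+ n → g b j ≈ F (k ℕ.+ b) j) → detL block ≈ Det (k ℕ.+ n) F
    Det-block-cong {F} upper lower = trans detL-block (Det-cong (k ℕ.+ n) entry-cong)
      where
      entry-cong : ∀ i j → i < k ℕ.+ n → j < k ℕ.+ n → nth block i j ≈ F i j
      entry-cong i j i< j< with i ℕ.<? k
      ... | yes i<k = trans (≡⇒≈ (≡.cong (λ ρ → ρ j) (nth-block-upper i i<k))) (upper i j i<k j<)
      ... | no i≮k = ≡.subst (λ m → nth block m j ≈ F m j) k+b
          (trans (≡⇒≈ (≡.cong (λ ρ → ρ j) (nth-block-lower (i ∸ k) b<n))) (lower (i ∸ k) j b<n j<))
        where
        k+b : k ℕ.+ (i ∸ k) ≡ i
        k+b = ℕₚ.m+[n∸m]≡n (ℕₚ.≮⇒≥ i≮k)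
        b<n : i ∸ k < n
        b<n = ℕₚ.+-cancelˡ-< k _ _ (≡.subst (_< k ℕ.+ n) (≡.sym k+b) i<)

-- Row operations and interlacing sequences

module Interlacing {c ℓ} (R : CommutativeRing c ℓ) where

  open RingSums R
  open Determinant R

  -- The sum of x ^ (Σ β - Σ γ) * f γ over β₁ ≥ γ₁ > β₂ ≥ γ₂ > ... > βₘ ≥ γₘ ≥ 0.
  interlacingSum : Carrier → List ℕ → (List ℕ → Carrier) → Carrier
  interlacingSum x []            f = f []
  interlacingSum x (b ∷ [])      f = Σ< (suc b) (λ s → x ^ (b ∸ s) * f (s ∷ []))
  interlacingSum x (b ∷ b′ ∷ bs) f = Σ< (b ∸ b′) (λ s →
    x ^ (b ∸ suc (b′ ℕ.+ s)) * interlacingSum x (b′ ∷ bs) (λ γs → f (suc (b′ ℕ.+ s) ∷ γs)))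

  module _ (x : Carrier) (P Q : Matrix) (P-suc : ∀ b → P (suc b) ≋ (λ c → x * P b c + Q (suc b) c)) where

    -- Iterating the recursion only down to b′ leaves a multiple of P b′ as remainder. When b′
    -- belongs to the next row of a determinant, this remainder is what the row operation removes.
    unroll : ∀ b′ d → P (d ℕ.+ b′) ≋ (λ c → x ^ d * P b′ c + Σ< d (λ s → x ^ (d ∸ suc s) * Q (suc (b′ ℕ.+ s)) c))
    unroll b′ zero    c = sym (trans (+-cong (*-identityˡ _) (Σ<-0 _)) (+-identityʳ _))
    unroll b′ (suc d) c = begin
      P (suc (d ℕ.+ b′)) c                       ≈⟨ P-suc (d ℕ.+ b′) c ⟩
      x * P (d ℕ.+ b′) c + Q (suc (d ℕ.+ b′)) c  ≈⟨ +-cong (*-congˡ (unroll b′ d c)) (sym (*-identityˡ _)) ⟩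
      x * (x ^ d * P b′ c + Σ< d (λ s → x ^ (d ∸ suc s) * Q (suc (b′ ℕ.+ s)) c)) + 1# * Q (suc (d ℕ.+ b′)) c
        ≈⟨ solve 5 (λ x y p s q → x :* (y :* p :+ s) :+ q := x :* y :* p :+ (x :* s :+ q)) refl _ _ _ _ _ ⟩
      x ^ suc d * P b′ c + (x * Σ< d (λ s → x ^ (d ∸ suc s) * Q (suc (b′ ℕ.+ s)) c) + 1# * Q (suc (d ℕ.+ b′)) c)
        ≈⟨ +-congˡ (+-cong (trans (sym (Σ<-*ˡ d x _)) (Σ<-cong< d (λ s s<d → trans (sym (*-assoc _ _ _))
             (*-congʳ (≡⇒≈ (≡.cong (x ^_) (≡.sym (ℕₚ.+-∸-assoc 1 s<d))))))))
             (*-cong (≡⇒≈ (≡.cong (x ^_) (≡.sym (ℕₚ.n∸n≡0 d)))) (≡⇒≈ (≡.cong (λ m → Q (suc m) c) (ℕₚ.+-comm d b′))))) ⟩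
      x ^ suc d * P b′ c + (Σ< d (λ s → x ^ (suc d ∸ suc s) * Q (suc (b′ ℕ.+ s)) c) + x ^ (d ∸ d) * Q (suc (b′ ℕ.+ d)) c)
        ≈⟨ +-congˡ (Σ<-last d (λ s → x ^ (suc d ∸ suc s) * Q (suc (b′ ℕ.+ s)) c)) ⟨
      x ^ suc d * P b′ c + Σ< (suc d) (λ s → x ^ (suc d ∸ suc s) * Q (suc (b′ ℕ.+ s)) c) ∎

    unroll-between : ∀ {b′ b} → b′ ≤ b →
      P b ≋ (λ c → x ^ (b ∸ b′) * P b′ c + Σ< (b ∸ b′) (λ s → x ^ (b ∸ suc (b′ ℕ.+ s)) * Q (suc (b′ ℕ.+ s)) c))
    unroll-between {b′} {b} b′≤b c = begin
      P b c                ≡⟨ ≡.cong (λ m → P m c) (ℕₚ.m∸n+n≡m b′≤b) ⟨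
      P (b ∸ b′ ℕ.+ b′) c  ≈⟨ unroll b′ (b ∸ b′) c ⟩
      _ ≈⟨ +-congˡ (Σ<-cong (b ∸ b′) (λ s → *-congʳ (≡⇒≈ (≡.cong (x ^_) (expo s))))) ⟩
      _ ∎
      where
      expo : ∀ s → b ∸ b′ ∸ suc s ≡ b ∸ suc (b′ ℕ.+ s)
      expo s = ≡.trans (ℕₚ.∸-+-assoc b b′ (suc s)) (≡.cong (b ∸_) (ℕₚ.+-suc b′ s))

    module _ {n A} (isAlternating : Alternating n A) (P-0 : P 0 ≋[ n ] Q 0) where
      open Alternating isAlternating
      open AlternatingProperties isAlternating

      unroll-from-0 : ∀ b → P b ≋[ n ] (λ c → Σ< (suc b) (λ s → x ^ (b ∸ s) * Q s c))
      unroll-from-0 b c c<n = begin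
        P b c             ≡⟨ ≡.cong (λ m → P m c) (ℕₚ.+-identityʳ b) ⟨
        P (b ℕ.+ 0) c     ≈⟨ unroll 0 b c ⟩
        x ^ b * P 0 c + Σ< b (λ s → x ^ (b ∸ suc s) * Q (suc s) c) ≈⟨ +-congʳ (*-congˡ (P-0 c c<n)) ⟩
        x ^ b * Q 0 c + Σ< b (λ s → x ^ (b ∸ suc s) * Q (suc s) c) ≈⟨ Σ<-suc b _ ⟨
        Σ< (suc b) (λ s → x ^ (b ∸ s) * Q s c) ∎

      -- Subtracting from each row a multiple of the next one removes all non-interlacing terms.
      interlacing-expansion : ∀ pre βs post → Linked ℕ._≥_ βs → length (pre ++ L.map P βs ++ post) ≡ n →
        A (pre ++ L.map P βs ++ post) ≈ interlacingSum x βs (λ γs → A (pre ++ L.map Q γs ++ post))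
      interlacing-expansion pre []            post _          _ = refl
      interlacing-expansion pre (b ∷ [])      post _          e =
        trans (cong< e (PW.++⁺ (PW.refl (λ _ _ → refl)) (unroll-from-0 b ∷ PW.refl (λ _ _ → refl))))
              (linear-Σ pre (suc b) (λ s → x ^ (b ∸ s)) Q post)
      interlacing-expansion pre (b ∷ b′ ∷ bs) post (b≥b′ ∷ l) e = begin
        A (pre ++ P b ∷ rest)
          ≈⟨ cong (≋-at pre rest (unroll-between b≥b′)) ⟩
        A (pre ++ (λ c → x ^ (b ∸ b′) * P b′ c + S c) ∷ rest)
          ≈⟨ add pre _ S rest ⟩
        A (pre ++ (λ c → x ^ (b ∸ b′) * P b′ c) ∷ rest) + A (pre ++ S ∷ rest)
          ≈⟨ +-congʳ (trans (scale pre _ (P b′) rest) (trans (*-congˡ (alternating pre (P b′) _)) (zeroʳ _))) ⟩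
        0# + A (pre ++ S ∷ rest)
          ≈⟨ trans (+-identityˡ _) (linear-Σ pre (b ∸ b′) (λ s → x ^ (b ∸ suc (b′ ℕ.+ s))) (λ s → Q (suc (b′ ℕ.+ s))) rest) ⟩
        Σ< (b ∸ b′) (λ s → x ^ (b ∸ suc (b′ ℕ.+ s)) * A (pre ++ Q (suc (b′ ℕ.+ s)) ∷ rest))
          ≈⟨ Σ<-cong (b ∸ b′) (λ s → *-congˡ (tail (Q (suc (b′ ℕ.+ s))))) ⟩
        Σ< (b ∸ b′) (λ s → x ^ (b ∸ suc (b′ ℕ.+ s)) * interlacingSum x (b′ ∷ bs) (λ γs → A ((pre ++ Q (suc (b′ ℕ.+ s)) ∷ []) ++ L.map Q γs ++ post)))
          ≈⟨ Σ<-cong (b ∸ b′) (λ s → *-congˡ (interlacingSum-cong (b′ ∷ bs) (λ γs → at-++ pre (Q (suc (b′ ℕ.+ s)) ∷ []) _))) ⟩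
        interlacingSum x (b ∷ b′ ∷ bs) (λ γs → A (pre ++ L.map Q γs ++ post)) ∎
        where
        rest : List Row
        rest = P b′ ∷ L.map P bs ++ post
        S : Row
        S c = Σ< (b ∸ b′) (λ s → x ^ (b ∸ suc (b′ ℕ.+ s)) * Q (suc (b′ ℕ.+ s)) c)
        interlacingSum-cong : ∀ βs {f g : List ℕ → Carrier} → (∀ γs → f γs ≈ g γs) → interlacingSum x βs f ≈ interlacingSum x βs g
        interlacingSum-cong []            p = p []
        interlacingSum-cong (b ∷ [])      p = Σ<-cong (suc b) (λ s → *-congˡ (p _))
        interlacingSum-cong (b ∷ b′ ∷ bs) p = Σ<-cong (b ∸ b′) (λ s → *-congˡ (interlacingSum-cong (b′ ∷ bs) (λ γs → p _)))
        tail : ∀ y → A (pre ++ y ∷ rest) ≈ interlacingSum x (b′ ∷ bs) (λ γs → A ((pre ++ y ∷ []) ++ L.map Q γs ++ post))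
        tail y = trans (sym (at-++ pre (y ∷ []) rest))
          (interlacing-expansion (pre ++ y ∷ []) (b′ ∷ bs) post l
            (≡.trans (≡.cong length (Lₚ.++-assoc pre (y ∷ []) rest)) (≡.trans (length-at pre y (P b) rest) e)))

-- Expansion of a determinant into a sum over arrays

module PathExpansion {c ℓ} (R : CommutativeRing c ℓ) where

  open Preliminaries
  open Shapes
  open Arrays
  open RingSums R
  open Determinant R
  open Interlacing R

  ΣL-prefixed : ∀ {A : Set} (xs : List A) (g : A → List (List A)) f →
                ΣL (prefixed xs g) f ≈ ΣL xs (λ x → ΣL (g x) (λ ys → f (x ∷ ys)))
  ΣL-prefixed xs g f = trans (ΣL-concatMap (λ x → L.map (x ∷_) (g x)) xs f)
    (ΣL-cong xs (λ x _ → ΣL-map (x ∷_) (g x) f))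

  ΣL-nextL-∷ : ∀ c cs f → ΣL (nextL (c ∷ cs)) f ≈
    Σ< (suc (c ∸ 1) ∸ at cs 0) (λ s → ΣL (nextL cs) (λ γs → f (at cs 0 ℕ.+ s ∷ γs)))
  ΣL-nextL-∷ c cs f = trans (ΣL-prefixed (range (at cs 0) (c ∸ 1)) (λ _ → nextL cs) f)
    (trans (ΣL-map (at cs 0 ℕ.+_) (upTo (suc (c ∸ 1) ∸ at cs 0)) _) (ΣL-upTo _ _))

  ΣL-nextL-zeros : ∀ cs x → Linked _⊒_ (0 ∷ cs) → ΣL (nextL cs) (λ _ → x) ≈ x
  ΣL-nextL-zeros []       x l           = +-identityʳ x
  ΣL-nextL-zeros (_ ∷ cs) x (z≤n ∷ l) = begin
    ΣL (nextL (0 ∷ cs)) (λ _ → x)  ≈⟨ ΣL-nextL-∷ 0 cs (λ _ → x) ⟩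
    Σ< (1 ∸ at cs 0) (λ s → ΣL (nextL cs) (λ _ → x)) ≡⟨ ≡.cong (λ m → Σ< (1 ∸ m) (λ s → ΣL (nextL cs) (λ _ → x))) (head-0 l) ⟩
    Σ< 1 (λ s → ΣL (nextL cs) (λ _ → x))   ≈⟨ Σ<-suc 0 _ ⟩
    ΣL (nextL cs) (λ _ → x) + Σ< 0 _       ≈⟨ trans (+-cong (ΣL-nextL-zeros cs x l) (Σ<-0 _)) (+-identityʳ x) ⟩
    x ∎
    where
    head-0 : ∀ {cs} → Linked _⊒_ (0 ∷ cs) → at cs 0 ≡ 0
    head-0 [-]       = ≡.refl
    head-0 (z≤n ∷ _) = ≡.refl

  -- With c = b + 1 the range c(i+1) ≤ γ ≤ c(i) - 1 is the interlacing range b(i+1) < γ ≤ b(i), and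
  -- for the last living path it is 0 ≤ γ ≤ b. The entries after the living paths are forced to be 0
  -- and leave a single choice.
  interlacingSum-nextL : ∀ cs (G : List ℕ → Carrier) → Linked _⊒_ cs →
    interlacingSum 1# (pos cs) G ≈ ΣL (nextL cs) (λ cs′ → G (L.take (length (pos cs)) cs′))
  interlacingSum-nextL []          G l = sym (+-identityʳ _)
  interlacingSum-nextL (zero ∷ cs) G l = sym (ΣL-nextL-zeros (0 ∷ cs) (G []) (z≤n ∷ l))
  interlacingSum-nextL (suc b ∷ []) G l = sym (trans (ΣL-nextL-∷ (suc b) [] _)
    (Σ<-cong (suc b) (λ s → trans (+-identityʳ _) (sym (1^n*x≈x (b ∸ s) _)))))
  interlacingSum-nextL (suc b ∷ zero ∷ cs) G l = sym (trans (ΣL-nextL-∷ (suc b) (0 ∷ cs) _)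
    (Σ<-cong (suc b) (λ s → trans (ΣL-nextL-zeros (0 ∷ cs) (G (s ∷ [])) (z≤n ∷ Linked.tail l)) (sym (1^n*x≈x (b ∸ s) _)))))
  interlacingSum-nextL (suc b ∷ suc b′ ∷ cs) G l = sym (trans (ΣL-nextL-∷ (suc b) (suc b′ ∷ cs) _)
    (Σ<-cong (b ∸ b′) (λ s → sym (trans (1^n*x≈x (b ∸ suc (b′ ℕ.+ s)) _)
      (interlacingSum-nextL (suc b′ ∷ cs) (λ γs → G (suc (b′ ℕ.+ s) ∷ γs)) (Linked.tail l))))))

  module _ (X : Matrix) where

    -- Y t b is the sum of binomial (b , a) * X (t + a) over a.
    Y : ℕ → Matrix
    Y t zero    = X t
    Y t (suc b) = λ c → Y t b c + Y (suc t) b c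

    pos-decreasing : ∀ {cs} → Linked _⊒_ cs → Linked ℕ._≥_ (pos cs)
    pos-decreasing []                           = []
    pos-decreasing {zero ∷ []}   [-]            = []
    pos-decreasing {suc c ∷ []}  [-]            = [-]
    pos-decreasing {zero ∷ _}    (p ∷ l)        = []
    pos-decreasing {suc c ∷ zero ∷ _} (p ∷ l)   = [-]
    pos-decreasing {suc c ∷ suc d ∷ _} (p ∷ l)  = ℕₚ.<⇒≤ p ∷ pos-decreasing l

    private
      -- With x = 1 the recursion of `Y` has the shape required of P and Q: height b + 1 is passed
      -- on as height b at time t + 1, and height 0 ends the path and leaves the row `X t`.
      Q : ℕ → Matrix
      Q t zero    = X t
      Q t (suc b) = Y (suc t) b

      step : ∀ t cs as post → Linked _⊒_ cs →
        detL (L.map (Y t) (pos cs) ++ L.map X as ++ post) ≈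
        ΣL (nextL cs) (λ cs′ → detL (L.map (Y (suc t)) (pos cs′) ++ L.map X (if length (pos cs′) <ᵇ length (pos cs) then t ∷ as else as) ++ post))
      step t cs as post l = begin
        detL (L.map (Y t) (pos cs) ++ rest)
          ≈⟨ interlacing-expansion 1# (Y t) (Q t) (λ b c → +-congʳ (sym (*-identityˡ _)))
               (detL-alternating (length (L.map (Y t) (pos cs) ++ rest))) (λ _ _ → refl) [] (pos cs) rest (pos-decreasing l) ≡.refl ⟩
        interlacingSum 1# (pos cs) (λ γs → detL (L.map (Q t) γs ++ rest))
          ≈⟨ interlacingSum-nextL cs (λ γs → detL (L.map (Q t) γs ++ rest)) l ⟩
        ΣL (nextL cs) (λ cs′ → detL (L.map (Q t) (L.take (length (pos cs)) cs′) ++ rest))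
          ≈⟨ ΣL-cong (nextL cs) (λ cs′ cs′∈ → ≡⇒≈ (≡.cong detL (term cs′ (survives l (∈-nextL⁻ cs cs′∈))))) ⟩
        _ ∎
        where
        rest : List Row
        rest = L.map X as ++ post
        map-Q-suc : ∀ bs → L.map (Q t) (L.map suc bs) ≡ L.map (Y (suc t)) bs
        map-Q-suc bs = ≡.sym (Lₚ.map-∘ bs)
        term : ∀ cs′ → Survives cs cs′ → L.map (Q t) (L.take (length (pos cs)) cs′) ++ rest
          ≡ L.map (Y (suc t)) (pos cs′) ++ L.map X (if length (pos cs′) <ᵇ length (pos cs) then t ∷ as else as) ++ post
        term cs′ (all-survive e₁ e₂) rewrite e₂ | e₁ | <ᵇ-irrefl (length (pos cs)) = ≡.cong (_++ rest) (map-Q-suc (pos cs′))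
        term cs′ (last-dies e₁ e₂) rewrite e₂ | ≡.sym e₁ | <ᵇ-suc (length (pos cs′)) =
          ≡.trans (≡.cong (_++ rest) (≡.trans (Lₚ.map-++ (Q t) (L.map suc (pos cs′)) (0 ∷ [])) (≡.cong (_++ X t ∷ []) (map-Q-suc (pos cs′)))))
            (Lₚ.++-assoc (L.map (Y (suc t)) (pos cs′)) (X t ∷ []) rest)

    -- No sign arises: only the last path can end at time t, so its row `X t` already stands behind
    -- the living paths and in front of the rows recorded earlier. When the first entry is at most
    -- 0, no path is left and only recorded rows remain.
    path-expansion : ∀ m t cs as post → Linked _⊒_ cs → at cs 0 ≤ m →
      detL (L.map (Y t) (pos cs) ++ L.map X as ++ post) ≈ ΣL (chainsL m cs) (λ ch → detL (L.map X (arms t cs as ch) ++ post))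
    path-expansion zero    t cs as post l p rewrite pos-0 {cs} p = sym (+-identityʳ _)
    path-expansion (suc m) t cs as post l p = begin
      detL (L.map (Y t) (pos cs) ++ L.map X as ++ post)  ≈⟨ step t cs as post l ⟩
      ΣL (nextL cs) (λ cs′ → detL (L.map (Y (suc t)) (pos cs′) ++ L.map X (as′ cs′) ++ post))
        ≈⟨ ΣL-cong (nextL cs) (λ cs′ cs′∈ → let n = ∈-nextL⁻ cs cs′∈ in
             path-expansion m (suc t) cs′ (as′ cs′) post (Next-linked n) (ℕₚ.≤-trans (Next-head n) (ℕₚ.∸-monoˡ-≤ 1 p))) ⟩
      ΣL (nextL cs) (λ cs′ → ΣL (chainsL m cs′) (λ ch → detL (L.map X (arms (suc t) cs′ (as′ cs′) ch) ++ post)))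
        ≈⟨ ΣL-prefixed (nextL cs) (chainsL m) _ ⟨
      ΣL (chainsL (suc m) cs) (λ ch → detL (L.map X (arms t cs as ch) ++ post)) ∎
      where
      as′ : List ℕ → List ℕ
      as′ cs′ = if length (pos cs′) <ᵇ length (pos cs) then t ∷ as else as

    module _ (U : Matrix) (k : ℕ) (α β : ℕ → Carrier) where

      mixedRow : Matrix
      mixedRow b c = α b * U (k ℕ.+ b) c + sg (k ℕ.+ b) * β b * Y 0 b c

      coefficient : ∀ {n cs} → Sub n cs → Carrier
      coefficient none         = 1#
      coefficient (omit {n} s) = α n * coefficient s
      coefficient (take {n} s) = β n * coefficient s

      -- The sign (-1)^(k+b) of a row Y 0 b is the sign of moving it to the front.
      subset-expansion : ∀ n rest → detL (L.map U (upTo k) ++ applyUpTo mixedRow n ++ rest) ≈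
        ΣL (subsets n) (λ (cs , s) → coefficient s * detL (L.map (Y 0) (L.map pred cs) ++ L.map U (vac k s) ++ rest))
      subset-expansion zero    rest = sym (trans (+-identityʳ _) (*-identityˡ _))
      subset-expansion (suc n) rest = begin
        detL (L.map U (upTo k) ++ applyUpTo mixedRow (suc n) ++ rest)
          ≡⟨ ≡.cong (λ ys → detL (L.map U (upTo k) ++ ys))
               (≡.trans (≡.cong (_++ rest) (≡.sym (Lₚ.applyUpTo-∷ʳ mixedRow n))) (Lₚ.++-assoc (applyUpTo mixedRow n) (mixedRow n ∷ []) rest)) ⟩
        detL (L.map U (upTo k) ++ applyUpTo mixedRow n ++ mixedRow n ∷ rest)
          -- With the last row moved into `rest`, exactly k + n rows precede it in every term,
          -- however many of them were selected. This is why one sign per row suffices.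
          ≈⟨ subset-expansion n (mixedRow n ∷ rest) ⟩
        ΣL (subsets n) (λ (cs , s) → coefficient s * detL (front cs ++ back s ++ mixedRow n ∷ rest))
          ≈⟨ ΣL-cong (subsets n) (λ (cs , s) _ → split s) ⟩
        ΣL (subsets n) (λ (cs , s) → omitted s + taken s)
          ≈⟨ ΣL-+ (subsets n) ⟩
        ΣL (subsets n) (λ (cs , s) → omitted s) + ΣL (subsets n) (λ (cs , s) → taken s)
          ≈⟨ trans (ΣL-++ (L.map (λ (cs , s) → cs , omit s) (subsets n)) _ _) (+-cong (ΣL-map _ (subsets n) _) (ΣL-map _ (subsets n) _)) ⟨
        ΣL (subsets (suc n)) (λ (cs , s) → coefficient s * detL (front cs ++ back s ++ rest)) ∎
        where
        front : List ℕ → List Row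
        front cs = L.map (Y 0) (L.map pred cs)
        back : ∀ {n cs} → Sub n cs → List Row
        back s = L.map U (vac k s)
        omitted taken : ∀ {cs} → Sub n cs → Carrier
        omitted {cs} s = coefficient (omit s) * detL (front cs ++ back (omit s) ++ rest)
        taken {cs} s = coefficient (take s) * detL (front (suc n ∷ cs) ++ back (take s) ++ rest)
        split : ∀ {cs} (s : Sub n cs) → coefficient s * detL (front cs ++ back s ++ mixedRow n ∷ rest) ≈ omitted s + taken s
        split {cs} s = begin
          γ * detL (front cs ++ back s ++ mixedRow n ∷ rest)  ≈⟨ *-congˡ (at-++ (front cs) (back s) _) ⟨
          γ * detL (pre ++ mixedRow n ∷ rest)                 ≈⟨ *-congˡ (linear pre (α n) (U (k ℕ.+ n)) σβ (Y 0 n) rest) ⟩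
          γ * (α n * detL (pre ++ U (k ℕ.+ n) ∷ rest) + σβ * detL (pre ++ Y 0 n ∷ rest))
            ≈⟨ *-congˡ (+-cong (*-congˡ (≡⇒≈ (≡.cong detL omit-eq))) (*-congˡ (move [] pre (Y 0 n) rest))) ⟩
          γ * (α n * o + σβ * (sg (length pre) * detL (Y 0 n ∷ pre ++ rest)))
            ≈⟨ *-congˡ (+-congˡ (*-congˡ (*-cong (≡⇒≈ (≡.cong sg pre-length)) (≡⇒≈ (≡.cong (λ ys → detL (Y 0 n ∷ ys)) (Lₚ.++-assoc (front cs) (back s) rest)))))) ⟩
          γ * (α n * o + (sg (k ℕ.+ n) * β n) * (sg (k ℕ.+ n) * t))
            ≈⟨ solve 6 (λ γ α o σ β t → γ :* (α :* o :+ (σ :* β) :* (σ :* t)) := α :* γ :* o :+ (σ :* σ) :* (β :* γ :* t)) refl _ _ _ _ _ _ ⟩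
          α n * γ * o + (sg (k ℕ.+ n) * sg (k ℕ.+ n)) * (β n * γ * t)
            ≈⟨ +-congˡ (trans (*-congʳ (sg*sg≈1 (k ℕ.+ n))) (*-identityˡ _)) ⟩
          omitted s + taken s ∎
          where
          pre : List Row
          pre = front cs ++ back s
          open Alternating (detL-alternating 0)
          open AlternatingProperties (detL-alternating 0)
          γ σβ o t : Carrier
          γ = coefficient s
          σβ = sg (k ℕ.+ n) * β n
          o = detL (front cs ++ back (omit s) ++ rest)
          t = detL (Y 0 n ∷ front cs ++ back s ++ rest)
          omit-eq : pre ++ U (k ℕ.+ n) ∷ rest ≡ front cs ++ back (omit s) ++ rest
          omit-eq = ≡.trans (Lₚ.++-assoc (front cs) (back s) _) (≡.cong (front cs ++_)
            (≡.trans (≡.sym (Lₚ.++-assoc (back s) (U (k ℕ.+ n) ∷ []) rest)) (≡.cong (_++ rest) (≡.sym (Lₚ.map-++ U (vac k s) (k ℕ.+ n ∷ []))))))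
          pre-length : length pre ≡ k ℕ.+ n
          pre-length = ≡.trans (Lₚ.length-++ (front cs)) (≡.trans
            (≡.cong₂ ℕ._+_ (≡.trans (Lₚ.length-map (Y 0) (L.map pred cs)) (Lₚ.length-map pred cs)) (Lₚ.length-map U (vac k s)))
            (≡.trans (ℕₚ.+-comm (length cs) (length (vac k s))) (length-vac k s)))

      array-expansion : ∀ n → detL (L.map U (upTo k) ++ applyUpTo mixedRow n) ≈
        ΣL (subsets n) (λ (cs , s) → coefficient s * ΣL (chainsL n (pad n cs)) (λ ch → detL (L.map X (arms 0 (pad n cs) [] ch) ++ L.map U (vac k s))))
      array-expansion n = begin
        detL (L.map U (upTo k) ++ applyUpTo mixedRow n)
          ≡⟨ ≡.cong (λ ys → detL (L.map U (upTo k) ++ ys)) (Lₚ.++-identityʳ (applyUpTo mixedRow n)) ⟨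
        detL (L.map U (upTo k) ++ applyUpTo mixedRow n ++ [])
          ≈⟨ subset-expansion n [] ⟩
        ΣL (subsets n) (λ (cs , s) → coefficient s * detL (L.map (Y 0) (L.map pred cs) ++ L.map U (vac k s) ++ []))
          ≈⟨ ΣL-cong (subsets n) (λ (cs , s) _ → *-congˡ (trans
               (≡⇒≈ (≡.cong₂ (λ ys zs → detL (L.map (Y 0) ys ++ zs)) (≡.sym (pos-pad n (Sub-positive s))) (Lₚ.++-identityʳ (L.map U (vac k s)))))
               (path-expansion n 0 (pad n cs) [] (L.map U (vac k s)) (pad-linked (n ∸ length cs) (Sub-decreasing s)) (pad-head n (n ∸ length cs) {cs} (Sub-head s))))) ⟩
        _ ∎

-- Semistandard tableaux and the Jacobi-Trudi identity

module JacobiTrudi {c ℓ} (R : CommutativeRing c ℓ) (r u v w u′ v′ w′ : CommutativeRing.Carrier R) where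

  open Preliminaries
  open Shapes
  open RingSums R
  open Determinant R
  open Interlacing R
  open Sym R r u v w u′ v′ w′ using (xAt; hN; schur) renaming (_^_ to _^ˢ_)

  rowOk : List ℕ → List ℕ → Bool
  rowOk prev row = all (λ j → at prev j <ᵇ at row j) (upTo (length row))

  weight : (ℕ → Carrier) → List ℕ → Carrier
  weight f row = L.foldr _*_ 1# (L.map f row)

  -- Column strictness couples neighbouring rows only, so the tableau sum can be organized row by
  -- row with the previous row as its memory.
  fillings : ℕ → (ℕ → Carrier) → List ℕ → List ℕ → Carrier
  fillings N f prev []       = 1#
  fillings N f prev (p ∷ ps) =
    ΣL (incLists p 1 N) (λ row → if rowOk prev row then weight f row * fillings N f row ps else 0#)

  tableaux : ℕ → (ℕ → Carrier) → List ℕ → Carrier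
  tableaux N f []       = 1#
  tableaux N f (p ∷ ps) = ΣL (incLists p 1 N) (λ row → weight f row * fillings N f row ps)

  weight-++ : ∀ f xs ys → weight f (xs ++ ys) ≈ weight f xs * weight f ys
  weight-++ f []       ys = sym (*-identityˡ _)
  weight-++ f (x ∷ xs) ys = trans (*-congˡ (weight-++ f xs ys)) (sym (*-assoc _ _ _))

  weight-replicate : ∀ f k m → weight f (replicate k m) ≈ f m ^ k
  weight-replicate f zero    m = refl
  weight-replicate f (suc k) m = *-congˡ (weight-replicate f k m)

  weight-cong : ∀ {f g : ℕ → Carrier} {P : ℕ → Set} → (∀ i → P i → f i ≈ g i) → ∀ xs → All P xs → weight f xs ≈ weight g xs
  weight-cong p []       _        = refl
  weight-cong p (x ∷ xs) (q ∷ qs) = *-cong (p x q) (weight-cong p xs qs)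

  fillings-sum : ∀ N f r ps →
    ΣL (rowFillings ps N) (λ T → if colStrict (r ∷ T) then weight f (L.concat T) else 0#) ≈ fillings N f r ps
  fillings-sum N f r []       = +-identityʳ _
  fillings-sum N f r (p ∷ ps) = begin
    ΣL (rowFillings (p ∷ ps) N) _  ≈⟨ ΣL-concatMap _ (incLists p 1 N) _ ⟩
    ΣL (incLists p 1 N) (λ row → ΣL (L.map (row ∷_) (rowFillings ps N)) _)
      ≈⟨ ΣL-cong (incLists p 1 N) (λ row _ → trans (ΣL-map (row ∷_) (rowFillings ps N) _) (first row)) ⟩
    fillings N f r (p ∷ ps) ∎
    where
    first : ∀ row →
      ΣL (rowFillings ps N) (λ T → if rowOk r row ∧ colStrict (row ∷ T) then weight f (row ++ L.concat T) else 0#)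
        ≈ (if rowOk r row then weight f row * fillings N f row ps else 0#)
    first row with rowOk r row
    ... | false = ΣL-zero (rowFillings ps N) (λ _ _ → refl)
    ... | true  = begin
      ΣL (rowFillings ps N) (λ T → if colStrict (row ∷ T) then weight f (row ++ L.concat T) else 0#)
        ≈⟨ ΣL-cong (rowFillings ps N) (λ T _ → pull T) ⟩
      ΣL (rowFillings ps N) (λ T → weight f row * (if colStrict (row ∷ T) then weight f (L.concat T) else 0#))
        ≈⟨ ΣL-*ˡ (rowFillings ps N) _ _ ⟩
      _ ≈⟨ *-congˡ (fillings-sum N f row ps) ⟩
      weight f row * fillings N f row ps ∎
      where
      pull : ∀ T → (if colStrict (row ∷ T) then weight f (row ++ L.concat T) else 0#)
                 ≈ weight f row * (if colStrict (row ∷ T) then weight f (L.concat T) else 0#)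
      pull T with colStrict (row ∷ T)
      ... | true  = weight-++ f row (L.concat T)
      ... | false = sym (zeroʳ _)

  schur-tableaux : ∀ ps xs → schur ps xs ≈ tableaux (length xs) (xAt xs) ps
  schur-tableaux []       xs = +-identityʳ _
  schur-tableaux (p ∷ ps) xs = begin
    ΣL (L.filterᵇ colStrict (rowFillings (p ∷ ps) N)) (weight f ∘ L.concat) ≈⟨ ΣL-filter colStrict (rowFillings (p ∷ ps) N) _ ⟩
    ΣL (rowFillings (p ∷ ps) N) _  ≈⟨ ΣL-concatMap _ (incLists p 1 N) _ ⟩
    ΣL (incLists p 1 N) (λ row → ΣL (L.map (row ∷_) (rowFillings ps N)) _)
      ≈⟨ ΣL-cong (incLists p 1 N) (λ row _ → trans (ΣL-map (row ∷_) (rowFillings ps N) _)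
           (trans (ΣL-cong (rowFillings ps N) (λ T _ → pull row T)) (trans (ΣL-*ˡ (rowFillings ps N) _ _) (*-congˡ (fillings-sum N f row ps))))) ⟩
    tableaux N f (p ∷ ps) ∎
    where
    N : ℕ
    N = length xs
    f : ℕ → Carrier
    f = xAt xs
    pull : ∀ row T → (if colStrict (row ∷ T) then weight f (row ++ L.concat T) else 0#)
               ≈ weight f row * (if colStrict (row ∷ T) then weight f (L.concat T) else 0#)
    pull row T with colStrict (row ∷ T)
    ... | true  = weight-++ f row (L.concat T)
    ... | false = sym (zeroʳ _)

  ΣL-range : ∀ lo k f → ΣL (L.map (lo ℕ.+_) (upTo k)) f ≈ Σ< k (λ s → f (lo ℕ.+ s))
  ΣL-range lo k f = trans (ΣL-map (lo ℕ.+_) (upTo k) f) (ΣL-upTo k _)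

  incLists-suc : ∀ l lo N f →
    ΣL (incLists (suc l) lo N) f ≈ Σ< (suc N ∸ lo) (λ s → ΣL (incLists l (lo ℕ.+ s) N) (λ row → f (lo ℕ.+ s ∷ row)))
  incLists-suc l lo N f = begin
    ΣL (incLists (suc l) lo N) f  ≈⟨ ΣL-concatMap _ (L.map (lo ℕ.+_) (upTo (suc N ∸ lo))) f ⟩
    ΣL (L.map (lo ℕ.+_) (upTo (suc N ∸ lo))) (λ x → ΣL (L.map (x ∷_) (incLists l x N)) f)
      ≈⟨ ΣL-cong (L.map (lo ℕ.+_) (upTo (suc N ∸ lo))) (λ x _ → ΣL-map (x ∷_) (incLists l x N) f) ⟩
    ΣL (L.map (lo ℕ.+_) (upTo (suc N ∸ lo))) (λ x → ΣL (incLists l x N) (f ∘ (x ∷_)))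
      ≈⟨ ΣL-range lo (suc N ∸ lo) _ ⟩
    _ ∎

  incLists-∈ : ∀ l lo N {row} → row ∈ incLists l lo N → length row ≡ l × All (_≤ N) row
  incLists-∈ zero    lo N (here ≡.refl) = ≡.refl , []
  incLists-∈ (suc l) lo N row∈ with ∈ₚ.∈-concatMap⁻ (λ x → L.map (x ∷_) (incLists l x N)) {xs = L.map (lo ℕ.+_) (upTo (suc N ∸ lo))} row∈
  ... | any with Data.List.Membership.Propositional.find any
  ... | x , x∈ , row∈′ with ∈ₚ.∈-map⁻ (x ∷_) row∈′ | ∈ₚ.∈-map⁻ (lo ℕ.+_) x∈
  ... | row′ , row′∈ , ≡.refl | s , s∈ , ≡.refl with incLists-∈ l (lo ℕ.+ s) N row′∈
  ... | e , a = ≡.cong suc e , bound ∷ a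
    where
    bound : lo ℕ.+ s ≤ N
    bound = ℕ.≤-pred (<∸⇒+< s (suc N) lo (∈ₚ.∈-upTo⁻ s∈))

  -- A weakly increasing row ends in a block of entries N + 1, and q counts the entries before that
  -- block. In the induction, a first entry N + 1 forces q = 0.
  incLists-split : ∀ p lo N f → lo ≤ suc N → ΣL (incLists p lo (suc N)) f ≈
    Σ< (suc p) (λ q → ΣL (incLists q lo N) (λ row → f (row ++ replicate (p ∸ q) (suc N))))
  incLists-split zero    lo N f _    = sym (trans (Σ<-suc 0 _) (trans (+-congˡ (Σ<-0 _)) (+-identityʳ _)))
  incLists-split (suc p) lo N f lo≤ = begin
    ΣL (incLists (suc p) lo (suc N)) f                          ≈⟨ incLists-suc p lo (suc N) f ⟩
    Σ< (suc (suc N) ∸ lo) G                                     ≡⟨ ≡.cong (λ m → Σ< m G) (ℕₚ.+-∸-assoc 1 lo≤) ⟩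
    Σ< (suc d) G                                                ≈⟨ Σ<-last d G ⟩
    Σ< d G + G d                                                ≈⟨ +-cong small large ⟩
    Σ< (suc p) (λ q → F (suc q)) + F 0                          ≈⟨ +-comm _ _ ⟩
    F 0 + Σ< (suc p) (λ q → F (suc q))                          ≈⟨ Σ<-suc (suc p) F ⟨
    Σ< (suc (suc p)) F                                          ∎
    where
    d : ℕ
    d = suc N ∸ lo
    G F : ℕ → Carrier
    G s = ΣL (incLists p (lo ℕ.+ s) (suc N)) (λ row → f (lo ℕ.+ s ∷ row))
    F q = ΣL (incLists q lo N) (λ row → f (row ++ replicate (suc p ∸ q) (suc N)))
    small : Σ< d G ≈ Σ< (suc p) (λ q → F (suc q))
    small = begin
      Σ< d G
        ≈⟨ Σ<-cong< d (λ s s<d → incLists-split p (lo ℕ.+ s) N _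
             (ℕₚ.<⇒≤ (<∸⇒+< s (suc N) lo s<d))) ⟩
      Σ< d (λ s → Σ< (suc p) (λ q → ΣL (incLists q (lo ℕ.+ s) N) (λ row → f (lo ℕ.+ s ∷ row ++ replicate (p ∸ q) (suc N)))))
        ≈⟨ Σ<-swap d (suc p) _ ⟩
      Σ< (suc p) (λ q → Σ< d (λ s → ΣL (incLists q (lo ℕ.+ s) N) (λ row → f (lo ℕ.+ s ∷ row ++ replicate (p ∸ q) (suc N)))))
        ≈⟨ Σ<-cong (suc p) (λ q → incLists-suc q lo N (λ row → f (row ++ replicate (p ∸ q) (suc N)))) ⟨
      Σ< (suc p) (λ q → F (suc q)) ∎
    large : G d ≈ F 0
    large = begin
      G d  ≡⟨ ≡.cong (λ m → ΣL (incLists p m (suc N)) (λ row → f (m ∷ row))) (ℕₚ.m+[n∸m]≡n lo≤) ⟩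
      ΣL (incLists p (suc N) (suc N)) (λ row → f (suc N ∷ row)) ≈⟨ incLists-split p (suc N) N _ ℕₚ.≤-refl ⟩
      Σ< (suc p) (λ q → ΣL (incLists q (suc N) N) (λ row → f (suc N ∷ row ++ replicate (p ∸ q) (suc N))))
        ≈⟨ Σ<-single (suc p) 0 (s≤s z≤n) (λ q _ q≢0 → empty q q≢0 _) ⟩
      F 0  ∎
      where
      empty : ∀ q → q ≢ 0 → ∀ g → ΣL (incLists q (suc N) N) g ≈ 0#
      empty zero    q≢0 g = ⊥-elim (q≢0 ≡.refl)
      empty (suc q) _   g = trans (incLists-suc q (suc N) N g)
        (Σ<-zero (suc N ∸ suc N) (λ i i<0 → ⊥-elim (ℕₚ.n≮0 (≡.subst (i <_) (ℕₚ.n∸n≡0 N) i<0))))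

  rowOk-true⁻ : ∀ prev row → rowOk prev row ≡ true → ∀ j → j < length row → at prev j < at row j
  rowOk-true⁻ prev row e j j< = <ᵇ-true⁻ (all-applyUpTo⁻ (λ j → at prev j <ᵇ at row j) id (length row) e j j<)

  rowOk-true : ∀ prev row → (∀ j → j < length row → at prev j < at row j) → rowOk prev row ≡ true
  rowOk-true prev row h = all-applyUpTo (λ j → at prev j <ᵇ at row j) id (length row) (λ j j< → <ᵇ-true (h j j<))

  -- The new entries N + 1 of the lower row stand below entries that are at most N, so they satisfy
  -- column strictness by themselves.
  rowOk-extend : ∀ {N} prev k row e → All (_≤ N) prev → length row ℕ.+ e ≤ length prev →
    rowOk (prev ++ replicate k (suc N)) (row ++ replicate e (suc N)) ≡ rowOk prev row
  rowOk-extend {N} prev k row e prev≤ len = bool-ext to from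
    where
    rowlen : length (row ++ replicate e (suc N)) ≡ length row ℕ.+ e
    rowlen = ≡.trans (Lₚ.length-++ row) (≡.cong (length row ℕ.+_) (Lₚ.length-replicate e))
    to : rowOk (prev ++ replicate k (suc N)) (row ++ replicate e (suc N)) ≡ true → rowOk prev row ≡ true
    to h = rowOk-true prev row (λ j j< → ≡.subst₂ _<_
      (at-++ˡ prev _ j (ℕₚ.<-≤-trans j< (ℕₚ.≤-trans (ℕₚ.m≤m+n (length row) e) len))) (at-++ˡ row _ j j<)
      (rowOk-true⁻ (prev ++ replicate k (suc N)) (row ++ replicate e (suc N)) h j
        (≡.subst (j <_) (≡.sym rowlen) (ℕₚ.<-≤-trans j< (ℕₚ.m≤m+n (length row) e)))))
    from : rowOk prev row ≡ true → rowOk (prev ++ replicate k (suc N)) (row ++ replicate e (suc N)) ≡ true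
    from h = rowOk-true (prev ++ replicate k (suc N)) (row ++ replicate e (suc N)) entry
      where
      entry : ∀ j → j < length (row ++ replicate e (suc N)) → at (prev ++ replicate k (suc N)) j < at (row ++ replicate e (suc N)) j
      entry j j<′ with j ℕ.<? length row
      ... | yes j<row = ≡.subst₂ _<_
        (≡.sym (at-++ˡ prev _ j (ℕₚ.<-≤-trans (≡.subst (j <_) rowlen j<′) len))) (≡.sym (at-++ˡ row _ j j<row))
        (rowOk-true⁻ prev row h j j<row)
      ... | no j≮row = ≡.subst₂ _<_
        (≡.sym (at-++ˡ prev _ j (ℕₚ.<-≤-trans (≡.subst (j <_) rowlen j<′) len)))
        (≡.sym (≡.trans (≡.cong (at (row ++ replicate e (suc N))) (≡.sym (ℕₚ.m+[n∸m]≡n (ℕₚ.≮⇒≥ j≮row))))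
          (≡.trans (at-++ʳ row _ (j ∸ length row))
            (at-replicate e (suc N) (j ∸ length row)
              (ℕₚ.+-cancelˡ-< (length row) _ _ (≡.subst₂ _<_ (≡.sym (ℕₚ.m+[n∸m]≡n (ℕₚ.≮⇒≥ j≮row))) rowlen j<′))))))
        (s≤s (at-All-≤ prev j prev≤))

  -- The first position beyond `prev` has N + 1 above an entry that is at most N + 1.
  rowOk-tooLong : ∀ {N} prev k row → All (_≤ suc N) row → length prev < length row → length row ≤ length prev ℕ.+ k →
    rowOk (prev ++ replicate k (suc N)) row ≡ false
  rowOk-tooLong {N} prev k row row≤ lt le with rowOk (prev ++ replicate k (suc N)) row in eq
  ... | false = ≡.refl
  ... | true  = ⊥-elim (ℕₚ.<⇒≱ (rowOk-true⁻ (prev ++ replicate k (suc N)) row eq (length prev) lt)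
    (≡.subst (at row (length prev) ≤_) (≡.sym here-value) (at-All-≤ row (length prev) row≤)))
    where
    here-value : at (prev ++ replicate k (suc N)) (length prev) ≡ suc N
    here-value = ≡.trans (≡.cong (at (prev ++ replicate k (suc N))) (≡.sym (ℕₚ.+-identityʳ (length prev))))
      (≡.trans (at-++ʳ prev _ 0) (at-replicate k (suc N) 0
        (ℕₚ.+-cancelˡ-< (length prev) 0 k (≡.subst (_< length prev ℕ.+ k) (≡.sym (ℕₚ.+-identityʳ _)) (ℕₚ.<-≤-trans lt le)))))

  -- The sum of x ^ |p / q| * f q over the partitions q such that p / q is a horizontal strip.
  strips : Carrier → List ℕ → (List ℕ → Carrier) → Carrier
  strips x []       f = f []
  strips x (p ∷ ps) f = Σ< (suc p) (λ q → x ^ (p ∸ q) * (if at ps 0 ≤ᵇ q then strips x ps (λ qs → f (q ∷ qs)) else 0#))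

  if-cong : ∀ b {x y : Carrier} → x ≈ y → (if b then x else 0#) ≈ (if b then y else 0#)
  if-cong true  p = p
  if-cong false p = refl

  if-* : ∀ b x y → (if b then x * y else 0#) ≈ x * (if b then y else 0#)
  if-* true  x y = refl
  if-* false x y = sym (zeroʳ x)

  ΣL-if : ∀ b {a} {A : Set a} (xs : List A) f → (if b then ΣL xs f else 0#) ≈ ΣL xs (λ y → if b then f y else 0#)
  ΣL-if true  xs f = refl
  ΣL-if false xs f = sym (ΣL-zero xs (λ _ _ → refl))

  strips-cong : ∀ x ps {f g} → (∀ qs → f qs ≈ g qs) → strips x ps f ≈ strips x ps g
  strips-cong x []       p = p []
  strips-cong x (_ ∷ ps) p = Σ<-cong _ (λ q → *-congˡ (if-cong (at ps 0 ≤ᵇ q) (strips-cong x ps (λ qs → p (q ∷ qs)))))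

  strips-ΣL : ∀ x ps {a} {A : Set a} (ys : List A) (s : A → Carrier) (f : A → List ℕ → Carrier) →
    strips x ps (λ qs → ΣL ys (λ y → s y * f y qs)) ≈ ΣL ys (λ y → s y * strips x ps (f y))
  strips-ΣL x []       ys s f = refl
  strips-ΣL x (p ∷ ps) ys s f = begin
    Σ< (suc p) (λ q → x ^ (p ∸ q) * (if at ps 0 ≤ᵇ q then strips x ps (λ qs → ΣL ys (λ y → s y * f y (q ∷ qs))) else 0#))
      ≈⟨ Σ<-cong (suc p) (λ q → term q) ⟩
    Σ< (suc p) (λ q → ΣL ys (λ y → s y * t q y)) ≈⟨ Σ<-ΣL-swap (suc p) ys _ ⟩
    ΣL ys (λ y → Σ< (suc p) (λ q → s y * t q y)) ≈⟨ ΣL-cong ys (λ y _ → Σ<-*ˡ (suc p) (s y) _) ⟩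
    ΣL ys (λ y → s y * Σ< (suc p) (λ q → t q y)) ∎
    where
    t : ℕ → _ → Carrier
    t q y = x ^ (p ∸ q) * (if at ps 0 ≤ᵇ q then strips x ps (λ qs → f y (q ∷ qs)) else 0#)
    term : ∀ q → x ^ (p ∸ q) * (if at ps 0 ≤ᵇ q then strips x ps (λ qs → ΣL ys (λ y → s y * f y (q ∷ qs))) else 0#)
               ≈ ΣL ys (λ y → s y * t q y)
    term q = begin
      _ ≈⟨ *-congˡ (if-cong (at ps 0 ≤ᵇ q) (strips-ΣL x ps ys s (λ y qs → f y (q ∷ qs)))) ⟩
      _ ≈⟨ *-congˡ (ΣL-if (at ps 0 ≤ᵇ q) ys _) ⟩
      _ ≈⟨ ΣL-*ˡ ys _ _ ⟨
      _ ≈⟨ ΣL-cong ys (λ y _ → trans (*-congˡ (if-* (at ps 0 ≤ᵇ q) (s y) _))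
             (solve 3 (λ a b c → a :* (b :* c) := b :* (a :* c)) refl _ _ _)) ⟩
      ΣL ys (λ y → s y * t q y) ∎

  module Branching (N : ℕ) (f f⁺ : ℕ → Carrier) (x : Carrier) (f-old : ∀ i → i ≤ N → f⁺ i ≈ f i) (f-new : f⁺ (suc N) ≈ x) where

    weight-extend : ∀ row e → All (_≤ N) row → weight f⁺ (row ++ replicate e (suc N)) ≈ x ^ e * weight f row
    weight-extend row e row≤ = begin
      weight f⁺ (row ++ replicate e (suc N))          ≈⟨ weight-++ f⁺ row _ ⟩
      weight f⁺ row * weight f⁺ (replicate e (suc N)) ≈⟨ *-cong (weight-cong f-old row row≤) (trans (weight-replicate f⁺ e (suc N)) (^-cong-base e)) ⟩
      weight f row * x ^ e                            ≈⟨ *-comm _ _ ⟩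
      x ^ e * weight f row                            ∎
      where
      ^-cong-base : ∀ e → f⁺ (suc N) ^ e ≈ x ^ e
      ^-cong-base zero    = refl
      ^-cong-base (suc e) = *-cong f-new (^-cong-base e)

    -- The first row, where nothing is tested, and the later rows, where `rowOk` is, are treated at
    -- once; hence the abstract predicates. A row with q old entries contributes x^(p-q) for its new
    -- ones. On p ∷ ps `strips` passes lists of the form q ∷ qs, so the value at [] is a dummy.
    row-sum : ∀ p ps (ok : List ℕ → Bool) (ok⁺ : List ℕ → Bool) → Linked ℕ._≥_ (p ∷ ps) →
      (∀ q row → q ≤ p → row ∈ incLists q 1 N → ok⁺ (row ++ replicate (p ∸ q) (suc N)) ≡ ok row) →
      (∀ q row → q ≤ p → row ∈ incLists q 1 N →
         fillings (suc N) f⁺ (row ++ replicate (p ∸ q) (suc N)) ps ≈ (if at ps 0 ≤ᵇ q then strips x ps (fillings N f row) else 0#)) →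
      ΣL (incLists p 1 (suc N)) (λ row → if ok⁺ row then weight f⁺ row * fillings (suc N) f⁺ row ps else 0#)
        ≈ strips x (p ∷ ps) (λ { [] → 0# ; (q ∷ qs) → ΣL (incLists q 1 N) (λ row → if ok row then weight f row * fillings N f row qs else 0#) })
    row-sum p ps ok ok⁺ dec ok≡ fill≈ = begin
      _ ≈⟨ incLists-split p 1 N _ (s≤s z≤n) ⟩
      Σ< (suc p) (λ q → ΣL (incLists q 1 N) (λ row →
          if ok⁺ (row ++ replicate (p ∸ q) (suc N))
          then weight f⁺ (row ++ replicate (p ∸ q) (suc N)) * fillings (suc N) f⁺ (row ++ replicate (p ∸ q) (suc N)) ps else 0#))
        ≈⟨ Σ<-cong< (suc p) (λ q q<1+p → term q (ℕ.≤-pred q<1+p)) ⟩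
      _ ∎
      where
      term : ∀ q → q ≤ p → ΣL (incLists q 1 N) (λ row →
          if ok⁺ (row ++ replicate (p ∸ q) (suc N))
          then weight f⁺ (row ++ replicate (p ∸ q) (suc N)) * fillings (suc N) f⁺ (row ++ replicate (p ∸ q) (suc N)) ps else 0#)
        ≈ x ^ (p ∸ q) * (if at ps 0 ≤ᵇ q then strips x ps (λ qs → ΣL (incLists q 1 N) (λ row → if ok row then weight f row * fillings N f row qs else 0#)) else 0#)
      term q q≤p = begin
        _ ≈⟨ ΣL-cong (incLists q 1 N) (λ row row∈ → entry row row∈) ⟩
        ΣL (incLists q 1 N) (λ row → x ^ (p ∸ q) * (if at ps 0 ≤ᵇ q then wt row * strips x ps (fillings N f row) else 0#))
          ≈⟨ ΣL-*ˡ (incLists q 1 N) _ _ ⟩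
        _ ≈⟨ *-congˡ (ΣL-if (at ps 0 ≤ᵇ q) (incLists q 1 N) _) ⟨
        x ^ (p ∸ q) * (if at ps 0 ≤ᵇ q then ΣL (incLists q 1 N) (λ row → wt row * strips x ps (fillings N f row)) else 0#)
          ≈⟨ *-congˡ (if-cong (at ps 0 ≤ᵇ q) (strips-ΣL x ps (incLists q 1 N) wt (fillings N f))) ⟨
        _ ≈⟨ *-congˡ (if-cong (at ps 0 ≤ᵇ q) (strips-cong x ps (λ qs → ΣL-cong (incLists q 1 N) (λ row _ → wt-* row _)))) ⟩
        _ ∎
        where
        wt : List ℕ → Carrier
        wt row = if ok row then weight f row else 0#
        wt-* : ∀ row y → wt row * y ≈ (if ok row then weight f row * y else 0#)
        wt-* row y with ok row
        ... | true  = refl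
        ... | false = zeroˡ y
        entry : ∀ row → row ∈ incLists q 1 N →
          (if ok⁺ (row ++ replicate (p ∸ q) (suc N))
           then weight f⁺ (row ++ replicate (p ∸ q) (suc N)) * fillings (suc N) f⁺ (row ++ replicate (p ∸ q) (suc N)) ps else 0#) ≈ x ^ (p ∸ q) * (if at ps 0 ≤ᵇ q then wt row * strips x ps (fillings N f row) else 0#)
        entry row row∈ rewrite ok≡ q row q≤p row∈ = begin
          (if ok row then weight f⁺ row⁺ * fillings (suc N) f⁺ row⁺ ps else 0#)
            ≈⟨ if-cong (ok row) (*-cong (weight-extend row (p ∸ q) (proj₂ (incLists-∈ q 1 N row∈))) (fill≈ q row q≤p row∈)) ⟩
          (if ok row then (x ^ (p ∸ q) * weight f row) * (if at ps 0 ≤ᵇ q then strips x ps (fillings N f row) else 0#) else 0#)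
            ≈⟨ if-cong (ok row) (*-assoc _ _ _) ⟩
          (if ok row then x ^ (p ∸ q) * (weight f row * (if at ps 0 ≤ᵇ q then strips x ps (fillings N f row) else 0#)) else 0#)
            ≈⟨ if-* (ok row) _ _ ⟩
          x ^ (p ∸ q) * (if ok row then weight f row * (if at ps 0 ≤ᵇ q then strips x ps (fillings N f row) else 0#) else 0#)
            ≈⟨ *-congˡ (trans (sym (wt-* row _)) (sym (if-* (at ps 0 ≤ᵇ q) _ _))) ⟩
          x ^ (p ∸ q) * (if at ps 0 ≤ᵇ q then wt row * strips x ps (fillings N f row) else 0#) ∎
          where
          row⁺ : List ℕ
          row⁺ = row ++ replicate (p ∸ q) (suc N)

    -- The next row must not reach below the k entries N + 1 that end the previous row. This is the
    -- condition that the boxes of the new entries form a horizontal strip.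
    fillings-branch : ∀ prev k ps → All (_≤ N) prev → Linked ℕ._≥_ ps → at ps 0 ≤ length prev ℕ.+ k →
      fillings (suc N) f⁺ (prev ++ replicate k (suc N)) ps ≈ (if at ps 0 ≤ᵇ length prev then strips x ps (fillings N f prev) else 0#)

    next-row : ∀ p ps → Linked ℕ._≥_ (p ∷ ps) → ∀ q row → q ≤ p → row ∈ incLists q 1 N →
      fillings (suc N) f⁺ (row ++ replicate (p ∸ q) (suc N)) ps ≈ (if at ps 0 ≤ᵇ q then strips x ps (fillings N f row) else 0#)
    next-row p ps dec q row q≤p row∈ with incLists-∈ q 1 N row∈
    ... | ≡.refl , row≤ = fillings-branch row (p ∸ length row) ps row≤ (Linked.tail dec)
      (≡.subst (at ps 0 ≤_) (≡.sym (ℕₚ.m+[n∸m]≡n q≤p)) (at-≤-head dec))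

    fillings-branch prev k []       prev≤ dec le = refl
    fillings-branch prev k (p ∷ ps) prev≤ dec le with p ≤ᵇ length prev in eq
    ... | true  = row-sum p ps (rowOk prev) (rowOk (prev ++ replicate k (suc N))) dec
        (λ q row q≤p row∈ → rowOk-extend prev k row (p ∸ q) prev≤ (ℕₚ.≤-trans (ℕₚ.≤-reflexive
          (≡.trans (≡.cong (ℕ._+ (p ∸ q)) (proj₁ (incLists-∈ q 1 N row∈))) (ℕₚ.m+[n∸m]≡n q≤p))) (≤ᵇ-true⁻ eq)))
        (next-row p ps dec)
    ... | false = ΣL-zero (incLists p 1 (suc N)) vanish
      where
      vanish : ∀ row → row ∈ incLists p 1 (suc N) →
        (if rowOk (prev ++ replicate k (suc N)) row then weight f⁺ row * fillings (suc N) f⁺ row ps else 0#) ≈ 0#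
      vanish row row∈ with incLists-∈ p 1 (suc N) row∈
      ... | ≡.refl , row≤ rewrite rowOk-tooLong prev k row row≤ (≤ᵇ-false⁻ eq) le = refl

    tableaux-branch : ∀ ps → Linked ℕ._≥_ ps → tableaux (suc N) f⁺ ps ≈ strips x ps (tableaux N f)
    tableaux-branch []       dec = refl
    tableaux-branch (p ∷ ps) dec = row-sum p ps (λ _ → true) (λ _ → true) dec (λ _ _ _ _ → ≡.refl) (next-row p ps dec)

  ^ˢ≈^ : ∀ x n → x ^ˢ n ≈ x ^ n
  ^ˢ≈^ x zero    = refl
  ^ˢ≈^ x (suc n) = *-congˡ (^ˢ≈^ x n)

  hN-0 : ∀ xs → hN 0 xs ≈ 1#
  hN-0 []       = refl
  hN-0 (x ∷ xs) = trans (+-identityʳ _) (trans (*-identityˡ _) (hN-0 xs))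

  hN-∷ : ∀ m x xs → hN (suc m) (x ∷ xs) ≈ hN (suc m) xs + x * hN m (x ∷ xs)
  hN-∷ m x xs = begin
    ΣL (upTo (suc (suc m))) (λ j → x ^ˢ j * hN (suc m ∸ j) xs)   ≈⟨ ΣL-upTo (suc (suc m)) _ ⟩
    Σ< (suc (suc m)) (λ j → x ^ˢ j * hN (suc m ∸ j) xs)          ≈⟨ Σ<-suc (suc m) _ ⟩
    1# * hN (suc m) xs + Σ< (suc m) (λ j → x * x ^ˢ j * hN (m ∸ j) xs)
      ≈⟨ +-cong (*-identityˡ _) (trans (Σ<-cong (suc m) (λ j → *-assoc _ _ _)) (Σ<-*ˡ (suc m) x _)) ⟩
    hN (suc m) xs + x * Σ< (suc m) (λ j → x ^ˢ j * hN (m ∸ j) xs)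
      ≈⟨ +-congˡ (*-congˡ (trans (sym (ΣL-upTo (suc m) _)) (unfold m))) ⟩
    hN (suc m) xs + x * hN m (x ∷ xs) ∎
    where
    unfold : ∀ m → ΣL (upTo (suc m)) (λ j → x ^ˢ j * hN (m ∸ j) xs) ≈ hN m (x ∷ xs)
    unfold zero    = refl
    unfold (suc m) = refl

  -- The largest entry of a tableau stands for the last variable, whereas `hN` unfolds at the first;
  -- hence the recursion at the other end of the list.
  hN-∷ʳ : ∀ m xs x → hN (suc m) (xs L.∷ʳ x) ≈ hN (suc m) xs + x * hN m (xs L.∷ʳ x)
  hN-∷ʳ m       []       x = hN-∷ m x []
  hN-∷ʳ zero    (y ∷ xs) x = begin
    hN 1 (y ∷ xs L.∷ʳ x)                              ≈⟨ hN-∷ 0 y (xs L.∷ʳ x) ⟩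
    hN 1 (xs L.∷ʳ x) + y * hN 0 (y ∷ xs L.∷ʳ x)       ≈⟨ +-cong (hN-∷ʳ 0 xs x) (*-congˡ (trans (hN-0 (y ∷ xs L.∷ʳ x)) (sym (hN-0 (y ∷ xs))))) ⟩
    hN 1 xs + x * hN 0 (xs L.∷ʳ x) + y * hN 0 (y ∷ xs) ≈⟨ solve 3 (λ a b c → a :+ b :+ c := a :+ c :+ b) refl _ _ _ ⟩
    hN 1 xs + y * hN 0 (y ∷ xs) + x * hN 0 (xs L.∷ʳ x)
      ≈⟨ +-cong (sym (hN-∷ 0 y xs)) (*-congˡ (trans (hN-0 (xs L.∷ʳ x)) (sym (hN-0 (y ∷ xs L.∷ʳ x))))) ⟩
    hN 1 (y ∷ xs) + x * hN 0 (y ∷ xs L.∷ʳ x) ∎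
  hN-∷ʳ (suc m) (y ∷ xs) x = begin
    hN (2 ℕ.+ m) (y ∷ xs L.∷ʳ x)                                       ≈⟨ hN-∷ (suc m) y (xs L.∷ʳ x) ⟩
    hN (2 ℕ.+ m) (xs L.∷ʳ x) + y * hN (suc m) (y ∷ xs L.∷ʳ x)          ≈⟨ +-cong (hN-∷ʳ (suc m) xs x) (*-congˡ (hN-∷ʳ m (y ∷ xs) x)) ⟩
    hN (2 ℕ.+ m) xs + x * hN (suc m) (xs L.∷ʳ x) + y * (hN (suc m) (y ∷ xs) + x * hN m (y ∷ xs L.∷ʳ x))
      ≈⟨ solve 6 (λ a x b y c d → a :+ x :* b :+ y :* (c :+ x :* d) := (a :+ y :* c) :+ x :* (b :+ y :* d)) refl _ _ _ _ _ _ ⟩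
    (hN (2 ℕ.+ m) xs + y * hN (suc m) (y ∷ xs)) + x * (hN (suc m) (xs L.∷ʳ x) + y * hN m (y ∷ xs L.∷ʳ x))
      ≈⟨ +-cong (hN-∷ (suc m) y xs) (*-congˡ (hN-∷ m y (xs L.∷ʳ x))) ⟨
    hN (2 ℕ.+ m) (y ∷ xs) + x * hN (suc m) (y ∷ xs L.∷ʳ x) ∎

  -- h (m - k), with the value 0 for m < k.
  hSub : List Carrier → ℕ → ℕ → Carrier
  hSub xs m       zero    = hN m xs
  hSub xs zero    (suc k) = 0#
  hSub xs (suc m) (suc k) = hSub xs m k

  hSub-diag : ∀ xs m → hSub xs m m ≈ 1#
  hSub-diag xs zero    = hN-0 xs
  hSub-diag xs (suc m) = hSub-diag xs m

  hSub-below : ∀ xs {m k} → m < k → hSub xs m k ≈ 0#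
  hSub-below xs {zero}  {suc k} _       = refl
  hSub-below xs {suc m} {suc k} (s≤s p) = hSub-below xs p

  hSub-+ : ∀ xs k m → hSub xs (k ℕ.+ m) k ≡ hN m xs
  hSub-+ xs zero    m = ≡.refl
  hSub-+ xs (suc k) m = hSub-+ xs k m

  hSub-∷ʳ : ∀ xs x m k → hSub (xs L.∷ʳ x) (suc m) k ≈ x * hSub (xs L.∷ʳ x) m k + hSub xs (suc m) k
  hSub-∷ʳ xs x m       zero          = trans (hN-∷ʳ m xs x) (+-comm _ _)
  hSub-∷ʳ xs x zero    (suc zero)    = trans (hN-0 (xs L.∷ʳ x)) (sym (trans (+-cong (zeroʳ x) (hN-0 xs)) (+-identityˡ _)))
  hSub-∷ʳ xs x zero    (suc (suc k)) = sym (trans (+-identityʳ _) (zeroʳ x))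
  hSub-∷ʳ xs x (suc m) (suc k)       = hSub-∷ʳ xs x m k

  -- The Jacobi-Trudi entry h(p_i - i + c), both indices from 0: for l + 1 rows the beta-number β is
  -- p_i + l - i, and subtracting l undoes the shift.
  hRow : List Carrier → ℕ → Matrix
  hRow xs l β c = hSub xs (β ℕ.+ c) l

  -- Consecutive beta-numbers are shifted by amounts that differ by one, so q_i ≥ p_(i+1) turns into
  -- γ_i > β_(i+1), while q_i ≤ p_i stays γ_i ≤ β_i. The exponents of x agree because p_i and q_i
  -- receive the same shift.
  strips-interlacing : ∀ x ps {f g : List ℕ → Carrier} → Linked ℕ._≥_ ps →
    (∀ qs → length qs ≡ length ps → Linked ℕ._≥_ qs → at qs 0 ≤ at ps 0 → f qs ≈ g (beta qs)) →
    strips x ps f ≈ interlacingSum x (beta ps) g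
  strips-interlacing x []       _   h = h [] ≡.refl [] z≤n
  strips-interlacing x (p ∷ []) {f} {g} _ h = begin
    Σ< (suc p) (λ q → x ^ (p ∸ q) * f (q ∷ []))
      ≈⟨ Σ<-cong< (suc p) (λ q q<1+p → *-congˡ (trans (h (q ∷ []) ≡.refl [-] (ℕ.≤-pred q<1+p))
           (≡⇒≈ (≡.cong (λ m → g (m ∷ [])) (ℕₚ.+-identityʳ q))))) ⟩
    Σ< (suc p) (λ q → x ^ (p ∸ q) * g (q ∷ []))
      ≡⟨ ≡.cong (λ m → Σ< (suc m) (λ q → x ^ (m ∸ q) * g (q ∷ []))) (ℕₚ.+-identityʳ p) ⟨
    Σ< (suc (p ℕ.+ 0)) (λ q → x ^ (p ℕ.+ 0 ∸ q) * g (q ∷ [])) ∎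
  strips-interlacing x (p ∷ p′ ∷ ps) {f} {g} (p≥p′ ∷ dec) h = begin
    Σ< (suc p) F                              ≈⟨ Σ<-drop p′ (suc p) F below ⟩
    Σ< (suc p ∸ p′) (λ s → F (p′ ℕ.+ s))      ≈⟨ Σ<-cong< (suc p ∸ p′) (λ s s< → term s (ℕ.≤-pred (<∸⇒+< s (suc p) p′ s<))) ⟩
    Σ< (suc p ∸ p′) G                         ≡⟨ ≡.cong (λ m → Σ< m G) count ⟨
    Σ< (p ℕ.+ suc l ∸ (p′ ℕ.+ l)) G           ∎
    where
    l : ℕ
    l = length ps
    F G : ℕ → Carrier
    F q = x ^ (p ∸ q) * (if p′ ≤ᵇ q then strips x (p′ ∷ ps) (λ qs → f (q ∷ qs)) else 0#)
    G s = x ^ (p ℕ.+ suc l ∸ suc (p′ ℕ.+ l ℕ.+ s)) * interlacingSum x (beta (p′ ∷ ps)) (λ γs → g (suc (p′ ℕ.+ l ℕ.+ s) ∷ γs))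
    count : p ℕ.+ suc l ∸ (p′ ℕ.+ l) ≡ suc p ∸ p′
    count = ≡.trans (≡.cong (_∸ (p′ ℕ.+ l)) (ℕₚ.+-suc p l)) ([m+n]∸[o+n]≡m∸o (suc p) l p′)
    swap-s : ∀ s → p′ ℕ.+ l ℕ.+ s ≡ p′ ℕ.+ s ℕ.+ l
    swap-s s = ≡.trans (ℕₚ.+-assoc p′ l s) (≡.trans (≡.cong (p′ ℕ.+_) (ℕₚ.+-comm l s)) (≡.sym (ℕₚ.+-assoc p′ s l)))
    below : ∀ i → i < p′ → F i ≈ 0#
    below i i<p′ rewrite ≤ᵇ-false i<p′ = zeroʳ _
    term : ∀ s → p′ ℕ.+ s ≤ p → F (p′ ℕ.+ s) ≈ G s
    term s q≤p rewrite ≤ᵇ-true (ℕₚ.m≤m+n p′ s) = *-cong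
      (≡⇒≈ (≡.cong (x ^_) (≡.sym (≡.trans (≡.cong₂ _∸_ (ℕₚ.+-suc p l) (≡.cong suc (swap-s s)))
        ([m+n]∸[o+n]≡m∸o p l (p′ ℕ.+ s))))))
      (strips-interlacing x (p′ ∷ ps) dec (λ qs e lqs hd → trans
        (h (p′ ℕ.+ s ∷ qs) (≡.cong suc e) (link-≥ (ℕₚ.≤-trans hd (ℕₚ.m≤m+n p′ s)) lqs) q≤p)
        (≡⇒≈ (≡.cong (λ m → g (m ∷ beta qs)) (≡.trans (≡.cong (p′ ℕ.+ s ℕ.+_) e)
          (≡.trans (ℕₚ.+-suc (p′ ℕ.+ s) l) (≡.cong suc (≡.sym (swap-s s)))))))))

  xAt-∷ʳ-old : ∀ xs x i → i ≤ length xs → xAt (xs L.∷ʳ x) i ≈ xAt xs i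
  xAt-∷ʳ-old []       x zero          _       = refl
  xAt-∷ʳ-old (y ∷ xs) x zero          _       = refl
  xAt-∷ʳ-old (y ∷ xs) x (suc zero)    _       = refl
  xAt-∷ʳ-old (y ∷ xs) x (suc (suc i)) (s≤s p) = xAt-∷ʳ-old xs x (suc i) p

  xAt-∷ʳ-new : ∀ xs x → xAt (xs L.∷ʳ x) (suc (length xs)) ≈ x
  xAt-∷ʳ-new []       x = refl
  xAt-∷ʳ-new (y ∷ xs) x = xAt-∷ʳ-new xs x

  schur-∷ʳ : ∀ ps xs x → Linked ℕ._≥_ ps → schur ps (xs L.∷ʳ x) ≈ strips x ps (λ qs → schur qs xs)
  schur-∷ʳ ps xs x dec = begin
    schur ps (xs L.∷ʳ x)                                       ≈⟨ schur-tableaux ps (xs L.∷ʳ x) ⟩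
    tableaux (length (xs L.∷ʳ x)) (xAt (xs L.∷ʳ x)) ps         ≡⟨ ≡.cong (λ m → tableaux m (xAt (xs L.∷ʳ x)) ps) (≡.trans (Lₚ.length-++ xs) (ℕₚ.+-comm (length xs) 1)) ⟩
    tableaux (suc (length xs)) (xAt (xs L.∷ʳ x)) ps
      ≈⟨ Branching.tableaux-branch (length xs) (xAt xs) (xAt (xs L.∷ʳ x)) x (xAt-∷ʳ-old xs x) (xAt-∷ʳ-new xs x) ps dec ⟩
    strips x ps (tableaux (length xs) (xAt xs))                ≈⟨ strips-cong x ps (λ qs → schur-tableaux qs xs) ⟨
    strips x ps (λ qs → schur qs xs)                           ∎

  module _ (l : ℕ) where

    private
      rows : List Carrier → List ℕ → List Row
      rows xs ps = L.map (hRow xs l) (beta ps)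

      length-rows : ∀ xs ps → length (rows xs ps) ≡ length ps
      length-rows xs ps = ≡.trans (Lₚ.length-map (hRow xs l) (beta ps)) (length-beta ps)

      open Alternating (detL-alternating (suc l))
      open AlternatingProperties (detL-alternating (suc l))

      -- Without variables h(m) is 0 for m > 0 and 1 for m = 0. A positive first part makes the
      -- first row zero and leaves no tableau; a partition of zeros has one tableau and an upper
      -- unitriangular matrix.
      schur-[] : ∀ p ps → length ps ≡ l → Linked ℕ._≥_ (p ∷ ps) → schur (p ∷ ps) [] ≈ detL (rows [] (p ∷ ps))
      schur-[] (suc p) ps e dec = trans (schur-tableaux (suc p ∷ ps) [])
        (sym (trans (cong< {ys = (λ _ → 0#) ∷ rows [] ps} (≡.trans (length-rows [] (suc p ∷ ps)) (≡.cong suc e)) (zero-row ∷ PW.refl (λ _ _ → refl))) (null [] (rows [] ps))))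
        where
        zero-row : hRow [] l (suc p ℕ.+ length ps) ≋[ suc l ] (λ _ → 0#)
        zero-row c _ rewrite e = trans (≡⇒≈ (≡.cong (λ m → hSub [] m l)
          (≡.trans (≡.cong (λ m → suc (m ℕ.+ c)) (ℕₚ.+-comm p l)) (≡.trans (≡.cong suc (ℕₚ.+-assoc l p c)) (≡.sym (ℕₚ.+-suc l (p ℕ.+ c)))))))
          (≡⇒≈ (hSub-+ [] l (suc (p ℕ.+ c))))
      schur-[] zero ps e dec = begin
        schur (0 ∷ ps) []                  ≈⟨ schur-tableaux (0 ∷ ps) [] ⟩
        1# * fillings 0 (xAt []) [] ps + 0#  ≈⟨ trans (+-identityʳ _) (trans (*-identityˡ _) (fillings-0 ps dec)) ⟩
        1#                                 ≈⟨ Det-upperUnitriangular (suc l) diag lower ⟨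
        Det (suc l) (nth (rows [] (0 ∷ ps))) ≡⟨ ≡.cong (λ m → Det m (nth (rows [] (0 ∷ ps)))) (≡.trans (length-rows [] (0 ∷ ps)) (≡.cong suc e)) ⟨
        detL (rows [] (0 ∷ ps))            ∎
        where
        fillings-0 : ∀ ps → Linked ℕ._≥_ (0 ∷ ps) → fillings 0 (xAt []) [] ps ≈ 1#
        fillings-0 []       _             = refl
        fillings-0 (_ ∷ ps) (z≤n ∷ dec′)  = trans (+-identityʳ _) (trans (*-identityˡ _) (fillings-0 ps dec′))
        nth-rows : ∀ ps → Linked ℕ._≥_ (0 ∷ ps) → ∀ i → i < length ps → nth (rows [] ps) i ≡ hRow [] l (length ps ∸ suc i)
        nth-rows (_ ∷ ps) (z≤n ∷ dec′) zero    _       = ≡.refl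
        nth-rows (_ ∷ ps) (z≤n ∷ dec′) (suc i) (s≤s p) = nth-rows ps dec′ i p
        entry : ∀ i j → i < suc l → nth (rows [] (0 ∷ ps)) i j ≡ hSub [] (l ∸ i ℕ.+ j) l
        entry i j i<l = ≡.trans (≡.cong (λ ρ → ρ j) (nth-rows (0 ∷ ps) (z≤n ∷ dec) i (≡.subst (λ m → i < suc m) (≡.sym e) i<l)))
          (≡.cong (λ m → hSub [] (m ∸ i ℕ.+ j) l) e)
        diag : ∀ i → i < suc l → nth (rows [] (0 ∷ ps)) i i ≈ 1#
        diag i i<l = trans (≡⇒≈ (≡.trans (entry i i i<l) (≡.cong (λ m → hSub [] m l) (ℕₚ.m∸n+n≡m (ℕ.≤-pred i<l))))) (hSub-diag [] l)
        lower : ∀ i j → j < i → i < suc l → nth (rows [] (0 ∷ ps)) i j ≈ 0#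
        lower i j j<i i<l = trans (≡⇒≈ (entry i j i<l)) (hSub-below []
          (≡.subst (l ∸ i ℕ.+ j <_) (ℕₚ.m∸n+n≡m (ℕ.≤-pred i<l)) (ℕₚ.+-monoʳ-< (l ∸ i) j<i)))

    jacobi-trudi : ∀ xs ps → length ps ≡ suc l → Linked ℕ._≥_ ps → schur ps xs ≈ detL (L.map (hRow xs l) (beta ps))
    jacobi-trudi xs = go (reverseView xs)
      where
      -- The entries h(c - l) with c ≤ l are 0 or 1 for any variables. In later columns they depend
      -- on the variables, hence the equality on the first l + 1 columns.
      first-row : ∀ xs ys → hRow xs l 0 ≋[ suc l ] hRow ys l 0
      first-row xs ys c (s≤s c≤l) with ℕₚ.m≤n⇒m<n∨m≡n c≤l
      ... | inj₁ c<l    = trans (hSub-below xs c<l) (sym (hSub-below ys c<l))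
      ... | inj₂ ≡.refl = trans (hSub-diag xs c) (sym (hSub-diag ys c))
      go : ∀ {xs} → Reverse xs → ∀ ps → length ps ≡ suc l → Linked ℕ._≥_ ps → schur ps xs ≈ detL (L.map (hRow xs l) (beta ps))
      go []               (p ∷ ps) e dec = schur-[] p ps (ℕₚ.suc-injective e) dec
      go (xs ∶ rs ∶ʳ x)   ps e dec = begin
        schur ps xs⁺                       ≈⟨ schur-∷ʳ ps xs x dec ⟩
        strips x ps (λ qs → schur qs xs)
          ≈⟨ strips-interlacing x ps dec (λ qs e′ dec′ _ → trans (go rs qs (≡.trans e′ e) dec′)
               (≡⇒≈ (≡.cong detL (≡.sym (Lₚ.++-identityʳ (L.map (hRow xs l) (beta qs))))))) ⟩
        interlacingSum x (beta ps) (λ γs → detL (L.map (hRow xs l) γs ++ []))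
          ≈⟨ interlacing-expansion x (hRow xs⁺ l) (hRow xs l) (λ b c → hSub-∷ʳ xs x (b ℕ.+ c) l) (detL-alternating (suc l))
               (first-row xs⁺ xs) [] (beta ps) [] (beta-decreasing dec)
               (≡.trans (≡.cong length (Lₚ.++-identityʳ (rows xs⁺ ps))) (≡.trans (length-rows xs⁺ ps) e)) ⟨
        detL (L.map (hRow xs⁺ l) (beta ps) ++ [])  ≡⟨ ≡.cong detL (Lₚ.++-identityʳ (L.map (hRow xs⁺ l) (beta ps))) ⟩
        detL (L.map (hRow xs⁺ l) (beta ps))        ∎
        where
        xs⁺ : List Carrier
        xs⁺ = xs L.∷ʳ x

  fillings-zeros : ∀ N f prev ps → Linked ℕ._≥_ (0 ∷ ps) → fillings N f prev ps ≈ 1#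
  fillings-zeros N f prev []       _           = refl
  fillings-zeros N f prev (_ ∷ ps) (z≤n ∷ dec) = trans (+-identityʳ _) (trans (*-identityˡ _) (fillings-zeros N f [] ps dec))

  fillings-removeZeros : ∀ N f prev ps → Linked ℕ._≥_ ps → fillings N f prev (removeZeros ps) ≈ fillings N f prev ps
  fillings-removeZeros N f prev []           dec = refl
  fillings-removeZeros N f prev (zero ∷ ps)  dec rewrite removeZeros-zeros dec = sym (fillings-zeros N f prev (0 ∷ ps) (z≤n ∷ dec))
  fillings-removeZeros N f prev (suc p ∷ ps) dec = ΣL-cong (incLists (suc p) 1 N) (λ row _ →
    if-cong (rowOk prev row) (*-congˡ (fillings-removeZeros N f row ps (Linked.tail dec))))

  schur-removeZeros : ∀ ps xs → Linked ℕ._≥_ ps → schur (removeZeros ps) xs ≈ schur ps xs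
  schur-removeZeros ps xs dec = trans (schur-tableaux (removeZeros ps) xs) (trans (go ps dec) (sym (schur-tableaux ps xs)))
    where
    N : ℕ
    N = length xs
    f : ℕ → Carrier
    f = xAt xs
    go : ∀ ps → Linked ℕ._≥_ ps → tableaux N f (removeZeros ps) ≈ tableaux N f ps
    go []           dec = refl
    go (zero ∷ ps)  dec rewrite removeZeros-zeros dec = sym (trans (+-identityʳ _) (trans (*-identityˡ _) (fillings-zeros N f [] ps dec)))
    go (suc p ∷ ps) dec = ΣL-cong (incLists (suc p) 1 N) (λ row _ → *-congˡ (fillings-removeZeros N f row ps (Linked.tail dec)))

  hSub-+ˡ : ∀ xs k m n → hSub xs (k ℕ.+ m) (k ℕ.+ n) ≡ hSub xs m n
  hSub-+ˡ xs zero    m n = ≡.refl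
  hSub-+ˡ xs (suc k) m n = hSub-+ˡ xs k m n

  module _ (xs : List Carrier) where

    -- `X a` is the row h(a + 1 + c) of an arm, `U q` the row h(c - q) of the vacuum, that is, of
    -- the matrix of the empty partition. Neither depends on the size, so the determinants of all
    -- shapes draw on the same rows.
    U X : Matrix
    U q c = hSub xs c q
    X a c = hN (suc (a ℕ.+ c)) xs

    hRow-X : ∀ l a → hRow xs l (a ℕ.+ suc l) ≋ X a
    hRow-X l a c = ≡⇒≈ (≡.trans (≡.cong (λ m → hSub xs m l)
      (≡.trans (≡.cong (ℕ._+ c) (≡.trans (ℕₚ.+-comm a (suc l)) (≡.sym (ℕₚ.+-suc l a)))) (ℕₚ.+-assoc l (suc a) c)))
      (hSub-+ xs l (suc (a ℕ.+ c))))

    hRow-U : ∀ l q → q ≤ l → hRow xs l (l ∸ q) ≋ U q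
    hRow-U l q q≤l c = ≡⇒≈ (≡.trans (≡.cong (hSub xs (l ∸ q ℕ.+ c)) (≡.sym (ℕₚ.m∸n+n≡m q≤l))) (hSub-+ˡ xs (l ∸ q) c q))

    -- In the padded shape the arms have beta-numbers a + k + n, which give the rows `X a`, and the
    -- positions q not occupied by legs give the rows `U q`.
    schur-fromFrob : ∀ k {n cs} (s : Sub n cs) as → length as ≡ length cs → Linked ℕ._>_ as → 1 ≤ k ℕ.+ n →
      schur (fromFrob as (legs k cs)) xs ≈ detL (L.map X as ++ L.map U (vac k s))
    schur-fromFrob k {n} {cs} s as e dec pos = begin
      schur (fromFrob as (legs k cs)) xs       ≡⟨ ≡.cong (λ ps → schur ps xs) (fromFrob-shape k s as e pos) ⟩
      schur (removeZeros (shape k s as)) xs    ≈⟨ schur-removeZeros (shape k s as) xs dec′ ⟩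
      schur (shape k s as) xs                  ≈⟨ jacobi-trudi l xs (shape k s as) (≡.trans (length-shape k s as e) (≡.sym sl)) dec′ ⟩
      detL (L.map (hRow xs l) (beta (shape k s as)))
        ≡⟨ ≡.cong (detL ∘ L.map (hRow xs l)) (beta-shape k s as e) ⟩
      detL (L.map (hRow xs l) (L.map (λ a → a ℕ.+ (k ℕ.+ n)) as ++ L.map (λ q → l ∸ q) (vac k s)))
        ≡⟨ ≡.cong detL (Lₚ.map-++ (hRow xs l) (L.map (λ a → a ℕ.+ (k ℕ.+ n)) as) _) ⟩
      detL (L.map (hRow xs l) (L.map (λ a → a ℕ.+ (k ℕ.+ n)) as) ++ L.map (hRow xs l) (L.map (λ q → l ∸ q) (vac k s)))
        ≈⟨ Alternating.cong (detL-alternating 0) (PW.++⁺ (arms as) (vacs (vac k s) (vac-< k s))) ⟩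
      detL (L.map X as ++ L.map U (vac k s)) ∎
      where
      l : ℕ
      l = k ℕ.+ n ∸ 1
      sl : suc l ≡ k ℕ.+ n
      sl = ℕₚ.m+[n∸m]≡n pos
      dec′ : Linked ℕ._≥_ (shape k s as)
      dec′ = shape-decreasing k s as e dec
      arms : ∀ as → Pointwise _≋_ (L.map (hRow xs l) (L.map (λ a → a ℕ.+ (k ℕ.+ n)) as)) (L.map X as)
      arms []       = []
      arms (a ∷ as) = (λ c → trans (≡⇒≈ (≡.cong (λ m → hRow xs l (a ℕ.+ m) c) (≡.sym sl))) (hRow-X l a c)) ∷ arms as
      vacs : ∀ qs → All (_< k ℕ.+ n) qs → Pointwise _≋_ (L.map (hRow xs l) (L.map (λ q → l ∸ q) qs)) (L.map U qs)
      vacs []       _        = []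
      vacs (q ∷ qs) (p ∷ ps) = hRow-U l q (ℕ.≤-pred (≡.subst (q <_) (≡.sym sl) p)) ∷ vacs qs ps

-- Hook Schur functions

module Hooks {c ℓ} (R : CommutativeRing c ℓ) (r u v w u′ v′ w′ : CommutativeRing.Carrier R) where

  open import Data.Integer as ℤ using (ℤ; +_; -[1+_])
  open Preliminaries
  open Shapes
  open RingSums R
  open Determinant R
  open JacobiTrudi R r u v w u′ v′ w′
  open Sym R r u v w u′ v′ w′ using (eN; hN; schur; hook)

  -- In generating functions the new factor 1/(1 + yz) of H(-z) cancels the new factor 1 + yz of
  -- E(z). On coefficients, the recursions of e and h each produce y times the sum B, with opposite
  -- signs.
  he-∷ : ∀ y ys m → Σ< (suc (suc m)) (λ t → sg t * hN t (y ∷ ys) * eN (suc m ∸ t) (y ∷ ys))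
                  ≈ Σ< (suc (suc m)) (λ t → sg t * hN t ys * eN (suc m ∸ t) ys)
  he-∷ y ys m = begin
    Σ< (suc (suc m)) (λ t → sg t * h⁺ t * e⁺ (suc m ∸ t))
      ≈⟨ Σ<-last (suc m) _ ⟩
    Σ< (suc m) (λ t → sg t * h⁺ t * e⁺ (suc m ∸ t)) + sg (suc m) * h⁺ (suc m) * e⁺ (suc m ∸ suc m)
      ≈⟨ +-cong (Σ<-cong< (suc m) (λ t t<1+m → begin
           sg t * h⁺ t * e⁺ (suc m ∸ t)               ≡⟨ ≡.cong (λ k → sg t * h⁺ t * e⁺ k) (ℕₚ.+-∸-assoc 1 (ℕ.≤-pred t<1+m)) ⟩
           sg t * h⁺ t * (e₀ (suc (m ∸ t)) + y * e₀ (m ∸ t)) ≡⟨ ≡.cong (λ k → sg t * h⁺ t * (e₀ k + y * e₀ (m ∸ t))) (≡.sym (ℕₚ.+-∸-assoc 1 (ℕ.≤-pred t<1+m))) ⟩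
           sg t * h⁺ t * (e₀ (suc m ∸ t) + y * e₀ (m ∸ t)) ≈⟨ solve 4 (λ s a y b → s :* (a :+ y :* b) := s :* a :+ y :* (s :* b)) refl _ _ _ _ ⟩
           sg t * h⁺ t * e₀ (suc m ∸ t) + y * (sg t * h⁺ t * e₀ (m ∸ t)) ∎))
         (*-congˡ (≡⇒≈ (≡.trans (≡.cong e⁺ (ℕₚ.n∸n≡0 m)) (≡.cong e₀ (≡.sym (ℕₚ.n∸n≡0 m)))))) ⟩
    Σ< (suc m) (λ t → sg t * h⁺ t * e₀ (suc m ∸ t) + y * (sg t * h⁺ t * e₀ (m ∸ t))) + sg (suc m) * h⁺ (suc m) * e₀ (suc m ∸ suc m)
      ≈⟨ +-congʳ (trans (Σ<-+ (suc m) _ _) (+-congˡ (Σ<-*ˡ (suc m) y _))) ⟩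
    (Σ< (suc m) (λ t → sg t * h⁺ t * e₀ (suc m ∸ t)) + y * B) + sg (suc m) * h⁺ (suc m) * e₀ (suc m ∸ suc m)
      ≈⟨ solve 3 (λ a b c → (a :+ b) :+ c := (a :+ c) :+ b) refl _ _ _ ⟩
    (Σ< (suc m) (λ t → sg t * h⁺ t * e₀ (suc m ∸ t)) + sg (suc m) * h⁺ (suc m) * e₀ (suc m ∸ suc m)) + y * B
      ≈⟨ +-congʳ (Σ<-last (suc m) (λ t → sg t * h⁺ t * e₀ (suc m ∸ t))) ⟨
    Σ< (suc (suc m)) (λ t → sg t * h⁺ t * e₀ (suc m ∸ t)) + y * B
      ≈⟨ +-congʳ (Σ<-suc (suc m) _) ⟩
    (1# * h⁺ 0 * e₀ (suc m) + Σ< (suc m) (λ t → sg (suc t) * h⁺ (suc t) * e₀ (m ∸ t))) + y * B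
      ≈⟨ +-congʳ (+-cong (*-congʳ (*-congˡ (trans (hN-0 (y ∷ ys)) (sym (hN-0 ys))))) (Σ<-cong (suc m) (λ t → begin
           sg (suc t) * h⁺ (suc t) * e₀ (m ∸ t)             ≈⟨ *-congʳ (*-congˡ (hN-∷ t y ys)) ⟩
           sg (suc t) * (h₀ (suc t) + y * h⁺ t) * e₀ (m ∸ t) ≈⟨ solve 6 (λ ε s a y b e → ε :* s :* (a :+ y :* b) :* e := ε :* s :* a :* e :+ ε :* y :* (s :* b :* e)) refl _ _ _ _ _ _ ⟩
           sg (suc t) * h₀ (suc t) * e₀ (m ∸ t) + ε * y * (sg t * h⁺ t * e₀ (m ∸ t)) ∎))) ⟩
    (1# * h₀ 0 * e₀ (suc m) + Σ< (suc m) (λ t → sg (suc t) * h₀ (suc t) * e₀ (m ∸ t) + ε * y * (sg t * h⁺ t * e₀ (m ∸ t)))) + y * B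
      ≈⟨ +-congʳ (+-congˡ (trans (Σ<-+ (suc m) _ _) (+-congˡ (Σ<-*ˡ (suc m) (ε * y) _)))) ⟩
    (1# * h₀ 0 * e₀ (suc m) + (Σ< (suc m) (λ t → sg (suc t) * h₀ (suc t) * e₀ (m ∸ t)) + ε * y * B)) + y * B
      ≈⟨ solve 5 (λ a b ε y B → (a :+ (b :+ ε :* y :* B)) :+ y :* B := (a :+ b) :+ (ε :* (y :* B) :+ y :* B)) refl _ _ _ _ _ ⟩
    (1# * h₀ 0 * e₀ (suc m) + Σ< (suc m) (λ t → sg (suc t) * h₀ (suc t) * e₀ (m ∸ t))) + (ε * (y * B) + y * B)
      ≈⟨ trans (+-congˡ (εx+x≈0 (y * B))) (+-identityʳ _) ⟩
    1# * h₀ 0 * e₀ (suc m) + Σ< (suc m) (λ t → sg (suc t) * h₀ (suc t) * e₀ (m ∸ t))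
      ≈⟨ Σ<-suc (suc m) _ ⟨
    Σ< (suc (suc m)) (λ t → sg t * h₀ t * e₀ (suc m ∸ t)) ∎
    where
    h⁺ e⁺ h₀ e₀ : ℕ → Carrier
    h⁺ t = hN t (y ∷ ys)
    e⁺ t = eN t (y ∷ ys)
    h₀ t = hN t ys
    e₀ t = eN t ys
    B : Carrier
    B = Σ< (suc m) (λ t → sg t * h⁺ t * e₀ (m ∸ t))

  he-orthogonal : ∀ xs m → Σ< (suc (suc m)) (λ t → sg t * hN t xs * eN (suc m ∸ t) xs) ≈ 0#
  he-orthogonal []       m = trans (Σ<-suc (suc m) _)
    (trans (+-cong (zeroʳ _) (Σ<-zero (suc m) (λ t _ → trans (*-congʳ (zeroʳ _)) (zeroˡ _)))) (+-identityˡ 0#))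
  he-orthogonal (y ∷ ys) m = trans (he-∷ y ys m) (he-orthogonal ys m)

  module HookFormulas (xs : List Carrier) where

    private
      h e : ℕ → Carrier
      h m = hN m xs
      e m = eN m xs

    -- The hook Schur function s_(a|b), obtained by solving Pieri's rule h_m e_n = s_(m-1|n) +
    -- s_(m|n-1) for the hook; `hook-hk` identifies it with the tableau sum.
    hk : ℕ → ℕ → Carrier
    hk a b = Σ< (suc b) (λ t → sg t * h (suc (a ℕ.+ t)) * e (b ∸ t))

    hk-0 : ∀ a → hk a 0 ≈ h (suc a)
    hk-0 a = trans (Σ<-suc 0 _) (trans (+-cong (trans (*-identityʳ _) (trans (*-identityˡ _) (≡⇒≈ (≡.cong (h ∘ suc) (ℕₚ.+-identityʳ a))))) (Σ<-0 _)) (+-identityʳ _))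

    hk-suc : ∀ a b → hk a (suc b) ≈ h (suc a) * e (suc b) + ε * hk (suc a) b
    hk-suc a b = begin
      Σ< (suc (suc b)) (λ t → sg t * h (suc (a ℕ.+ t)) * e (suc b ∸ t))  ≈⟨ Σ<-suc (suc b) _ ⟩
      1# * h (suc (a ℕ.+ 0)) * e (suc b) + Σ< (suc b) (λ t → sg (suc t) * h (suc (a ℕ.+ suc t)) * e (b ∸ t))
        ≈⟨ +-cong (*-congʳ (trans (*-identityˡ _) (≡⇒≈ (≡.cong (h ∘ suc) (ℕₚ.+-identityʳ a)))))
             (trans (Σ<-cong (suc b) (λ t → trans (*-congʳ (*-congˡ (≡⇒≈ (≡.cong (h ∘ suc) (ℕₚ.+-suc a t)))))
               (solve 4 (λ ε s a b → ε :* s :* a :* b := ε :* (s :* a :* b)) refl _ _ _ _))) (Σ<-*ˡ (suc b) ε _)) ⟩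
      h (suc a) * e (suc b) + ε * hk (suc a) b ∎

    hk-0ˡ : ∀ b → hk 0 b ≈ e (suc b)
    hk-0ˡ b = begin
      hk 0 b                     ≈⟨ sg-cancel 1 _ ⟨
      (ε * 1#) * ((ε * 1#) * hk 0 b) ≈⟨ *-cong (*-identityʳ ε) (*-congʳ (*-identityʳ ε)) ⟩
      ε * (ε * hk 0 b)           ≈⟨ +-unique-ε total ⟨
      e (suc b)                  ∎
      where
      total : e (suc b) + ε * hk 0 b ≈ 0#
      total = begin
        e (suc b) + ε * hk 0 b
          ≈⟨ +-cong (trans (*-congʳ (trans (*-identityˡ _) (hN-0 xs))) (*-identityˡ _))
               (trans (Σ<-cong (suc b) (λ t → solve 4 (λ ε s a b → ε :* s :* a :* b := ε :* (s :* a :* b)) refl _ _ _ _)) (Σ<-*ˡ (suc b) ε _)) ⟨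
        1# * h 0 * e (suc b) + Σ< (suc b) (λ t → sg (suc t) * h (suc t) * e (b ∸ t)) ≈⟨ Σ<-suc (suc b) _ ⟨
        Σ< (suc (suc b)) (λ t → sg t * h t * e (suc b ∸ t)) ≈⟨ he-orthogonal xs b ⟩
        0# ∎

    hk-sucˡ : ∀ a b → hk (suc a) b ≈ ε * hk a (suc b) + h (suc a) * e (suc b)
    hk-sucˡ a b = begin
      hk (suc a) b                                        ≈⟨ +-identityʳ _ ⟨
      hk (suc a) b + 0#                                   ≈⟨ +-congˡ (εx+x≈0 p) ⟨
      hk (suc a) b + (ε * p + p)                          ≈⟨ +-congʳ (trans (*-congʳ ε*ε≈1) (*-identityˡ _)) ⟨
      (ε * ε) * hk (suc a) b + (ε * p + p)                ≈⟨ solve 3 (λ ε k p → (ε :* ε) :* k :+ (ε :* p :+ p) := ε :* (p :+ ε :* k) :+ p) refl _ _ _ ⟩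
      ε * (p + ε * hk (suc a) b) + p                      ≈⟨ +-congʳ (*-congˡ (hk-suc a b)) ⟨
      ε * hk a (suc b) + p                                ∎
      where
      p : Carrier
      p = h (suc a) * e (suc b)

    eh-orthogonal : ∀ m → Σ< (suc (suc m)) (λ t → sg t * e t * h (suc m ∸ t)) ≈ 0#
    eh-orthogonal m = begin
      Σ< (suc (suc m)) (λ t → sg t * e t * h (suc m ∸ t))   ≈⟨ Σ<-reverse (suc m) _ ⟩
      Σ< (suc (suc m)) (λ t → sg (suc m ∸ t) * e (suc m ∸ t) * h (suc m ∸ (suc m ∸ t)))
        ≈⟨ Σ<-cong< (suc (suc m)) (λ t t< → trans (*-cong (*-congʳ (sg-∸ (ℕ.≤-pred t<))) (≡⇒≈ (≡.cong h (ℕₚ.m∸[m∸n]≡n (ℕ.≤-pred t<)))))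
             (solve 4 (λ a b c d → a :* b :* c :* d := a :* (b :* d :* c)) refl _ _ _ _)) ⟩
      Σ< (suc (suc m)) (λ t → sg (suc m) * (sg t * h t * e (suc m ∸ t))) ≈⟨ Σ<-*ˡ (suc (suc m)) _ _ ⟩
      sg (suc m) * Σ< (suc (suc m)) (λ t → sg t * h t * e (suc m ∸ t))   ≈⟨ trans (*-congˡ (he-orthogonal xs m)) (zeroʳ _) ⟩
      0# ∎

    -- Induction on m for all a at once. By `hk-suc` the sum for (a, m + 1) is h(a + 1) times an
    -- alternating sum of e h, which vanishes, plus the sum for (a + 1, m).
    h-expand : ∀ a m → h (suc (a ℕ.+ m)) ≈ Σ< (suc m) (λ q → sg q * hk a q * h (m ∸ q))
    h-expand a zero = sym (trans (Σ<-suc 0 _) (trans (+-cong (trans (*-cong (trans (*-identityˡ _) (hk-0 a)) (hN-0 xs)) (*-identityʳ _)) (Σ<-0 _))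
      (trans (+-identityʳ _) (≡⇒≈ (≡.cong (h ∘ suc) (≡.sym (ℕₚ.+-identityʳ a)))))))
    h-expand a (suc m) = sym (begin
      Σ< (suc (suc m)) (λ q → sg q * hk a q * h (suc m ∸ q))  ≈⟨ Σ<-suc (suc m) _ ⟩
      1# * hk a 0 * h (suc m) + Σ< (suc m) (λ q → sg (suc q) * hk a (suc q) * h (m ∸ q))
        ≈⟨ +-cong (*-congʳ (trans (*-identityˡ _) (hk-0 a))) (Σ<-cong (suc m) (λ q → trans (*-congʳ (*-congˡ (hk-suc a q)))
             (solve 6 (λ ε s a e k b → ε :* s :* (a :* e :+ ε :* k) :* b := a :* (ε :* s :* e :* b) :+ (ε :* ε) :* (s :* k :* b)) refl _ _ _ _ _ _))) ⟩
      h (suc a) * h (suc m) + Σ< (suc m) (λ q → h (suc a) * (sg (suc q) * e (suc q) * h (m ∸ q)) + (ε * ε) * (sg q * hk (suc a) q * h (m ∸ q)))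
        ≈⟨ +-congˡ (trans (Σ<-+ (suc m) _ _) (+-cong (Σ<-*ˡ (suc m) _ _) (trans (Σ<-*ˡ (suc m) _ _) (trans (*-congʳ ε*ε≈1) (*-identityˡ _))))) ⟩
      h (suc a) * h (suc m) + (h (suc a) * Σ< (suc m) (λ q → sg (suc q) * e (suc q) * h (m ∸ q)) + Σ< (suc m) (λ q → sg q * hk (suc a) q * h (m ∸ q)))
        ≈⟨ solve 4 (λ a b s t → a :* b :+ (a :* s :+ t) := a :* (b :+ s) :+ t) refl _ _ _ _ ⟩
      h (suc a) * (h (suc m) + Σ< (suc m) (λ q → sg (suc q) * e (suc q) * h (m ∸ q))) + Σ< (suc m) (λ q → sg q * hk (suc a) q * h (m ∸ q))
        ≈⟨ +-cong (*-congˡ (trans (+-congʳ (sym (trans (*-congʳ (*-identityˡ _)) (*-identityˡ _)))) (trans (sym (Σ<-suc (suc m) _)) (eh-orthogonal m))))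
             (sym (h-expand (suc a) m)) ⟩
      h (suc a) * 0# + h (suc (suc a ℕ.+ m))  ≈⟨ trans (+-congʳ (zeroʳ _)) (+-identityˡ _) ⟩
      h (suc (suc a ℕ.+ m))                   ≡⟨ ≡.cong (h ∘ suc) (≡.sym (ℕₚ.+-suc a m)) ⟩
      h (suc (a ℕ.+ suc m))                   ∎)

    -- The dual argument: `hk-sucˡ` lowers the arm, and the sum that vanishes is the one with h and
    -- e exchanged.
    e-expand : ∀ b m → e (suc (b ℕ.+ m)) ≈ Σ< (suc m) (λ a → sg a * hk a b * e (m ∸ a))
    e-expand b zero = sym (trans (Σ<-suc 0 _) (trans (+-cong (trans (*-identityʳ _) (trans (*-identityˡ _) (hk-0ˡ b))) (Σ<-0 _))
      (trans (+-identityʳ _) (≡⇒≈ (≡.cong (e ∘ suc) (≡.sym (ℕₚ.+-identityʳ b)))))))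
    e-expand b (suc m) = sym (begin
      Σ< (suc (suc m)) (λ a → sg a * hk a b * e (suc m ∸ a))  ≈⟨ Σ<-suc (suc m) _ ⟩
      1# * hk 0 b * e (suc m) + Σ< (suc m) (λ a → sg (suc a) * hk (suc a) b * e (m ∸ a))
        ≈⟨ +-cong (*-congʳ (trans (*-identityˡ _) (hk-0ˡ b))) (Σ<-cong (suc m) (λ a → trans (*-congʳ (*-congˡ (hk-sucˡ a b)))
             (solve 6 (λ ε s k a e b → ε :* s :* (ε :* k :+ a :* e) :* b := e :* (ε :* s :* a :* b) :+ (ε :* ε) :* (s :* k :* b)) refl _ _ _ _ _ _))) ⟩
      e (suc b) * e (suc m) + Σ< (suc m) (λ a → e (suc b) * (sg (suc a) * h (suc a) * e (m ∸ a)) + (ε * ε) * (sg a * hk a (suc b) * e (m ∸ a)))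
        ≈⟨ +-congˡ (trans (Σ<-+ (suc m) _ _) (+-cong (Σ<-*ˡ (suc m) _ _) (trans (Σ<-*ˡ (suc m) _ _) (trans (*-congʳ ε*ε≈1) (*-identityˡ _))))) ⟩
      e (suc b) * e (suc m) + (e (suc b) * Σ< (suc m) (λ a → sg (suc a) * h (suc a) * e (m ∸ a)) + Σ< (suc m) (λ a → sg a * hk a (suc b) * e (m ∸ a)))
        ≈⟨ solve 4 (λ a b s t → a :* b :+ (a :* s :+ t) := a :* (b :+ s) :+ t) refl _ _ _ _ ⟩
      e (suc b) * (e (suc m) + Σ< (suc m) (λ a → sg (suc a) * h (suc a) * e (m ∸ a))) + Σ< (suc m) (λ a → sg a * hk a (suc b) * e (m ∸ a))
        ≈⟨ +-cong (*-congˡ (trans (+-congʳ (sym (trans (*-congʳ (trans (*-identityˡ _) (hN-0 xs))) (*-identityˡ _)))) (trans (sym (Σ<-suc (suc m) _)) (he-orthogonal xs m))))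
             (sym (e-expand (suc b) m)) ⟩
      e (suc b) * 0# + e (suc (suc b ℕ.+ m))  ≈⟨ trans (+-congʳ (zeroʳ _)) (+-identityˡ _) ⟩
      e (suc (suc b ℕ.+ m))                   ≡⟨ ≡.cong (e ∘ suc) (≡.sym (ℕₚ.+-suc b m)) ⟩
      e (suc (b ℕ.+ suc m))                   ∎)

    -- Makes the range of summation independent of the column c, so that arm rows become linear
    -- combinations of vacuum rows in a matrix with L columns.
    X-expand : ∀ L a c → c < L → X xs a c ≈ Σ< L (λ q → sg q * hk a q * U xs q c)
    X-expand L a c c<L = begin
      h (suc (a ℕ.+ c))                              ≈⟨ h-expand a c ⟩
      Σ< (suc c) (λ q → sg q * hk a q * h (c ∸ q))
        ≈⟨ Σ<-cong< (suc c) (λ q q<1+c → *-congˡ (≡⇒≈ (sub c q (ℕ.≤-pred q<1+c)))) ⟩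
      Σ< (suc c) (λ q → sg q * hk a q * U xs q c)
        ≈⟨ Σ<-extend (λ q → sg q * hk a q * U xs q c) c<L (λ q c<q _ → trans (*-congˡ (hSub-below xs c<q)) (zeroʳ _)) ⟩
      Σ< L (λ q → sg q * hk a q * U xs q c) ∎
      where
      sub : ∀ c q → q ≤ c → h (c ∸ q) ≡ hSub xs c q
      sub c       zero    _       = ≡.refl
      sub (suc c) (suc q) (s≤s p) = sub c q p

    private
      hooks-sub : ∀ b → Sub (suc b) (suc b ∷ [])
      hooks-sub b = take (empty b)
        where
        empty : ∀ b → Sub b []
        empty zero    = none
        empty (suc b) = omit (empty b)

      vac-empty : ∀ b (s : Sub b []) → vac 0 s ≡ upTo b
      vac-empty zero    none     = ≡.refl
      vac-empty (suc b) (omit s) = ≡.trans (≡.cong (_++ b ∷ []) (vac-empty b s)) (Lₚ.upTo-∷ʳ b)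

      vac-hook : ∀ b (s : Sub (suc b) (suc b ∷ [])) → vac 0 s ≡ upTo b
      vac-hook b (omit s) with () ← ℕₚ.1+n≰n (Sub-head s)
      vac-hook b (take s) = vac-empty b s

    -- The arm row is expanded in vacuum rows. Those with q < b already occur in the matrix, so only
    -- q = b survives; its sign (-1)^b cancels against that of moving `U b` to the last place.
    hook-hk : ∀ a b → hook (+ a) (+ b) xs ≈ hk a b
    hook-hk a b = begin
      schur (fromFrob (a ∷ []) (b ∷ [])) xs
        ≈⟨ schur-fromFrob xs 0 s (a ∷ []) ≡.refl [-] (s≤s z≤n) ⟩
      detL (X xs a ∷ L.map (U xs) (vac 0 s))
        ≡⟨ ≡.cong (λ qs → detL (X xs a ∷ L.map (U xs) qs)) (vac-hook b s) ⟩
      detL (X xs a ∷ Us)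
        ≈⟨ cong< {X xs a ∷ Us} {_ ∷ Us} (≡.cong suc len) ((λ c c< → X-expand (suc b) a c c<) ∷ PW.refl (λ _ _ → refl)) ⟩
      detL ((λ c → Σ< (suc b) (λ q → sg q * hk a q * U xs q c)) ∷ Us)
        ≈⟨ linear-Σ [] (suc b) (λ q → sg q * hk a q) (U xs) Us ⟩
      Σ< (suc b) (λ q → sg q * hk a q * detL (U xs q ∷ Us))
        ≈⟨ Σ<-single (suc b) b ℕₚ.≤-refl (λ q q< q≢b → trans (*-congˡ (repeated q (ℕₚ.≤∧≢⇒< (ℕ.≤-pred q<) q≢b))) (zeroʳ _)) ⟩
      sg b * hk a b * detL (U xs b ∷ Us)  ≈⟨ *-congˡ front ⟩
      sg b * hk a b * sg b                ≈⟨ solve 2 (λ s k → s :* k :* s := s :* (s :* k)) refl _ _ ⟩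
      sg b * (sg b * hk a b)              ≈⟨ sg-cancel b _ ⟩
      hk a b                              ∎
      where
      open Alternating (detL-alternating (suc b))
      open AlternatingProperties (detL-alternating (suc b))
      s : Sub (suc b) (suc b ∷ [])
      s = hooks-sub b
      Us : List Row
      Us = L.map (U xs) (upTo b)
      len : length Us ≡ b
      len = ≡.trans (Lₚ.length-map (U xs) (upTo b)) (Lₚ.length-upTo b)
      repeated : ∀ q → q < b → detL (U xs q ∷ Us) ≈ 0#
      repeated q q<b with applyUpTo-skip (U xs) {q} {b ∸ 1} (ℕₚ.<⇒≤pred q<b)
      ... | p , p′ , _ , e₂ , _ = begin
        detL (U xs q ∷ Us)                           ≡⟨ ≡.cong (λ ys → detL (U xs q ∷ ys)) (Lₚ.map-applyUpTo id (U xs) b) ⟩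
        detL (U xs q ∷ applyUpTo (U xs) b)           ≡⟨ ≡.cong (λ m → detL (U xs q ∷ applyUpTo (U xs) m)) (≡.sym (ℕₚ.m+[n∸m]≡n {1} {b} (ℕₚ.≤-trans (s≤s z≤n) q<b))) ⟩
        detL (U xs q ∷ applyUpTo (U xs) (suc (b ∸ 1))) ≡⟨ ≡.cong (λ ys → detL (U xs q ∷ ys)) e₂ ⟩
        detL (U xs q ∷ p ++ U xs q ∷ p′)             ≈⟨ alternating-far [] (U xs q) p p′ ⟩
        0# ∎
      identity : detL (Us ++ U xs b ∷ []) ≈ 1#
      identity = begin
        detL (Us ++ U xs b ∷ [])              ≡⟨ ≡.cong detL (≡.trans (≡.cong (_++ U xs b ∷ []) (Lₚ.map-applyUpTo id (U xs) b)) (Lₚ.applyUpTo-∷ʳ (U xs) b)) ⟩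
        detL (applyUpTo (U xs) (suc b))       ≈⟨ detL-applyUpTo (suc b) (U xs) ⟩
        Det (suc b) (U xs)                    ≈⟨ Det-upperUnitriangular (suc b) (λ i _ → hSub-diag xs i) (λ i j j<i _ → hSub-below xs j<i) ⟩
        1# ∎
      front : detL (U xs b ∷ Us) ≈ sg b
      front = begin
        detL (U xs b ∷ Us)                          ≡⟨ ≡.cong (λ ys → detL (U xs b ∷ ys)) (≡.sym (Lₚ.++-identityʳ Us)) ⟩
        detL (U xs b ∷ Us ++ [])                    ≈⟨ sg-cancel b _ ⟨
        sg b * (sg b * detL (U xs b ∷ Us ++ []))    ≡⟨ ≡.cong (λ m → sg b * (sg m * detL (U xs b ∷ Us ++ []))) (≡.sym len) ⟩
        sg b * (sg (length Us) * detL (U xs b ∷ Us ++ [])) ≈⟨ *-congˡ (move [] Us (U xs b) []) ⟨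
        sg b * detL (Us ++ U xs b ∷ [])             ≈⟨ *-congˡ identity ⟩
        sg b * 1#                                   ≈⟨ *-identityʳ _ ⟩
        sg b ∎

-- The four determinants and the sum over plane partitions

module Evaluation {c ℓ} (R : CommutativeRing c ℓ) (r u v w u′ v′ w′ : CommutativeRing.Carrier R) where

  open import Data.Integer as ℤ using (ℤ; +_; -[1+_]; _⊖_)
  open Preliminaries
  open Shapes
  open Arrays
  open PlanePartitions
  open FrobeniusData
  open RingSums R
  open Determinant R
  open PathExpansion R
  open JacobiTrudi R r u v w u′ v′ w′
  open Hooks R r u v w u′ v′ w′
  open Sym R r u v w u′ v′ w′ hiding (_^_)
  open Sym R r u v w u′ v′ w′ using () renaming (_^_ to _^ˢ_)

  if-skip : ∀ j c → (if c <ᵇ j then c else suc c) ≡ skip j c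
  if-skip zero    c       = ≡.refl
  if-skip (suc j) zero    = ≡.refl
  if-skip (suc j) (suc c) with c <ᵇ j | if-skip j c
  ... | true  | e = ≡.cong suc e
  ... | false | e = ≡.cong suc e

  sgn-+ : ∀ n → sgn (+ n) ≈ sg n
  sgn-+ n = ^ˢ≈^ ε n

  det-Det : ∀ n f → det n f ≈ Det n (λ i j → f (suc i) (suc j))
  det-Det zero    f = refl
  det-Det (suc n) f = begin
    ΣL (L.map suc (upTo (suc n))) _   ≈⟨ ΣL-map suc (upTo (suc n)) _ ⟩
    ΣL (upTo (suc n)) _               ≈⟨ ΣL-upTo (suc n) _ ⟩
    Σ< (suc n) (λ j → sgn (+ j) * f 1 (suc j) * det n (λ i′ j′ → f (suc i′) (if j′ <ᵇ suc j then j′ else suc j′)))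
      ≈⟨ Σ<-cong (suc n) (λ j → *-cong (*-congʳ (sgn-+ j)) (trans (det-Det n _)
           (Det-cong n (λ i c _ _ → ≡⇒≈ (≡.cong (f (suc (suc i))) (if-suc j c)))))) ⟩
    Det (suc n) (λ i j → f (suc i) (suc j)) ∎
    where
    if-suc : ∀ j c → (if suc c <ᵇ suc j then suc c else suc (suc c)) ≡ suc (skip j c)
    if-suc j c with c <ᵇ j | if-skip j c
    ... | true  | e = ≡.cong suc e
    ... | false | e = ≡.cong suc e

  ipow-⊖ : ∀ {x x′} → x * x′ ≈ 1# → ∀ m n → ipow x x′ (m ⊖ n) ≈ x ^ m * x′ ^ n
  ipow-⊖ p m       zero    = trans (^ˢ≈^ _ m) (sym (*-identityʳ _))
  ipow-⊖ p zero    (suc n) = trans (^ˢ≈^ _ (suc n)) (sym (*-identityˡ _))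
  ipow-⊖ {x} {x′} p (suc m) (suc n) = begin
    ipow x x′ (suc m ⊖ suc n)        ≡⟨ ≡.cong (ipow x x′) (ℤₚ.[1+m]⊖[1+n]≡m⊖n m n) ⟩
    ipow x x′ (m ⊖ n)                ≈⟨ ipow-⊖ p m n ⟩
    x ^ m * x′ ^ n                   ≈⟨ *-identityˡ _ ⟨
    1# * (x ^ m * x′ ^ n)            ≈⟨ *-congʳ p ⟨
    (x * x′) * (x ^ m * x′ ^ n)      ≈⟨ solve 4 (λ a b c d → (a :* b) :* (c :* d) := (a :* c) :* (b :* d)) refl _ _ _ _ ⟩
    x ^ suc m * x′ ^ suc n           ∎

  ipow-minus : ∀ {x x′} → x * x′ ≈ 1# → ∀ m n → ipow x x′ (+ m ℤ.- + n) ≈ x ^ m * x′ ^ n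
  ipow-minus {x} {x′} p m n = trans (≡⇒≈ (≡.cong (ipow x x′) (ℤₚ.m-n≡m⊖n m n))) (ipow-⊖ p m n)

  sgn-minus : ∀ m n → sgn (+ m ℤ.- + n) ≈ sg m * sg n
  sgn-minus = ipow-minus ε*ε≈1

  minus-+ : ∀ {x} y z → x ≡ y ℕ.+ z → + x ℤ.- + z ≡ + y
  minus-+ y z ≡.refl = ≡.trans (ℤₚ.m-n≡m⊖n (y ℕ.+ z) z) (≡.trans (ℤₚ.⊖-≥ (ℕₚ.m≤n+m z y)) (≡.cong +_ (ℕₚ.m+n∸n≡m y z)))

  minus-< : ∀ {m n} → m < n → ∃ λ x → + m ℤ.- + n ≡ -[1+ x ]
  minus-< {m} {n} m<n = n ∸ suc m , ≡.trans (ℤₚ.m-n≡m⊖n m n) (≡.trans (ℤₚ.⊖-< m<n) (≡.cong (λ k → ℤ.- (+ k)) (ℕₚ.+-∸-assoc 1 m<n)))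

  Σℤ-ℕ : ∀ B F → (∀ x → F -[1+ x ] ≈ 0#) → Σℤ B F ≈ Σ< (suc B) (λ s → F (+ s))
  Σℤ-ℕ B F neg = begin
    ΣL (upTo (suc (B ℕ.+ B))) (λ t → F (+ t ℤ.- + B))      ≈⟨ ΣL-upTo (suc (B ℕ.+ B)) _ ⟩
    Σ< (suc (B ℕ.+ B)) (λ t → F (+ t ℤ.- + B))             ≈⟨ Σ<-drop B (suc (B ℕ.+ B)) _ small ⟩
    Σ< (suc (B ℕ.+ B) ∸ B) (λ s → F (+ (B ℕ.+ s) ℤ.- + B)) ≡⟨ ≡.cong (λ m → Σ< m (λ s → F (+ (B ℕ.+ s) ℤ.- + B))) (ℕₚ.m+n∸n≡m (suc B) B) ⟩
    Σ< (suc B) (λ s → F (+ (B ℕ.+ s) ℤ.- + B))             ≈⟨ Σ<-cong (suc B) (λ s → ≡⇒≈ (≡.cong F (minus-+ s B (ℕₚ.+-comm B s)))) ⟩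
    Σ< (suc B) (λ s → F (+ s))                             ∎
    where
    small : ∀ t → t < B → F (+ t ℤ.- + B) ≈ 0#
    small t t<B with minus-< t<B
    ... | x , e = trans (≡⇒≈ (≡.cong F e)) (neg x)

  -- Replaces a bounded sum over the integers by the sum over its support, which has to fit below
  -- the bound B.
  Σℤ-range : ∀ B F p len → p ℕ.+ len ≤ suc B → (∀ x → F -[1+ x ] ≈ 0#) → (∀ s → s < p → F (+ s) ≈ 0#) →
             (∀ s → p ℕ.+ len ≤ s → F (+ s) ≈ 0#) → Σℤ B F ≈ Σ< len (λ s → F (+ (p ℕ.+ s)))
  Σℤ-range B F p len le neg low high = begin
    Σℤ B F                                         ≈⟨ Σℤ-ℕ B F neg ⟩
    Σ< (suc B) (λ s → F (+ s))                     ≈⟨ Σ<-drop p (suc B) _ low ⟩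
    Σ< (suc B ∸ p) (λ s → F (+ (p ℕ.+ s)))         ≈⟨ Σ<-extend (λ s → F (+ (p ℕ.+ s))) (≡.subst (_≤ suc B ∸ p) (ℕₚ.m+n∸m≡n p len) (ℕₚ.∸-monoˡ-≤ p le))
                                                        (λ s len≤s _ → high (p ℕ.+ s) (ℕₚ.+-monoʳ-≤ p len≤s)) ⟨
    Σ< len (λ s → F (+ (p ℕ.+ s)))                 ∎

  fromℕ-+ : ∀ m n → fromℕ (m ℕ.+ n) ≈ fromℕ m + fromℕ n
  fromℕ-+ zero    n = sym (+-identityˡ _)
  fromℕ-+ (suc m) n = trans (+-congˡ (fromℕ-+ m n)) (sym (+-assoc _ _ _))

  binomial : ℕ → ℕ → Carrier
  binomial n k = fromℕ (n C k)

  binomial-suc : ∀ n k → binomial (suc n) (suc k) ≈ binomial n k + binomial n (suc k)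
  binomial-suc n k = trans (≡⇒≈ (≡.cong fromℕ (≡.sym (nCk+nC[k+1]≡[n+1]C[k+1] n k)))) (fromℕ-+ (n C k) (n C suc k))

  binomial-> : ∀ {n k} → n < k → binomial n k ≈ 0#
  binomial-> p = ≡⇒≈ (≡.cong fromℕ (k>n⇒nCk≡0 p))

  binomial-0 : ∀ n → binomial n 0 ≈ 1#
  binomial-0 n = trans (≡⇒≈ (≡.cong fromℕ (≡.trans (nCk≡nC[n∸k] (z≤n {n})) (nCn≡1 n)))) (+-identityʳ _)

  binomial-diag : ∀ n → binomial n n ≈ 1#
  binomial-diag n = trans (≡⇒≈ (≡.cong fromℕ (nCn≡1 n))) (+-identityʳ _)

  -- Each of the b unfoldings of `Y` keeps t or raises it by one, and C(b, a) sequences of choices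
  -- raise it a times. The induction is Pascal's rule.
  Y-binomial : ∀ X t b c → Y X t b c ≈ Σ< (suc b) (λ a → binomial b a * X (t ℕ.+ a) c)
  Y-binomial X t zero    c = sym (trans (Σ<-suc 0 _) (trans (+-cong
    (trans (*-cong (binomial-0 0) (≡⇒≈ (≡.cong (λ m → X m c) (ℕₚ.+-identityʳ t)))) (*-identityˡ _)) (Σ<-0 _)) (+-identityʳ _)))
  Y-binomial X t (suc b) c = begin
    Y X t b c + Y X (suc t) b c
      ≈⟨ +-cong (trans (Y-binomial X t b c) (Σ<-extend (λ a → binomial b a * X (t ℕ.+ a) c) (ℕₚ.n≤1+n (suc b)) (λ a b<a _ → trans (*-congʳ (binomial-> b<a)) (zeroˡ _))))
           (Y-binomial X (suc t) b c) ⟩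
    Σ< (suc (suc b)) (λ a → binomial b a * X (t ℕ.+ a) c) + Σ< (suc b) (λ a → binomial b a * X (suc t ℕ.+ a) c)
      ≈⟨ +-congʳ (Σ<-suc (suc b) _) ⟩
    (binomial b 0 * X (t ℕ.+ 0) c + Σ< (suc b) (λ a → binomial b (suc a) * X (t ℕ.+ suc a) c)) + Σ< (suc b) (λ a → binomial b a * X (suc t ℕ.+ a) c)
      ≈⟨ trans (+-assoc _ _ _) (+-congˡ (trans (+-comm _ _) (sym (Σ<-+ (suc b) _ _)))) ⟩
    binomial b 0 * X (t ℕ.+ 0) c + Σ< (suc b) (λ a → binomial b a * X (suc t ℕ.+ a) c + binomial b (suc a) * X (t ℕ.+ suc a) c)
      ≈⟨ +-cong (*-congʳ (trans (binomial-0 b) (sym (binomial-0 (suc b)))))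
           (Σ<-cong (suc b) (λ a → trans (+-congʳ (*-congˡ (≡⇒≈ (≡.cong (λ m → X m c) (≡.sym (ℕₚ.+-suc t a))))))
             (trans (sym (distribʳ _ _ _)) (*-congʳ (sym (binomial-suc b a)))))) ⟩
    binomial (suc b) 0 * X (t ℕ.+ 0) c + Σ< (suc b) (λ a → binomial (suc b) (suc a) * X (t ℕ.+ suc a) c)
      ≈⟨ Σ<-suc (suc b) _ ⟨
    Σ< (suc (suc b)) (λ a → binomial (suc b) a * X (t ℕ.+ a) c) ∎

  -- By Pascal's rule in both factors.
  binomial-inverse : ∀ n i j → i < n → Σ< n (λ m → sg (i ℕ.+ m) * binomial i m * binomial m j) ≈ kr i j
  binomial-inverse n zero j 0<n = begin
    Σ< n (λ m → sg m * binomial 0 m * binomial m j)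
      ≈⟨ Σ<-single n 0 0<n (λ m _ m≢0 → trans (*-congʳ (trans (*-congˡ (binomial-> (ℕₚ.n≢0⇒n>0 m≢0))) (zeroʳ _))) (zeroˡ _)) ⟩
    1# * binomial 0 0 * binomial 0 j  ≈⟨ trans (*-congʳ (trans (*-identityˡ _) (binomial-0 0))) (*-identityˡ _) ⟩
    binomial 0 j                      ≈⟨ first j ⟩
    kr 0 j                            ∎
    where
    first : ∀ j → binomial 0 j ≈ kr 0 j
    first zero    = binomial-0 0
    first (suc j) = binomial-> {0} {suc j} (s≤s z≤n)
  binomial-inverse (suc n) (suc i) j (s≤s i<n) = begin
    Σ< (suc n) (λ m → sg (suc i ℕ.+ m) * binomial (suc i) m * binomial m j)
      ≈⟨ Σ<-suc n _ ⟩
    sg (suc i ℕ.+ 0) * binomial (suc i) 0 * binomial 0 j + Σ< n (λ m → sg (suc i ℕ.+ suc m) * binomial (suc i) (suc m) * binomial (suc m) j)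
      ≈⟨ +-cong (*-congʳ (*-congˡ (trans (binomial-0 (suc i)) (sym (binomial-0 i))))) (Σ<-cong n (λ m → split m)) ⟩
    ε * sg (i ℕ.+ 0) * binomial i 0 * binomial 0 j + Σ< n (λ m → sg (i ℕ.+ m) * binomial i m * binomial (suc m) j + ε * (sg (i ℕ.+ suc m) * binomial i (suc m) * binomial (suc m) j))
      ≈⟨ +-congˡ (trans (Σ<-+ n _ _) (+-congˡ (Σ<-*ˡ n ε _))) ⟩
    ε * sg (i ℕ.+ 0) * binomial i 0 * binomial 0 j + (Σ< n (λ m → sg (i ℕ.+ m) * binomial i m * binomial (suc m) j) + ε * Σ< n (λ m → sg (i ℕ.+ suc m) * binomial i (suc m) * binomial (suc m) j))
      ≈⟨ solve 6 (λ ε s a b x y → ε :* s :* a :* b :+ (x :+ ε :* y) := x :+ ε :* (s :* a :* b :+ y)) refl _ _ _ _ _ _ ⟩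
    Σ< n (λ m → sg (i ℕ.+ m) * binomial i m * binomial (suc m) j) + ε * (sg (i ℕ.+ 0) * binomial i 0 * binomial 0 j + Σ< n (λ m → sg (i ℕ.+ suc m) * binomial i (suc m) * binomial (suc m) j))
      ≈⟨ +-congˡ (*-congˡ (trans (sym (Σ<-suc n _)) (trans (Σ<-last n _) (trans (+-congˡ (trans (*-congʳ (trans (*-congˡ (binomial-> i<n)) (zeroʳ _))) (zeroˡ _))) (+-identityʳ _))))) ⟩
    Σ< n (λ m → sg (i ℕ.+ m) * binomial i m * binomial (suc m) j) + ε * Σ< n (λ m → sg (i ℕ.+ m) * binomial i m * binomial m j)
      ≈⟨ last j ⟩
    kr (suc i) j ∎
    where
    split : ∀ m → sg (suc i ℕ.+ suc m) * binomial (suc i) (suc m) * binomial (suc m) j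
      ≈ sg (i ℕ.+ m) * binomial i m * binomial (suc m) j + ε * (sg (i ℕ.+ suc m) * binomial i (suc m) * binomial (suc m) j)
    split m = begin
      ε * sg (i ℕ.+ suc m) * binomial (suc i) (suc m) * binomial (suc m) j
        ≈⟨ *-congʳ (*-congˡ (binomial-suc i m)) ⟩
      ε * sg (i ℕ.+ suc m) * (binomial i m + binomial i (suc m)) * binomial (suc m) j
        ≈⟨ solve 5 (λ ε s a b c → ε :* s :* (a :+ b) :* c := ε :* s :* a :* c :+ ε :* (s :* b :* c)) refl _ _ _ _ _ ⟩
      ε * sg (i ℕ.+ suc m) * binomial i m * binomial (suc m) j + ε * (sg (i ℕ.+ suc m) * binomial i (suc m) * binomial (suc m) j)
        ≈⟨ +-congʳ (*-congʳ (*-congʳ (trans (*-congˡ (≡⇒≈ (≡.cong sg (ℕₚ.+-suc i m)))) (trans (sym (*-assoc _ _ _)) (trans (*-congʳ ε*ε≈1) (*-identityˡ _)))))) ⟩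
      sg (i ℕ.+ m) * binomial i m * binomial (suc m) j + ε * (sg (i ℕ.+ suc m) * binomial i (suc m) * binomial (suc m) j) ∎
    last : ∀ j → Σ< n (λ m → sg (i ℕ.+ m) * binomial i m * binomial (suc m) j) + ε * Σ< n (λ m → sg (i ℕ.+ m) * binomial i m * binomial m j) ≈ kr (suc i) j
    last zero    = trans (+-congʳ (Σ<-cong n (λ m → *-congˡ (trans (binomial-0 (suc m)) (sym (binomial-0 m)))))) (x+εx≈0 _)
    last (suc j) = begin
      Σ< n (λ m → sg (i ℕ.+ m) * binomial i m * binomial (suc m) (suc j)) + ε * Z
        ≈⟨ +-congʳ (trans (Σ<-cong n (λ m → trans (*-congˡ (binomial-suc m j)) (distribˡ _ _ _))) (Σ<-+ n _ _)) ⟩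
      (Σ< n (λ m → sg (i ℕ.+ m) * binomial i m * binomial m j) + Z) + ε * Z
        ≈⟨ trans (+-assoc _ _ _) (trans (+-congˡ (x+εx≈0 Z)) (+-identityʳ _)) ⟩
      Σ< n (λ m → sg (i ℕ.+ m) * binomial i m * binomial m j)
        ≈⟨ binomial-inverse n i j i<n ⟩
      kr i j ∎
      where
      Z : Carrier
      Z = Σ< n (λ m → sg (i ℕ.+ m) * binomial i m * binomial m (suc j))

  h-minus : ∀ xs m k → h (+ m ℤ.- + k) xs ≡ hSub xs m k
  h-minus xs m k = ≡.trans (≡.cong (λ z → h z xs) (ℤₚ.m-n≡m⊖n m k)) (go m k)
    where
    go : ∀ m k → h (m ⊖ k) xs ≡ hSub xs m k
    go m       zero    = ≡.refl
    go zero    (suc k) = ≡.refl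
    go (suc m) (suc k) = ≡.trans (≡.cong (λ z → h z xs) (ℤₚ.[1+m]⊖[1+n]≡m⊖n m k)) (go m k)

  hSub-cong : ∀ xs m k m′ k′ → m ℕ.+ k′ ≡ m′ ℕ.+ k → hSub xs m k ≡ hSub xs m′ k′
  hSub-cong xs m k m′ k′ e = ≡.trans (≡.sym (hSub-+ˡ xs k′ m k))
    (≡.trans (≡.cong₂ (hSub xs) (≡.trans (ℕₚ.+-comm k′ m) (≡.trans e (ℕₚ.+-comm m′ k))) (ℕₚ.+-comm k′ k)) (hSub-+ˡ xs k m′ k′))

  module Identities (uu′ : u * u′ ≈ 1#) (vv′ : v * v′ ≈ 1#) (ww′ : w * w′ ≈ 1#) (xs : List Carrier) (n k : ℕ) where

    open HookFormulas xs

    -- The weight ω factors over rows: an arm a carries u^(a+1) w^(-a), a leg b carries r w^b, and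
    -- each b that is not a leg carries v^(b+1). These are `κ`, `β` and `α`.
    κ : ℕ → Carrier
    κ a = u ^ suc a * w′ ^ a

    X̂ : Matrix
    X̂ a c = κ a * X xs a c

    α β : ℕ → Carrier
    α b = v ^ suc b
    β b = r * w ^ b

    mrow : Matrix
    mrow = mixedRow X̂ (U xs) k α β

    -- The matrix M with its rows and columns in reverse order.
    rows : List Row
    rows = applyUpTo (U xs) k ++ applyUpTo mrow n

    -- Splits u^(b+1) (w/u)^(b-a) into a factor of the row b and a factor of the term a, so that the
    -- rows of M take the form of `mixedRow` with the scaled arm rows.
    uw-balance : ∀ {a b} → a ≤ b → u ^ suc b * (w ^ (b ∸ a) * u′ ^ (b ∸ a)) ≈ w ^ b * κ a
    uw-balance {a} {b} a≤b = begin
      u ^ suc b * (w ^ d * u′ ^ d)              ≡⟨ ≡.cong (λ m → u ^ suc m * (w ^ d * u′ ^ d)) d+a ⟨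
      u ^ suc (d ℕ.+ a) * (w ^ d * u′ ^ d)      ≈⟨ *-congʳ (*-congˡ (^-homo-* u d a)) ⟩
      u * (u ^ d * u ^ a) * (w ^ d * u′ ^ d)    ≈⟨ solve 5 (λ u ud ua wd ud′ → u :* (ud :* ua) :* (wd :* ud′) := (ud :* ud′) :* (wd :* (u :* ua))) refl _ _ _ _ _ ⟩
      (u ^ d * u′ ^ d) * (w ^ d * (u * u ^ a))  ≈⟨ *-congʳ (trans (^-inverse uu′ d) (sym (^-inverse ww′ a))) ⟩
      (w ^ a * w′ ^ a) * (w ^ d * (u * u ^ a))  ≈⟨ solve 4 (λ wa wa′ wd x → (wa :* wa′) :* (wd :* x) := (wd :* wa) :* (x :* wa′)) refl _ _ _ _ ⟩
      (w ^ d * w ^ a) * κ a                     ≈⟨ *-congʳ (^-homo-* w d a) ⟨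
      w ^ (d ℕ.+ a) * κ a                       ≡⟨ ≡.cong (λ m → w ^ m * κ a) d+a ⟩
      w ^ b * κ a                               ∎
      where
      d : ℕ
      d = b ∸ a
      d+a : d ℕ.+ a ≡ b
      d+a = ℕₚ.m∸n+n≡m a≤b

    wu-+ : ∀ q → wu (+ q) ≈ w ^ q * u′ ^ q
    wu-+ q = *-cong (^ˢ≈^ w q) (^ˢ≈^ u′ q)

    M-lower : ∀ {I J i j} → n < I → I ℕ.+ i ≡ n ℕ.+ k → J ℕ.+ j ≡ n ℕ.+ k → M n k xs I J ≈ U xs i j
    M-lower {I} {J} {i} {j} n<I eI eJ rewrite ≤ᵇ-false n<I =
      ≡⇒≈ (≡.trans (h-minus xs I J) (hSub-cong xs I J j i (≡.trans eI (≡.trans (≡.sym eJ) (ℕₚ.+-comm J j)))))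

    -- Here I and J are the indices of M, counted from 1, and b and j those after reversal, counted
    -- from 0. Equations in place of subtractions keep the index arithmetic free of truncation.
    M-upper : ∀ {I J b j} → 1 ≤ I → I ℕ.+ b ≡ n → J ℕ.+ j ≡ n ℕ.+ k → M n k xs I J ≈ mrow b j
    M-upper {suc I₀} {J} {b} {j} _ eI eJ rewrite ≤ᵇ-true (≡.subst (suc I₀ ≤_) eI (ℕₚ.m≤m+n (suc I₀) b)) = +-cong first second
      where
      I : ℕ
      I = suc I₀
      n∸I : n ∸ I ≡ b
      n∸I = ≡.trans (≡.cong (_∸ I) (≡.sym eI)) (ℕₚ.m+n∸m≡n I b)
      exponent : n ∸ I ℕ.+ 1 ≡ suc b
      exponent = ≡.trans (≡.cong (ℕ._+ 1) n∸I) (ℕₚ.+-comm b 1)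
      first : v ^ˢ (n ∸ I ℕ.+ 1) * h (+ I ℤ.- + J) xs ≈ α b * U xs (k ℕ.+ b) j
      first = *-cong (trans (^ˢ≈^ v (n ∸ I ℕ.+ 1)) (≡⇒≈ (≡.cong (v ^_) exponent)))
        (≡⇒≈ (≡.trans (h-minus xs I J) (hSub-cong xs I J j (k ℕ.+ b) (≡.trans
          (≡.trans (≡.cong (I ℕ.+_) (ℕₚ.+-comm k b)) (≡.trans (≡.sym (ℕₚ.+-assoc I b k)) (≡.cong (ℕ._+ k) eI))) (≡.trans (≡.sym eJ) (ℕₚ.+-comm J j))))))
      F : ℤ → Carrier
      F m = binom (+ n ℤ.- + I) (m ℤ.- + I) * h (+ k ℤ.+ + 1 ℤ.+ + 2 ℤ.* + n ℤ.- m ℤ.- + J) xs * wu (m ℤ.- + I)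
      n-I : + n ℤ.- + I ≡ + b
      n-I = minus-+ b I (≡.trans (≡.sym eI) (ℕₚ.+-comm I b))
      zero-binom : ∀ m → binom (+ n ℤ.- + I) (m ℤ.- + I) ≈ 0# → F m ≈ 0#
      zero-binom m p = trans (*-congʳ (trans (*-congʳ p) (zeroˡ _))) (zeroˡ _)
      neg-binom : ∀ {z x} → z ≡ -[1+ x ] → binom (+ n ℤ.- + I) z ≈ 0#
      neg-binom ≡.refl rewrite n-I = refl
      low : ∀ s → s < I → F (+ s) ≈ 0#
      low s s<I = zero-binom (+ s) (neg-binom (proj₂ (minus-< s<I)))
      high : ∀ s → I ℕ.+ suc b ≤ s → F (+ s) ≈ 0#
      high s le = zero-binom (+ s) (trans (≡⇒≈ (≡.cong₂ binom n-I (minus-+ (s ∸ I) I (≡.sym (ℕₚ.m∸n+n≡m (ℕₚ.≤-trans (ℕₚ.m≤m+n I (suc b)) le))))))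
        (binomial-> (≡.subst (_≤ s ∸ I) (ℕₚ.m+n∸m≡n I (suc b)) (ℕₚ.∸-monoˡ-≤ I le))))
      h-index : ∀ q → q ≤ b → + k ℤ.+ + 1 ℤ.+ + 2 ℤ.* + n ℤ.- + (I ℕ.+ q) ℤ.- + J ≡ + suc (b ∸ q ℕ.+ j)
      h-index q q≤b = ≡.trans (≡.cong (λ z → + k ℤ.+ + 1 ℤ.+ z ℤ.- + (I ℕ.+ q) ℤ.- + J) (≡.sym (ℤₚ.pos-* 2 n)))
        (≡.trans (≡.cong (ℤ._- + J) (minus-+ (suc (b ∸ q ℕ.+ j) ℕ.+ J) (I ℕ.+ q) arith)) (minus-+ (suc (b ∸ q ℕ.+ j)) J ≡.refl))
        where
        arith : k ℕ.+ 1 ℕ.+ 2 ℕ.* n ≡ suc (b ∸ q ℕ.+ j) ℕ.+ J ℕ.+ (I ℕ.+ q)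
        arith = ≡.trans (NS.solve 2 (λ k n → k NS.:+ NS.con 1 NS.:+ NS.con 2 NS.:* n NS.:= NS.con 1 NS.:+ (n NS.:+ k) NS.:+ n) ≡.refl k n)
          (≡.trans (≡.cong₂ (λ x y → 1 ℕ.+ x ℕ.+ y) (≡.sym eJ) (≡.trans (≡.sym eI) (≡.cong (I ℕ.+_) (≡.sym (ℕₚ.m∸n+n≡m q≤b)))))
            (NS.solve 5 (λ J j I d q → NS.con 1 NS.:+ (J NS.:+ j) NS.:+ (I NS.:+ (d NS.:+ q)) NS.:= NS.con 1 NS.:+ (d NS.:+ j) NS.:+ J NS.:+ (I NS.:+ q)) ≡.refl J j I (b ∸ q) q))
      sum : Σℤ (bnd n k) F ≈ Σ< (suc b) (λ a → binomial b a * X xs a j * (w ^ (b ∸ a) * u′ ^ (b ∸ a)))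
      sum = begin
        Σℤ (bnd n k) F
          ≈⟨ Σℤ-range (bnd n k) F I (suc b) (≡.subst (_≤ suc (bnd n k)) (≡.trans (≡.cong suc (≡.sym eI)) (≡.sym (ℕₚ.+-suc I b)))
               (s≤s (ℕₚ.≤-trans (ℕₚ.m≤m+n n k) (ℕₚ.≤-trans (ℕₚ.n≤1+n _) (ℕₚ.n≤1+n _)))))
               (λ x → zero-binom -[1+ x ] (neg-binom ≡.refl)) low high ⟩
        Σ< (suc b) (λ q → F (+ (I ℕ.+ q)))
          ≈⟨ Σ<-cong< (suc b) (λ q q<1+b → *-cong (*-cong (≡⇒≈ (≡.cong₂ binom n-I (minus-+ q I (ℕₚ.+-comm I q)))) (≡⇒≈ (≡.cong (λ z → h z xs) (h-index q (ℕ.≤-pred q<1+b)))))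
               (trans (≡⇒≈ (≡.cong wu (minus-+ q I (ℕₚ.+-comm I q)))) (wu-+ q))) ⟩
        Σ< (suc b) (λ q → binomial b q * X xs (b ∸ q) j * (w ^ q * u′ ^ q))
          -- So far q = m - I; the arm is a = b - q.
          ≈⟨ Σ<-reverse b _ ⟩
        Σ< (suc b) (λ a → binomial b (b ∸ a) * X xs (b ∸ (b ∸ a)) j * (w ^ (b ∸ a) * u′ ^ (b ∸ a)))
          ≈⟨ Σ<-cong< (suc b) (λ a a<1+b → *-congʳ (*-cong (≡⇒≈ (≡.cong fromℕ (≡.sym (nCk≡nC[n∸k] (ℕ.≤-pred a<1+b)))))
               (≡⇒≈ (≡.cong (λ m → X xs m j) (ℕₚ.m∸[m∸n]≡n (ℕ.≤-pred a<1+b)))))) ⟩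
        Σ< (suc b) (λ a → binomial b a * X xs a j * (w ^ (b ∸ a) * u′ ^ (b ∸ a))) ∎
      second : sgn (+ k ℤ.+ + n ℤ.- + I) * r * (u ^ˢ (n ∸ I ℕ.+ 1)) * Σℤ (bnd n k) F ≈ sg (k ℕ.+ b) * β b * Y X̂ 0 b j
      second = begin
        sgn (+ k ℤ.+ + n ℤ.- + I) * r * (u ^ˢ (n ∸ I ℕ.+ 1)) * Σℤ (bnd n k) F
          ≈⟨ *-cong (*-cong (*-congʳ (trans (≡⇒≈ (≡.cong sgn (minus-+ (k ℕ.+ b) I (≡.trans (≡.cong (k ℕ.+_) (≡.trans (≡.sym eI) (ℕₚ.+-comm I b))) (≡.sym (ℕₚ.+-assoc k b I)))))) (sgn-+ (k ℕ.+ b))))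
               (trans (^ˢ≈^ u (n ∸ I ℕ.+ 1)) (≡⇒≈ (≡.cong (u ^_) exponent)))) sum ⟩
        σ * r * u ^ suc b * Σ< (suc b) (λ a → binomial b a * X xs a j * (w ^ (b ∸ a) * u′ ^ (b ∸ a)))
          ≈⟨ Σ<-*ˡ (suc b) _ _ ⟨
        Σ< (suc b) (λ a → σ * r * u ^ suc b * (binomial b a * X xs a j * (w ^ (b ∸ a) * u′ ^ (b ∸ a))))
          ≈⟨ Σ<-cong< (suc b) (λ a a<1+b → begin
               σ * r * u ^ suc b * (binomial b a * X xs a j * (w ^ (b ∸ a) * u′ ^ (b ∸ a)))
                 ≈⟨ solve 6 (λ s r u c x y → s :* r :* u :* (c :* x :* y) := s :* r :* (u :* y) :* (c :* x)) refl _ _ _ _ _ _ ⟩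
               σ * r * (u ^ suc b * (w ^ (b ∸ a) * u′ ^ (b ∸ a))) * (binomial b a * X xs a j)
                 ≈⟨ *-congʳ (*-congˡ (uw-balance (ℕ.≤-pred a<1+b))) ⟩
               σ * r * (w ^ b * κ a) * (binomial b a * X xs a j)
                 ≈⟨ solve 6 (λ s r w κ c x → s :* r :* (w :* κ) :* (c :* x) := (s :* (r :* w)) :* (c :* (κ :* x))) refl _ _ _ _ _ _ ⟩
               σ * β b * (binomial b a * X̂ a j) ∎) ⟩
        Σ< (suc b) (λ a → σ * β b * (binomial b a * X̂ a j))  ≈⟨ Σ<-*ˡ (suc b) _ _ ⟩
        σ * β b * Σ< (suc b) (λ a → binomial b a * X̂ a j)    ≈⟨ *-congˡ (Y-binomial X̂ 0 b j) ⟨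
        σ * β b * Y X̂ 0 b j                                  ∎
        where
        σ : Carrier
        σ = sg (k ℕ.+ b)

    -- Reversing rows and columns costs the reversal sign twice. The last k rows of M come to the
    -- front as the vacuum rows `U 0`, ..., `U (k-1)`.
    det-M : det (n ℕ.+ k) (M n k xs) ≈ detL rows
    det-M = begin
      det (n ℕ.+ k) (M n k xs)                                  ≈⟨ det-Det (n ℕ.+ k) (M n k xs) ⟩
      Det (n ℕ.+ k) (λ i j → M n k xs (suc i) (suc j))          ≈⟨ Det-reverse (n ℕ.+ k) (λ i j → M n k xs (suc i) (suc j)) ⟨
      Det (n ℕ.+ k) (λ i j → M n k xs (suc (n ℕ.+ k ∸ 1 ∸ i)) (suc (n ℕ.+ k ∸ 1 ∸ j)))
        ≡⟨ ≡.cong (λ m → Det m (λ i j → M n k xs (suc (n ℕ.+ k ∸ 1 ∸ i)) (suc (n ℕ.+ k ∸ 1 ∸ j)))) (ℕₚ.+-comm n k) ⟩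
      Det (k ℕ.+ n) (λ i j → M n k xs (suc (n ℕ.+ k ∸ 1 ∸ i)) (suc (n ℕ.+ k ∸ 1 ∸ j)))
        ≈⟨ Det-block-cong k n (U xs) mrow
             (λ i j i<k j< → sym (M-lower (above i i<k) (reflect i (ℕₚ.<-≤-trans i<k (ℕₚ.m≤m+n k n))) (reflect j j<)))
             (λ b j b<n j< → sym (M-upper (s≤s z≤n) (within b b<n) (reflect j j<))) ⟨
      detL rows ∎
      where
      reflect : ∀ i → i < k ℕ.+ n → suc (n ℕ.+ k ∸ 1 ∸ i) ℕ.+ i ≡ n ℕ.+ k
      reflect i i< = go (n ℕ.+ k) (≡.subst (i <_) (ℕₚ.+-comm k n) i<)
        where
        go : ∀ m → i < m → suc (m ∸ 1 ∸ i) ℕ.+ i ≡ m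
        go (suc m) (s≤s i≤m) = ≡.cong suc (ℕₚ.m∸n+n≡m i≤m)
      above : ∀ i → i < k → n < suc (n ℕ.+ k ∸ 1 ∸ i)
      above i i<k = ℕₚ.+-cancelʳ-< i n _ (≡.subst (n ℕ.+ i <_) (≡.sym (reflect i (ℕₚ.<-≤-trans i<k (ℕₚ.m≤m+n k n)))) (ℕₚ.+-monoʳ-< n i<k))
      within : ∀ b → b < n → suc (n ℕ.+ k ∸ 1 ∸ (k ℕ.+ b)) ℕ.+ b ≡ n
      within b b<n = ℕₚ.+-cancelʳ-≡ k _ n (≡.trans (≡.trans (ℕₚ.+-assoc _ b k) (≡.cong (suc (n ℕ.+ k ∸ 1 ∸ (k ℕ.+ b)) ℕ.+_) (ℕₚ.+-comm b k)))
        (reflect (k ℕ.+ b) (ℕₚ.+-monoʳ-< k b<n)))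

    -- Every determinant of the theorem is the determinant of this matrix.
    E : Matrix
    E b b′ = α b * kr b b′ + β b * Σ< (suc b) (λ a → binomial b a * (κ a * hk a (k ℕ.+ b′)))

    private
      L : ℕ
      L = k ℕ.+ n

      coordinates : Matrix
      coordinates b q = α b * kr (k ℕ.+ b) q + sg (k ℕ.+ b) * β b * (sg q * Σ< (suc b) (λ a → binomial b a * (κ a * hk a q)))

      mrow-expand : ∀ b j → b < n → j < L → mrow b j ≈ (coordinates b ·[ L ] U xs) j
      mrow-expand b j b<n j<L = sym (begin
        Σ< L (λ q → (α b * kr (k ℕ.+ b) q + sβ * (sg q * S q)) * U xs q j)
          ≈⟨ Σ<-cong L (λ q → solve 6 (λ a x s g S U → (a :* x :+ s :* (g :* S)) :* U := a :* (x :* U) :+ s :* (g :* S :* U)) refl _ _ _ _ _ _) ⟩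
        Σ< L (λ q → α b * (kr (k ℕ.+ b) q * U xs q j) + sβ * (sg q * S q * U xs q j))
          ≈⟨ trans (Σ<-+ L _ _) (+-cong (Σ<-*ˡ L _ _) (Σ<-*ˡ L _ _)) ⟩
        α b * Σ< L (λ q → kr (k ℕ.+ b) q * U xs q j) + sβ * Σ< L (λ q → sg q * S q * U xs q j)
          ≈⟨ +-cong (*-congˡ unit) (*-congˡ expand) ⟩
        α b * U xs (k ℕ.+ b) j + sβ * Y X̂ 0 b j ∎)
        where
        sβ : Carrier
        sβ = sg (k ℕ.+ b) * β b
        S : ℕ → Carrier
        S q = Σ< (suc b) (λ a → binomial b a * (κ a * hk a q))
        unit : Σ< L (λ q → kr (k ℕ.+ b) q * U xs q j) ≈ U xs (k ℕ.+ b) j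
        unit = trans (Σ<-single L (k ℕ.+ b) (ℕₚ.+-monoʳ-< k b<n) (λ q _ q≢ → trans (*-congʳ (≡⇒≈ (kr-off (q≢ ∘ ≡.sym)))) (zeroˡ _)))
          (trans (*-congʳ (≡⇒≈ (kr-diag (k ℕ.+ b)))) (*-identityˡ _))
        expand : Σ< L (λ q → sg q * S q * U xs q j) ≈ Y X̂ 0 b j
        expand = begin
          Σ< L (λ q → sg q * S q * U xs q j)
            ≈⟨ Σ<-cong L (λ q → trans (solve 3 (λ g S U → g :* S :* U := (g :* U) :* S) refl _ _ _) (sym (Σ<-*ˡ (suc b) _ _))) ⟩
          Σ< L (λ q → Σ< (suc b) (λ a → (sg q * U xs q j) * (binomial b a * (κ a * hk a q))))
            ≈⟨ Σ<-swap L (suc b) _ ⟩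
          Σ< (suc b) (λ a → Σ< L (λ q → (sg q * U xs q j) * (binomial b a * (κ a * hk a q))))
            ≈⟨ Σ<-cong (suc b) (λ a → trans (Σ<-cong L (λ q → solve 5 (λ g U c κ h → (g :* U) :* (c :* (κ :* h)) := (c :* κ) :* (g :* h :* U)) refl _ _ _ _ _))
                 (trans (Σ<-*ˡ L _ _) (trans (*-congˡ (sym (X-expand L a j j<L))) (*-assoc _ _ _)))) ⟩
          Σ< (suc b) (λ a → binomial b a * X̂ a j)
            ≈⟨ Y-binomial X̂ 0 b j ⟨
          Y X̂ 0 b j ∎

    detL-rows : detL rows ≈ Det n E
    detL-rows = begin
      detL rows
        ≈⟨ Det-block-cong k n (U xs) mrow upper (λ b j b<n j<L → trans (mrow-expand b j b<n j<L)
             (Σ<-cong L (λ q → *-congʳ (≡⇒≈ (≡.cong (λ ρ → ρ q) (≡.sym (nth-block-lower k n kr coordinates b b<n))))))) ⟩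
      Det L (λ i → nth P i ·[ L ] U xs)  ≈⟨ Det-* L (nth P) (U xs) ⟩
      Det L (nth P) * Det L (U xs)       ≈⟨ *-congˡ (Det-upperUnitriangular L (λ i _ → hSub-diag xs i) (λ i j j<i _ → hSub-below xs j<i)) ⟩
      Det L (nth P) * 1#                 ≈⟨ *-identityʳ _ ⟩
      Det L (nth P)                      ≈⟨ Det-dropUnitRows k n (λ i i<k j _ → ≡⇒≈ (≡.cong (λ ρ → ρ j) (nth-block-upper k n kr coordinates i i<k))) ⟩
      Det n (λ b b′ → nth P (k ℕ.+ b) (k ℕ.+ b′))
        ≈⟨ Det-cong n (λ b b′ b<n _ → trans (≡⇒≈ (≡.cong (λ ρ → ρ (k ℕ.+ b′)) (nth-block-lower k n kr coordinates b b<n))) (signs b b′)) ⟩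
      Det n (λ b b′ → sg (k ℕ.+ b) * (sg (k ℕ.+ b′) * E b b′)) ≈⟨ Det-conjugate n E (λ i → sg*sg≈1 (k ℕ.+ i)) ⟩
      Det n E ∎
      where
      P : List Row
      P = block k n kr coordinates
      upper : ∀ i j → i < k → j < L → U xs i j ≈ (nth P i ·[ L ] U xs) j
      upper i j i<k j<L = sym (trans (Σ<-cong L (λ q → *-congʳ (≡⇒≈ (≡.cong (λ ρ → ρ q) (nth-block-upper k n kr coordinates i i<k)))))
        (trans (Σ<-single L i (ℕₚ.<-≤-trans i<k (ℕₚ.m≤m+n k n)) (λ q _ q≢ → trans (*-congʳ (≡⇒≈ (kr-off (q≢ ∘ ≡.sym)))) (zeroˡ _)))
          (trans (*-congʳ (≡⇒≈ (kr-diag i))) (*-identityˡ _))))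
      kr-+ : ∀ k b b′ → kr (k ℕ.+ b) (k ℕ.+ b′) ≡ kr b b′
      kr-+ zero    b b′ = ≡.refl
      kr-+ (suc k) b b′ = kr-+ k b b′
      signs-kr : ∀ b b′ → kr b b′ ≈ sg (k ℕ.+ b) * (sg (k ℕ.+ b′) * kr b b′)
      signs-kr b b′ with b ℕ.≟ b′
      ... | yes ≡.refl = sym (sg-cancel (k ℕ.+ b) _)
      ... | no b≢b′ = trans (≡⇒≈ (kr-off b≢b′)) (sym (trans (*-congˡ (trans (*-congˡ (≡⇒≈ (kr-off b≢b′))) (zeroʳ _))) (zeroʳ _)))
      signs : ∀ b b′ → coordinates b (k ℕ.+ b′) ≈ sg (k ℕ.+ b) * (sg (k ℕ.+ b′) * E b b′)
      signs b b′ = trans (+-congʳ (*-congˡ (trans (≡⇒≈ (kr-+ k b b′)) (signs-kr b b′))))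
        (solve 6 (λ a s s′ x β S → a :* (s :* (s′ :* x)) :+ s :* β :* (s′ :* S) := s :* (s′ :* (a :* x :+ β :* S))) refl _ _ _ _ _ _)

    hook-at : ∀ a b {y z} → y ≡ + a → z ≡ + b → hook y z xs ≈ hk a b
    hook-at a b ≡.refl ≡.refl = hook-hk a b

    column-index : ∀ b′ → + suc b′ ℤ.+ + k ℤ.- + 1 ≡ + (k ℕ.+ b′)
    column-index b′ = minus-+ (k ℕ.+ b′) 1 (≡.trans (≡.cong suc (ℕₚ.+-comm b′ k)) (ℕₚ.+-comm 1 (k ℕ.+ b′)))

    δ-kr : ∀ i j → δ i j ≡ kr i j
    δ-kr zero    zero    = ≡.refl
    δ-kr zero    (suc j) = ≡.refl
    δ-kr (suc i) zero    = ≡.refl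
    δ-kr (suc i) (suc j) = δ-kr i j

    -- The two matrices differ by the conjugation with powers of u: the factor u^j belongs to the
    -- column here, whereas `E` carries u^(a+1) inside the sum.
    det-D₄ : det n (D₄ n k xs) ≈ Det n E
    det-D₄ = begin
      det n (D₄ n k xs)                                    ≈⟨ det-Det n (D₄ n k xs) ⟩
      Det n (λ b b′ → D₄ n k xs (suc b) (suc b′))          ≈⟨ Det-cong n (λ b b′ b<n _ → entry-eq b b′ b<n) ⟩
      Det n (λ b b′ → u′ ^ b * (u ^ b′ * E b b′))          ≈⟨ Det-conjugate n E (λ i → trans (*-comm _ _) (^-inverse uu′ i)) ⟩
      Det n E                                              ∎
      where
      entry-eq : ∀ b b′ → b < n → D₄ n k xs (suc b) (suc b′) ≈ u′ ^ b * (u ^ b′ * E b b′)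
      entry-eq b b′ b<n = trans (+-cong first second) (trans (sym (distribˡ _ _ _)) (*-congˡ (sym (distribˡ _ _ _))))
        where
        F : ℤ → Carrier
        F m = binom (+ suc b ℤ.- + 1) (+ suc b ℤ.- m) * wu (+ suc b ℤ.- m) * hook (m ℤ.- + 1) (+ suc b′ ℤ.+ + k ℤ.- + 1) xs
        first : δ (suc b) (suc b′) * v ^ˢ suc b ≈ u′ ^ b * (u ^ b′ * (α b * kr b b′))
        first with b ℕ.≟ b′
        ... | yes ≡.refl = begin
          δ b b * v ^ˢ suc b                      ≈⟨ *-cong (≡⇒≈ (δ-kr b b)) (^ˢ≈^ v (suc b)) ⟩
          kr b b * α b                            ≈⟨ *-comm _ _ ⟩
          α b * kr b b                            ≈⟨ trans (*-congʳ (trans (*-comm _ _) (^-inverse uu′ b))) (*-identityˡ _) ⟨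
          (u′ ^ b * u ^ b) * (α b * kr b b)       ≈⟨ *-assoc _ _ _ ⟩
          u′ ^ b * (u ^ b * (α b * kr b b))       ∎
        ... | no b≢b′ = trans (*-congʳ (≡⇒≈ (≡.trans (δ-kr b b′) (kr-off b≢b′)))) (trans (zeroˡ _)
          (sym (trans (*-congˡ (trans (*-congˡ (trans (*-congˡ (≡⇒≈ (kr-off b≢b′))) (zeroʳ _))) (zeroʳ _))) (zeroʳ _))))
        zero-binom : ∀ m → binom (+ b) (+ suc b ℤ.- m) ≈ 0# → F m ≈ 0#
        zero-binom m p = trans (*-congʳ (trans (*-congʳ p) (zeroˡ _))) (zeroˡ _)
        sum : Σℤ (bnd n k) F ≈ Σ< (suc b) (λ a → binomial b a * (w ^ (b ∸ a) * u′ ^ (b ∸ a)) * hk a (k ℕ.+ b′))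
        sum = begin
          Σℤ (bnd n k) F
            ≈⟨ Σℤ-range (bnd n k) F 1 (suc b) (s≤s (ℕₚ.≤-trans b<n (ℕₚ.≤-trans (ℕₚ.m≤m+n n k) (ℕₚ.≤-trans (ℕₚ.n≤1+n _) (ℕₚ.n≤1+n _)))))
                 (λ x → zero-binom -[1+ x ] (binomial-> {b} (ℕₚ.m≤m+n (suc b) (suc x)))) low high ⟩
          Σ< (suc b) (λ a → F (+ suc a))
            ≈⟨ Σ<-cong< (suc b) (λ a a<1+b → *-cong (*-cong (trans (≡⇒≈ (≡.cong (binom (+ b)) (difference a (ℕ.≤-pred a<1+b)))) (≡⇒≈ (≡.cong fromℕ (≡.sym (nCk≡nC[n∸k] (ℕ.≤-pred a<1+b))))))
                 (trans (≡⇒≈ (≡.cong wu (difference a (ℕ.≤-pred a<1+b)))) (wu-+ (b ∸ a)))) (hook-at a (k ℕ.+ b′) ≡.refl (column-index b′))) ⟩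
          _ ∎
          where
          difference : ∀ a → a ≤ b → + suc b ℤ.- + suc a ≡ + (b ∸ a)
          difference a a≤b = minus-+ (b ∸ a) (suc a) (≡.trans (≡.cong suc (≡.sym (ℕₚ.m∸n+n≡m a≤b))) (≡.sym (ℕₚ.+-suc (b ∸ a) a)))
          low : ∀ s → s < 1 → F (+ s) ≈ 0#
          -- At m = 0 the summand vanishes because of C(b, b + 1) = 0.
          low zero _ = zero-binom (+ 0) (binomial-> {b} (≡.subst (b <_) (≡.sym (ℕₚ.+-identityʳ (suc b))) ℕₚ.≤-refl))
          low (suc s) (s≤s ())
          high : ∀ s → suc (suc b) ≤ s → F (+ s) ≈ 0#
          high s le with minus-< le
          ... | x , e = zero-binom (+ s) (≡⇒≈ (≡.cong (binom (+ b)) e))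
        second : r * u ^ˢ suc b′ * Σℤ (bnd n k) F ≈ u′ ^ b * (u ^ b′ * (β b * Σ< (suc b) (λ a → binomial b a * (κ a * hk a (k ℕ.+ b′)))))
        second = begin
          r * u ^ˢ suc b′ * Σℤ (bnd n k) F
            ≈⟨ *-cong (*-congˡ (^ˢ≈^ u (suc b′))) sum ⟩
          r * u ^ suc b′ * Σ< (suc b) (λ a → binomial b a * (w ^ (b ∸ a) * u′ ^ (b ∸ a)) * hk a (k ℕ.+ b′))
            ≈⟨ Σ<-*ˡ (suc b) _ _ ⟨
          Σ< (suc b) (λ a → r * u ^ suc b′ * (binomial b a * (w ^ (b ∸ a) * u′ ^ (b ∸ a)) * hk a (k ℕ.+ b′)))
            ≈⟨ Σ<-cong< (suc b) (λ a a<1+b → term a (ℕ.≤-pred a<1+b)) ⟩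
          Σ< (suc b) (λ a → (u′ ^ b * (u ^ b′ * β b)) * (binomial b a * (κ a * hk a (k ℕ.+ b′))))
            ≈⟨ Σ<-*ˡ (suc b) _ _ ⟩
          (u′ ^ b * (u ^ b′ * β b)) * Σ< (suc b) (λ a → binomial b a * (κ a * hk a (k ℕ.+ b′)))
            ≈⟨ trans (*-assoc _ _ _) (*-congˡ (*-assoc _ _ _)) ⟩
          _ ∎
          where
          term : ∀ a → a ≤ b → r * u ^ suc b′ * (binomial b a * (w ^ (b ∸ a) * u′ ^ (b ∸ a)) * hk a (k ℕ.+ b′))
               ≈ (u′ ^ b * (u ^ b′ * β b)) * (binomial b a * (κ a * hk a (k ℕ.+ b′)))
          term a a≤b = begin
            r * (u * u ^ b′) * (C * W * H)                       ≈⟨ *-identityˡ _ ⟨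
            1# * (r * (u * u ^ b′) * (C * W * H))                ≈⟨ *-congʳ (^-inverse uu′ b) ⟨
            (u ^ b * u′ ^ b) * (r * (u * u ^ b′) * (C * W * H))
              ≈⟨ solve 8 (λ ub ub′ r u x C W H → (ub :* ub′) :* (r :* (u :* x) :* (C :* W :* H)) := (ub′ :* (x :* r)) :* ((u :* ub :* W) :* (C :* H))) refl _ _ _ _ _ _ _ _ ⟩
            (u′ ^ b * (u ^ b′ * r)) * ((u ^ suc b * W) * (C * H)) ≈⟨ *-congˡ (*-congʳ (uw-balance a≤b)) ⟩
            (u′ ^ b * (u ^ b′ * r)) * ((w ^ b * κ a) * (C * H))
              ≈⟨ solve 7 (λ ub′ x r w κ C H → (ub′ :* (x :* r)) :* ((w :* κ) :* (C :* H)) := (ub′ :* (x :* (r :* w))) :* (C :* (κ :* H))) refl _ _ _ _ _ _ _ ⟩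
            (u′ ^ b * (u ^ b′ * β b)) * (C * (κ a * H))          ∎
            where
            C W H : Carrier
            C = binomial b a
            W = w ^ (b ∸ a) * u′ ^ (b ∸ a)
            H = hk a (k ℕ.+ b′)

    D̂₁ : Matrix
    D̂₁ a b′ = sg (a ℕ.+ b′) * binomial a b′ * α b′ + r * (u ^ suc a * (w ^ b′ * w′ ^ a)) * hk a (k ℕ.+ b′)

    D₁-entry : ∀ a b′ → D₁ n k xs (suc a) (suc b′) ≈ D̂₁ a b′
    D₁-entry a b′ = +-cong
      (trans (*-congʳ (*-cong (trans (≡⇒≈ (≡.cong sgn shift)) (trans (sgn-minus b′ a) (trans (*-comm _ _) (sym (sg-+ a b′))))) (^ˢ≈^ v (suc b′))))
        (solve 3 (λ s v c → s :* v :* c := s :* c :* v) refl _ _ _))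
      (*-cong (trans (*-cong (*-congˡ (^ˢ≈^ u (suc a))) (trans (≡⇒≈ (≡.cong (ipow w w′) shift)) (ipow-minus ww′ b′ a))) (*-assoc _ _ _))
        (hook-at a (k ℕ.+ b′) ≡.refl (column-index b′)))
      where
      shift : + suc b′ ℤ.- + suc a ≡ + b′ ℤ.- + a
      shift = ≡.trans (ℤₚ.m-n≡m⊖n (suc b′) (suc a)) (≡.trans (ℤₚ.[1+m]⊖[1+n]≡m⊖n b′ a) (≡.sym (ℤₚ.m-n≡m⊖n b′ a)))

    -- Conjugating `E` by powers of w removes w^b from the row b. Multiplication by the inverse of
    -- the binomial matrix then clears the binomials from the hook part and puts them, with signs,
    -- on the diagonal part.
    Det-D̂₁ : Det n D̂₁ ≈ Det n E
    Det-D̂₁ = begin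
      Det n D̂₁                                        ≈⟨ Det-cong n (λ a b′ a<n b′<n → entry-eq a b′ a<n b′<n) ⟩
      Det n (λ a → S a ·[ n ] G)                      ≈⟨ Det-* n S G ⟩
      Det n S * Det n G                               ≈⟨ *-cong (Det-lowerUnitriangular n (λ i _ → trans (*-cong (trans (sg-+ i i) (sg*sg≈1 i)) (binomial-diag i)) (*-identityˡ _))
                                                           (λ i j i<j _ → trans (*-congˡ (binomial-> i<j)) (zeroʳ _)))
                                                           (Det-conjugate n E (λ i → trans (*-comm _ _) (^-inverse ww′ i))) ⟩
      1# * Det n E                                    ≈⟨ *-identityˡ _ ⟩
      Det n E                                         ∎
      where
      S G : Matrix
      S a b = sg (a ℕ.+ b) * binomial a b
      G b b′ = w′ ^ b * (w ^ b′ * E b b′)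
      entry-eq : ∀ a b′ → a < n → b′ < n → D̂₁ a b′ ≈ (S a ·[ n ] G) b′
      entry-eq a b′ a<n b′<n = sym (begin
        Σ< n (λ b → S a b * G b b′)
          ≈⟨ Σ<-cong< n (λ b b<n → split b b<n) ⟩
        Σ< n (λ b → (S a b * (w′ ^ b * (w ^ b′ * α b))) * kr b b′ + w ^ b′ * r * Σ< n (λ m → (S a b * binomial b m) * (κ m * hk m (k ℕ.+ b′))))
          ≈⟨ trans (Σ<-+ n _ _) (+-cong (Σ<-kr n b′ _ b′<n) (Σ<-*ˡ n _ _)) ⟩
        S a b′ * (w′ ^ b′ * (w ^ b′ * α b′)) + w ^ b′ * r * Σ< n (λ b → Σ< n (λ m → (S a b * binomial b m) * (κ m * hk m (k ℕ.+ b′))))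
          ≈⟨ +-cong (*-congˡ (trans (sym (*-assoc _ _ _)) (trans (*-congʳ (trans (*-comm _ _) (^-inverse ww′ b′))) (*-identityˡ _)))) (*-congˡ collapse) ⟩
        S a b′ * α b′ + w ^ b′ * r * (κ a * hk a (k ℕ.+ b′))
          ≈⟨ +-congˡ (solve 5 (λ w r u w′ h → w :* r :* ((u :* w′) :* h) := r :* (u :* (w :* w′)) :* h) refl _ _ _ _ _) ⟩
        D̂₁ a b′ ∎)
        where
        split : ∀ b → b < n → S a b * G b b′ ≈ (S a b * (w′ ^ b * (w ^ b′ * α b))) * kr b b′ + w ^ b′ * r * Σ< n (λ m → (S a b * binomial b m) * (κ m * hk m (k ℕ.+ b′)))
        split b b<n = begin
          S a b * (w′ ^ b * (w ^ b′ * (α b * kr b b′ + (r * w ^ b) * Q)))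
            ≈⟨ solve 8 (λ S w′ x α k r w Q → S :* (w′ :* (x :* (α :* k :+ (r :* w) :* Q))) := (S :* (w′ :* (x :* α))) :* k :+ (w :* w′) :* (x :* r :* (S :* Q))) refl _ _ _ _ _ _ _ _ ⟩
          (S a b * (w′ ^ b * (w ^ b′ * α b))) * kr b b′ + (w ^ b * w′ ^ b) * (w ^ b′ * r * (S a b * Q))
            ≈⟨ +-congˡ (trans (*-congʳ (^-inverse ww′ b)) (*-identityˡ _)) ⟩
          (S a b * (w′ ^ b * (w ^ b′ * α b))) * kr b b′ + w ^ b′ * r * (S a b * Q)
            ≈⟨ +-congˡ (*-congˡ (trans (*-congˡ (Σ<-extend (λ m → binomial b m * (κ m * hk m (k ℕ.+ b′))) b<n (λ m b<m _ → trans (*-congʳ (binomial-> b<m)) (zeroˡ _))))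
                 (trans (sym (Σ<-*ˡ n _ _)) (Σ<-cong n (λ m → sym (*-assoc _ _ _)))))) ⟩
          _ ∎
          where
          Q : Carrier
          Q = Σ< (suc b) (λ m → binomial b m * (κ m * hk m (k ℕ.+ b′)))
        collapse : Σ< n (λ b → Σ< n (λ m → (S a b * binomial b m) * (κ m * hk m (k ℕ.+ b′)))) ≈ κ a * hk a (k ℕ.+ b′)
        collapse = begin
          Σ< n (λ b → Σ< n (λ m → (S a b * binomial b m) * (κ m * hk m (k ℕ.+ b′))))  ≈⟨ Σ<-swap n n _ ⟩
          Σ< n (λ m → Σ< n (λ b → (S a b * binomial b m) * (κ m * hk m (k ℕ.+ b′))))
            ≈⟨ Σ<-cong n (λ m → trans (Σ<-*ʳ n _ _) (*-congʳ (binomial-inverse n a m a<n))) ⟩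
          Σ< n (λ m → kr a m * (κ m * hk m (k ℕ.+ b′)))
            ≈⟨ Σ<-single n a a<n (λ m _ m≢a → trans (*-congʳ (≡⇒≈ (kr-off (m≢a ∘ ≡.sym)))) (zeroˡ _)) ⟩
          kr a a * (κ a * hk a (k ℕ.+ b′))  ≈⟨ trans (*-congʳ (≡⇒≈ (kr-diag a))) (*-identityˡ _) ⟩
          κ a * hk a (k ℕ.+ b′) ∎

    det-D₁ : det n (D₁ n k xs) ≈ Det n E
    det-D₁ = trans (det-Det n (D₁ n k xs)) (trans (Det-cong n (λ a b′ _ _ → D₁-entry a b′)) Det-D̂₁)

    private
      eSub : Matrix
      eSub c       zero    = eN c xs
      eSub zero    (suc a) = 0#
      eSub (suc c) (suc a) = eSub c a

      e-minus : ∀ c a → e (+ c ℤ.- + a) xs ≡ eSub c a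
      e-minus c a = ≡.trans (≡.cong (λ z → e z xs) (ℤₚ.m-n≡m⊖n c a)) (go c a)
        where
        go : ∀ c a → e (c ⊖ a) xs ≡ eSub c a
        go c       zero    = ≡.refl
        go zero    (suc a) = ≡.refl
        go (suc c) (suc a) = ≡.trans (≡.cong (λ z → e z xs) (ℤₚ.[1+m]⊖[1+n]≡m⊖n c a)) (go c a)

      eSub-∸ : ∀ {c a} → a ≤ c → eN (c ∸ a) xs ≡ eSub c a
      eSub-∸ z≤n     = ≡.refl
      eSub-∸ (s≤s p) = eSub-∸ p

      eSub-below : ∀ {c a} → c < a → eSub c a ≈ 0#
      eSub-below {zero}  {suc a} _       = refl
      eSub-below {suc c} {suc a} (s≤s p) = eSub-below p

      eSub-diag : ∀ c → eSub c c ≈ 1#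
      eSub-diag zero    = refl
      eSub-diag (suc c) = eSub-diag c

      W : ℕ → Carrier
      W q = w ^ q * u′ ^ q

      binom-neg : ∀ z {y x} → y ≡ -[1+ x ] → binom z y ≈ 0#
      binom-neg (+ _)    ≡.refl = refl
      binom-neg -[1+ _ ] ≡.refl = refl

    -- What remains of the second determinant after a unitriangular factor of elementary symmetric
    -- functions and column signs are split off. The row index is the leg and the column index the
    -- arm, so it is compared with the transpose of `D̂₁`.
    D̂₂ : Matrix
    D̂₂ b a = r * u ^ suc b * hk a (k ℕ.+ b) + sg (a ℕ.+ b) * α b * (binomial a b * W (a ∸ b))

    -- Columns are read from the right, c = n - 1 - j. Then `e-expand` writes the first part of the
    -- entry, and the substitution m = a + 1 the second, as a combination of the functions e(c - a).
    D₂-entry : ∀ b j c → b < n → suc j ℕ.+ c ≡ n →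
      D₂ n k xs (suc b) (suc j) ≈ ((λ a → sg a * D̂₂ b a) ·[ n ] (λ a c → eSub c a)) c
    D₂-entry b j c b<n ec = sym (begin
      Σ< n (λ a → sg a * (r * u ^ suc b * hk a (k ℕ.+ b) + sg (a ℕ.+ b) * α b * (binomial a b * W (a ∸ b))) * eSub c a)
        ≈⟨ Σ<-cong n (λ a → trans (solve 8 (λ s r u h t α x e → s :* (r :* u :* h :+ t :* α :* x) :* e := (r :* u) :* (s :* h :* e) :+ (s :* t) :* α :* (x :* e)) refl _ _ _ _ _ _ _ _)
             (+-congˡ (*-congʳ (*-congʳ (trans (*-congˡ (sg-+ a b)) (sg-cancel a _)))))) ⟩
      Σ< n (λ a → (r * u ^ suc b) * (sg a * hk a (k ℕ.+ b) * eSub c a) + sg b * α b * (binomial a b * W (a ∸ b) * eSub c a))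
        ≈⟨ trans (Σ<-+ n _ _) (+-cong (Σ<-*ˡ n _ _) (Σ<-*ˡ n _ _)) ⟩
      (r * u ^ suc b) * Σ< n (λ a → sg a * hk a (k ℕ.+ b) * eSub c a) + sg b * α b * Σ< n (λ a → binomial a b * W (a ∸ b) * eSub c a)
        ≈⟨ +-cong (*-cong (*-congˡ (^ˢ≈^ u (suc b))) first) (*-cong (*-cong (sgn-+ b) (^ˢ≈^ v (suc b))) second) ⟨
      D₂ n k xs (suc b) (suc j) ∎)
      where
      c<n : c < n
      c<n = ≡.subst (suc c ≤_) ec (s≤s (ℕₚ.m≤n+m c j))
      first : e (+ n ℤ.+ + k ℤ.+ + suc b ℤ.- + suc j) xs ≈ Σ< n (λ a → sg a * hk a (k ℕ.+ b) * eSub c a)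
      first = begin
        e (+ n ℤ.+ + k ℤ.+ + suc b ℤ.- + suc j) xs   ≡⟨ ≡.cong (λ z → e z xs) (minus-+ (suc (k ℕ.+ b ℕ.+ c)) (suc j) arith) ⟩
        eN (suc (k ℕ.+ b ℕ.+ c)) xs                  ≈⟨ e-expand (k ℕ.+ b) c ⟩
        Σ< (suc c) (λ a → sg a * hk a (k ℕ.+ b) * eN (c ∸ a) xs)
          ≈⟨ Σ<-cong< (suc c) (λ a a<1+c → *-congˡ (≡⇒≈ (eSub-∸ (ℕ.≤-pred a<1+c)))) ⟩
        Σ< (suc c) (λ a → sg a * hk a (k ℕ.+ b) * eSub c a)
          ≈⟨ Σ<-extend (λ a → sg a * hk a (k ℕ.+ b) * eSub c a) c<n (λ a c<a _ → trans (*-congˡ (eSub-below c<a)) (zeroʳ _)) ⟩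
        Σ< n (λ a → sg a * hk a (k ℕ.+ b) * eSub c a) ∎
        where
        arith : n ℕ.+ k ℕ.+ suc b ≡ suc (k ℕ.+ b ℕ.+ c) ℕ.+ suc j
        arith = ≡.trans (≡.cong (λ m → m ℕ.+ k ℕ.+ suc b) (≡.sym ec))
          (NS.solve 4 (λ j c k b → NS.con 1 NS.:+ j NS.:+ c NS.:+ k NS.:+ (NS.con 1 NS.:+ b) NS.:= NS.con 1 NS.:+ (k NS.:+ b NS.:+ c) NS.:+ (NS.con 1 NS.:+ j)) ≡.refl j c k b)
      F : ℤ → Carrier
      F m = binom (m ℤ.- + 1) (m ℤ.- + suc b) * e (+ n ℤ.+ + 1 ℤ.- + suc j ℤ.- m) xs * wu (m ℤ.- + suc b)
      n+1-j : + n ℤ.+ + 1 ℤ.- + suc j ≡ + suc c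
      n+1-j = minus-+ (suc c) (suc j) (≡.trans (≡.cong (ℕ._+ 1) (≡.sym ec)) (NS.solve 2 (λ j c → NS.con 1 NS.:+ j NS.:+ c NS.:+ NS.con 1 NS.:= NS.con 1 NS.:+ c NS.:+ (NS.con 1 NS.:+ j)) ≡.refl j c))
      e-index : ∀ s → e (+ n ℤ.+ + 1 ℤ.- + suc j ℤ.- + s) xs ≡ eSub (suc c) s
      e-index s = ≡.trans (≡.cong (λ z → e (z ℤ.- + s) xs) n+1-j) (e-minus (suc c) s)
      low : ∀ s → s < suc b → F (+ s) ≈ 0#
      low s s<1+b = trans (*-congʳ (trans (*-congʳ (binom-neg (+ s ℤ.- + 1) (proj₂ (minus-< s<1+b)))) (zeroˡ _))) (zeroˡ _)
      support : suc b ℕ.+ (n ∸ b) ≡ suc n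
      support = ≡.cong suc (ℕₚ.m+[n∸m]≡n (ℕₚ.<⇒≤ b<n))
      high : ∀ s → suc b ℕ.+ (n ∸ b) ≤ s → F (+ s) ≈ 0#
      high s le = trans (*-congʳ (trans (*-congˡ (trans (≡⇒≈ (e-index s)) (eSub-below (ℕₚ.<-≤-trans (s≤s c<n) (≡.subst (_≤ s) support le))))) (zeroʳ _))) (zeroˡ _)
      shifted : ∀ q → + suc (b ℕ.+ q) ℤ.- + suc b ≡ + q
      shifted q = minus-+ q (suc b) (≡.trans (≡.cong suc (ℕₚ.+-comm b q)) (≡.sym (ℕₚ.+-suc q b)))
      second : Σℤ (bnd n k) F ≈ Σ< n (λ a → binomial a b * W (a ∸ b) * eSub c a)
      second = begin
        Σℤ (bnd n k) F
          ≈⟨ Σℤ-range (bnd n k) F (suc b) (n ∸ b) (≡.subst (_≤ suc (bnd n k)) (≡.sym support)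
               (s≤s (ℕₚ.≤-trans (ℕₚ.m≤m+n n k) (ℕₚ.≤-trans (ℕₚ.n≤1+n _) (ℕₚ.n≤1+n _)))))
               (λ x → trans (*-congʳ (zeroˡ _)) (zeroˡ _)) low high ⟩
        Σ< (n ∸ b) (λ q → F (+ suc (b ℕ.+ q)))
          ≈⟨ Σ<-cong (n ∸ b) (λ q → begin
               F (+ suc (b ℕ.+ q))
                 ≈⟨ *-cong (*-cong (trans (≡⇒≈ (≡.cong (binom (+ (b ℕ.+ q))) (shifted q))) (≡⇒≈ (≡.cong fromℕ (complement q)))) (≡⇒≈ (e-index (suc (b ℕ.+ q)))))
                      (trans (≡⇒≈ (≡.cong wu (shifted q))) (wu-+ q)) ⟩
               binomial (b ℕ.+ q) b * eSub c (b ℕ.+ q) * W q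
                 ≈⟨ solve 3 (λ x y z → x :* y :* z := x :* z :* y) refl _ _ _ ⟩
               binomial (b ℕ.+ q) b * W q * eSub c (b ℕ.+ q)
                 ≡⟨ ≡.cong (λ m → binomial (b ℕ.+ q) b * W m * eSub c (b ℕ.+ q)) (ℕₚ.m+n∸m≡n b q) ⟨
               binomial (b ℕ.+ q) b * W (b ℕ.+ q ∸ b) * eSub c (b ℕ.+ q) ∎) ⟩
        Σ< (n ∸ b) (λ q → binomial (b ℕ.+ q) b * W (b ℕ.+ q ∸ b) * eSub c (b ℕ.+ q))
          ≈⟨ Σ<-drop b n _ (λ a a<b → trans (*-congʳ (trans (*-congʳ (binomial-> a<b)) (zeroˡ _))) (zeroˡ _)) ⟨
        Σ< n (λ a → binomial a b * W (a ∸ b) * eSub c a) ∎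
        where
        complement : ∀ q → (b ℕ.+ q) C q ≡ (b ℕ.+ q) C b
        complement q = ≡.sym (≡.trans (nCk≡nC[n∸k] (ℕₚ.m≤m+n b q)) (≡.cong ((b ℕ.+ q) C_) (ℕₚ.m+n∸m≡n b q)))

    -- Transposition together with the conjugation by powers of w/u, which turns the hook part
    -- u^(b+1) of `D̂₂` into u^(a+1) w^(b-a).
    Det-D̂₂ : Det n D̂₂ ≈ Det n D̂₁
    Det-D̂₂ = begin
      Det n D̂₂                                       ≈⟨ Det-transpose n D̂₂ ⟨
      Det n (λ a b → D̂₂ b a)                         ≈⟨ Det-cong n (λ a b _ _ → conjugate a b) ⟩
      Det n (λ a b → f a * (g b * D̂₁ a b))           ≈⟨ Det-conjugate n D̂₁ (λ i → trans (solve 4 (λ a b c d → (a :* b) :* (c :* d) := (c :* a) :* (b :* d)) refl _ _ _ _)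
                                                          (trans (*-cong (^-inverse uu′ i) (^-inverse ww′ i)) (*-identityˡ _))) ⟩
      Det n D̂₁                                       ∎
      where
      f g : ℕ → Carrier
      f a = u′ ^ a * w ^ a
      g b = u ^ b * w′ ^ b
      fg : ∀ {a b} → b ≤ a → W (a ∸ b) ≈ f a * g b
      fg {a} {b} b≤a = begin
        w ^ d * u′ ^ d                                    ≈⟨ trans (*-congʳ (trans (*-cong (^-inverse uu′ b) (^-inverse ww′ b)) (*-identityˡ _))) (*-identityˡ _) ⟨
        ((u ^ b * u′ ^ b) * (w ^ b * w′ ^ b)) * (w ^ d * u′ ^ d)
          ≈⟨ solve 6 (λ u u′ w w′ x y → ((u :* u′) :* (w :* w′)) :* (x :* y) := ((y :* u′) :* (x :* w)) :* (u :* w′)) refl _ _ _ _ _ _ ⟩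
        ((u′ ^ d * u′ ^ b) * (w ^ d * w ^ b)) * g b       ≈⟨ *-congʳ (*-cong (^-homo-* u′ d b) (^-homo-* w d b)) ⟨
        (u′ ^ (d ℕ.+ b) * w ^ (d ℕ.+ b)) * g b            ≡⟨ ≡.cong (λ m → (u′ ^ m * w ^ m) * g b) (ℕₚ.m∸n+n≡m b≤a) ⟩
        f a * g b                                         ∎
        where
        d : ℕ
        d = a ∸ b
      binomial-fg : ∀ a b → binomial a b * W (a ∸ b) ≈ binomial a b * (f a * g b)
      binomial-fg a b with b ℕ.≤? a
      ... | yes b≤a = *-congˡ (fg b≤a)
      -- For b > a the exponent a - b is truncated and the splitting fails, but there the binomial
      -- is 0.
      ... | no b≰a  = trans (*-congʳ (binomial-> (ℕₚ.≰⇒> b≰a))) (trans (zeroˡ _) (sym (trans (*-congʳ (binomial-> (ℕₚ.≰⇒> b≰a))) (zeroˡ _))))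
      conjugate : ∀ a b → D̂₂ b a ≈ f a * (g b * D̂₁ a b)
      conjugate a b = begin
        r * u ^ suc b * hk a (k ℕ.+ b) + sg (a ℕ.+ b) * α b * (binomial a b * W (a ∸ b))
          ≈⟨ +-cong (sym powers) (*-congˡ (binomial-fg a b)) ⟩
        (u ^ a * u′ ^ a) * ((w ^ a * w′ ^ a) * (w ^ b * w′ ^ b)) * (r * u ^ suc b * hk a (k ℕ.+ b)) + sg (a ℕ.+ b) * α b * (binomial a b * (f a * g b))
          ≈⟨ solve 13 (λ ua ua′ wa wa′ wb wb′ r u ub h s α C →
               (ua :* ua′) :* ((wa :* wa′) :* (wb :* wb′)) :* (r :* (u :* ub) :* h) :+ s :* α :* (C :* ((ua′ :* wa) :* (ub :* wb′)))
                 := (ua′ :* wa) :* ((ub :* wb′) :* (s :* C :* α :+ r :* ((u :* ua) :* (wb :* wa′)) :* h))) refl _ _ _ _ _ _ _ _ _ _ _ _ _ ⟩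
        f a * (g b * D̂₁ a b) ∎
        where
        powers : (u ^ a * u′ ^ a) * ((w ^ a * w′ ^ a) * (w ^ b * w′ ^ b)) * (r * u ^ suc b * hk a (k ℕ.+ b)) ≈ r * u ^ suc b * hk a (k ℕ.+ b)
        powers = trans (*-congʳ (trans (*-cong (^-inverse uu′ a) (trans (*-cong (^-inverse ww′ a) (^-inverse ww′ b)) (*-identityˡ _))) (*-identityˡ _))) (*-identityˡ _)

    det-D₂ : det n (D₂ n k xs) ≈ Det n E
    det-D₂ = begin
      det n (D₂ n k xs)             ≈⟨ det-Det n (D₂ n k xs) ⟩
      Det n Δ                       ≈⟨ trans (*-congʳ (reversalSign² n)) (*-identityˡ _) ⟨
      ρ * ρ * Det n Δ               ≈⟨ *-assoc _ _ _ ⟩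
      ρ * (ρ * Det n Δ)             ≈⟨ *-congˡ (Det-reverseColumns n Δ) ⟨
      ρ * Det n (λ i j → Δ i (n ∸ 1 ∸ j))
        ≈⟨ *-congˡ (Det-cong n (λ b c b<n c<n → D₂-entry b (n ∸ 1 ∸ c) c b<n (reflect c c<n))) ⟩
      ρ * Det n (λ b → (λ a → sg a * D̂₂ b a) ·[ n ] (λ a c → eSub c a))
        ≈⟨ *-congˡ (Det-* n (λ b a → sg a * D̂₂ b a) (λ a c → eSub c a)) ⟩
      ρ * (Det n (λ b a → sg a * D̂₂ b a) * Det n (λ a c → eSub c a))
        -- The column signs (-1)^a multiply to the same ρ as the reversal of the columns, so the two
        -- cancel.
        ≈⟨ *-congˡ (*-cong (Det-scaleColumns n sg D̂₂) (Det-upperUnitriangular n (λ i _ → eSub-diag i) (λ i j j<i _ → eSub-below j<i))) ⟩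
      ρ * ((ρ * Det n D̂₂) * 1#)     ≈⟨ trans (*-congˡ (*-identityʳ _)) (sym (*-assoc _ _ _)) ⟩
      ρ * ρ * Det n D̂₂              ≈⟨ trans (*-congʳ (reversalSign² n)) (*-identityˡ _) ⟩
      Det n D̂₂                      ≈⟨ Det-D̂₂ ⟩
      Det n D̂₁                      ≈⟨ Det-D̂₁ ⟩
      Det n E                       ∎
      where
      ρ : Carrier
      ρ = reversalSign n
      Δ : Matrix
      Δ i j = D₂ n k xs (suc i) (suc j)
      reflect : ∀ c → c < n → suc (n ∸ 1 ∸ c) ℕ.+ c ≡ n
      reflect c c<n = go n c<n
        where
        go : ∀ m → c < m → suc (m ∸ 1 ∸ c) ℕ.+ c ≡ m
        go (suc m) (s≤s c≤m) = ≡.cong suc (ℕₚ.m∸n+n≡m c≤m)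

    -- The summand of `𝒜` in terms of the Frobenius coordinates alone, which is what allows the sum
    -- to be transferred from plane partitions to arrays.
    term : List ℕ → List ℕ → Carrier
    term a b = (r ^ˢ length a) * (u ^ˢ sumℕ (L.map suc a)) * ipow v v′ (+ ((n ℕ.+ 1) C 2) ℤ.- + sumℕ (L.map suc b)) * ipow w w′ (+ sumℕ b ℤ.- + sumℕ a)
             * schur (fromFrob a (L.map (k ℕ.+_) b)) xs

    arrayTerm : List (List ℕ) → Carrier
    -- A dummy value: members of `arrays n` have a first row.
    arrayTerm []        = 0#
    arrayTerm (c₀ ∷ ch) = term (arms 0 c₀ [] ch) (pos c₀)

    𝒜-arrays : 1 ≤ n → 𝒜 (n ℕ.+ 1) k xs ≈ ΣL (arrays n) arrayTerm
    𝒜-arrays 1≤n = begin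
      𝒜 (n ℕ.+ 1) k xs
        ≡⟨ ≡.cong (λ m → ΣL (TSPP m) (λ t → term (frobA (diagT m t)) (frobB (diagT m t)))) (ℕₚ.m+n∸n≡m n 1) ⟩
      ΣL (TSPP n) (λ t → term (frobA (diagT n t)) (frobB (diagT n t)))
        ≈⟨ ΣL-cong (TSPP n) (λ t t∈ → let tspp = proj₂ (TSPP-∈⁻ n t∈) in
             ≡⇒≈ (≡.cong₂ term (FrobeniusOfTSPP.frobA-arms tspp) (FrobeniusOfTSPP.frobB-pos tspp))) ⟩
      ΣL (TSPP n) (arrayTerm ∘ array)          ≈⟨ ΣL-map array (TSPP n) arrayTerm ⟨
      ΣL (L.map array (TSPP n)) arrayTerm      ≈⟨ ΣL-↭ arrayTerm TSPP↭arrays ⟩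
      ΣL (arrays n) arrayTerm                  ∎
      where
      open Bijection n {{ℕ.>-nonZero 1≤n}}

    triangle : ℕ → ℕ
    triangle zero    = 0
    triangle (suc m) = suc m ℕ.+ triangle m

    triangle-C : ∀ m → (m ℕ.+ 1) C 2 ≡ triangle m
    triangle-C zero    = ≡.refl
    triangle-C (suc m) = ≡.trans (≡.sym (nCk+nC[k+1]≡[n+1]C[k+1] (m ℕ.+ 1) 1)) (≡.cong₂ ℕ._+_ (≡.trans (nC1≡n (m ℕ.+ 1)) (ℕₚ.+-comm m 1)) (triangle-C m))

    -- ω gives the power of v as a total, the triangular number, minus the part of the legs, whereas
    -- `coefficient` multiplies the factors v^(b+1) of the elements left out.
    coefficient-weight : ∀ {m cs} (s : Sub m cs) → coefficient X̂ (U xs) k α β s ≈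
      r ^ length cs * (v ^ triangle m * v′ ^ sumℕ cs) * w ^ sumℕ (L.map pred cs)
    coefficient-weight none = sym (trans (*-identityʳ _) (trans (*-identityˡ _) (*-identityˡ _)))
    coefficient-weight (omit {m} {cs} s) = begin
      v ^ suc m * coefficient X̂ (U xs) k α β s    ≈⟨ *-congˡ (coefficient-weight s) ⟩
      v ^ suc m * (r ^ length cs * (v ^ triangle m * v′ ^ sumℕ cs) * w ^ sumℕ (L.map pred cs))
        ≈⟨ solve 5 (λ x r v v′ w → x :* (r :* (v :* v′) :* w) := r :* ((x :* v) :* v′) :* w) refl _ _ _ _ _ ⟩
      r ^ length cs * ((v ^ suc m * v ^ triangle m) * v′ ^ sumℕ cs) * w ^ sumℕ (L.map pred cs)
        ≈⟨ *-congʳ (*-congˡ (*-congʳ (^-homo-* v (suc m) (triangle m)))) ⟨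
      r ^ length cs * (v ^ triangle (suc m) * v′ ^ sumℕ cs) * w ^ sumℕ (L.map pred cs) ∎
    coefficient-weight (take {m} {cs} s) = begin
      r * w ^ m * coefficient X̂ (U xs) k α β s    ≈⟨ *-congˡ (coefficient-weight s) ⟩
      r * w ^ m * (r ^ length cs * (v ^ triangle m * v′ ^ sumℕ cs) * w ^ sumℕ (L.map pred cs))
        ≈⟨ solve 6 (λ r w rl v v′ w₁ → r :* w :* (rl :* (v :* v′) :* w₁) := (r :* rl) :* (v :* v′) :* (w :* w₁)) refl _ _ _ _ _ _ ⟩
      (r * r ^ length cs) * (v ^ triangle m * v′ ^ sumℕ cs) * (w ^ m * w ^ sumℕ (L.map pred cs))
        ≈⟨ *-cong (*-congˡ (begin
             -- A taken element m + 1 raises the total and the deduction alike, so the unit v^(m+1)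
             -- v′^(m+1) is inserted.
             v ^ triangle m * v′ ^ sumℕ cs                                        ≈⟨ trans (*-congʳ (^-inverse vv′ (suc m))) (*-identityˡ _) ⟨
             (v ^ suc m * v′ ^ suc m) * (v ^ triangle m * v′ ^ sumℕ cs)           ≈⟨ solve 4 (λ a b c d → (a :* b) :* (c :* d) := (a :* c) :* (b :* d)) refl _ _ _ _ ⟩
             (v ^ suc m * v ^ triangle m) * (v′ ^ suc m * v′ ^ sumℕ cs)           ≈⟨ *-cong (^-homo-* v (suc m) (triangle m)) (^-homo-* v′ (suc m) (sumℕ cs)) ⟨
             v ^ triangle (suc m) * v′ ^ (suc m ℕ.+ sumℕ cs)                      ∎))
           (sym (^-homo-* w m (sumℕ (L.map pred cs)))) ⟩
      r ^ length (suc m ∷ cs) * (v ^ triangle (suc m) * v′ ^ sumℕ (suc m ∷ cs)) * w ^ sumℕ (L.map pred (suc m ∷ cs)) ∎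

    detL-scale : ∀ as post → detL (L.map X̂ as ++ post) ≈ (u ^ sumℕ (L.map suc as) * w′ ^ sumℕ as) * detL (L.map (X xs) as ++ post)
    detL-scale as post = go [] as
      where
      open AlternatingProperties (detL-alternating 0)
      go : ∀ pre as → detL (pre ++ L.map X̂ as ++ post) ≈ (u ^ sumℕ (L.map suc as) * w′ ^ sumℕ as) * detL (pre ++ L.map (X xs) as ++ post)
      go pre []       = sym (trans (*-congʳ (*-identityˡ _)) (*-identityˡ _))
      go pre (a ∷ as) = begin
        detL (pre ++ X̂ a ∷ L.map X̂ as ++ post)                ≈⟨ scale pre (κ a) (X xs a) _ ⟩
        κ a * detL (pre ++ X xs a ∷ L.map X̂ as ++ post)        ≈⟨ *-congˡ (at-++ pre (X xs a ∷ []) _) ⟨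
        κ a * detL ((pre ++ X xs a ∷ []) ++ L.map X̂ as ++ post) ≈⟨ *-congˡ (go (pre ++ X xs a ∷ []) as) ⟩
        κ a * ((u ^ sumℕ (L.map suc as) * w′ ^ sumℕ as) * detL ((pre ++ X xs a ∷ []) ++ L.map (X xs) as ++ post))
          ≈⟨ *-congˡ (*-congˡ (at-++ pre (X xs a ∷ []) _)) ⟩
        (u ^ suc a * w′ ^ a) * ((u ^ sumℕ (L.map suc as) * w′ ^ sumℕ as) * D)
          ≈⟨ solve 5 (λ a b c d e → (a :* b) :* ((c :* d) :* e) := ((a :* c) :* (b :* d)) :* e) refl _ _ _ _ _ ⟩
        ((u ^ suc a * u ^ sumℕ (L.map suc as)) * (w′ ^ a * w′ ^ sumℕ as)) * D
          ≈⟨ *-congʳ (*-cong (^-homo-* u (suc a) (sumℕ (L.map suc as))) (^-homo-* w′ a (sumℕ as))) ⟨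
        (u ^ sumℕ (L.map suc (a ∷ as)) * w′ ^ sumℕ (a ∷ as)) * D ∎
        where
        D : Carrier
        D = detL (pre ++ X xs a ∷ L.map (X xs) as ++ post)

    -- The powers of r and v and the legs' power of w come from the coefficient of the subset. The
    -- arms' powers of u and w are pulled out of the scaled rows.
    term-det : ∀ {cs} (s : Sub n cs) as → length as ≡ length cs → Linked ℕ._>_ as → 1 ≤ n →
      term as (L.map pred cs) ≈ coefficient X̂ (U xs) k α β s * detL (L.map X̂ as ++ L.map (U xs) (vac k s))
    term-det {cs} s as e dec 1≤n = begin
      term as (L.map pred cs)
        ≈⟨ *-cong (*-cong (*-cong (*-cong (trans (^ˢ≈^ r (length as)) (≡⇒≈ (≡.cong (r ^_) e))) (^ˢ≈^ u (sumℕ (L.map suc as))))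
             (trans (ipow-minus vv′ ((n ℕ.+ 1) C 2) (sumℕ (L.map suc (L.map pred cs))))
               (≡⇒≈ (≡.cong₂ (λ x ys → v ^ x * v′ ^ sumℕ ys) (triangle-C n) (map-suc-pred (Sub-positive s))))))
             (ipow-minus ww′ (sumℕ (L.map pred cs)) (sumℕ as)))
           (schur-fromFrob xs k s as e dec (ℕₚ.≤-trans 1≤n (ℕₚ.m≤n+m n k))) ⟩
      r ^ length cs * u ^ sumℕ (L.map suc as) * (v ^ triangle n * v′ ^ sumℕ cs) * (w ^ sumℕ (L.map pred cs) * w′ ^ sumℕ as) * D
        ≈⟨ solve 6 (λ r u v w w′ D → r :* u :* v :* (w :* w′) :* D := (r :* v :* w) :* ((u :* w′) :* D)) refl _ _ _ _ _ _ ⟩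
      (r ^ length cs * (v ^ triangle n * v′ ^ sumℕ cs) * w ^ sumℕ (L.map pred cs)) * ((u ^ sumℕ (L.map suc as) * w′ ^ sumℕ as) * D)
        ≈⟨ *-cong (coefficient-weight s) (detL-scale as (L.map (U xs) (vac k s))) ⟨
      coefficient X̂ (U xs) k α β s * detL (L.map X̂ as ++ L.map (U xs) (vac k s)) ∎
      where
      D : Carrier
      D = detL (L.map (X xs) as ++ L.map (U xs) (vac k s))

    -- An array is a first row, which corresponds to a subset of legs, followed by a chain of n
    -- rows. The coefficient depends on the subset alone and leaves the inner sum, which gives
    -- `array-expansion`.
    𝒜-det : 1 ≤ n → 𝒜 (n ℕ.+ 1) k xs ≈ detL rows
    𝒜-det 1≤n = begin
      𝒜 (n ℕ.+ 1) k xs             ≈⟨ 𝒜-arrays 1≤n ⟩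
      ΣL (arrays n) arrayTerm       ≈⟨ ΣL-prefixed (starts n) (chainsL n) arrayTerm ⟩
      ΣL (starts n) (λ c₀ → ΣL (chainsL n c₀) (λ ch → arrayTerm (c₀ ∷ ch)))
        ≈⟨ ΣL-map (λ (cs , _) → pad n cs) (subsets n) _ ⟩
      ΣL (subsets n) (λ (cs , s) → ΣL (chainsL n (pad n cs)) (λ ch → arrayTerm (pad n cs ∷ ch)))
        ≈⟨ ΣL-cong (subsets n) (λ (cs , s) _ → trans (ΣL-cong (chainsL n (pad n cs)) (λ ch ch∈ → each s ch (∈-chainsL⁻ n (pad n cs) ch∈)))
             (ΣL-*ˡ (chainsL n (pad n cs)) _ _)) ⟩
      ΣL (subsets n) (λ (cs , s) → coefficient X̂ (U xs) k α β s * ΣL (chainsL n (pad n cs)) (λ ch → detL (L.map X̂ (arms 0 (pad n cs) [] ch) ++ L.map (U xs) (vac k s))))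
        ≈⟨ array-expansion X̂ (U xs) k α β n ⟨
      detL (L.map (U xs) (upTo k) ++ applyUpTo mrow n)
        ≡⟨ ≡.cong (λ ys → detL (ys ++ applyUpTo mrow n)) (Lₚ.map-applyUpTo id (U xs) k) ⟩
      detL rows ∎
      where
      each : ∀ {cs} (s : Sub n cs) ch → Chain n (pad n cs) ch → arrayTerm (pad n cs ∷ ch) ≈
        coefficient X̂ (U xs) k α β s * detL (L.map X̂ (arms 0 (pad n cs) [] ch) ++ L.map (U xs) (vac k s))
      each {cs} s ch chain with arms-props {t = 0} {as = []} (pad-linked (n ∸ length cs) (Sub-decreasing s)) (pad-head n (n ∸ length cs) {cs} (Sub-head s)) chain [-]
      ... | len , dec = trans (≡⇒≈ (≡.cong (term (arms 0 (pad n cs) [] ch)) (pos-pad n (Sub-positive s))))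
        (term-det s _ (≡.trans len (≡.trans (ℕₚ.+-identityʳ _) (≡.trans (≡.cong length (pos-pad n (Sub-positive s))) (Lₚ.length-map pred cs)))) dec 1≤n)

    𝒜-determinants : 1 ≤ n →
      (𝒜 (n ℕ.+ 1) k xs ≈ det n (D₁ n k xs)) × (𝒜 (n ℕ.+ 1) k xs ≈ det n (D₂ n k xs))
      × (𝒜 (n ℕ.+ 1) k xs ≈ det (n ℕ.+ k) (M n k xs)) × (𝒜 (n ℕ.+ 1) k xs ≈ det n (D₄ n k xs))
    𝒜-determinants 1≤n = trans 𝒜-E (sym det-D₁) , trans 𝒜-E (sym det-D₂) , trans (𝒜-det 1≤n) (sym det-M) , trans 𝒜-E (sym det-D₄)
      where
      𝒜-E : 𝒜 (n ℕ.+ 1) k xs ≈ Det n E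
      𝒜-E = trans (𝒜-det 1≤n) detL-rows

theorem1p1 : ∀ {c ℓ} (R : CommutativeRing c ℓ) →
    let open CommutativeRing R in
    (n : ℕ) → 1 ≤ n → (k : ℕ) →
    (r u v w u′ v′ w′ : Carrier) → u * u′ ≈ 1# → v * v′ ≈ 1# → w * w′ ≈ 1# →
    (xs : List Carrier) →
    let open Sym R r u v w u′ v′ w′ in
    (𝒜 (n ℕ.+ 1) k xs ≈ det n (D₁ n k xs))
    × (𝒜 (n ℕ.+ 1) k xs ≈ det n (D₂ n k xs))
    × (𝒜 (n ℕ.+ 1) k xs ≈ det (n ℕ.+ k) (M n k xs))
    × (𝒜 (n ℕ.+ 1) k xs ≈ det n (D₄ n k xs))
theorem1p1 R n 1≤n k r u v w u′ v′ w′ uu′ vv′ ww′ xs =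
  Evaluation.Identities.𝒜-determinants R r u v w u′ v′ w′ uu′ vv′ ww′ xs n k 1≤n
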